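{- Let $\mathfrak n\in\mathsf A_+$ and $\ell\in\mathbb N$. For every character $\chi\in\widehat{\mathsf G}_{\mathfrak n,\ell}$ with (finite) conductor $\mathfrak c_\chi$, $$L_{\mathsf A}'(0,\chi)=-L_{\mathsf A}(0,\chi)\,\ln|\mathfrak c_\chi|_\infty+\sum_{\substack{a\in\mathsf A,\ \deg a<\deg\mathfrak c_\chi\\ \gcd(a,\mathfrak c_\chi)=1}}\ \sum_{i=0}^{\ell-1}\chi(a,i+\deg\mathfrak c_\chi)\cdot\ln\Big|\Gamma^*\Big(\frac{a(\theta)}{\mathfrak c_\chi(\theta)},1-\frac{q^i}{q^\ell-1}\Big)\Big|_\infty .$$ (When $\mathfrak c_\chi=1$ the outer sum has the single term $a=0$.)
   Context: $q$ is a power of a prime $p$; $A=\mathbb F_q[\theta]$, $k=\mathbb F_q(\theta)$, $k_\infty=\mathbb F_q((1/\theta))$ with $|\theta|_\infty=q$, $\mathbb C_\infty$ the completion of an algebraic closure of $k_\infty$ with extended absolute value; $A_+$ the monic elements of $A$. $\mathsf A=\mathbb F_q[t]$, $\mathsf A_+$ its monic elements; $f(\theta)$ denotes $f\in\mathsf A$ evaluated at $t=\theta$, and $|f|_\infty=|f(\theta)|_\infty$. $\mathbb N=\{1,2,\dots\}$. Characters. $\mathsf G_{\mathfrak n,\ell}$ is identified with $(\mathsf A/\mathfrak n)^\times\times\mathbb Z/\ell\mathbb Z$ (it is the Galois group over $\mathbb F_q(t)$ of the compositum of $\mathbb F_{q^\ell}$ and the $\mathfrak n$-th Carlitz cyclotomic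 function field, identified via the Artin map, a monic irreducible $\mathfrak p\nmid\mathfrak n$ having Frobenius $(\mathfrak p\bmod\mathfrak n,\deg\mathfrak p\bmod\ell)$); $\widehat{\mathsf G}_{\mathfrak n,\ell}$ is its group of complex characters. For such $\chi$, $\mathfrak c_\chi\in\mathsf A_+$ is the conductor of $\chi|_{(\mathsf A/\mathfrak n)^\times}$ and $\chi$ is regarded as a character of $(\mathsf A/\mathfrak c_\chi)^\times\times\mathbb Z/\ell\mathbb Z$. $L_{\mathsf A}(s,\chi)$ is the meromorphic continuation of $\prod_{\mathfrak p\nmid\mathfrak c_\chi}(1-\chi(\mathfrak p,\deg\mathfrak p)|\mathfrak p|_\infty^{ -s})^{ -1}$ ($\mathrm{Re}\,s>1$, $\mathfrak p\in\mathsf A_+$ irreducible), and $L'_{\mathsf A}$ is its derivative in $s$. Normalized gamma values. For $y=\sum_{i\ge0}y_iq^i\in\mathbb Z_p$ ($0\le y_i<q$) put $\partial(y)=\sum_{i\ge0}iy_iq^i\in\mathbb Z_p$; for $0\le c<\ell$, $\partial(\frac{q^c}{1-q^\ell})=\frac{cq^c}{1-q^\ell}+\frac{\ell q^{\ell+c}}{(1-q^\ell)^2}\in\mathbb Q$. Put $\Pi_{\rm ari}(y)=\prod_{i\ge1}(\prod_{j=0}^{i-1}(1-\theta^{q^j}/\theta^{q^i}))^{y_i}$, $\Pi_{\rm geo}(x,y)=\prod_{i\ge0}\prod_{a\in A_+,\deg a=i}(1+x/a)^{ -y_i}$. Let $\Gamma_{\rm ari}(y)=\Pi_{\rm ari}(y-1)$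 and $\Gamma^*_{\rm ari}(y)=\theta^{\partial(y-1)}\Gamma_{\rm ari}(y)$ for $y\in\mathbb Z_{(p)}$ (a rational power of $\theta$; only its absolute value $q^{\partial(y-1)}$ matters). For $N\ge0$ and $x=\sum_i\epsilon_i\theta^{ -i}\in k_\infty$, $\langle x\rangle_N=1$ if $\epsilon_i=0$ for $0<i<N+1$ and $\epsilon_{N+1}=1$, else $0$; for $0\le i<\ell$ put $\langle x,\frac{q^i}{q^\ell-1}\rangle=\sum_{N\ge0,\,N\equiv-1-i\bmod\ell}\langle x\rangle_N$. For $y=1-\frac{q^i}{q^\ell-1}$, put $\partial(x,y-1)=\langle x,\frac{q^i}{q^\ell-1}\rangle$ and $$\Gamma^*(x,y)=\frac{x^{ -\partial(x,y-1)}\,\Pi_{\rm geo}(x,y-1)}{\Gamma^*_{\rm ari}(y)}\quad(x\in k\setminus(-A_+\cup\{0\})),\qquad \Gamma^*(0,y)=\Gamma^*_{\rm ari}(y)^{ -1}.$$ -}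

module Defs where

open import Algebra.Bundles using (CommutativeRing; RawRing)
open import Algebra.Apartness.Bundles using (HeytingField; HeytingCommutativeRing)
import Algebra.Definitions
import Algebra.Definitions.RawSemiring
open import Data.Bool.Base using (if_then_else_)
open import Data.Empty using (⊥-elim)
open import Data.Fin.Base as Fin using (Fin; toℕ)
import Data.Fin.Properties as Fin
open import Data.Integer.Base as ℤ using (ℤ; +_; -[1+_])
import Data.Integer.Divisibility as ℤ
open import Data.List.Base as List using (List; []; _∷_; foldr; upTo)
open import Data.Nat.Base as ℕ using (ℕ; zero; suc; NonZero; NonTrivial; _∸_; _≡ᵇ_; _!)
open import Data.Nat.DivMod using (_%_)
open import Data.Nat.Divisibility using (_∣?_)
import Data.Nat.Properties as ℕ
open import Data.Product.Base using (Σ-syntax; ∃-syntax; _×_; _,_; proj₁; proj₂)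
open import Data.Rational.Unnormalised.Base as ℚᵘ using (ℚᵘ; ↥_; ↧ₙ_)
open import Data.Sum.Base using (_⊎_; inj₂)
open import Data.Unit.Base using (⊤; tt)
open import Function.Base using (_∘_)
open import Function.Bundles using (Inverse; Injection; _⇔_; Equivalence)
open import Function.Properties.Inverse using (Inverse⇒Injection)
open import Level using (0ℓ)
open import Relation.Binary.Core using (Rel)
open import Relation.Binary.Definitions using (Decidable)
open import Relation.Binary.PropositionalEquality using (_≡_; refl)
import Relation.Binary.PropositionalEquality as ≡
open import Relation.Binary.Structures using (IsStrictPartialOrder)
open import Relation.Nullary.Decidable using (does; via-injection; _×-dec_)
open import Relation.Nullary.Negation using (¬_)

module Ring (A : RawRing 0ℓ 0ℓ) where
  open RawRing A public
  open Algebra.Definitions.RawSemiring rawSemiring public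
    using (_^_; sum; product; _∣_; Coprime; Irreducible)
    renaming (_×_ to _·_)

  IsUnit : Carrier → Set
  IsUnit = Algebra.Definitions.Invertible _≈_ 1# _*_

  infixl 6 _-_
  _-_ : Carrier → Carrier → Carrier
  x - y = x + (- y)

------------------------------------------------------------------------
-- Real and complex numbers

-- The reals: a Cauchy complete archimedean ordered field.
record RealNumbers : Set₁ where
  field
    heytingField : HeytingField 0ℓ 0ℓ 0ℓ

  private
    module H = HeytingField heytingField

  commutativeRing : CommutativeRing 0ℓ 0ℓ
  commutativeRing = HeytingCommutativeRing.commutativeRing H.heytingCommutativeRing

  open CommutativeRing commutativeRing public
    using (rawRing; +-identityˡ; +-identityʳ; +-comm; +-congˡ; zeroʳ)
    renaming (refl to ≈-refl; sym to ≈-sym; trans to ≈-trans)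
  open Ring rawRing public
  open H public using (_#_; #⇒invertible)

  infix 4 _<_
  field
    _<_                  : Rel Carrier 0ℓ
    isStrictPartialOrder : IsStrictPartialOrder _≈_ _<_
    #⇔<⊎>                : ∀ {x y} → (x # y) ⇔ (x < y ⊎ y < x)
    +-monoˡ-<            : ∀ z {x y} → x < y → x + z < y + z
    *-pos                : ∀ {x y} → 0# < x → 0# < y → 0# < x * y
    0<1                  : 0# < 1#
    archimedean          : ∀ x → ∃[ n ] (x < n · 1#)

  open IsStrictPartialOrder isStrictPartialOrder public
    using (<-respʳ-≈; <-respˡ-≈) renaming (trans to <-trans)

  infix 4 _≤_
  _≤_ : Rel Carrier 0ℓ
  x ≤ y = ¬ (y < x)

  Within : Carrier → Carrier → Carrier → Set
  Within ε x y = x - y < ε × y - x < ε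

  IsCauchy : (ℕ → Carrier) → Set
  IsCauchy u = ∀ ε → 0# < ε → ∃[ N ] (∀ m n → N ℕ.≤ m → N ℕ.≤ n → Within ε (u m) (u n))

  ConvergesTo : (ℕ → Carrier) → Carrier → Set
  ConvergesTo u x = ∀ ε → 0# < ε → ∃[ N ] (∀ n → N ℕ.≤ n → Within ε (u n) x)

  field
    complete : ∀ u → IsCauchy u → ∃[ x ] ConvergesTo u x

  0<suc : ∀ n → 0# < suc n · 1#
  0<suc zero    = <-respʳ-≈ (≈-sym (+-identityʳ 1#)) 0<1
  0<suc (suc n) = <-trans 0<1
    (<-respʳ-≈ (+-comm _ _) (<-respˡ-≈ (+-identityˡ 1#) (+-monoˡ-< 1# (0<suc n))))

  1/_ : (n : ℕ) .{{_ : NonZero n}} → Carrier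
  1/ suc n = proj₁ (#⇒invertible (Equivalence.from #⇔<⊎> (inj₂ (0<suc n))))

  ^-pos : ∀ {x} → 0# < x → ∀ n → 0# < x ^ n
  ^-pos 0<x zero    = 0<1
  ^-pos 0<x (suc n) = *-pos 0<x (^-pos 0<x n)

module Complex (R : RealNumbers) where
  private
    module ℝ = RealNumbers R

  infix 5 _+i_
  record ℂ : Set where
    constructor _+i_
    field
      re im : ℝ.Carrier

  open ℂ public

  rawRing : RawRing 0ℓ 0ℓ
  rawRing = record
    { Carrier = ℂ
    ; _≈_     = λ z w → (re z ℝ.≈ re w) × (im z ℝ.≈ im w)
    ; _+_     = λ z w → (re z ℝ.+ re w) +i (im z ℝ.+ im w)
    ; _*_     = λ z w → (re z ℝ.* re w ℝ.- im z ℝ.* im w) +i (re z ℝ.* im w ℝ.+ im z ℝ.* re w)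
    ; -_      = λ z → (ℝ.- re z) +i (ℝ.- im z)
    ; 0#      = ℝ.0# +i ℝ.0#
    ; 1#      = ℝ.1# +i ℝ.0#
    }

  open Ring rawRing public hiding (Carrier)

  real : ℝ.Carrier → ℂ
  real x = x +i ℝ.0#

  -- |z|²
  normSq : ℂ → ℝ.Carrier
  normSq z = re z ℝ.* re z ℝ.+ im z ℝ.* im z

  ConvergesTo : (ℕ → ℂ) → ℂ → Set
  ConvergesTo u z = ∀ ε → ℝ.0# ℝ.< ε →
    ∃[ N ] (∀ n → N ℕ.≤ n → normSq (u n - z) ℝ.< ε ℝ.* ε)

  SumsTo : (ℕ → ℂ) → ℂ → Set
  SumsTo t = ConvergesTo (λ n → sum {n} (t ∘ toℕ))

  -- The partial function f, with domain D, has complex derivative f′ at s₀.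
  HasDerivativeAt : (D : ℂ → Set) (f : ∀ s → D s → ℂ) (s₀ : ℂ) → D s₀ → ℂ → Set
  HasDerivativeAt D f s₀ d₀ f′ = ∀ ε → ℝ.0# ℝ.< ε → ∃[ δ ] (ℝ.0# ℝ.< δ ×
    (∀ s (d : D s) → normSq (s - s₀) ℝ.< δ ℝ.* δ →
      normSq (f s d - f s₀ d₀ - f′ * (s - s₀)) ℝ.≤ ε ℝ.* ε ℝ.* normSq (s - s₀)))

  record Entire : Set where
    field
      value        : ℂ → ℂ
      derivative   : ℂ → ℂ
      isDerivative : ∀ s → HasDerivativeAt (λ _ → ⊤) (λ z _ → value z) s tt (derivative s)

  -- A meromorphic function on the plane, as a quotient of entire functions.
  -- Two of them that agree on a nonempty open set agree wherever both are
  -- defined, so an analytic continuation of this kind is unique.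
  record Meromorphic : Set where
    field
      numerator   : Entire
      denominator : Entire
      nonTrivial  : ∃[ s ] IsUnit (Entire.value denominator s)

    Domain : ℂ → Set
    Domain s = IsUnit (Entire.value denominator s)

    value : ∀ s → Domain s → ℂ
    value s d = Entire.value numerator s * proj₁ d

-- The exponential function and the natural logarithm.
record ExpLog (R : RealNumbers) : Set where
  private
    module ℝ = RealNumbers R
  open Complex R
  field
    exp        : ℂ → ℂ
    exp-series : ∀ z → SumsTo (λ n → z ^ n * real (ℝ.1/_ (n !) {{n ℕ.!≢0}})) (exp z)
    ln         : ∀ x → ℝ.0# ℝ.< x → ℝ.Carrier
    exp-ln     : ∀ x 0<x → exp (real (ln x 0<x)) ≈ real x

------------------------------------------------------------------------
-- The finite field 𝔽_q

-- A field with q elements (so q is a prime power).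
record FiniteField : Set₁ where
  field
    commutativeRing : CommutativeRing 0ℓ 0ℓ

  open CommutativeRing commutativeRing public
    using (rawRing; setoid; sym; trans) renaming (refl to ≈-refl)
  open Ring rawRing public

  field
    0≉1         : ¬ (0# ≈ 1#)
    inverse     : ∀ x → ¬ (x ≈ 0#) → IsUnit x
    q           : ℕ
    enumeration : Inverse setoid (≡.setoid (Fin q))

  infix 4 _≟_
  _≟_ : Decidable _≈_
  _≟_ = via-injection (Inverse⇒Injection enumeration) Fin._≟_

  instance
    q-nonTrivial : NonTrivial q
    q-nonTrivial = helper q enumeration
      where
      helper : ∀ n → Inverse setoid (≡.setoid (Fin n)) → NonTrivial n
      helper 0 e with () ← Inverse.to e 0#
      helper 1 e = ⊥-elim (0≉1 (Injection.injective (Inverse⇒Injection e) (only _ _)))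
        where
        only : (i j : Fin 1) → i ≡ j
        only Fin.zero Fin.zero = refl
      helper (suc (suc n)) e = _

-- A finite set of elements of A, given as the range of an injective family.
record Enumeration (A : RawRing 0ℓ 0ℓ) (P : RawRing.Carrier A → Set) : Set where
  open RawRing A
  field
    size     : ℕ
    element  : Fin size → Carrier
    sound    : ∀ m → P (element m)
    complete : ∀ a → P a → ∃[ m ] (element m ≈ a)
    distinct : ∀ {m n} → element m ≈ element n → m ≡ n

------------------------------------------------------------------------
-- The polynomial ring 𝔽_q[t]

module Polynomial (K : FiniteField) where
  private
    module F = FiniteField K

  -- Coefficients in order of increasing degree; trailing zeros are allowed.
  Poly : Set
  Poly = List F.Carrier

  coeff : Poly → ℕ → F.Carrier
  coeff []      _       = F.0#
  coeff (c ∷ f) zero    = c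
  coeff (c ∷ f) (suc i) = coeff f i

  private
    _⊞_ : Poly → Poly → Poly
    []      ⊞ g       = g
    (c ∷ f) ⊞ []      = c ∷ f
    (c ∷ f) ⊞ (d ∷ g) = (c F.+ d) ∷ (f ⊞ g)

    _⊠_ : Poly → Poly → Poly
    []      ⊠ g = []
    (c ∷ f) ⊠ g = List.map (c F.*_) g ⊞ (F.0# ∷ (f ⊠ g))

  rawRing : RawRing 0ℓ 0ℓ
  rawRing = record
    { Carrier = Poly
    ; _≈_     = λ f g → ∀ i → coeff f i F.≈ coeff g i
    ; _+_     = _⊞_
    ; _*_     = _⊠_
    ; -_      = List.map (λ c → F.- c)
    ; 0#      = []
    ; 1#      = F.1# ∷ []
    }

  open Ring rawRing public hiding (Carrier)

  DegreeBelow : ℕ → Poly → Set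
  DegreeBelow d f = ∀ i → d ℕ.≤ i → coeff f i F.≈ F.0#

  -- f is monic of degree d.
  MonicOfDegree : ℕ → Poly → Set
  MonicOfDegree d f = (coeff f d F.≈ F.1#) × DegreeBelow (suc d) f

------------------------------------------------------------------------
-- The field k_∞ = 𝔽_q((1/θ))

module Laurent (K : FiniteField) where
  private
    module F = FiniteField K
    module A = Polynomial K

  -- The series Σ_{j ≥ 0} (digit j) θ^(top - j); digit 0 may vanish.
  record k∞ : Set where
    constructor laurent
    field
      top   : ℤ
      digit : ℕ → F.Carrier

  open k∞

  -- The coefficient of θ^e.
  coeff : k∞ → ℤ → F.Carrier
  coeff f e with top f ℤ.- e
  ... | + j      = digit f j
  ... | -[1+ _ ] = F.0#

  monomial : F.Carrier → ℤ → k∞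
  monomial c e = laurent e λ { zero → c ; (suc _) → F.0# }

  rawRing : RawRing 0ℓ 0ℓ
  rawRing = record
    { Carrier = k∞
    ; _≈_     = λ f g → ∀ e → coeff f e F.≈ coeff g e
    ; _+_     = λ f g → let N = top f ℤ.⊔ top g in
                  laurent N (λ j → coeff f (N ℤ.- + j) F.+ coeff g (N ℤ.- + j))
    ; _*_     = λ f g → laurent (top f ℤ.+ top g)
                  (λ n → F.sum {suc n} (λ j → digit f (toℕ j) F.* digit g (n ∸ toℕ j)))
    ; -_      = λ f → laurent (top f) (λ j → F.- digit f j)
    ; 0#      = monomial F.0# (+ 0)
    ; 1#      = monomial F.1# (+ 0)
    }

  open Ring rawRing public hiding (Carrier)

  θ^_ : ℤ → k∞
  θ^ e = monomial F.1# e

  -- f(θ), by Horner's rule.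
  _⟨θ⟩ : A.Poly → k∞
  f ⟨θ⟩ = foldr (λ c g → monomial c (+ 0) + (θ^ (+ 1)) * g) 0# f

  HasDegree : k∞ → ℤ → Set
  HasDegree f d = ¬ (coeff f d F.≈ F.0#) × (∀ e → d ℤ.< e → coeff f e F.≈ F.0#)

  ConvergesTo : (ℕ → k∞) → k∞ → Set
  ConvergesTo u f = ∀ d → ∃[ N ] (∀ n → N ℕ.≤ n → ∀ e → d ℤ.≤ e → coeff (u n) e F.≈ coeff f e)

------------------------------------------------------------------------
-- Normalized gamma values

module Gamma (K : FiniteField) (ℓ : ℕ) {{_ : NonZero ℓ}} where
  open FiniteField K using (q; q-nonTrivial)
  private
    module F = FiniteField K
    module A = Polynomial K
  open Laurent K

  -- A p-adic integer Σ y_i q^i is given by its digits 0 ≤ y_i < q.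
  Digits : Set
  Digits = ℕ → ℕ

  -- The digits of q^c / (1 - q^ℓ) = Σ_j q^(c + jℓ), for 0 ≤ c < ℓ.
  digits : ℕ → Digits
  digits c m = if m % ℓ ≡ᵇ c then 1 else 0

  private instance
    q^ℓ∸1-nonZero : NonZero (q ℕ.^ ℓ ∸ 1)
    q^ℓ∸1-nonZero = ℕ.>-nonZero (ℕ.m<n⇒0<n∸m (ℕ.<-≤-trans (ℕ.nonTrivial⇒n>1 q)
      (≡.subst (ℕ._≤ q ℕ.^ ℓ) (ℕ.*-identityʳ q)
        (ℕ.^-monoʳ-≤ q {{ℕ.nonTrivial⇒nonZero q}} (ℕ.>-nonZero⁻¹ ℓ)))))

  -- ∂ (q^c / (1 - q^ℓ)) = c q^c / (1 - q^ℓ) + ℓ q^(ℓ + c) / (1 - q^ℓ)²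
  ∂ : ℕ → ℚᵘ
  ∂ c = ℚᵘ.- ((+ (c ℕ.* q ℕ.^ c)) ℚᵘ./ (q ℕ.^ ℓ ∸ 1))
        ℚᵘ.+ ((+ (ℓ ℕ.* q ℕ.^ (ℓ ℕ.+ c))) ℚᵘ./ (q ℕ.^ ℓ ∸ 1)) ℚᵘ.* ((+ 1) ℚᵘ./ (q ℕ.^ ℓ ∸ 1))

  record Π-ari (y : Digits) : Set where
    field
      value : k∞
      limit : ConvergesTo
        (λ n → product {n} λ i → let m = suc (toℕ i) in
          (product {m} λ j → 1# - (θ^ ((+ (q ℕ.^ toℕ j)) ℤ.- (+ (q ℕ.^ m))))) ^ y m)
        value

  -- The existence of the factors (1 + x/a)⁻¹ entails that x is not in -A₊.
  record Π-geo (x : k∞) (y : Digits) : Set where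
    field
      monics : ∀ i → Enumeration A.rawRing (A.MonicOfDegree i)

    a : ∀ i → Fin (Enumeration.size (monics i)) → A.Poly
    a i = Enumeration.element (monics i)

    field
      1/a    : ∀ i m → IsUnit (a i m ⟨θ⟩)
      factor : ∀ i m → IsUnit (1# + x * proj₁ (1/a i m))
      value  : k∞
      limit  : ConvergesTo
        (λ n → product {n} λ i → product λ m → proj₁ (factor (toℕ i) m) ^ y (toℕ i))
        value

  -- With x = Σ ε_i θ^(-i).
  ε : k∞ → ℕ → F.Carrier
  ε x i = coeff x (ℤ.- + i)

  ⟨_⟩_ : k∞ → ℕ → ℕ
  ⟨ x ⟩ N = if does (Fin.all? {N} (λ j → ε x (suc (toℕ j)) F.≟ F.0#) ×-dec (ε x (suc N) F.≟ F.1#))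
            then 1 else 0

  -- m = ⟨ x , q^i / (q^ℓ - 1) ⟩, the sum of ⟨ x ⟩ N over N ≡ -1 - i mod ℓ.
  IsBracket : k∞ → ℕ → ℕ → Set
  IsBracket x i m = ∃[ M ] (∀ n → M ℕ.≤ n →
    List.sum (List.map (λ N → if does (ℓ ∣? (N ℕ.+ 1 ℕ.+ i)) then ⟨ x ⟩ N else 0) (upTo n)) ≡ m)

  -- The data defining Γ*(x , y) for y = 1 - q^i / (q^ℓ - 1), so that
  -- y - 1 = q^i / (1 - q^ℓ).  Here Γ_ari(y) = Π_ari(y - 1).
  data Γ* (x : k∞) (i : ℕ) : Set where
    at-zero  : x ≈ 0# → (Γari : Π-ari (digits i)) → IsUnit (Π-ari.value Γari) → Γ* x i
    off-zero : ¬ (x ≈ 0#) → (Γari : Π-ari (digits i)) → IsUnit (Π-ari.value Γari) →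
              (m : ℕ) → IsBracket x i m → IsUnit (x ^ m) → Π-geo x (digits i) → Γ* x i

  -- Γ*(x , y) = θ^(exponent) · mantissa
  exponent : ∀ {x i} → Γ* x i → ℚᵘ
  exponent {i = i} _ = ℚᵘ.- ∂ i

  mantissa : ∀ {x i} → Γ* x i → k∞
  mantissa (at-zero _ _ 1/Γari)                  = proj₁ 1/Γari
  mantissa (off-zero _ _ 1/Γari _ _ 1/x^m geo) = proj₁ 1/x^m * Π-geo.value geo * proj₁ 1/Γari

------------------------------------------------------------------------
-- Absolute values

module Absolute (K : FiniteField) (R : RealNumbers) where
  open FiniteField K using (q; q-nonTrivial)
  open RealNumbers R

  private instance
    q-nonZero : NonZero q
    q-nonZero = ℕ.nonTrivial⇒nonZero q

  q^_ : ℤ → Carrier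
  q^ (+ n)    = (q · 1#) ^ n
  q^ -[1+ n ] = (1/ q) ^ suc n

  private
    0<n : ∀ n .{{_ : NonZero n}} → 0# < n · 1#
    0<n (suc n) = 0<suc n

  0<q^ : ∀ n → 0# < q^ (+ n)
  0<q^ = ^-pos (0<n q)

  -- v = |θ^r f|, for rational r and f of degree d: the positive real with
  -- v^b = |θ|^a |f|^b, where r = a/b.
  record AbsoluteValue (r : ℚᵘ) (f : Laurent.k∞ K) : Set where
    field
      degree    : ℤ
      hasDegree : Laurent.HasDegree K f degree
      value     : Carrier
      positive  : 0# < value
      power     : value ^ ↧ₙ r ≈ q^ (↥ r ℤ.+ degree ℤ.* + ↧ₙ r)

------------------------------------------------------------------------
-- Characters of (A/𝔫)^× × ℤ/ℓ and their L-functions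

module Characters (K : FiniteField) (R : RealNumbers) (ℓ : ℕ) where
  open Complex R using (ℂ)
  private
    module A = Polynomial K
    module C = Complex R

  -- The group is the setoid of pairs (a , i) with a prime to 𝔫, taken modulo
  -- 𝔫 and ℓ; the value of χ at other pairs is irrelevant.  Values are nonzero
  -- by 1-homo and *-homo.
  record Character (𝔫 : A.Poly) : Set where
    field
      χ      : A.Poly → ℤ → ℂ
      χ-cong : ∀ {a b i j} → A.Coprime a 𝔫 → A.Coprime b 𝔫 →
               𝔫 A.∣ (a A.- b) → + ℓ ℤ.∣ (i ℤ.- j) → χ a i C.≈ χ b j
      *-homo : ∀ {a b} i j → A.Coprime a 𝔫 → A.Coprime b 𝔫 →
               χ (a A.* b) (i ℤ.+ j) C.≈ χ a i C.* χ b j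
      1-homo : χ A.1# (+ 0) C.≈ C.1#

  open Character public

  -- χ is the composite of ψ with (A/𝔫)^× × ℤ/ℓ → (A/𝔠)^× × ℤ/ℓ.
  _Induces_ : ∀ {𝔠 𝔫} → Character 𝔠 → Character 𝔫 → Set
  _Induces_ {𝔫 = 𝔫} ψ φ = ∀ a i → A.Coprime a 𝔫 → χ ψ a i C.≈ χ φ a i

  -- The conductor of φ, with φ regarded as a character modulo it.
  record Conductor {𝔫 : A.Poly} (φ : Character 𝔫) : Set where
    field
      𝔠         : A.Poly
      deg       : ℕ
      monic     : A.MonicOfDegree deg 𝔠
      divides   : 𝔠 A.∣ 𝔫
      reduced   : Character 𝔠
      induces   : reduced Induces φ
      minimal   : ∀ {𝔡 d} → A.MonicOfDegree d 𝔡 → 𝔡 A.∣ 𝔫 →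
                  (ψ : Character 𝔡) → ψ Induces φ → 𝔠 A.∣ 𝔡

module LFunction (K : FiniteField) (R : RealNumbers) (E : ExpLog R) (ℓ : ℕ) where
  open Complex R
  open ExpLog E
  open Characters K R ℓ
  open Absolute K R
  private
    module A = Polynomial K
    module ℝ = RealNumbers R

  -- ln |f| for f of degree d.
  ln∣_∣ : ℕ → ℝ.Carrier
  ln∣ d ∣ = ln (q^ (+ d)) (0<q^ d)

  -- The primes of degree at most n that do not divide 𝔠.
  EulerPrime : A.Poly → ℕ → A.Poly → Set
  EulerPrime 𝔠 n 𝔭 = ∃[ d ] (A.MonicOfDegree d 𝔭 × d ℕ.≤ n × A.Irreducible 𝔭 × ¬ (𝔭 A.∣ 𝔠))

  -- z is the value at s of the Euler product, ordered by degree.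
  EulerProduct : ∀ {𝔠} → Character 𝔠 → ℂ → ℂ → Set
  EulerProduct {𝔠} ψ s z = (primes : ∀ n → Enumeration A.rawRing (EulerPrime 𝔠 n)) →
    let 𝔭 = λ n m → Enumeration.element (primes n) m
        d = λ n m → proj₁ (Enumeration.sound (primes n) m)
    in Σ[ factor ∈ (∀ n m → IsUnit (1# - χ ψ (𝔭 n m) (+ d n m) * exp (- s * real ln∣ d n m ∣))) ]
         ConvergesTo (λ n → product (λ m → proj₁ (factor n m))) z

  -- The meromorphic continuation of the Euler product from Re s > 1.
  record L-function {𝔠} (ψ : Character 𝔠) : Set where
    field
      L     : Meromorphic
      euler : ∀ s → ℝ.1# ℝ.< re s →
              Σ[ s∈D ∈ Meromorphic.Domain L s ] EulerProduct ψ s (Meromorphic.value L s s∈D)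

-- With u = q^(-s), let c_d be the sum of χ(a, d) over the monic a of degree d
-- prime to 𝔠, so that L(s) = Σ c_d u^d.  If deg 𝔠 > 0, then χ is nontrivial on
-- (A/𝔠)^×, so c_d = 0 for d ≥ deg 𝔠 and L is a polynomial in u; if 𝔠 = 1, then
-- L = 1/(1 - zu) with z = q χ(1, 1).  Removing the Euler factors of a finite set
-- S of primes leaves the sum over the a with no divisor in S; once S contains
-- all primes of degree at most n, this is 1 + O(|qu|^(n+1)), and so the Euler
-- product converges to L for Re s > 1.
--
-- On the gamma side |x| < 1 for x = a/𝔠, hence Π_geo, Γ_ari and their inverses
-- have absolute value 1, and ln|Γ*(x, y)| / ln q = -∂_i + (deg 𝔠 - deg a) [...],
-- where the bracket is 1 if a is monic and i + deg 𝔠 ≡ deg a mod ℓ, and 0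
-- otherwise.  For deg 𝔠 > 0 the terms ∂_i cancel by orthogonality, and both sides
-- equal -Σ c_d d ln q.  For 𝔠 = 1 only Σ χ(1, i) ∂_i = z/(1 - z)² remains.
module Submission where

open import Defs
open import Algebra.Bundles using (CommutativeRing; RawRing)
import Algebra.Solver.Ring
open import Algebra.Solver.Ring.AlmostCommutativeRing using (fromCommutativeRing; _-Raw-AlmostCommutative⟶_)
open import Algebra.Apartness.Bundles using (HeytingField)
import Algebra.Properties.Ring
import Algebra.Properties.AbelianGroup
import Algebra.Properties.Semiring.Sum
import Algebra.Properties.CommutativeMonoid.Sum
import Algebra.Properties.Semiring.Exp
import Algebra.Properties.CommutativeSemiring.Exp
import Algebra.Properties.Semiring.Mult
import Algebra.Properties.Semiring.Mult.TCOptimised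
import Algebra.Definitions.RawMagma
open import Algebra.Structures using (IsCommutativeRing)
open import Data.Bool.Base using (if_then_else_; true; false)
open import Data.Empty using (⊥; ⊥-elim)
open import Data.Fin.Base using (Fin; toℕ)
import Data.Fin.Base as Fin
import Data.Fin.Properties as Fin
import Data.Fin.Permutation as Perm
open import Data.Integer.Base using (ℤ; +_; -[1+_])
import Data.Integer.Base as ℤ
import Data.Integer.Properties as ℤ
import Data.Integer.Divisibility as ℤ
open import Data.List.Base using (List; []; _∷_)
import Data.List.Base as List
open import Data.Maybe.Base using (Maybe; just; nothing)
open import Data.Nat.Base using (ℕ; NonZero; zero; suc) renaming (_+_ to _+ℕ_)
import Data.Nat.Base as ℕ
import Data.Nat.Properties as ℕ
import Data.Nat.DivMod as ℕ
import Data.Nat.Divisibility as ℕ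
open import Data.Product.Base using (Σ-syntax; ∃-syntax; _×_; _,_; proj₁; proj₂)
import Data.Rational.Unnormalised.Base as ℚᵘ
open import Data.Sum.Base using (_⊎_; inj₁; inj₂; [_,_]′)
open import Function.Base using (_∘_; _$_; id; case_of_)
open import Function.Bundles using (Inverse; Equivalence)
open import Level using (0ℓ; _⊔_)
open import Relation.Binary.Definitions using (tri<; tri≈; tri>)
open import Relation.Binary.PropositionalEquality using (_≡_; _≢_; cong; cong₂; subst)
import Relation.Binary.PropositionalEquality as ≡
import Relation.Binary.Reasoning.Setoid
open import Relation.Binary.Structures using (IsStrictPartialOrder; IsEquivalence)
open import Relation.Nullary.Decidable using (Dec; yes; no; does; _×-dec_; ¬?; toSum)
open import Relation.Nullary.Negation using (¬_)

-- The order on the reals is undecidable: `x ≤ y` means `¬ (y < x)`, and equality follows from two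
-- such negations. Three features of the proof come from this. Moduli appear as squared norms and as
-- bounds `z ≼ b`, so that no square root is taken. The case distinction is on whether deg 𝔠 is 0,
-- which can be decided; for deg 𝔠 > 0, that χ is nontrivial on (A/𝔠)^× follows from minimality of
-- the conductor only as a negation, and orthogonality can be drawn from it because equality in ℂ is
-- stable under double negation. Every nonvanishing statement has to come with an inverse; for 𝔠 = 1
-- and s = 0 it is built from z^ℓ = q^ℓ. `exp` is given by its series and `ln` by `exp-ln` alone, so
-- the functional equation, positivity, monotonicity and derivative of exp are developed from the
-- series, and identities between logarithms are obtained by exponentiating. The gamma values are
-- arbitrary data satisfying the definitions, hence their absolute values are read off from leading
-- terms that all such data must share.

-- Algebra.Solver.Ring only cancels terms when it can decide equality of
-- coefficients, so it is given integer ones.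
module IntegerSolver {c ℓ} (R : CommutativeRing c ℓ) where
  open CommutativeRing R
  open Algebra.Properties.Ring ring using (-0#≈0#; -‿distribˡ-*; -‿distribʳ-*; -‿involutive)
  open Algebra.Properties.AbelianGroup +-abelianGroup using (⁻¹-∙-comm)
  open Algebra.Properties.Semiring.Mult.TCOptimised semiring
    using (×1-homo-*; ×-homo-+) renaming (_×_ to _·_)
  open Relation.Binary.Reasoning.Setoid setoid

  ⟦_⟧ℤ : ℤ → Carrier
  ⟦ + n      ⟧ℤ = n · 1#
  ⟦ -[1+ n ] ⟧ℤ = - (suc n · 1#)

  ⟦⟧-neg : ∀ i → ⟦ ℤ.- i ⟧ℤ ≈ - ⟦ i ⟧ℤ
  ⟦⟧-neg (+ zero)  = sym -0#≈0#
  ⟦⟧-neg (+ suc n) = refl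
  ⟦⟧-neg -[1+ n ]  = sym (-‿involutive _)

  private
    cancel : ∀ x y z → (x + y) - (x + z) ≈ y - z
    cancel x y z = begin
      (x + y) - (x + z)     ≈⟨ +-congˡ (⁻¹-∙-comm x z) ⟨
      (x + y) + (- x - z)   ≈⟨ +-congʳ (+-comm x y) ⟩
      (y + x) + (- x - z)   ≈⟨ +-assoc y x _ ⟩
      y + (x + (- x - z))   ≈⟨ +-congˡ (+-assoc x (- x) (- z)) ⟨
      y + ((x - x) - z)     ≈⟨ +-congˡ (+-congʳ (-‿inverseʳ x)) ⟩
      y + (0# - z)          ≈⟨ +-congˡ (+-identityˡ _) ⟩
      y - z                 ∎

  ⟦⟧-⊖ : ∀ m n → ⟦ m ℤ.⊖ n ⟧ℤ ≈ m · 1# - n · 1#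
  ⟦⟧-⊖ m zero = begin
    m · 1#        ≈⟨ +-identityʳ _ ⟨
    m · 1# + 0#   ≈⟨ +-congˡ -0#≈0# ⟨
    m · 1# - 0#   ∎
  ⟦⟧-⊖ zero (suc n)    = sym (+-identityˡ _)
  ⟦⟧-⊖ (suc m) (suc n) = begin
    ⟦ suc m ℤ.⊖ suc n ⟧ℤ            ≡⟨ cong ⟦_⟧ℤ (ℤ.[1+m]⊖[1+n]≡m⊖n m n) ⟩
    ⟦ m ℤ.⊖ n ⟧ℤ                    ≈⟨ ⟦⟧-⊖ m n ⟩
    m · 1# - n · 1#                 ≈⟨ cancel 1# _ _ ⟨
    (1# + m · 1#) - (1# + n · 1#)   ≈⟨ +-cong (×-homo-+ 1# 1 m) (-‿cong (×-homo-+ 1# 1 n)) ⟨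
    suc m · 1# - suc n · 1#         ∎

  ⟦⟧-+ : ∀ i j → ⟦ i ℤ.+ j ⟧ℤ ≈ ⟦ i ⟧ℤ + ⟦ j ⟧ℤ
  ⟦⟧-+ (+ m)    (+ n)    = ×-homo-+ 1# m n
  ⟦⟧-+ (+ m)    -[1+ n ] = ⟦⟧-⊖ m (suc n)
  ⟦⟧-+ -[1+ m ] (+ n)    = trans (⟦⟧-⊖ n (suc m)) (+-comm _ _)
  ⟦⟧-+ -[1+ m ] -[1+ n ] = begin
    - (suc (suc (m ℕ.+ n)) · 1#)        ≡⟨ cong (λ k → - (suc k · 1#)) (ℕ.+-suc m n) ⟨
    - ((suc m ℕ.+ suc n) · 1#)          ≈⟨ -‿cong (×-homo-+ 1# (suc m) (suc n)) ⟩
    - (suc m · 1# + suc n · 1#)         ≈⟨ ⁻¹-∙-comm _ _ ⟨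
    - (suc m · 1#) - (suc n · 1#)       ∎

  ⟦⟧-+* : ∀ m j → ⟦ + m ℤ.* j ⟧ℤ ≈ (m · 1#) * ⟦ j ⟧ℤ
  ⟦⟧-+* m (+ n)    = begin
    ⟦ + m ℤ.* + n ⟧ℤ   ≡⟨ cong ⟦_⟧ℤ (ℤ.pos-* m n) ⟨
    (m ℕ.* n) · 1#     ≈⟨ ×1-homo-* m n ⟩
    m · 1# * (n · 1#)  ∎
  ⟦⟧-+* m -[1+ n ] = begin
    ⟦ + m ℤ.* (ℤ.- (+ suc n)) ⟧ℤ   ≡⟨ cong ⟦_⟧ℤ (ℤ.neg-distribʳ-* (+ m) (+ suc n)) ⟨
    ⟦ ℤ.- (+ m ℤ.* + suc n) ⟧ℤ     ≈⟨ ⟦⟧-neg (+ m ℤ.* + suc n) ⟩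
    - ⟦ + m ℤ.* + suc n ⟧ℤ         ≈⟨ -‿cong (⟦⟧-+* m (+ suc n)) ⟩
    - (m · 1# * (suc n · 1#))      ≈⟨ -‿distribʳ-* _ _ ⟩
    m · 1# * - (suc n · 1#)        ∎

  ⟦⟧-* : ∀ i j → ⟦ i ℤ.* j ⟧ℤ ≈ ⟦ i ⟧ℤ * ⟦ j ⟧ℤ
  ⟦⟧-* (+ m) j    = ⟦⟧-+* m j
  ⟦⟧-* -[1+ m ] j = begin
    ⟦ ℤ.- (+ suc m) ℤ.* j ⟧ℤ       ≡⟨ cong ⟦_⟧ℤ (ℤ.neg-distribˡ-* (+ suc m) j) ⟨
    ⟦ ℤ.- (+ suc m ℤ.* j) ⟧ℤ       ≈⟨ ⟦⟧-neg (+ suc m ℤ.* j) ⟩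
    - ⟦ + suc m ℤ.* j ⟧ℤ           ≈⟨ -‿cong (⟦⟧-+* (suc m) j) ⟩
    - (suc m · 1# * ⟦ j ⟧ℤ)        ≈⟨ -‿distribˡ-* _ _ ⟩
    - (suc m · 1#) * ⟦ j ⟧ℤ        ∎

  private
    morphism : ℤ.+-*-rawRing -Raw-AlmostCommutative⟶ fromCommutativeRing R
    morphism = record
      { ⟦_⟧    = ⟦_⟧ℤ
      ; +-homo = ⟦⟧-+
      ; *-homo = ⟦⟧-*
      ; -‿homo = ⟦⟧-neg
      ; 0-homo = refl
      ; 1-homo = refl
      }

    coefficient≟ : ∀ i j → Maybe (⟦ i ⟧ℤ ≈ ⟦ j ⟧ℤ)
    coefficient≟ i j with i ℤ.≟ j
    ... | yes i≡j = just (reflexive (cong ⟦_⟧ℤ i≡j))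
    ... | no  _   = nothing

  open Algebra.Solver.Ring ℤ.+-*-rawRing (fromCommutativeRing R) morphism coefficient≟ public
    using (solve; _:=_; _:+_; _:*_; _:-_; :-_; con; _:^_)

  :0 :1 : ∀ {n} → Algebra.Solver.Ring.Polynomial ℤ.+-*-rawRing (fromCommutativeRing R) morphism coefficient≟ n
  :0 = con (+ 0)
  :1 = con (+ 1)

-- Finite sums, convolutions and residues modulo ℓ

module FiniteSums {c ℓ} (A : CommutativeRing c ℓ) where
  open CommutativeRing A
  open Algebra.Properties.Semiring.Sum semiring
  open IntegerSolver A
  open Relation.Binary.Reasoning.Setoid setoid

  Σ< : ℕ → (ℕ → Carrier) → Carrier
  Σ< n t = sum {n} (t ∘ toℕ)

  Σ<-suc : ∀ n t → Σ< (suc n) t ≈ Σ< n t + t n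
  Σ<-suc zero    t = +-comm _ _
  Σ<-suc (suc n) t = trans (+-congˡ (Σ<-suc n (t ∘ suc))) (sym (+-assoc _ _ _))

  Σ<-cong : ∀ n {t t′ : ℕ → Carrier} → (∀ k → k ℕ.< n → t k ≈ t′ k) → Σ< n t ≈ Σ< n t′
  Σ<-cong zero    h = refl
  Σ<-cong (suc n) h = +-cong (h 0 (ℕ.s≤s ℕ.z≤n)) (Σ<-cong n (λ k k<n → h (suc k) (ℕ.s≤s k<n)))

  Σ<-+ : ∀ m n t → Σ< (m +ℕ n) t ≈ Σ< m t + Σ< n (λ k → t (m +ℕ k))
  Σ<-+ zero    n t = sym (+-identityˡ _)
  Σ<-+ (suc m) n t = trans (+-congˡ (Σ<-+ m n (t ∘ suc))) (sym (+-assoc _ _ _))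

  sum-zero : ∀ {n} (f : Fin n → Carrier) → (∀ i → f i ≈ 0#) → sum f ≈ 0#
  sum-zero {n} f f≈0 = trans (sum-cong-≋ f≈0) (sum-replicate-zero n)

  sum-single : ∀ {n} (f : Fin n → Carrier) i → (∀ j → j ≢ i → f j ≈ 0#) → sum f ≈ f i
  sum-single {suc n} f Fin.zero    f≈0 = trans (+-congˡ (sum-zero _ (λ j → f≈0 (Fin.suc j) λ ()))) (+-identityʳ _)
  sum-single {suc n} f (Fin.suc i) f≈0 = trans (+-cong (f≈0 Fin.zero λ ()) (sum-single (f ∘ Fin.suc) i λ j j≢i → f≈0 (Fin.suc j) (j≢i ∘ Fin.suc-injective))) (+-identityˡ _)

  convolution : (a b : ℕ → Carrier) → ℕ → Carrier
  convolution a b zero    = a 0 * b 0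
  convolution a b (suc n) = a 0 * b (suc n) + convolution (a ∘ suc) b n

  convolution-cong : ∀ {a a′ b b′} n → (∀ k → a k ≈ a′ k) → (∀ k → b k ≈ b′ k) → convolution a b n ≈ convolution a′ b′ n
  convolution-cong zero    p q = *-cong (p 0) (q 0)
  convolution-cong (suc n) p q = +-cong (*-cong (p 0) (q (suc n))) (convolution-cong n (p ∘ suc) q)

  convolution-last : ∀ a b n → convolution a b (suc n) ≈ convolution a (b ∘ suc) n + a (suc n) * b 0
  convolution-last a b zero    = refl
  convolution-last a b (suc n) = trans (+-congˡ (convolution-last (a ∘ suc) b n)) (sym (+-assoc _ _ _))

  convolution-scaleˡ : ∀ c a b n → convolution (λ k → c * a k) b n ≈ c * convolution a b n
  convolution-scaleˡ c a b zero    = *-assoc _ _ _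
  convolution-scaleˡ c a b (suc n) = trans (+-cong (*-assoc _ _ _) (convolution-scaleˡ c (a ∘ suc) b n)) (sym (distribˡ _ _ _))

  convolution-scaleʳ : ∀ c a b n → convolution a (λ k → c * b k) n ≈ c * convolution a b n
  convolution-scaleʳ c a b zero    = solve 3 (λ c a b → a :* (c :* b) := c :* (a :* b)) refl c (a 0) (b 0)
  convolution-scaleʳ c a b (suc n) = trans (+-congˡ (convolution-scaleʳ c (a ∘ suc) b n))
    (solve 4 (λ c a b x → a :* (c :* b) :+ c :* x := c :* (a :* b :+ x)) refl c (a 0) (b (suc n)) (convolution (a ∘ suc) b n))

  -- The Leibniz rule on coefficients: weights that add up along the antidiagonal act on a product
  -- as a derivation does. If both weights are the index, this is the derivative of a product of
  -- power series.
  convolution-weight : ∀ n (a b α β : ℕ → Carrier) γ → (∀ j k → j +ℕ k ≡ n → α j + β k ≈ γ) →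
    convolution (λ j → α j * a j) b n + convolution a (λ k → β k * b k) n ≈ γ * convolution a b n
  convolution-weight zero a b α β γ h = begin
    α 0 * a 0 * b 0 + a 0 * (β 0 * b 0)  ≈⟨ solve 4 (λ α β a b → α :* a :* b :+ a :* (β :* b) := (α :+ β) :* (a :* b)) refl (α 0) (β 0) (a 0) (b 0) ⟩
    (α 0 + β 0) * (a 0 * b 0)            ≈⟨ *-congʳ (h 0 0 ≡.refl) ⟩
    γ * (a 0 * b 0)                      ∎
  convolution-weight (suc n) a b α β γ h = begin
    (α 0 * a 0 * b (suc n) + X) + (a 0 * (β (suc n) * b (suc n)) + Y)
      ≈⟨ solve 6 (λ α β a b x y → (α :* a :* b :+ x) :+ (a :* (β :* b) :+ y) := (α :+ β) :* (a :* b) :+ (x :+ y)) refl (α 0) (β (suc n)) (a 0) (b (suc n)) X Y ⟩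
    (α 0 + β (suc n)) * (a 0 * b (suc n)) + (X + Y)
      ≈⟨ +-cong (*-congʳ (h 0 (suc n) ≡.refl)) (convolution-weight n (a ∘ suc) b (α ∘ suc) β γ (λ j k eq → h (suc j) k (cong suc eq))) ⟩
    γ * (a 0 * b (suc n)) + γ * convolution (a ∘ suc) b n
      ≈⟨ distribˡ _ _ _ ⟨
    γ * (a 0 * b (suc n) + convolution (a ∘ suc) b n) ∎
    where
    X = convolution (λ j → α (suc j) * a (suc j)) b n
    Y = convolution (a ∘ suc) (λ k → β k * b k) n

  -- The sum of a j * b k over j + k < n.
  triangle : (a b : ℕ → Carrier) → ℕ → Carrier
  triangle a b zero    = 0#
  triangle a b (suc n) = a 0 * Σ< (suc n) b + triangle (a ∘ suc) b n

  -- The same pairs j + k < n, grouped by j instead of by j + k.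
  Σ<-convolution : ∀ n a b → Σ< n (convolution a b) ≈ triangle a b n
  Σ<-convolution zero    a b = refl
  Σ<-convolution (suc n) a b = begin
    a 0 * b 0 + Σ< n (λ k → a 0 * b (suc k) + convolution (a ∘ suc) b k)
      ≈⟨ +-congˡ (∑-distrib-+ {n} (λ i → a 0 * b (suc (toℕ i))) _) ⟩
    a 0 * b 0 + (Σ< n (λ k → a 0 * b (suc k)) + Σ< n (convolution (a ∘ suc) b))
      ≈⟨ +-congˡ (+-cong (*-distribˡ-sum {n} (a 0) _) (sym (Σ<-convolution n (a ∘ suc) b))) ⟨
    a 0 * b 0 + (a 0 * Σ< n (b ∘ suc) + triangle (a ∘ suc) b n)
      ≈⟨ solve 4 (λ a b x y → a :* b :+ (a :* x :+ y) := a :* (b :+ x) :+ y) refl (a 0) (b 0) (Σ< n (b ∘ suc)) (triangle (a ∘ suc) b n) ⟩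
    a 0 * (b 0 + Σ< n (b ∘ suc)) + triangle (a ∘ suc) b n ∎

-- ρ k and ν k stand for 1 / k! and k.
record ReciprocalFactorials {c ℓ} (A : CommutativeRing c ℓ) : Set (c ⊔ ℓ) where
  open CommutativeRing A
  field
    ρ ν    : ℕ → Carrier
    ρ0≈1   : ρ 0 ≈ 1#
    ν0≈0   : ν 0 ≈ 0#
    ν-+    : ∀ j k → ν j + ν k ≈ ν (j +ℕ k)
    νρ     : ∀ k → ν (suc k) * ρ (suc k) ≈ ρ k
    ν-unit : ∀ k → ∃[ u ] (u * ν (suc k) ≈ 1#)

module ExponentialTerms {c ℓ} {A : CommutativeRing c ℓ} (reciprocals : ReciprocalFactorials A) where
  open CommutativeRing A
  open ReciprocalFactorials reciprocals
  open Algebra.Properties.Semiring.Exp semiring using (_^_)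
  open IntegerSolver A
  open FiniteSums A
  open Relation.Binary.Reasoning.Setoid setoid

  term : Carrier → ℕ → Carrier
  term z k = z ^ k * ρ k

  private
    ν-term : ∀ z k → ν (suc k) * term z (suc k) ≈ z * term z k
    ν-term z k = trans (solve 4 (λ ν z p ρ → ν :* (z :* p :* ρ) := z :* (p :* (ν :* ρ))) refl (ν (suc k)) z (z ^ k) (ρ (suc k)))
      (*-congˡ (*-congˡ (νρ k)))

    ν-cancel : ∀ k {x y} → ν (suc k) * x ≈ ν (suc k) * y → x ≈ y
    ν-cancel k {x} {y} eq = begin
      x                  ≈⟨ inv x ⟨
      u * (ν (suc k) * x) ≈⟨ *-congˡ eq ⟩
      u * (ν (suc k) * y) ≈⟨ inv y ⟩
      y                  ∎
      where
      u = proj₁ (ν-unit k)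
      inv : ∀ x → u * (ν (suc k) * x) ≈ x
      inv x = trans (sym (*-assoc _ _ _)) (trans (*-congʳ (proj₂ (ν-unit k))) (*-identityˡ x))

  -- The binomial theorem divided by n!. Both sides satisfy (n + 1) c (n + 1) = (z + w) c n, the
  -- recurrence of the differential equation y′ = (z + w) y, so binomial coefficients never appear.
  convolution-term : ∀ z w n → convolution (term z) (term w) n ≈ term (z + w) n
  convolution-term z w zero = trans (*-congˡ (trans (*-identityˡ _) ρ0≈1)) (*-identityʳ _)
  convolution-term z w (suc n) = ν-cancel n (begin
    ν (suc n) * C (suc n)
      ≈⟨ convolution-weight (suc n) (term z) (term w) ν ν (ν (suc n)) (λ j k eq → trans (ν-+ j k) (reflexive (cong ν eq))) ⟨
    ν 0 * term z 0 * term w (suc n) + convolution (λ j → ν (suc j) * term z (suc j)) (term w) n + convolution (term z) (λ k → ν k * term w k) (suc n)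
      -- Both terms of weight `ν 0` vanish; the rest is shifted by one, and `ν-term` lowers the
      -- index.
      ≈⟨ +-cong (+-cong (*-congʳ (trans (*-congʳ ν0≈0) (zeroˡ _))) (convolution-cong n (ν-term z) (λ _ → refl)))
                (trans (convolution-last (term z) (λ k → ν k * term w k) n) (+-cong (convolution-cong n (λ _ → refl) (ν-term w)) (*-congˡ (trans (*-congʳ ν0≈0) (zeroˡ _))))) ⟩
    0# * term w (suc n) + convolution (λ j → z * term z j) (term w) n + (convolution (term z) (λ k → w * term w k) n + term z (suc n) * 0#)
      ≈⟨ +-cong (+-congˡ (convolution-scaleˡ z (term z) (term w) n)) (+-congʳ (convolution-scaleʳ w (term z) (term w) n)) ⟩
    0# * term w (suc n) + z * C n + (w * C n + term z (suc n) * 0#)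
      ≈⟨ solve 5 (λ z w c s t → :0 :* s :+ z :* c :+ (w :* c :+ t :* :0) := (z :+ w) :* c) refl z w (C n) (term w (suc n)) (term z (suc n)) ⟩
    (z + w) * C n
      ≈⟨ *-congˡ (convolution-term z w n) ⟩
    (z + w) * term (z + w) n
      ≈⟨ ν-term (z + w) n ⟨
    ν (suc n) * term (z + w) (suc n) ∎)
    where
    C = convolution (term z) (term w)

  triangle-term : ∀ z w n → triangle (term z) (term w) n ≈ Σ< n (term (z + w))
  triangle-term z w n = trans (sym (Σ<-convolution n (term z) (term w))) (Σ<-cong n (λ k _ → convolution-term z w k))

module Convolution {c ℓ} (A : CommutativeRing c ℓ) where
  open CommutativeRing A
  open IntegerSolver A
  open FiniteSums A
  open Relation.Binary.Reasoning.Setoid setoid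

  convolution-comm : ∀ a b n → convolution a b n ≈ convolution b a n
  convolution-comm a b zero    = *-comm _ _
  convolution-comm a b (suc n) = begin
    a 0 * b (suc n) + convolution (a ∘ suc) b n  ≈⟨ +-cong (*-comm _ _) (convolution-comm (a ∘ suc) b n) ⟩
    b (suc n) * a 0 + convolution b (a ∘ suc) n  ≈⟨ +-comm _ _ ⟩
    convolution b (a ∘ suc) n + b (suc n) * a 0  ≈⟨ convolution-last b a n ⟨
    convolution b a (suc n)                      ∎

  convolution-+ˡ : ∀ a a′ b n → convolution (λ k → a k + a′ k) b n ≈ convolution a b n + convolution a′ b n
  convolution-+ˡ a a′ b zero    = distribʳ _ _ _
  convolution-+ˡ a a′ b (suc n) = trans (+-congˡ (convolution-+ˡ (a ∘ suc) (a′ ∘ suc) b n))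
    (solve 5 (λ a a′ b x y → (a :+ a′) :* b :+ (x :+ y) := (a :* b :+ x) :+ (a′ :* b :+ y)) refl (a 0) (a′ 0) (b (suc n)) _ _)

  convolution-assoc : ∀ a b c n → convolution (convolution a b) c n ≈ convolution a (convolution b c) n
  convolution-assoc a b c zero    = *-assoc _ _ _
  convolution-assoc a b c (suc n) = begin
    a 0 * b 0 * c (suc n) + convolution (λ k → a 0 * b (suc k) + convolution (a ∘ suc) b k) c n
      ≈⟨ +-congˡ (convolution-+ˡ (λ k → a 0 * b (suc k)) (convolution (a ∘ suc) b) c n) ⟩
    a 0 * b 0 * c (suc n) + (convolution (λ k → a 0 * b (suc k)) c n + convolution (convolution (a ∘ suc) b) c n)
      ≈⟨ +-congˡ (+-cong (convolution-scaleˡ (a 0) (b ∘ suc) c n) (convolution-assoc (a ∘ suc) b c n)) ⟩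
    a 0 * b 0 * c (suc n) + (a 0 * convolution (b ∘ suc) c n + convolution (a ∘ suc) (convolution b c) n)
      ≈⟨ solve 5 (λ a b c x y → a :* b :* c :+ (a :* x :+ y) := a :* (b :* c :+ x) :+ y) refl (a 0) (b 0) (c (suc n)) _ _ ⟩
    a 0 * (b 0 * c (suc n) + convolution (b ∘ suc) c n) + convolution (a ∘ suc) (convolution b c) n ∎

  convolution-zeroˡ : ∀ {a} b n → (∀ k → a k ≈ 0#) → convolution a b n ≈ 0#
  convolution-zeroˡ b zero    a≈0 = trans (*-congʳ (a≈0 0)) (zeroˡ _)
  convolution-zeroˡ b (suc n) a≈0 = trans (+-cong (trans (*-congʳ (a≈0 0)) (zeroˡ _)) (convolution-zeroˡ b n (a≈0 ∘ suc))) (+-identityˡ _)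

  convolution-constantˡ : ∀ {a} b n → (∀ k → a (suc k) ≈ 0#) → convolution a b n ≈ a 0 * b n
  convolution-constantˡ b zero    a≈0 = refl
  convolution-constantˡ b (suc n) a≈0 = trans (+-congˡ (convolution-zeroˡ b n a≈0)) (+-identityʳ _)

  convolution-leading : ∀ {a b} d e → (∀ i → d ℕ.< i → a i ≈ 0#) → (∀ i → e ℕ.< i → b i ≈ 0#) →
    convolution a b (d +ℕ e) ≈ a d * b e
  convolution-leading {a} {b} zero    e a≈0 b≈0 = convolution-constantˡ b e (λ k → a≈0 (suc k) (ℕ.s≤s ℕ.z≤n))
  convolution-leading {a} {b} (suc d) e a≈0 b≈0 = trans
    (+-cong (trans (*-congˡ (b≈0 _ (ℕ.s≤s (ℕ.m≤n+m e d)))) (zeroʳ _)) (convolution-leading d e (λ i d<i → a≈0 (suc i) (ℕ.s≤s d<i)) b≈0))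
    (+-identityˡ _)

  convolution-above : ∀ {a b} d e → (∀ i → d ℕ.< i → a i ≈ 0#) → (∀ i → e ℕ.< i → b i ≈ 0#) →
    ∀ i → d +ℕ e ℕ.< i → convolution a b i ≈ 0#
  convolution-above {a} {b} zero    e a≈0 b≈0 i e<i = trans (convolution-constantˡ b i (λ k → a≈0 (suc k) (ℕ.s≤s ℕ.z≤n)))
    (trans (*-congˡ (b≈0 i e<i)) (zeroʳ _))
  convolution-above {a} {b} (suc d) e a≈0 b≈0 (suc i) (ℕ.s≤s d+e<i) = trans
    (+-cong (trans (*-congˡ (b≈0 _ (ℕ.≤-<-trans (ℕ.m≤n+m e d) (ℕ.m<n⇒m<1+n d+e<i)))) (zeroʳ _))
            (convolution-above d e (λ i d<i → a≈0 (suc i) (ℕ.s≤s d<i)) b≈0 i d+e<i))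
    (+-identityˡ _)

  convolution-dropˡ : ∀ {a} b p n → (∀ i → i ℕ.< p → a i ≈ 0#) → convolution a b (p +ℕ n) ≈ convolution (λ k → a (p +ℕ k)) b n
  convolution-dropˡ b zero    n a≈0 = refl
  convolution-dropˡ b (suc p) n a≈0 = trans
    (+-cong (trans (*-congʳ (a≈0 0 (ℕ.s≤s ℕ.z≤n))) (zeroˡ _)) (convolution-dropˡ b p n (λ i i<p → a≈0 (suc i) (ℕ.s≤s i<p))))
    (+-identityˡ _)

  -- Dropping the zeros of a and, after commuting, those of b leaves a single product. The digits of
  -- a Laurent series run downwards from its top, so there the first nonzero digit is the leading
  -- coefficient.
  convolution-trailing : ∀ {a b} p n → (∀ i → i ℕ.< p → a i ≈ 0#) → (∀ i → i ℕ.< n → b i ≈ 0#) → convolution a b (p +ℕ n) ≈ a p * b n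
  convolution-trailing {a} {b} p n a≈0 b≈0 = begin
    convolution a b (p +ℕ n)                   ≈⟨ convolution-dropˡ b p n a≈0 ⟩
    convolution a′ b n                         ≈⟨ convolution-comm a′ b n ⟩
    convolution b a′ n                         ≡⟨ cong (convolution b a′) (ℕ.+-identityʳ n) ⟨
    convolution b a′ (n +ℕ 0)                  ≈⟨ convolution-dropˡ a′ n 0 b≈0 ⟩
    b (n +ℕ 0) * a (p +ℕ 0)                    ≡⟨ cong₂ (λ i j → b i * a j) (ℕ.+-identityʳ n) (ℕ.+-identityʳ p) ⟩
    b n * a p                                  ≈⟨ *-comm _ _ ⟩
    a p * b n                                  ∎
    where a′ = λ k → a (p +ℕ k)

  convolution-below : ∀ {a b} p q n → (∀ i → i ℕ.< p → a i ≈ 0#) → (∀ i → i ℕ.< q → b i ≈ 0#) → n ℕ.< p +ℕ q → convolution a b n ≈ 0#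
  convolution-below {a} {b} zero    q n       a≈0 b≈0 n<q = trans (convolution-comm a b n) (initial n b≈0 n<q)
    where
    initial : ∀ {a b q} n → (∀ i → i ℕ.< q → a i ≈ 0#) → n ℕ.< q → convolution a b n ≈ 0#
    initial {a} zero    a≈0 0<q = trans (*-congʳ (a≈0 0 0<q)) (zeroˡ _)
    initial {a} {q = suc q} (suc n) a≈0 (ℕ.s≤s n<q) = trans
      (+-cong (trans (*-congʳ (a≈0 0 (ℕ.s≤s ℕ.z≤n))) (zeroˡ _)) (initial n (λ i i<q → a≈0 (suc i) (ℕ.s≤s i<q)) n<q)) (+-identityˡ _)
  convolution-below {a} {b} (suc p) q zero    a≈0 b≈0 _ = trans (*-congʳ (a≈0 0 (ℕ.s≤s ℕ.z≤n))) (zeroˡ _)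
  convolution-below {a} {b} (suc p) q (suc n) a≈0 b≈0 (ℕ.s≤s n<) = trans
    (+-cong (trans (*-congʳ (a≈0 0 (ℕ.s≤s ℕ.z≤n))) (zeroˡ _)) (convolution-below p q n (λ i i<p → a≈0 (suc i) (ℕ.s≤s i<p)) b≈0 n<))
    (+-identityˡ _)

module Complements (ℓ : ℕ) {{_ : NonZero ℓ}} where
  -- i is - x modulo ℓ. Later x is deg 𝔠 - deg a, and i is the one index at which the bracket of a
  -- monic a equals 1.
  complement-exists : ∀ x → ∃[ i ] (ℓ ℕ.∣ (x +ℕ toℕ {ℓ} i))
  complement-exists x = Fin.fromℕ< i<ℓ , subst (λ i → ℓ ℕ.∣ (x +ℕ i)) (≡.sym (Fin.toℕ-fromℕ< i<ℓ)) (ℕ.m%n≡0⇒n∣m _ ℓ total)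
    where
    open ≡.≡-Reasoning
    r = x ℕ.% ℓ
    r≤ℓ : r ℕ.≤ ℓ
    r≤ℓ = ℕ.<⇒≤ (ℕ.m%n<n x ℓ)
    -- The outer remainder is for r = 0, where ℓ ∸ r would be ℓ itself.
    i<ℓ : (ℓ ℕ.∸ r) ℕ.% ℓ ℕ.< ℓ
    i<ℓ = ℕ.m%n<n (ℓ ℕ.∸ r) ℓ
    total : (x +ℕ (ℓ ℕ.∸ r) ℕ.% ℓ) ℕ.% ℓ ≡ 0
    total = begin
      (x +ℕ (ℓ ℕ.∸ r) ℕ.% ℓ) ℕ.% ℓ                 ≡⟨ ℕ.%-distribˡ-+ x _ ℓ ⟩
      (r +ℕ (ℓ ℕ.∸ r) ℕ.% ℓ ℕ.% ℓ) ℕ.% ℓ           ≡⟨ cong (λ k → (r +ℕ k) ℕ.% ℓ) (ℕ.m%n%n≡m%n (ℓ ℕ.∸ r) ℓ) ⟩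
      (r +ℕ (ℓ ℕ.∸ r) ℕ.% ℓ) ℕ.% ℓ                 ≡⟨ cong (λ k → (k +ℕ (ℓ ℕ.∸ r) ℕ.% ℓ) ℕ.% ℓ) (ℕ.m%n%n≡m%n x ℓ) ⟨
      (r ℕ.% ℓ +ℕ (ℓ ℕ.∸ r) ℕ.% ℓ) ℕ.% ℓ           ≡⟨ ℕ.%-distribˡ-+ r (ℓ ℕ.∸ r) ℓ ⟨
      (r +ℕ (ℓ ℕ.∸ r)) ℕ.% ℓ                       ≡⟨ cong (ℕ._% ℓ) (ℕ.m+[n∸m]≡n r≤ℓ) ⟩
      ℓ ℕ.% ℓ                                      ≡⟨ ℕ.n%n≡0 ℓ ⟩
      0                                            ∎

  private
    not-both : ∀ x (i j : Fin ℓ) → toℕ i ℕ.< toℕ j → ℓ ℕ.∣ (x +ℕ toℕ i) → ¬ (ℓ ℕ.∣ (x +ℕ toℕ j))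
    not-both x i j i<j ℓ∣x+i ℓ∣x+j = ℕ.>⇒∤ {{ℕ.>-nonZero (ℕ.m<n⇒0<n∸m i<j)}} (ℕ.≤-<-trans (ℕ.m∸n≤m (toℕ j) (toℕ i)) (Fin.toℕ<n j))
      (ℕ.∣m+n∣m⇒∣n (subst (ℓ ℕ.∣_) (≡.sym (≡.trans (ℕ.+-assoc x (toℕ i) _) (cong (x +ℕ_) (ℕ.m+[n∸m]≡n (ℕ.<⇒≤ i<j))))) ℓ∣x+j) ℓ∣x+i)

  complement-unique : ∀ x (i j : Fin ℓ) → ℓ ℕ.∣ (x +ℕ toℕ i) → ℓ ℕ.∣ (x +ℕ toℕ j) → i ≡ j
  complement-unique x i j ℓ∣x+i ℓ∣x+j with ℕ.<-cmp (toℕ i) (toℕ j)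
  ... | tri< i<j _ _ = ⊥-elim (not-both x i j i<j ℓ∣x+i ℓ∣x+j)
  ... | tri≈ _ i≡j _ = Fin.toℕ-injective i≡j
  ... | tri> _ _ j<i = ⊥-elim (not-both x j i j<i ℓ∣x+j ℓ∣x+i)

-- Real numbers

module RealProperties (R : RealNumbers) where
  open RealNumbers R using (_#_; _<_; _≤_; *-pos; 0<1; +-monoˡ-<; <-respʳ-≈; <-respˡ-≈; <-trans; 0<suc; 1/_; archimedean) public
  open CommutativeRing (RealNumbers.commutativeRing R) public
    renaming (refl to ≈-refl; sym to ≈-sym; trans to ≈-trans)
  open Algebra.Properties.Semiring.Exp semiring public using (_^_; ^-congˡ; ^-homo-*)
  open Algebra.Properties.CommutativeSemiring.Exp commutativeSemiring public using (^-distrib-*)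
  open Algebra.Properties.Semiring.Mult semiring public using (×-homo-+; ×1-homo-*) renaming (_×_ to _·_)
  open IntegerSolver (RealNumbers.commutativeRing R) public
  open FiniteSums (RealNumbers.commutativeRing R) public
  private
    module ℝ = RealNumbers R
    module H = HeytingField ℝ.heytingField
    module < = IsStrictPartialOrder ℝ.isStrictPartialOrder

  <-irrefl : ∀ {x y} → x ≈ y → ¬ (x < y)
  <-irrefl = <.irrefl

  <-asym : ∀ {x y} → x < y → ¬ (y < x)
  <-asym x<y y<x = <-irrefl ≈-refl (<-trans x<y y<x)

  <⇒# : ∀ {x y} → x < y → x # y
  <⇒# x<y = Equivalence.from ℝ.#⇔<⊎> (inj₁ x<y)

  #⇒<⊎ : ∀ {x y} → x # y → x < y ⊎ y < x
  #⇒<⊎ = Equivalence.to ℝ.#⇔<⊎>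

  -- The apartness of x and y passes to z on one side. Of its two orientations the unwanted one
  -- still places z, by transitivity with x < y. This is the constructive way to compare an
  -- arbitrary z.
  <-cotrans : ∀ {x y} → x < y → ∀ z → x < z ⊎ z < y
  <-cotrans {x} {y} x<y z with H.#-cotrans (<⇒# x<y) z
  ... | inj₁ x#z = [ inj₁ , (λ z<x → inj₂ (<-trans z<x x<y)) ]′ (#⇒<⊎ x#z)
  ... | inj₂ z#y = [ inj₂ , (λ y<z → inj₁ (<-trans x<y y<z)) ]′ (#⇒<⊎ z#y)

  ≤-antisym : ∀ {x y} → x ≤ y → y ≤ x → x ≈ y
  ≤-antisym x≤y y≤x = proj₁ (H.tight _ _) (λ x#y → [ y≤x , x≤y ]′ (#⇒<⊎ x#y))

  -- Trichotomy may be used to prove a negation, and `≤` is one.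
  ¬¬-tri : ∀ x y {X : Set} → (x < y → ¬ X) → (x ≈ y → ¬ X) → (y < x → ¬ X) → ¬ X
  ¬¬-tri x y lt eq gt t = eq (≤-antisym (λ y<x → gt y<x t) (λ x<y → lt x<y t)) t

  <⇒≤ : ∀ {x y} → x < y → x ≤ y
  <⇒≤ = <-asym

  ≤-reflexive : ∀ {x y} → x ≈ y → x ≤ y
  ≤-reflexive x≈y = <-irrefl (≈-sym x≈y)

  ≤-refl : ∀ {x} → x ≤ x
  ≤-refl = ≤-reflexive ≈-refl

  ≤-trans : ∀ {x y z} → x ≤ y → y ≤ z → x ≤ z
  ≤-trans {y = y} x≤y y≤z z<x = [ y≤z , x≤y ]′ (<-cotrans z<x y)

  <-≤-trans : ∀ {x y z} → x < y → y ≤ z → x < z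
  <-≤-trans {z = z} x<y y≤z = [ id , (λ z<y → ⊥-elim (y≤z z<y)) ]′ (<-cotrans x<y z)

  ≤-<-trans : ∀ {x y z} → x ≤ y → y < z → x < z
  ≤-<-trans {x} x≤y y<z = [ (λ y<x → ⊥-elim (x≤y y<x)) , id ]′ (<-cotrans y<z x)

  ≤-resp : ∀ {x x′ y y′} → x ≈ x′ → y ≈ y′ → x ≤ y → x′ ≤ y′
  ≤-resp x≈x′ y≈y′ x≤y = ≤-trans (≤-reflexive (≈-sym x≈x′)) (≤-trans x≤y (≤-reflexive y≈y′))

  <-resp : ∀ {x x′ y y′} → x ≈ x′ → y ≈ y′ → x < y → x′ < y′
  <-resp x≈x′ y≈y′ x<y = <-respʳ-≈ y≈y′ (<-respˡ-≈ x≈x′ x<y)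

  +-monoʳ-< : ∀ z {x y} → x < y → z + x < z + y
  +-monoʳ-< z x<y = <-resp (+-comm _ _) (+-comm _ _) (+-monoˡ-< z x<y)

  +-monoˡ-≤ : ∀ z {x y} → x ≤ y → x + z ≤ y + z
  +-monoˡ-≤ z x≤y lt = x≤y (<-resp (lem _ z) (lem _ z) (+-monoˡ-< (- z) lt))
    where
    lem : ∀ x z → (x + z) - z ≈ x
    lem = solve 2 (λ x z → (x :+ z) :- z := x) ≈-refl

  +-mono-≤ : ∀ {x y z w} → x ≤ y → z ≤ w → x + z ≤ y + w
  +-mono-≤ {z = z} x≤y z≤w =
    ≤-trans (+-monoˡ-≤ z x≤y) (≤-resp (+-comm _ _) (+-comm _ _) (+-monoˡ-≤ _ z≤w))

  +-mono-< : ∀ {x y z w} → x < y → z < w → x + z < y + w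
  +-mono-< {z = z} x<y z<w = <-trans (+-monoˡ-< z x<y) (+-monoʳ-< _ z<w)

  +-mono-≤-< : ∀ {x y z w} → x ≤ y → z < w → x + z < y + w
  +-mono-≤-< {z = z} x≤y z<w = ≤-<-trans (+-monoˡ-≤ z x≤y) (+-monoʳ-< _ z<w)

  +-nonneg : ∀ {x y} → 0# ≤ x → 0# ≤ y → 0# ≤ x + y
  +-nonneg 0≤x 0≤y = ≤-resp (+-identityˡ _) ≈-refl (+-mono-≤ 0≤x 0≤y)

  +-nonneg-pos : ∀ {x y} → 0# ≤ x → 0# < y → 0# < x + y
  +-nonneg-pos 0≤x 0<y = <-respˡ-≈ (+-identityˡ _) (+-mono-≤-< 0≤x 0<y)

  +-pos : ∀ {x y} → 0# < x → 0# < y → 0# < x + y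
  +-pos 0<x 0<y = +-nonneg-pos (<⇒≤ 0<x) 0<y

  <⇒0<- : ∀ {x y} → x < y → 0# < y - x
  <⇒0<- {x} x<y = <-respˡ-≈ (-‿inverseʳ x) (+-monoˡ-< (- x) x<y)

  0<-⇒< : ∀ {x y} → 0# < y - x → x < y
  0<-⇒< {x} {y} 0<y-x = <-resp (+-identityˡ x) (solve 2 (λ x y → (y :- x) :+ x := y) ≈-refl x y) (+-monoˡ-< x 0<y-x)

  ≤⇒0≤- : ∀ {x y} → x ≤ y → 0# ≤ y - x
  ≤⇒0≤- {x} x≤y = ≤-resp (-‿inverseʳ x) ≈-refl (+-monoˡ-≤ (- x) x≤y)

  0≤-⇒≤ : ∀ {x y} → 0# ≤ y - x → x ≤ y
  0≤-⇒≤ {x} {y} 0≤y-x = ≤-resp (+-identityˡ x) (solve 2 (λ x y → (y :- x) :+ x := y) ≈-refl x y) (+-monoˡ-≤ x 0≤y-x)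

  neg-pos : ∀ {x} → x < 0# → 0# < - x
  neg-pos x<0 = <-respʳ-≈ (+-identityˡ _) (<⇒0<- x<0)

  x≤y+z : ∀ {x y z} → x ≤ y → 0# ≤ z → x ≤ y + z
  x≤y+z x≤y 0≤z = ≤-resp (+-identityʳ _) ≈-refl (+-mono-≤ x≤y 0≤z)

  *-nonneg : ∀ {x y} → 0# ≤ x → 0# ≤ y → 0# ≤ x * y
  *-nonneg {x} {y} 0≤x 0≤y =
    ¬¬-tri 0# x (λ 0<x → ¬¬-tri 0# y (λ 0<y → <⇒≤ (*-pos 0<x 0<y))
                                     (λ 0≈y → ≤-reflexive (≈-sym (≈-trans (*-congˡ (≈-sym 0≈y)) (zeroʳ x))))
                                     (λ y<0 → ⊥-elim (0≤y y<0)))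
                (λ 0≈x → ≤-reflexive (≈-sym (≈-trans (*-congʳ (≈-sym 0≈x)) (zeroˡ y))))
                (λ x<0 → ⊥-elim (0≤x x<0))

  square-nonneg : ∀ x → 0# ≤ x * x
  square-nonneg x =
    ¬¬-tri 0# x (λ 0<x → <⇒≤ (*-pos 0<x 0<x))
                (λ 0≈x → ≤-reflexive (≈-sym (≈-trans (*-congʳ (≈-sym 0≈x)) (zeroˡ x))))
                (λ x<0 → ≤-resp ≈-refl (solve 1 (λ x → (:- x) :* (:- x) := x :* x) ≈-refl x)
                                (<⇒≤ (*-pos (neg-pos x<0) (neg-pos x<0))))

  *-monoʳ-≤ : ∀ {x y} z → 0# ≤ z → x ≤ y → x * z ≤ y * z
  *-monoʳ-≤ {x} {y} z 0≤z x≤y =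
    0≤-⇒≤ (≤-resp ≈-refl (solve 3 (λ x y z → (y :- x) :* z := y :* z :- x :* z) ≈-refl x y z) (*-nonneg (≤⇒0≤- x≤y) 0≤z))

  *-monoˡ-≤ : ∀ {x y} z → 0# ≤ z → x ≤ y → z * x ≤ z * y
  *-monoˡ-≤ z 0≤z x≤y = ≤-resp (*-comm _ _) (*-comm _ _) (*-monoʳ-≤ z 0≤z x≤y)

  *-mono-≤ : ∀ {x y z w} → 0# ≤ x → 0# ≤ w → x ≤ y → z ≤ w → x * z ≤ y * w
  *-mono-≤ 0≤x 0≤w x≤y z≤w = ≤-trans (*-monoˡ-≤ _ 0≤x z≤w) (*-monoʳ-≤ _ 0≤w x≤y)

  *-monoʳ-< : ∀ {x y} z → 0# < z → x < y → x * z < y * z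
  *-monoʳ-< {x} {y} z 0<z x<y =
    0<-⇒< (<-respʳ-≈ (solve 3 (λ x y z → (y :- x) :* z := y :* z :- x :* z) ≈-refl x y z) (*-pos (<⇒0<- x<y) 0<z))

  *-cancelʳ-≤ : ∀ {x y} z → 0# < z → x * z ≤ y * z → x ≤ y
  *-cancelʳ-≤ z 0<z xz≤yz y<x = xz≤yz (*-monoʳ-< z 0<z y<x)

  *-cancelʳ : ∀ {x y} z → 0# < z → x * z ≈ y * z → x ≈ y
  *-cancelʳ z 0<z xz≈yz = ≤-antisym (*-cancelʳ-≤ z 0<z (≤-reflexive xz≈yz)) (*-cancelʳ-≤ z 0<z (≤-reflexive (≈-sym xz≈yz)))

  -- If y < x, then x² - y² = (x - y)(x + y) is a product of positive numbers. Since x may be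
  -- negative, the lemma also bounds - x.
  square-cancel-≤ : ∀ {x y} → 0# ≤ y → x * x ≤ y * y → x ≤ y
  square-cancel-≤ {x} {y} 0≤y xx≤yy y<x = xx≤yy (0<-⇒< (<-respʳ-≈
    (solve 2 (λ x y → (x :- y) :* (x :+ y) := x :* x :- y :* y) ≈-refl x y)
    (*-pos (<⇒0<- y<x) (<-respʳ-≈ (+-comm y x) (+-nonneg-pos 0≤y (≤-<-trans 0≤y y<x))))))

  private
    invert : ∀ {x} → (x#0 : x # 0#) → x * proj₁ (ℝ.#⇒invertible x#0) ≈ 1#
    invert {x} x#0 = ≈-trans
      (*-congʳ (solve 1 (λ x → x := x :- :0) ≈-refl x))
      (proj₂ (proj₂ (ℝ.#⇒invertible x#0)))

    inverse-pos : ∀ {x y} → 0# < x → x * y ≈ 1# → 0# < y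
    inverse-pos {x} {y} 0<x xy≈1 = [ id , (λ y<0 → ⊥-elim (<-asym 0<1 (1<0 y<0))) ]′ (#⇒<⊎ 0#y)
      where
      -x*-y : (- x) * (0# - y) ≈ x * y
      -x*-y = solve 2 (λ x y → (:- x) :* (:0 :- y) := x :* y) ≈-refl x y
      0#y : 0# # y
      -- 0 - y has the inverse - x, hence is apart from 0; the orientation y < 0 would make 1 = x y
      -- negative.
      0#y = H.invertible⇒# (- x , ≈-trans -x*-y xy≈1 , ≈-trans (*-comm _ _) (≈-trans -x*-y xy≈1))
      1<0 : y < 0# → 1# < 0#
      1<0 y<0 = <-resp (≈-trans (*-comm y x) xy≈1) (zeroˡ x) (*-monoʳ-< x 0<x y<0)

  inverse⁺ : ∀ {x} → 0# < x → ∃[ y ] (0# < y × x * y ≈ 1#)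
  inverse⁺ 0<x = _ , inverse-pos 0<x eq , eq
    where eq = invert (Equivalence.from ℝ.#⇔<⊎> (inj₂ 0<x))

  n*1/n≈1 : ∀ n .{{_ : NonZero n}} → (n · 1#) * 1/ n ≈ 1#
  n*1/n≈1 (suc n) = invert _

  0<n· : ∀ n .{{_ : NonZero n}} → 0# < n · 1#
  0<n· (suc n) = 0<suc n

  0≤n· : ∀ n → 0# ≤ n · 1#
  0≤n· zero    = ≤-refl
  0≤n· (suc n) = <⇒≤ (0<suc n)

  0<1/ : ∀ n .{{_ : NonZero n}} → 0# < 1/ n
  0<1/ n = inverse-pos (0<n· n) (n*1/n≈1 n)

  0≤1 : 0# ≤ 1#
  0≤1 = <⇒≤ 0<1

  ^-nonneg : ∀ {x} → 0# ≤ x → ∀ n → 0# ≤ x ^ n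
  ^-nonneg 0≤x zero    = 0≤1
  ^-nonneg 0≤x (suc n) = *-nonneg 0≤x (^-nonneg 0≤x n)

  ½ : Carrier
  ½ = proj₁ (inverse⁺ (+-pos 0<1 0<1))

  0<½ : 0# < ½
  0<½ = proj₁ (proj₂ (inverse⁺ (+-pos 0<1 0<1)))

  2*½≈1 : (1# + 1#) * ½ ≈ 1#
  2*½≈1 = proj₂ (proj₂ (inverse⁺ (+-pos 0<1 0<1)))

  ½+½ : ∀ x → ½ * x + ½ * x ≈ x
  ½+½ x = ≈-trans (solve 2 (λ h x → h :* x :+ h :* x := ((:1 :+ :1) :* h) :* x) ≈-refl ½ x)
                  (≈-trans (*-congʳ 2*½≈1) (*-identityˡ x))

  x+y<z : ∀ {x y z} → x < ½ * z → y < ½ * z → x + y < z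
  x+y<z {z = z} x< y< = <-≤-trans (+-mono-< x< y<) (≤-reflexive (½+½ z))

  ≤-approx : ∀ {x y} → (∀ ε → 0# < ε → x ≤ y + ε) → x ≤ y
  ≤-approx {x} {y} h y<x = h δ 0<δ (0<-⇒< (<-respʳ-≈ lem 0<δ))
    where
    δ = ½ * (x - y)
    0<δ : 0# < δ
    0<δ = *-pos 0<½ (<⇒0<- y<x)
    lem : δ ≈ x - (y + δ)
    lem = ≈-trans (solve 1 (λ δ → δ := (δ :+ δ) :- δ) ≈-refl δ)
            (≈-trans (+-congʳ (½+½ (x - y))) (solve 3 (λ x y δ → x :- y :- δ := x :- (y :+ δ)) ≈-refl x y δ))

  -- a = ε / (K + ε + 1): the denominator dominates both K and ε, so one choice meets both bounds,
  -- and it is positive even for K = 0.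
  small : ∀ {ε K} → 0# < ε → 0# ≤ K → ∃[ a ] (0# < a × a ≤ 1# × a * K ≤ ε)
  small {ε} {K} 0<ε 0≤K = ε * y , *-pos 0<ε 0<y , εy≤1 , εyK≤ε
    where
    S = K + (ε + 1#)
    inv : ∃[ y ] (0# < y × S * y ≈ 1#)
    inv = inverse⁺ (+-nonneg-pos 0≤K (+-pos 0<ε 0<1))
    y = proj₁ inv
    0<y = proj₁ (proj₂ inv)
    eq : S * y ≈ 1#
    eq = proj₂ (proj₂ inv)
    ε≤S : ε ≤ S
    ε≤S = ≤-resp ≈-refl (+-comm _ _) (x≤y+z (x≤y+z ≤-refl 0≤1) 0≤K)
    K≤S : K ≤ S
    K≤S = x≤y+z ≤-refl (<⇒≤ (+-pos 0<ε 0<1))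
    εy≤1 : ε * y ≤ 1#
    εy≤1 = ≤-resp ≈-refl eq (*-monoʳ-≤ y (<⇒≤ 0<y) ε≤S)
    Ky≤1 : K * y ≤ 1#
    Ky≤1 = ≤-resp ≈-refl eq (*-monoʳ-≤ y (<⇒≤ 0<y) K≤S)
    εyK≤ε : ε * y * K ≤ ε
    εyK≤ε = ≤-resp (solve 3 (λ ε y K → ε :* (K :* y) := ε :* y :* K) ≈-refl ε y K) (*-identityʳ ε)
              (*-monoˡ-≤ ε (<⇒≤ 0<ε) Ky≤1)

  -- For a ≤ 1 and a ≤ ε one has a² ≤ a ≤ ε. This stands in for a square root when bounds on
  -- `normSq` are converted to the ε² of the definitions.
  sqrt-below : ∀ {ε} → 0# < ε → ∃[ a ] (0# < a × a * a ≤ ε)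
  sqrt-below 0<ε = let a , 0<a , a≤1 , a1≤ε = small 0<ε 0≤1 in
    a , 0<a , ≤-trans (*-monoˡ-≤ a (<⇒≤ 0<a) a≤1) a1≤ε

  -- x y / (x + y) lies below both numbers, whichever of them is smaller.
  min⁺ : ∀ {x y} → 0# < x → 0# < y → ∃[ a ] (0# < a × a ≤ x × a ≤ y)
  min⁺ {x} {y} 0<x 0<y = x * y * z , *-pos (*-pos 0<x 0<y) 0<z , ≤x , ≤y
    where
    inv : ∃[ z ] (0# < z × (x + y) * z ≈ 1#)
    inv = inverse⁺ (+-pos 0<x 0<y)
    z = proj₁ inv
    0<z = proj₁ (proj₂ inv)
    eq : (x + y) * z ≈ 1#
    eq = proj₂ (proj₂ inv)
    xz≤1 : x * z ≤ 1#
    xz≤1 = ≤-resp ≈-refl eq (*-monoʳ-≤ z (<⇒≤ 0<z) (x≤y+z ≤-refl (<⇒≤ 0<y)))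
    yz≤1 : y * z ≤ 1#
    yz≤1 = ≤-resp ≈-refl eq (*-monoʳ-≤ z (<⇒≤ 0<z) (≤-resp ≈-refl (+-comm y x) (x≤y+z ≤-refl (<⇒≤ 0<x))))
    ≤x : x * y * z ≤ x
    ≤x = ≤-resp (≈-sym (*-assoc x y z)) (*-identityʳ x) (*-monoˡ-≤ x (<⇒≤ 0<x) yz≤1)
    ≤y : x * y * z ≤ y
    ≤y = ≤-resp (solve 3 (λ x y z → y :* (x :* z) := x :* y :* z) ≈-refl x y z) (*-identityʳ y)
           (*-monoˡ-≤ y (<⇒≤ 0<y) xz≤1)

  archimedean-multiple : ∀ K {ε} → 0# < ε → ∃[ n ] (K < (n · 1#) * ε)
  archimedean-multiple K {ε} 0<ε = n , <-respˡ-≈ Kyε≈K (*-monoʳ-< ε 0<ε (proj₂ (archimedean (K * y))))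
    where
    y = proj₁ (inverse⁺ 0<ε)
    n = proj₁ (archimedean (K * y))
    Kyε≈K : K * y * ε ≈ K
    Kyε≈K = ≈-trans (solve 3 (λ k y e → (k :* y) :* e := k :* (e :* y)) ≈-refl K y ε)
              (≈-trans (*-congˡ (proj₂ (proj₂ (inverse⁺ 0<ε)))) (*-identityʳ K))

  1^n≈1 : ∀ n → 1# ^ n ≈ 1#
  1^n≈1 zero    = ≈-refl
  1^n≈1 (suc n) = ≈-trans (*-identityˡ _) (1^n≈1 n)

  bernoulli : ∀ {h} → 0# ≤ h → ∀ n → 1# + (n · 1#) * h ≤ (1# + h) ^ n
  bernoulli {h} 0≤h zero    = ≤-reflexive (solve 1 (λ h → :1 :+ :0 :* h := :1) ≈-refl h)
  bernoulli {h} 0≤h (suc n) = ≤-trans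
    (≤-resp (+-identityʳ _) (solve 2 (λ n h → (:1 :+ (:1 :+ n) :* h) :+ n :* (h :* h) := (:1 :+ h) :* (:1 :+ n :* h)) ≈-refl (n · 1#) h)
      (x≤y+z (≤-reflexive (+-identityʳ _)) (*-nonneg (0≤n· n) (square-nonneg h))))
    (*-monoˡ-≤ (1# + h) (+-nonneg 0≤1 0≤h) (bernoulli 0≤h n))

  ·1-mono : ∀ {m n} → m ℕ.≤ n → m · 1# ≤ n · 1#
  ·1-mono {n = n} ℕ.z≤n = 0≤n· n
  ·1-mono (ℕ.s≤s m≤n) = +-mono-≤ ≤-refl (·1-mono m≤n)

  ^-inverse : ∀ {x y} → x * y ≈ 1# → ∀ n → x ^ n * y ^ n ≈ 1#
  ^-inverse {x} {y} xy≈1 n = ≈-trans (≈-sym (^-distrib-* x y n)) (≈-trans (^-congˡ n xy≈1) (1^n≈1 n))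

  -- By Bernoulli's inequality for y = 1 + h, the powers of y = 1 / x exceed n h, hence eventually 1
  -- / ε.
  ^→0 : ∀ {x y} → 0# < x → 1# < y → x * y ≈ 1# → ∀ {ε} → 0# < ε → ∃[ N ] (∀ n → N ℕ.≤ n → x ^ n < ε)
  ^→0 {x} {y} 0<x 1<y xy≈1 {ε} 0<ε = proj₁ arch , bound
    where
    e h : Carrier
    e = proj₁ (inverse⁺ 0<ε)
    h = y - 1#
    εe≈1 : ε * e ≈ 1#
    εe≈1 = proj₂ (proj₂ (inverse⁺ 0<ε))
    0≤h : 0# ≤ h
    0≤h = <⇒≤ (<⇒0<- 1<y)
    arch : ∃[ n ] (e < (n · 1#) * h)
    arch = archimedean-multiple e (<⇒0<- 1<y)
    1+h≈y : 1# + h ≈ y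
    1+h≈y = solve 1 (λ y → :1 :+ (y :- :1) := y) ≈-refl y
    bound : ∀ n → proj₁ arch ℕ.≤ n → x ^ n < ε
    bound n N≤n = <-resp eq₁ eq₂ (*-monoʳ-< (x ^ n * ε) (*-pos (RealNumbers.^-pos R 0<x n) 0<ε) e<yⁿ)
      where
      nh≤yⁿ : (n · 1#) * h ≤ y ^ n
      nh≤yⁿ = ≤-trans (≤-resp ≈-refl (+-comm _ _) (x≤y+z ≤-refl 0≤1))
                (≤-trans (bernoulli 0≤h n) (≤-reflexive (^-congˡ n 1+h≈y)))
      e<yⁿ : e < y ^ n
      e<yⁿ = <-≤-trans (proj₂ arch) (≤-trans (*-monoʳ-≤ h 0≤h (·1-mono N≤n)) nh≤yⁿ)
      eq₁ : e * (x ^ n * ε) ≈ x ^ n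
      eq₁ = ≈-trans (solve 3 (λ e p ε → e :* (p :* ε) := p :* (ε :* e)) ≈-refl e (x ^ n) ε)
              (≈-trans (*-congˡ εe≈1) (*-identityʳ _))
      eq₂ : y ^ n * (x ^ n * ε) ≈ ε
      eq₂ = ≈-trans (≈-sym (*-assoc _ _ _))
              (≈-trans (*-congʳ (≈-trans (*-comm _ _) (^-inverse xy≈1 n))) (*-identityˡ ε))

  Σ : ∀ {n} → (Fin n → Carrier) → Carrier
  Σ = Algebra.Properties.Semiring.Sum.sum semiring

  Σ-nonneg : ∀ {n} (f : Fin n → Carrier) → (∀ i → 0# ≤ f i) → 0# ≤ Σ f
  Σ-nonneg {zero}  f 0≤f = ≤-refl
  Σ-nonneg {suc n} f 0≤f = +-nonneg (0≤f Fin.zero) (Σ-nonneg _ (0≤f ∘ Fin.suc))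

  -- With A = |z|², B = |w|² and r = Re (z w̄), these bound |z + w|² = A + B + 2r.
  minkowski : ∀ {a b A B r} → 0# ≤ a → 0# ≤ b → 0# ≤ B → A ≤ a * a → B ≤ b * b →
              r * r ≤ A * B → A + B + (r + r) ≤ (a + b) * (a + b)
  minkowski {a} {b} {A} {B} {r} 0≤a 0≤b 0≤B A≤ B≤ rr≤AB =
    ≤-resp ≈-refl (solve 2 (λ a b → a :* a :+ b :* b :+ (a :* b :+ a :* b) := (a :+ b) :* (a :+ b)) ≈-refl a b)
      (+-mono-≤ (+-mono-≤ A≤ B≤) (+-mono-≤ r≤ab r≤ab))
    where
    AB≤ : A * B ≤ (a * a) * (b * b)
    AB≤ = ≤-trans (*-monoʳ-≤ B 0≤B A≤) (*-monoˡ-≤ (a * a) (square-nonneg a) B≤)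
    r≤ab : r ≤ a * b
    r≤ab = square-cancel-≤ (*-nonneg 0≤a 0≤b) (≤-trans rr≤AB
      (≤-resp ≈-refl (solve 2 (λ a b → (a :* a) :* (b :* b) := (a :* b) :* (a :* b)) ≈-refl a b) AB≤))

  parallelogram : ∀ {A B r} → 0# ≤ A → 0# ≤ B → r * r ≤ A * B → A + B + (r + r) ≤ (1# + 1#) * (A + B)
  parallelogram {A} {B} {r} 0≤A 0≤B rr≤AB =
    ≤-resp ≈-refl (solve 2 (λ A B → A :+ B :+ (A :+ B) := (:1 :+ :1) :* (A :+ B)) ≈-refl A B) (+-mono-≤ ≤-refl 2r≤A+B)
    where
    4AB≤ : (1# + 1#) * (1# + 1#) * (A * B) ≤ (A + B) * (A + B)
    4AB≤ = 0≤-⇒≤ (≤-resp ≈-refl (solve 2 (λ A B → (A :- B) :* (A :- B) := (A :+ B) :* (A :+ B) :- (:1 :+ :1) :* (:1 :+ :1) :* (A :* B)) ≈-refl A B)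
                              (square-nonneg (A - B)))
    2r≤A+B : r + r ≤ A + B
    2r≤A+B = square-cancel-≤ (+-nonneg 0≤A 0≤B) (≤-trans
      (≤-resp (solve 1 (λ r → (:1 :+ :1) :* (:1 :+ :1) :* (r :* r) := (r :+ r) :* (r :+ r)) ≈-refl r) ≈-refl
        (*-monoˡ-≤ ((1# + 1#) * (1# + 1#)) (square-nonneg (1# + 1#)) rr≤AB)) 4AB≤)

  Σ<-nonneg : ∀ n t → (∀ k → 0# ≤ t k) → 0# ≤ Σ< n t
  Σ<-nonneg n t 0≤t = Σ-nonneg {n} _ (0≤t ∘ toℕ)

  Σ<-mono-length : ∀ {m n} t → (∀ k → 0# ≤ t k) → m ℕ.≤ n → Σ< m t ≤ Σ< n t
  Σ<-mono-length {n = n} t 0≤t ℕ.z≤n = Σ<-nonneg n t 0≤t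
  Σ<-mono-length t 0≤t (ℕ.s≤s m≤n) = +-mono-≤ ≤-refl (Σ<-mono-length (t ∘ suc) (0≤t ∘ suc) m≤n)

  triangle-nonneg : ∀ a b n → (∀ k → 0# ≤ a k) → (∀ k → 0# ≤ b k) → 0# ≤ triangle a b n
  triangle-nonneg a b zero    0≤a 0≤b = ≤-refl
  triangle-nonneg a b (suc n) 0≤a 0≤b = +-nonneg (*-nonneg (0≤a 0) (Σ<-nonneg (suc n) b 0≤b)) (triangle-nonneg (a ∘ suc) b n (0≤a ∘ suc) 0≤b)

  -- j < m and k < n imply j + k < m + n, and the remaining pairs of the triangle add nonnegative
  -- terms.
  rectangle≤triangle : ∀ a b m n → (∀ k → 0# ≤ a k) → (∀ k → 0# ≤ b k) → Σ< m a * Σ< n b ≤ triangle a b (m +ℕ n)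
  rectangle≤triangle a b zero    n 0≤a 0≤b = ≤-trans (≤-reflexive (zeroˡ _)) (triangle-nonneg a b n 0≤a 0≤b)
  rectangle≤triangle a b (suc m) n 0≤a 0≤b = ≤-trans (≤-reflexive (distribʳ _ _ _))
    (+-mono-≤ (*-monoˡ-≤ (a 0) (0≤a 0) (Σ<-mono-length b 0≤b (ℕ.m≤n⇒m≤1+n (ℕ.m≤n+m n m))))
              (rectangle≤triangle (a ∘ suc) b m n (0≤a ∘ suc) 0≤b))

  unit⇒≷0 : ∀ {x y} → x * y ≈ 1# → x < 0# ⊎ 0# < x
  unit⇒≷0 {x} {y} xy≈1 = #⇒<⊎ (H.invertible⇒# (y , ≈-trans (*-comm _ _) x-0 , x-0))
    where
    x-0 : (x - 0#) * y ≈ 1#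
    x-0 = ≈-trans (*-congʳ (solve 1 (λ x → x :- :0 := x) ≈-refl x)) xy≈1

  -- Strict positivity carries information that a negation cannot give; the inverse supplies it.
  nonneg-unit⇒pos : ∀ {x y} → 0# ≤ x → x * y ≈ 1# → 0# < x
  nonneg-unit⇒pos 0≤x xy≈1 = [ (λ x<0 → ⊥-elim (0≤x x<0)) , id ]′ (unit⇒≷0 xy≈1)

  -- Placing x against 0 < 1 leaves the case 0 < x, where 1 - x = (1 - x²) / (1 + x) is a product of
  -- positive numbers.
  square<1⇒<1 : ∀ {x} → x * x < 1# → x < 1#
  square<1⇒<1 {x} xx<1 = [ positive , id ]′ (<-cotrans 0<1 x)
    where
    positive : 0# < x → x < 1#
    positive 0<x = 0<-⇒< (<-respʳ-≈ eq (*-pos (<⇒0<- xx<1) 0<y))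
      where
      inv : ∃[ y ] (0# < y × (1# + x) * y ≈ 1#)
      inv = inverse⁺ (+-pos 0<1 0<x)
      y = proj₁ inv
      0<y = proj₁ (proj₂ inv)
      eq : (1# - x * x) * y ≈ 1# - x
      eq = ≈-trans (solve 2 (λ x y → (:1 :- x :* x) :* y := (:1 :- x) :* ((:1 :+ x) :* y)) ≈-refl x y)
             (≈-trans (*-congˡ (proj₂ (proj₂ inv))) (*-identityʳ _))

  1<^suc : ∀ {x} → 1# < x → ∀ n → 1# < x ^ suc n
  1<^suc {x} 1<x zero    = <-respʳ-≈ (≈-sym (*-identityʳ x)) 1<x
  1<^suc {x} 1<x (suc n) = <-trans 1<x (<-resp (*-identityˡ x) (*-comm _ x) (*-monoʳ-< x (<-trans 0<1 1<x) (1<^suc 1<x n)))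

  0<^-1 : ∀ {x} → 1# < x → ∀ n .{{_ : NonZero n}} → 0# < x ^ n - 1#
  0<^-1 1<x (suc n) = <⇒0<- (1<^suc 1<x n)

  ·1-homo-^ : ∀ m n → (m ℕ.^ n) · 1# ≈ (m · 1#) ^ n
  ·1-homo-^ m zero    = +-identityʳ 1#
  ·1-homo-^ m (suc n) = ≈-trans (×1-homo-* m (m ℕ.^ n)) (*-congˡ (·1-homo-^ m n))

  private
    1^n≤ : ∀ {x} → 0# ≤ x → x ≤ 1# → ∀ n → x ^ n ≤ 1#
    1^n≤ 0≤x x≤1 zero    = ≤-refl
    1^n≤ 0≤x x≤1 (suc n) = ≤-trans (*-monoˡ-≤ _ 0≤x (1^n≤ 0≤x x≤1 n)) (≤-trans (≤-reflexive (*-identityʳ _)) x≤1)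

    1≤^n : ∀ {x} → 1# ≤ x → ∀ n → 1# ≤ x ^ n
    1≤^n 1≤x zero    = ≤-refl
    1≤^n {x} 1≤x (suc n) = ≤-trans 1≤x (≤-trans (≤-reflexive (≈-sym (*-identityʳ x))) (*-monoˡ-≤ x (≤-trans 0≤1 1≤x) (1≤^n 1≤x n)))

  -- Both x < 1 and 1 < x persist under positive powers. Applied to squared norms, this puts roots
  -- of unity on the unit circle.
  ^suc≈1⇒≈1 : ∀ {x} n → 0# ≤ x → x ^ suc n ≈ 1# → x ≈ 1#
  ^suc≈1⇒≈1 {x} n 0≤x eq = ≤-antisym
    (λ 1<x → <-irrefl (≈-sym eq) (<-≤-trans 1<x (≤-trans (≤-reflexive (≈-sym (*-identityʳ x))) (*-monoˡ-≤ x 0≤x (1≤^n (<⇒≤ 1<x) n)))))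
    (λ x<1 → <-irrefl eq (≤-<-trans (≤-trans (*-monoˡ-≤ x 0≤x (1^n≤ 0≤x (<⇒≤ x<1) n)) (≤-reflexive (*-identityʳ x))) x<1))

-- Complex numbers

-- ℂ is used through this interface only: equations in an abstract ring do not
-- unfold into real components.
record ComplexField (R : RealNumbers) : Set₁ where
  private
    module ℝ = RealProperties R
  field
    commutativeRing : CommutativeRing 0ℓ 0ℓ

  open CommutativeRing commutativeRing

  field
    re normSq : Carrier → ℝ.Carrier
    real      : ℝ.Carrier → Carrier
    conj      : Carrier → Carrier

    re-cong     : ∀ {z w} → z ≈ w → re z ℝ.≈ re w
    normSq-cong : ∀ {z w} → z ≈ w → normSq z ℝ.≈ normSq w
    real-cong   : ∀ {x y} → x ℝ.≈ y → real x ≈ real y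
    conj-cong   : ∀ {z w} → z ≈ w → conj z ≈ conj w

    real-+ : ∀ x y → real (x ℝ.+ y) ≈ real x + real y
    real-* : ∀ x y → real (x ℝ.* y) ≈ real x * real y
    real-1 : real ℝ.1# ≈ 1#

    conj-+    : ∀ z w → conj (z + w) ≈ conj z + conj w
    conj-*    : ∀ z w → conj (z * w) ≈ conj z * conj w
    conj-real : ∀ x → conj (real x) ≈ real x

    re-real : ∀ x → re (real x) ℝ.≈ x
    re-+    : ∀ z w → re (z + w) ℝ.≈ re z ℝ.+ re w
    re-neg  : ∀ z → re (- z) ℝ.≈ ℝ.- re z
    re-real* : ∀ z x → re (z * real x) ℝ.≈ re z ℝ.* x

    z+conj : ∀ z → z + conj z ≈ real (re z ℝ.+ re z)
    z*conj : ∀ z → z * conj z ≈ real (normSq z)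

    normSq-nonneg : ∀ z → ℝ.0# ℝ.≤ normSq z
    normSq-zero   : ∀ z → normSq z ℝ.≤ ℝ.0# → z ≈ 0#
    normSq-*      : ∀ z w → normSq (z * w) ℝ.≈ normSq z ℝ.* normSq w
    normSq-real   : ∀ x → normSq (real x) ℝ.≈ x ℝ.* x
    normSq-neg    : ∀ z → normSq (- z) ℝ.≈ normSq z
    normSq-conj   : ∀ z → normSq (conj z) ℝ.≈ normSq z
    normSq-+      : ∀ z w → normSq (z + w) ℝ.≈ normSq z ℝ.+ normSq w ℝ.+ (re (z * conj w) ℝ.+ re (z * conj w))
    re²≤normSq    : ∀ z → re z ℝ.* re z ℝ.≤ normSq z

module ComplexFieldInstance (R : RealNumbers) where
  open RealProperties R
  private
    module C = Complex R
  open C using (ℂ; _+i_; re; im)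

  ℂ-commutativeRing : CommutativeRing 0ℓ 0ℓ
  ℂ-commutativeRing = record
    { Carrier = ℂ ; _≈_ = C._≈_ ; _+_ = C._+_ ; _*_ = C._*_ ; -_ = C.-_ ; 0# = C.0# ; 1# = C.1#
    ; isCommutativeRing = record
      { isRing = record
        { +-isAbelianGroup = record
          { isGroup = record
            { isMonoid = record
              { isSemigroup = record
                { isMagma = record
                  { isEquivalence = record
                    { refl  = ≈-refl , ≈-refl
                    ; sym   = λ (p , q) → ≈-sym p , ≈-sym q
                    ; trans = λ (p , q) (r , s) → ≈-trans p r , ≈-trans q s
                    }
                  ; ∙-cong = λ (p , q) (r , s) → +-cong p r , +-cong q s
                  }
                ; assoc = λ x y z → +-assoc _ _ _ , +-assoc _ _ _
                }
              ; identity = (λ x → +-identityˡ _ , +-identityˡ _) , (λ x → +-identityʳ _ , +-identityʳ _)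
              }
            ; inverse = (λ x → -‿inverseˡ _ , -‿inverseˡ _) , (λ x → -‿inverseʳ _ , -‿inverseʳ _)
            ; ⁻¹-cong = λ (p , q) → -‿cong p , -‿cong q
            }
          ; comm = λ x y → +-comm _ _ , +-comm _ _
          }
        ; *-cong = λ (p , q) (r , s) → +-cong (*-cong p r) (-‿cong (*-cong q s)) , +-cong (*-cong p s) (*-cong q r)
        ; *-assoc = λ (a +i b) (c +i d) (e +i f) →
            solve 6 (λ a b c d e f → (a :* c :- b :* d) :* e :- (a :* d :+ b :* c) :* f := a :* (c :* e :- d :* f) :- b :* (c :* f :+ d :* e)) ≈-refl a b c d e f ,
            solve 6 (λ a b c d e f → (a :* c :- b :* d) :* f :+ (a :* d :+ b :* c) :* e := a :* (c :* f :+ d :* e) :+ b :* (c :* e :- d :* f)) ≈-refl a b c d e f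
        ; *-identity = (λ (a +i b) → solve 2 (λ a b → :1 :* a :- :0 :* b := a) ≈-refl a b , solve 2 (λ a b → :1 :* b :+ :0 :* a := b) ≈-refl a b) ,
                       (λ (a +i b) → solve 2 (λ a b → a :* :1 :- b :* :0 := a) ≈-refl a b , solve 2 (λ a b → a :* :0 :+ b :* :1 := b) ≈-refl a b)
        ; distrib =
            (λ (a +i b) (c +i d) (e +i f) →
              solve 6 (λ a b c d e f → a :* (c :+ e) :- b :* (d :+ f) := (a :* c :- b :* d) :+ (a :* e :- b :* f)) ≈-refl a b c d e f ,
              solve 6 (λ a b c d e f → a :* (d :+ f) :+ b :* (c :+ e) := (a :* d :+ b :* c) :+ (a :* f :+ b :* e)) ≈-refl a b c d e f) ,
            (λ (a +i b) (c +i d) (e +i f) →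
              solve 6 (λ a b c d e f → (c :+ e) :* a :- (d :+ f) :* b := (c :* a :- d :* b) :+ (e :* a :- f :* b)) ≈-refl a b c d e f ,
              solve 6 (λ a b c d e f → (c :+ e) :* b :+ (d :+ f) :* a := (c :* b :+ d :* a) :+ (e :* b :+ f :* a)) ≈-refl a b c d e f)
        }
      ; *-comm = λ (a +i b) (c +i d) →
          solve 4 (λ a b c d → a :* c :- b :* d := c :* a :- d :* b) ≈-refl a b c d ,
          solve 4 (λ a b c d → a :* d :+ b :* c := c :* b :+ d :* a) ≈-refl a b c d
      }
    }

  complexField : ComplexField R
  complexField = record
    { commutativeRing = ℂ-commutativeRing
    ; re = re
    ; normSq = C.normSq
    ; real = C.real
    ; conj = λ (a +i b) → a +i (- b)
    ; re-cong = proj₁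
    ; normSq-cong = λ (p , q) → +-cong (*-cong p p) (*-cong q q)
    ; real-cong = λ p → p , ≈-refl
    ; conj-cong = λ (p , q) → p , -‿cong q
    ; real-+ = λ x y → ≈-refl , ≈-sym (+-identityˡ 0#)
    ; real-* = λ x y → solve 2 (λ x y → x :* y := x :* y :- :0 :* :0) ≈-refl x y , solve 2 (λ x y → :0 := x :* :0 :+ :0 :* y) ≈-refl x y
    ; real-1 = ≈-refl , ≈-refl
    ; conj-+ = λ (a +i b) (c +i d) → ≈-refl , solve 2 (λ b d → :- (b :+ d) := :- b :- d) ≈-refl b d
    ; conj-* = λ (a +i b) (c +i d) →
        solve 4 (λ a b c d → a :* c :- b :* d := a :* c :- (:- b) :* (:- d)) ≈-refl a b c d ,
        solve 4 (λ a b c d → :- (a :* d :+ b :* c) := a :* (:- d) :+ (:- b) :* c) ≈-refl a b c d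
    ; conj-real = λ x → ≈-refl , solve 0 (:- :0 := :0) ≈-refl
    ; re-real = λ x → ≈-refl
    ; re-+ = λ z w → ≈-refl
    ; re-neg = λ z → ≈-refl
    ; re-real* = λ (a +i b) x → solve 3 (λ a b x → a :* x :- b :* :0 := a :* x) ≈-refl a b x
    ; z+conj = λ (a +i b) → ≈-refl , -‿inverseʳ b
    ; z*conj = λ (a +i b) → solve 2 (λ a b → a :* a :- b :* (:- b) := a :* a :+ b :* b) ≈-refl a b , solve 2 (λ a b → a :* (:- b) :+ b :* a := :0) ≈-refl a b
    ; normSq-nonneg = λ (a +i b) → +-nonneg (square-nonneg a) (square-nonneg b)
    ; normSq-zero = λ (a +i b) n≤0 → component a b n≤0 , component b a (≤-resp (+-comm _ _) ≈-refl n≤0)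
    ; normSq-* = λ (a +i b) (c +i d) → solve 4 (λ a b c d → (a :* c :- b :* d) :* (a :* c :- b :* d) :+ (a :* d :+ b :* c) :* (a :* d :+ b :* c) := (a :* a :+ b :* b) :* (c :* c :+ d :* d)) ≈-refl a b c d
    ; normSq-real = λ x → solve 1 (λ x → x :* x :+ :0 :* :0 := x :* x) ≈-refl x
    ; normSq-neg = λ (a +i b) → solve 2 (λ a b → (:- a) :* (:- a) :+ (:- b) :* (:- b) := a :* a :+ b :* b) ≈-refl a b
    ; normSq-conj = λ (a +i b) → solve 2 (λ a b → a :* a :+ (:- b) :* (:- b) := a :* a :+ b :* b) ≈-refl a b
    ; normSq-+ = λ (a +i b) (c +i d) → solve 4 (λ a b c d → (a :+ c) :* (a :+ c) :+ (b :+ d) :* (b :+ d) :=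
        (a :* a :+ b :* b) :+ (c :* c :+ d :* d) :+ ((a :* c :- b :* (:- d)) :+ (a :* c :- b :* (:- d)))) ≈-refl a b c d
    ; re²≤normSq = λ (a +i b) → x≤y+z ≤-refl (square-nonneg b)
    }
    where
    -- a² ≤ 0 bounds a, and equally - a, by 0.
    component : ∀ a b → a * a + b * b ≤ 0# → a ≈ 0#
    component a b n≤0 = ≤-antisym (square-cancel-≤ ≤-refl aa≤00) (≤-resp (solve 0 (:- :0 := :0) ≈-refl) (solve 1 (λ a → :- (:- a) := a) ≈-refl a) (neg≤ (square-cancel-≤ ≤-refl (≤-resp (solve 1 (λ a → a :* a := (:- a) :* (:- a)) ≈-refl a) ≈-refl aa≤00))))
      where
      aa≤00 : a * a ≤ 0# * 0#
      aa≤00 = ≤-resp ≈-refl (≈-sym (zeroˡ 0#)) (≤-trans (x≤y+z ≤-refl (square-nonneg b)) n≤0)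
      neg≤ : ∀ {x y} → x ≤ y → - y ≤ - x
      neg≤ {x} {y} x≤y = 0≤-⇒≤ (≤-resp ≈-refl (solve 2 (λ x y → y :- x := (:- x) :- (:- y)) ≈-refl x y) (≤⇒0≤- x≤y))

module ComplexAnalysis {R : RealNumbers} (C : ComplexField R) where
  module ℝ = RealProperties R
  open ComplexField C public
  open CommutativeRing commutativeRing public
    renaming (refl to ≈-refl; sym to ≈-sym; trans to ≈-trans)
  open Algebra.Properties.Semiring.Exp semiring public using (_^_; ^-congˡ)
  open Algebra.Properties.CommutativeSemiring.Exp commutativeSemiring public using (^-distrib-*)
  open Algebra.Properties.Semiring.Sum semiring public using (sum; sum-cong-≋; ∑-distrib-+; ∑-comm; *-distribˡ-sum; *-distribʳ-sum; sum-permute; sum-replicate-zero; sum-init-last)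
  open IntegerSolver commutativeRing public
  open FiniteSums commutativeRing public

  real-0 : real ℝ.0# ≈ 0#
  real-0 = ≈-trans (solve 1 (λ x → x := (x :+ x) :- x) ≈-refl (real ℝ.0#))
    (≈-trans (+-congʳ (≈-trans (≈-sym (real-+ ℝ.0# ℝ.0#)) (real-cong (ℝ.+-identityˡ ℝ.0#)))) (-‿inverseʳ _))

  real-neg : ∀ x → real (ℝ.- x) ≈ - real x
  real-neg x = ≈-trans (solve 2 (λ x y → y := (x :+ y) :- x) ≈-refl (real x) (real (ℝ.- x)))
    (≈-trans (+-congʳ (≈-trans (≈-sym (real-+ x (ℝ.- x))) (≈-trans (real-cong (ℝ.-‿inverseʳ x)) real-0))) (+-identityˡ _))

  real-^ : ∀ x n → real (x ℝ.^ n) ≈ real x ^ n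
  real-^ x zero    = real-1
  real-^ x (suc n) = ≈-trans (real-* x _) (*-congˡ (real-^ x n))

  real-injective : ∀ {x y} → real x ≈ real y → x ℝ.≈ y
  real-injective p = ℝ.≈-trans (ℝ.≈-sym (re-real _)) (ℝ.≈-trans (re-cong p) (re-real _))

  normSq-0 : normSq 0# ℝ.≈ ℝ.0#
  normSq-0 = ℝ.≈-trans (normSq-cong (≈-sym real-0)) (ℝ.≈-trans (normSq-real _) (ℝ.zeroˡ _))

  normSq-1 : normSq 1# ℝ.≈ ℝ.1#
  normSq-1 = ℝ.≈-trans (normSq-cong (≈-sym real-1)) (ℝ.≈-trans (normSq-real _) (ℝ.*-identityˡ _))

  normSq-^ : ∀ z n → normSq (z ^ n) ℝ.≈ normSq z ℝ.^ n
  normSq-^ z zero    = normSq-1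
  normSq-^ z (suc n) = ℝ.≈-trans (normSq-* z _) (ℝ.*-congˡ (normSq-^ z n))

  private
    re²≤ : ∀ z w → re (z * conj w) ℝ.* re (z * conj w) ℝ.≤ normSq z ℝ.* normSq w
    re²≤ z w = ℝ.≤-trans (re²≤normSq (z * conj w))
      (ℝ.≤-reflexive (ℝ.≈-trans (normSq-* z (conj w)) (ℝ.*-congˡ (normSq-conj w))))

  infix 4 _≼_
  -- |z| ≤ b
  record _≼_ (z : Carrier) (b : ℝ.Carrier) : Set where
    constructor _∣≼∣_
    field
      nonneg  : ℝ.0# ℝ.≤ b
      normSq≤ : normSq z ℝ.≤ b ℝ.* b

  open _≼_ public

  ≼-cong : ∀ {z w a b} → z ≈ w → a ℝ.≈ b → z ≼ a → w ≼ b
  ≼-cong z≈w a≈b (0≤a ∣≼∣ n≤) = ℝ.≤-resp ℝ.≈-refl a≈b 0≤a ∣≼∣ ℝ.≤-resp (normSq-cong z≈w) (ℝ.*-cong a≈b a≈b) n≤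

  ≼-weaken : ∀ {z a b} → a ℝ.≤ b → z ≼ a → z ≼ b
  ≼-weaken a≤b (0≤a ∣≼∣ n≤) = 0≤b ∣≼∣ ℝ.≤-trans n≤ (ℝ.*-mono-≤ 0≤a 0≤b a≤b a≤b)
    where 0≤b = ℝ.≤-trans 0≤a a≤b

  ≼-+ : ∀ {z w a b} → z ≼ a → w ≼ b → z + w ≼ a ℝ.+ b
  ≼-+ {z} {w} (0≤a ∣≼∣ n≤a) (0≤b ∣≼∣ n≤b) = ℝ.+-nonneg 0≤a 0≤b ∣≼∣
    ℝ.≤-trans (ℝ.≤-reflexive (normSq-+ z w)) (ℝ.minkowski 0≤a 0≤b (normSq-nonneg w) n≤a n≤b (re²≤ z w))

  ≼-* : ∀ {z w a b} → z ≼ a → w ≼ b → z * w ≼ a ℝ.* b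
  ≼-* {z} {w} {a} {b} (0≤a ∣≼∣ n≤a) (0≤b ∣≼∣ n≤b) = ℝ.*-nonneg 0≤a 0≤b ∣≼∣
    ℝ.≤-resp (ℝ.≈-sym (normSq-* z w)) (ℝ.solve 2 (λ a b → a ℝ.:* a ℝ.:* (b ℝ.:* b) ℝ.:= a ℝ.:* b ℝ.:* (a ℝ.:* b)) ℝ.≈-refl a b)
      (ℝ.*-mono-≤ (normSq-nonneg z) (ℝ.square-nonneg b) n≤a n≤b)

  ≼-real : ∀ {x} → ℝ.0# ℝ.≤ x → real x ≼ x
  ≼-real {x} 0≤x = 0≤x ∣≼∣ ℝ.≤-reflexive (normSq-real x)

  ≼-1 : 1# ≼ ℝ.1#
  ≼-1 = ≼-cong real-1 ℝ.≈-refl (≼-real ℝ.0≤1)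

  ≼-0 : 0# ≼ ℝ.0#
  ≼-0 = ≼-cong real-0 ℝ.≈-refl (≼-real ℝ.≤-refl)

  ≼-^ : ∀ {z a} → z ≼ a → ∀ n → z ^ n ≼ a ℝ.^ n
  ≼-^ z≼a zero    = ≼-1
  ≼-^ z≼a (suc n) = ≼-* z≼a (≼-^ z≼a n)

  ≼-sum : ∀ {n} (f : Fin n → Carrier) (b : Fin n → ℝ.Carrier) → (∀ i → f i ≼ b i) → sum f ≼ ℝ.Σ b
  ≼-sum {zero}  f b f≼b = ≼-0
  ≼-sum {suc n} f b f≼b = ≼-+ (f≼b Fin.zero) (≼-sum _ _ (f≼b ∘ Fin.suc))

  -- n ≤ (n + 1)² for n = |z|²: a majorant of |z| that is polynomial in the coordinates.
  ≼-bound : ∀ z → z ≼ normSq z ℝ.+ ℝ.1#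
  ≼-bound z = ℝ.+-nonneg 0≤n ℝ.0≤1 ∣≼∣
    ℝ.≤-resp ℝ.≈-refl (ℝ.solve 1 (λ n → n ℝ.:+ ((n ℝ.:* n ℝ.:+ n) ℝ.:+ ℝ.:1) ℝ.:= (n ℝ.:+ ℝ.:1) ℝ.:* (n ℝ.:+ ℝ.:1)) ℝ.≈-refl (normSq z))
      (ℝ.x≤y+z ℝ.≤-refl (ℝ.+-nonneg (ℝ.+-nonneg (ℝ.*-nonneg 0≤n 0≤n) 0≤n) ℝ.0≤1))
    where 0≤n = normSq-nonneg z

  -- 2 |z| |w| ≤ |z|² + |w|². The factor 2 is the price for a triangle inequality in terms of
  -- squares alone.
  normSq-+≤ : ∀ z w → normSq (z + w) ℝ.≤ (ℝ.1# ℝ.+ ℝ.1#) ℝ.* (normSq z ℝ.+ normSq w)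
  normSq-+≤ z w = ℝ.≤-trans (ℝ.≤-reflexive (normSq-+ z w)) (ℝ.parallelogram (normSq-nonneg z) (normSq-nonneg w) (re²≤ z w))

  normSq-swap : ∀ z w → normSq (z - w) ℝ.≈ normSq (w - z)
  normSq-swap z w = ℝ.≈-trans (normSq-cong (solve 2 (λ z w → z :- w := :- (w :- z)) ≈-refl z w)) (normSq-neg (w - z))

  normSq-triangle : ∀ x y z → normSq (x - z) ℝ.≤ (ℝ.1# ℝ.+ ℝ.1#) ℝ.* (normSq (x - y) ℝ.+ normSq (y - z))
  normSq-triangle x y z = ℝ.≤-resp (normSq-cong (solve 3 (λ x y z → (x :- y) :+ (y :- z) := x :- z) ≈-refl x y z)) ℝ.≈-refl
    (normSq-+≤ (x - y) (y - z))

  private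
    2+2 : ∀ x → (ℝ.1# ℝ.+ ℝ.1#) ℝ.* (ℝ.½ ℝ.* x) ℝ.≈ x
    2+2 x = ℝ.≈-trans (ℝ.≈-sym (ℝ.*-assoc _ _ _)) (ℝ.≈-trans (ℝ.*-congʳ ℝ.2*½≈1) (ℝ.*-identityˡ x))

    -- The factor 2 of `normSq-+≤` and the two summands together cost a factor 4.
    quarters : ∀ {x y ε} → x ℝ.< ℝ.½ ℝ.* (ℝ.½ ℝ.* ε) → y ℝ.< ℝ.½ ℝ.* (ℝ.½ ℝ.* ε) → (ℝ.1# ℝ.+ ℝ.1#) ℝ.* (x ℝ.+ y) ℝ.< ε
    quarters {x} {y} {ε} x< y< = ℝ.<-resp (ℝ.*-comm _ _) (ℝ.≈-trans (ℝ.*-comm _ _) (2+2 ε))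
      (ℝ.*-monoʳ-< (ℝ.1# ℝ.+ ℝ.1#) (ℝ.+-pos ℝ.0<1 ℝ.0<1) (ℝ.x+y<z x< y<))

    0<¼ : ∀ {ε} → ℝ.0# ℝ.< ε → ℝ.0# ℝ.< ℝ.½ ℝ.* (ℝ.½ ℝ.* ε)
    0<¼ 0<ε = ℝ.*-pos ℝ.0<½ (ℝ.*-pos ℝ.0<½ 0<ε)

  infix 4 _⟶_
  -- Squared distances are compared with ε and not with ε², which lets bounds on `normSq` be added
  -- directly.
  record _⟶_ (u : ℕ → Carrier) (z : Carrier) : Set where
    constructor limit
    field
      eventually : ∀ ε → ℝ.0# ℝ.< ε → ∃[ N ] (∀ n → N ℕ.≤ n → normSq (u n - z) ℝ.< ε)

  open _⟶_ public

  ⟶-from-squares : ∀ {u z} → (∀ ε → ℝ.0# ℝ.< ε → ∃[ N ] (∀ n → N ℕ.≤ n → normSq (u n - z) ℝ.< ε ℝ.* ε)) → u ⟶ z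
  ⟶-from-squares h = limit λ ε 0<ε →
    let a , 0<a , aa≤ε = ℝ.sqrt-below 0<ε
        N , close = h a 0<a
    in N , λ n N≤n → ℝ.<-≤-trans (close n N≤n) aa≤ε

  ⟶-to-squares : ∀ {u z} → u ⟶ z → ∀ ε → ℝ.0# ℝ.< ε → ∃[ N ] (∀ n → N ℕ.≤ n → normSq (u n - z) ℝ.< ε ℝ.* ε)
  ⟶-to-squares (limit h) ε 0<ε = h (ε ℝ.* ε) (ℝ.*-pos 0<ε 0<ε)

  ⟶-follow : ∀ {u v z} → u ⟶ z →
    (∀ ε → ℝ.0# ℝ.< ε → ∃[ N ] (∀ n → N ℕ.≤ n → normSq (v n - u n) ℝ.< ε)) → v ⟶ z
  ⟶-follow {u} {v} {z} (limit h) g = limit λ ε 0<ε →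
    let N , close = h _ (0<¼ 0<ε)
        M , near = g _ (0<¼ 0<ε)
    in N ℕ.⊔ M , λ n N⊔M≤n → ℝ.≤-<-trans (normSq-triangle (v n) (u n) z)
         (quarters (near n (ℕ.m⊔n≤o⇒n≤o N M N⊔M≤n)) (close n (ℕ.m⊔n≤o⇒m≤o N M N⊔M≤n)))

  normSq-small : ∀ {z} → (∀ ε → ℝ.0# ℝ.< ε → normSq z ℝ.≤ ε) → z ≈ 0#
  normSq-small {z} h = normSq-zero z (ℝ.≤-approx λ ε 0<ε → ℝ.≤-trans (h ε 0<ε) (ℝ.≤-reflexive (ℝ.≈-sym (ℝ.+-identityˡ ε))))

  difference-zero : ∀ {z w} → z - w ≈ 0# → z ≈ w
  difference-zero {z} {w} p = ≈-trans (solve 2 (λ z w → z := (z :- w) :+ w) ≈-refl z w) (≈-trans (+-congʳ p) (+-identityˡ w))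

  ⟶-unique : ∀ {u z w} → u ⟶ z → u ⟶ w → z ≈ w
  ⟶-unique {u} {z} {w} (limit h) (limit g) = difference-zero (normSq-small λ ε 0<ε →
    let N , close = h _ (0<¼ 0<ε)
        M , near = g _ (0<¼ 0<ε)
        n = N ℕ.⊔ M
    in ℝ.<⇒≤ (ℝ.≤-<-trans (normSq-triangle z (u n) w)
         (quarters (ℝ.<-respˡ-≈ (normSq-swap (u n) z) (close n (ℕ.m≤m⊔n N M))) (near n (ℕ.m≤n⊔m N M)))))

  ⟶-eventually : ∀ {u v z w} N → (∀ n → N ℕ.≤ n → u n ≈ v n) → z ≈ w → u ⟶ z → v ⟶ w
  ⟶-eventually N u≈v z≈w (limit h) = limit λ ε 0<ε →
    let M , close = h ε 0<ε
    in N ℕ.⊔ M , λ n N⊔M≤n → ℝ.<-respˡ-≈ (normSq-cong (+-cong (u≈v n (ℕ.m⊔n≤o⇒m≤o N M N⊔M≤n)) (-‿cong z≈w)))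
         (close n (ℕ.m⊔n≤o⇒n≤o N M N⊔M≤n))

  ⟶-cong : ∀ {u v z w} → (∀ n → u n ≈ v n) → z ≈ w → u ⟶ z → v ⟶ w
  ⟶-cong u≈v = ⟶-eventually 0 (λ n _ → u≈v n)

  ⟶-const : ∀ z → (λ _ → z) ⟶ z
  ⟶-const z = limit λ ε 0<ε → 0 , λ n _ →
    ℝ.<-respˡ-≈ (ℝ.≈-trans (ℝ.≈-sym normSq-0) (normSq-cong (≈-sym (-‿inverseʳ z)))) 0<ε

  ⟶-+ : ∀ {u v z w} → u ⟶ z → v ⟶ w → (λ n → u n + v n) ⟶ z + w
  ⟶-+ {u} {v} {z} {w} (limit h) (limit g) = limit λ ε 0<ε →
    let N , close = h _ (0<¼ 0<ε)
        M , near = g _ (0<¼ 0<ε)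
    in N ℕ.⊔ M , λ n N⊔M≤n → ℝ.≤-<-trans
         (ℝ.≤-resp (normSq-cong (solve 4 (λ u v z w → (u :- z) :+ (v :- w) := (u :+ v) :- (z :+ w)) ≈-refl (u n) (v n) z w)) ℝ.≈-refl
           (normSq-+≤ (u n - z) (v n - w)))
         (quarters (close n (ℕ.m⊔n≤o⇒m≤o N M N⊔M≤n)) (near n (ℕ.m⊔n≤o⇒n≤o N M N⊔M≤n)))

  ⟶-scale : ∀ {u z} c → u ⟶ z → (λ n → c * u n) ⟶ c * z
  ⟶-scale {u} {z} c (limit h) = limit λ ε 0<ε →
    -- The summand 1 keeps the factor strictly positive when c = 0.
    let a , 0<a , _ , aK≤ε = ℝ.small 0<ε (ℝ.+-nonneg (normSq-nonneg c) ℝ.0≤1)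
        N , close = h a 0<a
    in N , λ n N≤n → ℝ.<-≤-trans
         (ℝ.≤-<-trans
           (ℝ.≤-resp (ℝ.≈-sym (ℝ.≈-trans (normSq-cong (solve 3 (λ c u z → c :* u :- c :* z := (u :- z) :* c) ≈-refl c (u n) z)) (normSq-* (u n - z) c))) ℝ.≈-refl
             (ℝ.*-monoˡ-≤ _ (normSq-nonneg (u n - z)) (ℝ.x≤y+z ℝ.≤-refl ℝ.0≤1)))
           (ℝ.*-monoʳ-< _ (ℝ.+-nonneg-pos (normSq-nonneg c) ℝ.0<1) (close n N≤n)))
         aK≤ε

  ⟶-neg : ∀ {u z} → u ⟶ z → (λ n → - u n) ⟶ - z
  ⟶-neg {u} {z} u⟶z = ⟶-cong (λ n → lem (u n)) (lem z) (⟶-scale (- 1#) u⟶z)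
    where
    lem : ∀ x → - 1# * x ≈ - x
    lem = solve 1 (λ x → (:- :1) :* x := :- x) ≈-refl

  ⟶-null-* : ∀ {u v} → u ⟶ 0# → v ⟶ 0# → (λ n → u n * v n) ⟶ 0#
  ⟶-null-* {u} {v} (limit h) (limit g) = limit λ ε 0<ε →
    let N , close = h ε 0<ε
        M , near = g ℝ.1# ℝ.0<1
    in N ℕ.⊔ M , λ n N⊔M≤n → ℝ.≤-<-trans
         (ℝ.≤-resp (ℝ.≈-sym (ℝ.≈-trans (normSq-cong (solve 2 (λ u v → u :* v :- :0 := (u :- :0) :* (v :- :0)) ≈-refl (u n) (v n))) (normSq-* _ _))) (ℝ.*-identityʳ _)
           (ℝ.*-monoˡ-≤ _ (normSq-nonneg (u n - 0#)) (ℝ.<⇒≤ (near n (ℕ.m⊔n≤o⇒n≤o N M N⊔M≤n)))))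
         (close n (ℕ.m⊔n≤o⇒m≤o N M N⊔M≤n))

  -- u v = (u - z)(v - w) + z v + w (u - z): the only genuine product is one of null sequences,
  -- where it is enough to bound one factor by 1.
  ⟶-* : ∀ {u v z w} → u ⟶ z → v ⟶ w → (λ n → u n * v n) ⟶ z * w
  ⟶-* {u} {v} {z} {w} u⟶z v⟶w = ⟶-cong
    (λ n → solve 4 (λ u v z w → (u :- z) :* (v :- w) :+ (z :* v :+ w :* (u :- z)) := u :* v) ≈-refl (u n) (v n) z w)
    (solve 2 (λ z w → :0 :+ (z :* w :+ w :* :0) := z :* w) ≈-refl z w)
    (⟶-+ (⟶-null-* u-z⟶0 v-w⟶0) (⟶-+ (⟶-scale z v⟶w) (⟶-scale w u-z⟶0)))
    where
    u-z⟶0 : (λ n → u n - z) ⟶ 0#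
    u-z⟶0 = ⟶-cong (λ _ → ≈-refl) (-‿inverseʳ z) (⟶-+ u⟶z (⟶-const (- z)))
    v-w⟶0 : (λ n → v n - w) ⟶ 0#
    v-w⟶0 = ⟶-cong (λ _ → ≈-refl) (-‿inverseʳ w) (⟶-+ v⟶w (⟶-const (- w)))

  ⟶-reindex : ∀ {u z} (f : ℕ → ℕ) → (∀ n → n ℕ.≤ f n) → u ⟶ z → (u ∘ f) ⟶ z
  ⟶-reindex f n≤fn (limit h) = limit λ ε 0<ε →
    let N , close = h ε 0<ε
    in N , λ n N≤n → close (f n) (ℕ.≤-trans N≤n (n≤fn n))

  ⟶-predecessor : ∀ {u z} → (u ∘ suc) ⟶ z → u ⟶ z
  ⟶-predecessor {u} (limit h) = limit λ ε 0<ε →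
    let N , close = h ε 0<ε
    in suc N , λ { (suc n) (ℕ.s≤s N≤n) → close n N≤n }

  conj-⟶ : ∀ {u z} → u ⟶ z → (conj ∘ u) ⟶ conj z
  conj-⟶ {u} {z} (limit h) = limit λ ε 0<ε →
    let N , close = h ε 0<ε
    in N , λ n N≤n → ℝ.<-respˡ-≈ (ℝ.≈-trans (ℝ.≈-sym (normSq-conj (u n - z))) (normSq-cong (≈-trans (conj-+ (u n) (- z)) (+-congˡ (conj-neg z))))) (close n N≤n)
    where
    conj-neg : ∀ z → conj (- z) ≈ - conj z
    conj-neg z = ≈-trans (solve 2 (λ x y → y := (x :+ y) :- x) ≈-refl (conj z) (conj (- z)))
      (≈-trans (+-congʳ (≈-trans (≈-sym (conj-+ z (- z))) (≈-trans (conj-cong (≈-trans (-‿inverseʳ z) (≈-sym real-0))) (≈-trans (conj-real _) real-0)))) (+-identityˡ _))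

  ⟶-≼ : ∀ {u z b} N → (∀ n → N ℕ.≤ n → u n ≼ b) → u ⟶ z → z ≼ b
  ⟶-≼ {u} {z} {b} N u≼b u⟶z = 0≤b ∣≼∣ ℝ.≤-approx bound
    where
    0≤b : ℝ.0# ℝ.≤ b
    0≤b = nonneg (u≼b N ℕ.≤-refl)
    bound : ∀ ε → ℝ.0# ℝ.< ε → normSq z ℝ.≤ b ℝ.* b ℝ.+ ε
    bound ε 0<ε =
      -- (b + a)² - b² = a (2 b + a), and 2 b + 1 dominates 2 b + a because a ≤ 1.
      let K = (b ℝ.+ b) ℝ.+ ℝ.1#
          a , 0<a , a≤1 , aK≤ε = ℝ.small 0<ε (ℝ.+-nonneg (ℝ.+-nonneg 0≤b 0≤b) ℝ.0≤1)
          M , close = ⟶-to-squares u⟶z a 0<a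
          n = N ℕ.⊔ M
          z-u≼a : z - u n ≼ a
          z-u≼a = ℝ.<⇒≤ 0<a ∣≼∣ ℝ.≤-trans (ℝ.≤-reflexive (normSq-swap z (u n))) (ℝ.<⇒≤ (close n (ℕ.m≤n⊔m N M)))
          z≼ : z ≼ b ℝ.+ a
          z≼ = ≼-cong (solve 2 (λ u z → u :+ (z :- u) := z) ≈-refl (u n) z) ℝ.≈-refl (≼-+ (u≼b n (ℕ.m≤m⊔n N M)) z-u≼a)
          a*≤ : a ℝ.* (b ℝ.+ b ℝ.+ a) ℝ.≤ a ℝ.* K
          a*≤ = ℝ.*-monoˡ-≤ a (ℝ.<⇒≤ 0<a) (ℝ.+-mono-≤ ℝ.≤-refl a≤1)
      in ℝ.≤-trans (normSq≤ z≼) (ℝ.≤-resp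
           (ℝ.solve 2 (λ a b → b ℝ.:* b ℝ.:+ a ℝ.:* (b ℝ.:+ b ℝ.:+ a) ℝ.:= (b ℝ.:+ a) ℝ.:* (b ℝ.:+ a)) ℝ.≈-refl a b) ℝ.≈-refl
           (ℝ.+-mono-≤ ℝ.≤-refl (ℝ.≤-trans a*≤ aK≤ε)))

  normSq-pos⇒unit : ∀ {z} → ℝ.0# ℝ.< normSq z → ∃[ w ] (z * w ≈ 1#)
  normSq-pos⇒unit {z} 0<n = conj z * real y , (begin
      z * (conj z * real y)     ≈⟨ *-assoc _ _ _ ⟨
      z * conj z * real y       ≈⟨ *-congʳ (z*conj z) ⟩
      real (normSq z) * real y  ≈⟨ real-* _ _ ⟨
      real (normSq z ℝ.* y)     ≈⟨ real-cong (proj₂ (proj₂ (ℝ.inverse⁺ 0<n))) ⟩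
      real ℝ.1#                 ≈⟨ real-1 ⟩
      1#                        ∎)
    where
    y = proj₁ (ℝ.inverse⁺ 0<n)
    open Relation.Binary.Reasoning.Setoid setoid

  -- (re z)² ≤ |z|² < 1 gives re z < 1, so |1 - z|² ≥ (1 - re z)² > 0, and the inverse is the
  -- conjugate over the squared norm.
  normSq<1⇒1-unit : ∀ {z} → normSq z ℝ.< ℝ.1# → ∃[ w ] ((1# - z) * w ≈ 1#)
  normSq<1⇒1-unit {z} n<1 = normSq-pos⇒unit (ℝ.<-≤-trans (ℝ.*-pos 0<re 0<re) (re²≤normSq (1# - z)))
    where
    re≈ : ℝ.1# ℝ.- re z ℝ.≈ re (1# - z)
    re≈ = ℝ.≈-sym (ℝ.≈-trans (re-+ 1# (- z)) (ℝ.+-cong (ℝ.≈-trans (re-cong (≈-sym real-1)) (re-real _)) (re-neg z)))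
    0<re : ℝ.0# ℝ.< re (1# - z)
    0<re = ℝ.<-respʳ-≈ re≈ (ℝ.<⇒0<- (ℝ.square<1⇒<1 (ℝ.≤-<-trans (re²≤normSq z) n<1)))

-- The exponential function

module Factorials (R : RealNumbers) where
  open RealProperties R

  1/! : ℕ → Carrier
  1/! k = (1/ (k ℕ.!)) {{k ℕ.!≢0}}

  0≤1/! : ∀ k → 0# ≤ 1/! k
  0≤1/! k = <⇒≤ (0<1/ (k ℕ.!) {{k ℕ.!≢0}})

  1/!0 : 1/! 0 ≈ 1#
  1/!0 = ≈-trans (≈-sym (≈-trans (*-congʳ (+-identityʳ 1#)) (*-identityˡ _))) (n*1/n≈1 1)

  k*1/! : ∀ k → (suc k · 1#) * 1/! (suc k) ≈ 1/! k
  k*1/! k = begin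
    s * 1/! (suc k)                        ≈⟨ *-identityʳ _ ⟨
    s * 1/! (suc k) * 1#                   ≈⟨ *-congˡ (n*1/n≈1 (k ℕ.!) {{k ℕ.!≢0}}) ⟨
    s * 1/! (suc k) * (f * 1/! k)          ≈⟨ solve 4 (λ s x f y → s :* x :* (f :* y) := (s :* f) :* x :* y) ≈-refl s (1/! (suc k)) f (1/! k) ⟩
    (s * f) * 1/! (suc k) * 1/! k          ≈⟨ *-congʳ (*-congʳ (×1-homo-* (suc k) (k ℕ.!))) ⟨
    ((suc k ℕ.!) · 1#) * 1/! (suc k) * 1/! k ≈⟨ *-congʳ (n*1/n≈1 (suc k ℕ.!) {{suc k ℕ.!≢0}}) ⟩
    1# * 1/! k                             ≈⟨ *-identityˡ _ ⟩
    1/! k                                  ∎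
    where
    s = suc k · 1#
    f = (k ℕ.!) · 1#
    open Relation.Binary.Reasoning.Setoid setoid

  reciprocals : ReciprocalFactorials (RealNumbers.commutativeRing R)
  reciprocals = record
    { ρ = 1/! ; ν = _· 1# ; ρ0≈1 = 1/!0 ; ν0≈0 = ≈-refl ; ν-+ = λ j k → ≈-sym (×-homo-+ 1# j k)
    ; νρ = k*1/! ; ν-unit = λ k → 1/ (suc k) , ≈-trans (*-comm _ _) (n*1/n≈1 (suc k))
    }

  open ExponentialTerms reciprocals public

  0≤term : ∀ {x} → 0# ≤ x → ∀ k → 0# ≤ term x k
  0≤term 0≤x k = *-nonneg (^-nonneg 0≤x k) (0≤1/! k)

  -- The part above the antidiagonal of a product of partial sums lies in the tail of
  -- exp (x + y); this majorizes the error in exp z exp w = exp (z + w).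
  rectangle-triangle : ∀ {x y} n → 0# ≤ x → 0# ≤ y →
    Σ< n (term x) * Σ< n (term y) - triangle (term x) (term y) n ≤ Σ< (n +ℕ n) (term (x + y)) - Σ< n (term (x + y))
  rectangle-triangle {x} {y} n 0≤x 0≤y = +-mono-≤
    (≤-trans (rectangle≤triangle (term x) (term y) n n (0≤term 0≤x) (0≤term 0≤y)) (≤-reflexive (triangle-term x y (n +ℕ n))))
    (≤-reflexive (-‿cong (triangle-term x y n)))

record ExponentialFunction {R : RealNumbers} (C : ComplexField R) : Set where
  open ComplexAnalysis C
  field
    exp        : Carrier → Carrier
    exp-series : ∀ z → (λ n → Σ< n (λ k → z ^ k * real (Factorials.1/! R k))) ⟶ exp z

module Exponential {R : RealNumbers} {C : ComplexField R} (expFunction : ExponentialFunction C) where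
  open ComplexAnalysis C
  open ExponentialFunction expFunction
  private
    module ℝ! = Factorials R
  open Relation.Binary.Reasoning.Setoid setoid

  private
    reciprocals : ReciprocalFactorials commutativeRing
    reciprocals = record
      { ρ = λ k → real (ℝ!.1/! k)
      ; ν = λ k → real (k ℝ.· ℝ.1#)
      ; ρ0≈1 = ≈-trans (real-cong ℝ!.1/!0) real-1
      ; ν0≈0 = real-0
      ; ν-+ = λ j k → ≈-trans (≈-sym (real-+ _ _)) (real-cong (ℝ.≈-sym (ℝ.×-homo-+ ℝ.1# j k)))
      ; νρ = λ k → ≈-trans (≈-sym (real-* _ _)) (real-cong (ℝ!.k*1/! k))
      ; ν-unit = λ k → real (ℝ.1/ (suc k)) , ≈-trans (≈-sym (real-* _ _)) (≈-trans (real-cong (ℝ.≈-trans (ℝ.*-comm _ _) (ℝ.n*1/n≈1 (suc k)))) real-1)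
      }

  open ExponentialTerms reciprocals

  private
    E : ℕ → Carrier → Carrier
    E n z = Σ< n (term z)

    Eᵣ : ℕ → ℝ.Carrier → ℝ.Carrier
    Eᵣ n x = ℝ.Σ< n (ℝ!.term x)

    term-cong : ∀ {z w} → z ≈ w → ∀ k → term z k ≈ term w k
    term-cong z≈w k = *-congʳ {real (ℝ!.1/! k)} (^-congˡ k z≈w)

    term-real : ∀ x k → term (real x) k ≈ real (ℝ!.term x k)
    term-real x k = ≈-trans (*-congʳ {real (ℝ!.1/! k)} (≈-sym (real-^ x k))) (≈-sym (real-* _ _))

    real-Σ< : ∀ n t → real (ℝ.Σ< n t) ≈ Σ< n (real ∘ t)
    real-Σ< zero    t = real-0
    real-Σ< (suc n) t = ≈-trans (real-+ _ _) (+-congˡ (real-Σ< n (t ∘ suc)))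

    E-real : ∀ n x → E n (real x) ≈ real (Eᵣ n x)
    E-real n x = ≈-trans (Σ<-cong n (λ k _ → term-real x k)) (≈-sym (real-Σ< n (ℝ!.term x)))

    term-≼ : ∀ {z x} → z ≼ x → ∀ k → term z k ≼ ℝ!.term x k
    term-≼ z≼x k = ≼-* (≼-^ z≼x k) (≼-real {ℝ!.1/! k} (ℝ!.0≤1/! k))

    tail-≼ : ∀ {a : ℕ → Carrier} {â} → (∀ k → a k ≼ â k) → ∀ {m n} → m ℕ.≤ n → Σ< n a - Σ< m a ≼ ℝ.Σ< n â ℝ.- ℝ.Σ< m â
    tail-≼ {a} {â} a≼â {n = n} ℕ.z≤n = ≼-cong (solve 1 (λ x → x := x :- :0) ≈-refl (Σ< n a)) (ℝ.solve 1 (λ x → x ℝ.:= x ℝ.:- ℝ.:0) ℝ.≈-refl (ℝ.Σ< n â))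
      (≼-sum {n} _ _ (a≼â ∘ toℕ))
    tail-≼ {a} {â} a≼â (ℕ.s≤s {m} {n} m≤n) = ≼-cong
      (solve 3 (λ a x y → x :- y := (a :+ x) :- (a :+ y)) ≈-refl (a 0) (Σ< n (a ∘ suc)) (Σ< m (a ∘ suc)))
      (ℝ.solve 3 (λ a x y → x ℝ.:- y ℝ.:= (a ℝ.:+ x) ℝ.:- (a ℝ.:+ y)) ℝ.≈-refl (â 0) (ℝ.Σ< n (â ∘ suc)) (ℝ.Σ< m (â ∘ suc)))
      (tail-≼ (a≼â ∘ suc) m≤n)

    -- The error is the sum of a j * b k over j < m and m - j ≤ k < n. Nothing cancels in it, so
    -- majorants of the terms bound it. The induction splits off the row j = 0, in which a tail of b
    -- remains.
    cauchy-≼ : ∀ {a b : ℕ → Carrier} {â b̂} → (∀ k → a k ≼ â k) → (∀ k → b k ≼ b̂ k) → ∀ m n → m ℕ.≤ n →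
      Σ< m a * Σ< n b - triangle a b m ≼ ℝ.Σ< m â ℝ.* ℝ.Σ< n b̂ ℝ.- ℝ.triangle â b̂ m
    cauchy-≼ {b = b} {b̂ = b̂} a≼ b≼ zero n _ = ≼-cong
      (solve 1 (λ x → :0 := :0 :* x :- :0) ≈-refl (Σ< n b)) (ℝ.solve 1 (λ x → ℝ.:0 ℝ.:= ℝ.:0 ℝ.:* x ℝ.:- ℝ.:0) ℝ.≈-refl (ℝ.Σ< n b̂)) ≼-0
    cauchy-≼ {a} {b} {â} {b̂} a≼ b≼ (suc m) n m<n = ≼-cong
      (solve 5 (λ a A B B′ T → a :* (B :- B′) :+ (A :* B :- T) := (a :+ A) :* B :- (a :* B′ :+ T)) ≈-refl
        (a 0) (Σ< m (a ∘ suc)) (Σ< n b) (Σ< (suc m) b) (triangle (a ∘ suc) b m))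
      (ℝ.solve 5 (λ a A B B′ T → a ℝ.:* (B ℝ.:- B′) ℝ.:+ (A ℝ.:* B ℝ.:- T) ℝ.:= (a ℝ.:+ A) ℝ.:* B ℝ.:- (a ℝ.:* B′ ℝ.:+ T)) ℝ.≈-refl
        (â 0) (ℝ.Σ< m (â ∘ suc)) (ℝ.Σ< n b̂) (ℝ.Σ< (suc m) b̂) (ℝ.triangle (â ∘ suc) b̂ m))
      (≼-+ (≼-* (a≼ 0) (tail-≼ b≼ m<n)) (cauchy-≼ (a≼ ∘ suc) b≼ m n (ℕ.<⇒≤ m<n)))

    E-product-≼ : ∀ {z w x y} n → z ≼ x → w ≼ y → E n z * E n w - E n (z + w) ≼ Eᵣ (n +ℕ n) (x ℝ.+ y) ℝ.- Eᵣ n (x ℝ.+ y)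
    E-product-≼ {z} {w} n z≼x w≼y = ≼-weaken (ℝ!.rectangle-triangle n (nonneg z≼x) (nonneg w≼y))
      (≼-cong (+-congˡ (-‿cong (triangle-term z w n))) ℝ.≈-refl
        (cauchy-≼ (term-≼ z≼x) (term-≼ w≼y) n n ℕ.≤-refl))

  exp-cong : ∀ {z w} → z ≈ w → exp z ≈ exp w
  exp-cong {z} {w} z≈w = ⟶-unique (exp-series z) (⟶-cong (λ n → Σ<-cong n (λ k _ → term-cong (≈-sym z≈w) k)) ≈-refl (exp-series w))

  exp-0 : exp 0# ≈ 1#
  exp-0 = ⟶-unique (exp-series 0#) (⟶-predecessor (⟶-cong (λ n → ≈-sym (E0 n)) ≈-refl (⟶-const 1#)))
    where
    E0 : ∀ n → E (suc n) 0# ≈ 1#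
    E0 n = ≈-trans (+-cong (≈-trans (*-identityˡ _) (≈-trans (real-cong ℝ!.1/!0) real-1))
                     (sum-zero {n} _ (λ i → ≈-trans (*-congʳ (zeroˡ _)) (zeroˡ _)))) (+-identityʳ 1#)

  exp-+ : ∀ z w → exp (z + w) ≈ exp z * exp w
  exp-+ z w = ⟶-unique (⟶-follow (exp-series (z + w)) near) (⟶-* (exp-series z) (exp-series w))
    where
    x = normSq z ℝ.+ ℝ.1#
    y = normSq w ℝ.+ ℝ.1#
    B = real (x ℝ.+ y)
    -- Blocks from n to 2 n of a convergent series tend to 0. By `E-product-≼` such a block at B
    -- bounds the defect of the functional equation for partial sums.
    tail⟶0 : (λ n → E (n +ℕ n) B - E n B) ⟶ 0#
    tail⟶0 = ⟶-cong (λ _ → ≈-refl) (-‿inverseʳ _)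
      (⟶-+ (⟶-reindex (λ n → n +ℕ n) (λ n → ℕ.m≤m+n n n) (exp-series B)) (⟶-neg (exp-series B)))
    near : ∀ ε → ℝ.0# ℝ.< ε → ∃[ N ] (∀ n → N ℕ.≤ n → normSq (E n z * E n w - E n (z + w)) ℝ.< ε)
    near ε 0<ε = let N , close = eventually tail⟶0 ε 0<ε in N , λ n N≤n →
      ℝ.≤-<-trans (normSq≤ (E-product-≼ n (≼-bound z) (≼-bound w)))
        (ℝ.<-respˡ-≈ (ℝ.≈-trans (normSq-cong (tail-real n)) (normSq-real _)) (close n N≤n))
      where
      tail-real : ∀ n → (E (n +ℕ n) B - E n B) - 0# ≈ real (Eᵣ (n +ℕ n) (x ℝ.+ y) ℝ.- Eᵣ n (x ℝ.+ y))
      tail-real n = ≈-trans (solve 2 (λ a b → (a :- b) :- :0 := a :- b) ≈-refl (E (n +ℕ n) B) (E n B))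
        (≈-trans (+-cong (E-real (n +ℕ n) _) (≈-trans (-‿cong (E-real n _)) (≈-sym (real-neg _)))) (≈-sym (real-+ _ _)))

  -- The coefficients 1 / k! are real. Reality on the real line and the formula for |exp z| both
  -- rest on this.
  exp-conj : ∀ z → exp (conj z) ≈ conj (exp z)
  exp-conj z = ⟶-unique (exp-series (conj z)) (⟶-cong conj-E ≈-refl (conj-⟶ (exp-series z)))
    where
    conj-0 : conj 0# ≈ 0#
    conj-0 = ≈-trans (conj-cong (≈-sym real-0)) (≈-trans (conj-real _) real-0)
    conj-1 : conj 1# ≈ 1#
    conj-1 = ≈-trans (conj-cong (≈-sym real-1)) (≈-trans (conj-real _) real-1)
    conj-^ : ∀ n → conj (z ^ n) ≈ conj z ^ n
    conj-^ zero    = conj-1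
    conj-^ (suc n) = ≈-trans (conj-* _ _) (*-congˡ (conj-^ n))
    conj-Σ< : ∀ n t → conj (Σ< n t) ≈ Σ< n (conj ∘ t)
    conj-Σ< zero    t = conj-0
    conj-Σ< (suc n) t = ≈-trans (conj-+ _ _) (+-congˡ (conj-Σ< n (t ∘ suc)))
    conj-E : ∀ n → conj (E n z) ≈ E n (conj z)
    conj-E n = ≈-trans (conj-Σ< n (term z)) (Σ<-cong n (λ k _ → ≈-trans (conj-* _ _) (*-cong (conj-^ k) (conj-real (ℝ!.1/! k)))))

  expᵣ : ℝ.Carrier → ℝ.Carrier
  expᵣ x = re (exp (real x))

  -- By `exp-conj`, e = exp (real x) is its own conjugate, so e + e = e + conj e = 2 re e.
  real-expᵣ : ∀ x → real (expᵣ x) ≈ exp (real x)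
  real-expᵣ x = begin
    r                          ≈⟨ half r ⟨
    real ℝ.½ * (r + r)         ≈⟨ *-congˡ (real-+ _ _) ⟨
    real ℝ.½ * real (expᵣ x ℝ.+ expᵣ x) ≈⟨ *-congˡ (z+conj e) ⟨
    real ℝ.½ * (e + conj e)    ≈⟨ *-congˡ (+-congˡ (exp-conj (real x))) ⟨
    real ℝ.½ * (e + exp (conj (real x))) ≈⟨ *-congˡ (+-congˡ (exp-cong (conj-real x))) ⟩
    real ℝ.½ * (e + e)         ≈⟨ half e ⟩
    e                          ∎
    where
    e = exp (real x)
    r = real (expᵣ x)
    half : ∀ z → real ℝ.½ * (z + z) ≈ z
    half z = begin
      real ℝ.½ * (z + z)                        ≈⟨ solve 2 (λ h z → h :* (z :+ z) := ((:1 :+ :1) :* h) :* z) ≈-refl (real ℝ.½) z ⟩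
      (1# + 1#) * real ℝ.½ * z                  ≈⟨ *-congʳ (*-congʳ (≈-trans (real-+ _ _) (+-cong real-1 real-1))) ⟨
      real (ℝ.1# ℝ.+ ℝ.1#) * real ℝ.½ * z       ≈⟨ *-congʳ (real-* _ _) ⟨
      real ((ℝ.1# ℝ.+ ℝ.1#) ℝ.* ℝ.½) * z        ≈⟨ *-congʳ (≈-trans (real-cong ℝ.2*½≈1) real-1) ⟩
      1# * z                                    ≈⟨ *-identityˡ z ⟩
      z                                         ∎

  expᵣ-cong : ∀ {x y} → x ℝ.≈ y → expᵣ x ℝ.≈ expᵣ y
  expᵣ-cong x≈y = re-cong (exp-cong (real-cong x≈y))

  expᵣ-+ : ∀ x y → expᵣ (x ℝ.+ y) ℝ.≈ expᵣ x ℝ.* expᵣ y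
  expᵣ-+ x y = real-injective (begin
    real (expᵣ (x ℝ.+ y))        ≈⟨ real-expᵣ _ ⟩
    exp (real (x ℝ.+ y))         ≈⟨ exp-cong (real-+ x y) ⟩
    exp (real x + real y)        ≈⟨ exp-+ _ _ ⟩
    exp (real x) * exp (real y)  ≈⟨ *-cong (real-expᵣ x) (real-expᵣ y) ⟨
    real (expᵣ x) * real (expᵣ y) ≈⟨ real-* _ _ ⟨
    real (expᵣ x ℝ.* expᵣ y)     ∎)

  expᵣ-0 : expᵣ ℝ.0# ℝ.≈ ℝ.1#
  expᵣ-0 = real-injective (≈-trans (real-expᵣ _) (≈-trans (exp-cong real-0) (≈-trans exp-0 (≈-sym real-1))))

  expᵣ-inverse : ∀ x → expᵣ x ℝ.* expᵣ (ℝ.- x) ℝ.≈ ℝ.1#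
  expᵣ-inverse x = ℝ.≈-trans (ℝ.≈-sym (expᵣ-+ x (ℝ.- x))) (ℝ.≈-trans (expᵣ-cong (ℝ.-‿inverseʳ x)) expᵣ-0)

  -- It is the square of expᵣ (x / 2), and a unit.
  expᵣ-pos : ∀ x → ℝ.0# ℝ.< expᵣ x
  expᵣ-pos x = ℝ.nonneg-unit⇒pos
    (ℝ.≤-resp ℝ.≈-refl (ℝ.≈-trans (ℝ.≈-sym (expᵣ-+ _ _)) (expᵣ-cong (ℝ.½+½ x))) (ℝ.square-nonneg (expᵣ (ℝ.½ ℝ.* x))))
    (expᵣ-inverse x)

  -- The conjugate of exp z is exp of the conjugate, and z + conj z is twice the real part.
  normSq-exp : ∀ z → normSq (exp z) ℝ.≈ expᵣ (re z ℝ.+ re z)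
  normSq-exp z = real-injective (begin
    real (normSq (exp z))          ≈⟨ z*conj (exp z) ⟨
    exp z * conj (exp z)           ≈⟨ *-congˡ (exp-conj z) ⟨
    exp z * exp (conj z)           ≈⟨ exp-+ _ _ ⟨
    exp (z + conj z)               ≈⟨ exp-cong (z+conj z) ⟩
    exp (real (re z ℝ.+ re z))     ≈⟨ real-expᵣ _ ⟨
    real (expᵣ (re z ℝ.+ re z))    ∎)

  private
    limit-≥ : ∀ {u : ℕ → ℝ.Carrier} {x c : ℝ.Carrier} N → (λ n → real (u n)) ⟶ real x → (∀ n → N ℕ.≤ n → c ℝ.≤ u n) → c ℝ.≤ x
    limit-≥ {u} {x} {c} N u⟶x c≤u x<c =
      let 0<c-x = ℝ.<⇒0<- x<c
          M , close = ⟶-to-squares u⟶x (c ℝ.- x) 0<c-x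
          n = N ℕ.⊔ M
          c-x≤u-x : c ℝ.- x ℝ.≤ u n ℝ.- x
          c-x≤u-x = ℝ.+-monoˡ-≤ (ℝ.- x) (c≤u n (ℕ.m≤m⊔n N M))
          n≈ : normSq (real (u n) - real x) ℝ.≈ (u n ℝ.- x) ℝ.* (u n ℝ.- x)
          n≈ = ℝ.≈-trans (normSq-cong (≈-trans (+-congˡ (≈-sym (real-neg x))) (≈-sym (real-+ _ _)))) (normSq-real _)
      in ℝ.*-mono-≤ (ℝ.<⇒≤ 0<c-x) (ℝ.≤-trans (ℝ.<⇒≤ 0<c-x) c-x≤u-x) c-x≤u-x c-x≤u-x
           (ℝ.<-respˡ-≈ n≈ (close n (ℕ.m≤n⊔m N M)))

    Eᵣ⟶ : ∀ x → (λ n → real (Eᵣ n x)) ⟶ real (expᵣ x)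
    Eᵣ⟶ x = ⟶-cong (λ n → E-real n x) (≈-sym (real-expᵣ x)) (exp-series (real x))

    Eᵣ≤expᵣ : ∀ {x} → ℝ.0# ℝ.≤ x → ∀ n → Eᵣ n x ℝ.≤ expᵣ x
    Eᵣ≤expᵣ {x} 0≤x n = limit-≥ {λ m → Eᵣ m x} n (Eᵣ⟶ x) (λ m n≤m → ℝ.Σ<-mono-length (ℝ!.term x) (ℝ!.0≤term 0≤x) n≤m)

    1/!1 : ℝ!.1/! 1 ℝ.≈ ℝ.1#
    1/!1 = ℝ.≈-trans (ℝ.solve 1 (λ x → x ℝ.:= (ℝ.:1 ℝ.:+ ℝ.:0) ℝ.:* x) ℝ.≈-refl (ℝ!.1/! 1)) (ℝ.≈-trans (ℝ!.k*1/! 0) ℝ!.1/!0)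

  -- The first two terms of a series of nonnegative terms.
  1+x≤expᵣ : ∀ {x} → ℝ.0# ℝ.≤ x → ℝ.1# ℝ.+ x ℝ.≤ expᵣ x
  1+x≤expᵣ {x} 0≤x = ℝ.≤-trans (ℝ.≤-reflexive (ℝ.≈-sym E₂)) (Eᵣ≤expᵣ 0≤x 2)
    where
    E₂ : Eᵣ 2 x ℝ.≈ ℝ.1# ℝ.+ x
    E₂ = ℝ.≈-trans (ℝ.+-cong (ℝ.*-congˡ ℝ!.1/!0) (ℝ.+-congʳ (ℝ.*-congˡ 1/!1)))
      (ℝ.solve 1 (λ x → ℝ.:1 ℝ.:* ℝ.:1 ℝ.:+ (x ℝ.:* ℝ.:1 ℝ.:* ℝ.:1 ℝ.:+ ℝ.:0) ℝ.:= ℝ.:1 ℝ.:+ x) ℝ.≈-refl x)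

  -- exp y = exp (y - x) exp x, and the first factor is at least 1 + (y - x).
  expᵣ-mono-< : ∀ {x y} → x ℝ.< y → expᵣ x ℝ.< expᵣ y
  expᵣ-mono-< {x} {y} x<y = ℝ.<-≤-trans
    (ℝ.<-resp (ℝ.*-identityˡ _) ℝ.≈-refl (ℝ.*-monoʳ-< (expᵣ x) (expᵣ-pos x)
      (ℝ.<-respˡ-≈ (ℝ.+-identityʳ ℝ.1#) (ℝ.+-monoʳ-< ℝ.1# (ℝ.<⇒0<- x<y)))))
    (ℝ.≤-trans (ℝ.*-monoʳ-≤ (expᵣ x) (ℝ.<⇒≤ (expᵣ-pos x)) (1+x≤expᵣ (ℝ.<⇒≤ (ℝ.<⇒0<- x<y))))
      (ℝ.≤-reflexive (ℝ.≈-trans (ℝ.≈-sym (expᵣ-+ (y ℝ.- x) x)) (expᵣ-cong (ℝ.solve 2 (λ x y → (y ℝ.:- x) ℝ.:+ x ℝ.:= y) ℝ.≈-refl x y)))))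

  -- `ln` is specified through `exp-ln` only; this is what turns equations between exponentials into
  -- equations between logarithms.
  expᵣ-injective : ∀ {x y} → expᵣ x ℝ.≈ expᵣ y → x ℝ.≈ y
  expᵣ-injective eq = ℝ.≤-antisym (λ y<x → ℝ.<-irrefl (ℝ.≈-sym eq) (expᵣ-mono-< y<x)) (λ x<y → ℝ.<-irrefl eq (expᵣ-mono-< x<y))

  expᵣ-^ : ∀ x n → expᵣ ((n ℝ.· ℝ.1#) ℝ.* x) ℝ.≈ expᵣ x ℝ.^ n
  expᵣ-^ x zero    = ℝ.≈-trans (expᵣ-cong (ℝ.zeroˡ x)) expᵣ-0
  expᵣ-^ x (suc n) = ℝ.≈-trans (expᵣ-cong (ℝ.solve 2 (λ n x → (ℝ.:1 ℝ.:+ n) ℝ.:* x ℝ.:= x ℝ.:+ n ℝ.:* x) ℝ.≈-refl (n ℝ.· ℝ.1#) x))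
    (ℝ.≈-trans (expᵣ-+ _ _) (ℝ.*-congˡ (expᵣ-^ x n)))

  -- exp h - 1 - h = h² Σ h^k / (k + 2)!, and for |h| ≤ 1 the partial sums of the cofactor are
  -- bounded by those of exp 1.
  exp-quadratic : ∀ {h} → normSq h ℝ.≤ ℝ.1# → normSq (exp h - 1# - h) ℝ.≤ expᵣ ℝ.1# ℝ.* expᵣ ℝ.1# ℝ.* (normSq h ℝ.* normSq h)
  exp-quadratic {h} nh≤1 = ℝ.≤-trans (normSq≤ (⟶-≼ 0 (λ n _ → bound n) remainder⟶))
      (ℝ.≤-reflexive (ℝ.solve 2 (λ n b → n ℝ.:* b ℝ.:* (n ℝ.:* b) ℝ.:= b ℝ.:* b ℝ.:* (n ℝ.:* n)) ℝ.≈-refl (normSq h) b))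
    where
    b = expᵣ ℝ.1#
    S : ℕ → Carrier
    S n = Σ< n (λ k → h ^ k * real (ℝ!.1/! (2 +ℕ k)))
    h≼1 : h ≼ ℝ.1#
    h≼1 = ℝ.0≤1 ∣≼∣ ℝ.≤-trans nh≤1 (ℝ.≤-reflexive (ℝ.≈-sym (ℝ.*-identityˡ ℝ.1#)))
    S≼b : ∀ n → S n ≼ b
    S≼b n = ≼-weaken
      (ℝ.≤-trans (ℝ.≤-resp ℝ.≈-refl (ℝ.≈-trans (ℝ.+-comm _ _) (ℝ.+-assoc _ _ _))
          (ℝ.x≤y+z ℝ.≤-refl (ℝ.+-nonneg (ℝ!.0≤term ℝ.0≤1 0) (ℝ!.0≤term ℝ.0≤1 1))))
        (Eᵣ≤expᵣ ℝ.0≤1 (2 +ℕ n)))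
      (≼-cong ≈-refl (ℝ.Σ<-cong n (λ k _ → ℝ.*-congʳ {ℝ!.1/! (2 +ℕ k)} (ℝ.≈-trans (ℝ.1^n≈1 k) (ℝ.≈-sym (ℝ.1^n≈1 (2 +ℕ k))))))
        (≼-sum {n} _ _ (λ i → ≼-* (≼-^ h≼1 (toℕ i)) (≼-real {ℝ!.1/! (2 +ℕ toℕ i)} (ℝ!.0≤1/! (2 +ℕ toℕ i))))))
    remainder : ∀ n → E (2 +ℕ n) h - 1# - h ≈ h * h * S n
    remainder n = begin
      1# * real (ℝ!.1/! 0) + (h * 1# * real (ℝ!.1/! 1) + T) - 1# - h
        ≈⟨ +-congʳ (+-congʳ (+-cong (*-congˡ (≈-trans (real-cong ℝ!.1/!0) real-1)) (+-congʳ (*-congˡ (≈-trans (real-cong 1/!1) real-1))))) ⟩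
      1# * 1# + (h * 1# * 1# + T) - 1# - h
        ≈⟨ solve 2 (λ h t → :1 :* :1 :+ (h :* :1 :* :1 :+ t) :- :1 :- h := t) ≈-refl h T ⟩
      T
        ≈⟨ Σ<-cong n (λ k _ → solve 3 (λ h p r → h :* (h :* p) :* r := h :* h :* (p :* r)) ≈-refl h (h ^ k) (real (ℝ!.1/! (2 +ℕ k)))) ⟩
      Σ< n (λ k → h * h * (h ^ k * real (ℝ!.1/! (2 +ℕ k))))
        ≈⟨ *-distribˡ-sum {n} (h * h) _ ⟨
      h * h * S n ∎
      where T = Σ< n (λ k → term h (2 +ℕ k))
    bound : ∀ n → E (2 +ℕ n) h - 1# - h ≼ normSq h ℝ.* b
    bound n = ℝ.*-nonneg (normSq-nonneg h) (nonneg (S≼b n)) ∣≼∣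
      ℝ.≤-resp (ℝ.≈-sym (ℝ.≈-trans (normSq-cong (remainder n)) (ℝ.≈-trans (normSq-* _ _) (ℝ.*-congʳ (normSq-* h h)))))
               (ℝ.solve 2 (λ n b → n ℝ.:* n ℝ.:* (b ℝ.:* b) ℝ.:= n ℝ.:* b ℝ.:* (n ℝ.:* b)) ℝ.≈-refl (normSq h) b)
               (ℝ.*-monoˡ-≤ _ (ℝ.*-nonneg (normSq-nonneg h) (normSq-nonneg h)) (normSq≤ (S≼b n)))
    remainder⟶ : (λ n → E (2 +ℕ n) h - 1# - h) ⟶ exp h - 1# - h
    remainder⟶ = ⟶-+ (⟶-+ (⟶-reindex (2 +ℕ_) (λ n → ℕ.m≤n+m n 2) (exp-series h)) (⟶-const (- 1#))) (⟶-const (- h))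

-- Series

module Series {R : RealNumbers} (C : ComplexField R) where
  open ComplexAnalysis C
  open Relation.Binary.Reasoning.Setoid setoid

  Sums : (ℕ → Carrier) → Carrier → Set
  Sums t z = (λ n → Σ< n t) ⟶ z

  Sums-cong : ∀ {t t′ z w} → (∀ k → t k ≈ t′ k) → z ≈ w → Sums t z → Sums t′ w
  Sums-cong t≈t′ = ⟶-cong (λ n → Σ<-cong n (λ k _ → t≈t′ k))

  Sums-+ : ∀ {t t′ z w} → Sums t z → Sums t′ w → Sums (λ k → t k + t′ k) (z + w)
  Sums-+ {t} {t′} p q = ⟶-cong (λ n → ≈-sym (∑-distrib-+ {n} (t ∘ toℕ) (t′ ∘ toℕ))) ≈-refl (⟶-+ p q)

  Sums-scale : ∀ {t z} c → Sums t z → Sums (λ k → c * t k) (c * z)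
  Sums-scale {t} c p = ⟶-cong (λ n → *-distribˡ-sum {n} c (t ∘ toℕ)) ≈-refl (⟶-scale c p)

  -- On generating functions, multiplication by the m-th power of the variable.
  shift : ℕ → (ℕ → Carrier) → ℕ → Carrier
  shift zero    t d       = t d
  shift (suc m) t zero    = 0#
  shift (suc m) t (suc d) = shift m t d

  shift-+ : ∀ m t d → shift m t (m +ℕ d) ≡ t d
  shift-+ zero    t d = ≡.refl
  shift-+ (suc m) t d = shift-+ m t d

  shift-< : ∀ {m d} t → d ℕ.< m → shift m t d ≡ 0#
  shift-< {suc m} {zero}  t _           = ≡.refl
  shift-< {suc m} {suc d} t (ℕ.s≤s d<m) = shift-< t d<m

  Sums-shift : ∀ {t z} m → Sums t z → Sums (shift m t) z
  Sums-shift zero    p = p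
  Sums-shift (suc m) p = ⟶-predecessor (⟶-cong (λ n → ≈-sym (+-identityˡ _)) ≈-refl (Sums-shift m p))

  Sums-finite : ∀ {t} D → (∀ d → D ℕ.≤ d → t d ≈ 0#) → Sums t (Σ< D t)
  Sums-finite {t} D t≈0 = ⟶-eventually D stable ≈-refl (⟶-const (Σ< D t))
    where
    stable : ∀ n → D ℕ.≤ n → Σ< D t ≈ Σ< n t
    stable n D≤n = begin
      Σ< D t                                     ≈⟨ +-identityʳ _ ⟨
      Σ< D t + 0#                                ≈⟨ +-congˡ (sum-zero {n ℕ.∸ D} _ (λ i → t≈0 (D +ℕ toℕ i) (ℕ.m≤m+n D (toℕ i)))) ⟨
      Σ< D t + Σ< (n ℕ.∸ D) (λ k → t (D +ℕ k))    ≈⟨ Σ<-+ D (n ℕ.∸ D) t ⟨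
      Σ< (D +ℕ (n ℕ.∸ D)) t                      ≡⟨ cong (λ k → Σ< k t) (ℕ.m+[n∸m]≡n D≤n) ⟩
      Σ< n t                                     ∎

  geometric-sum : ∀ z n → (1# - z) * Σ< n (z ^_) ≈ 1# - z ^ n
  geometric-sum z zero    = solve 1 (λ z → (:1 :- z) :* :0 := :1 :- :1) ≈-refl z
  geometric-sum z (suc n) = begin
    (1# - z) * (1# + Σ< n (λ k → z * z ^ k))  ≈⟨ *-congˡ (+-congˡ (*-distribˡ-sum {n} z _)) ⟨
    (1# - z) * (1# + z * Σ< n (z ^_))         ≈⟨ solve 2 (λ z s → (:1 :- z) :* (:1 :+ z :* s) := (:1 :- z) :+ z :* ((:1 :- z) :* s)) ≈-refl z (Σ< n (z ^_)) ⟩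
    (1# - z) + z * ((1# - z) * Σ< n (z ^_))   ≈⟨ +-congˡ (*-congˡ (geometric-sum z n)) ⟩
    (1# - z) + z * (1# - z ^ n)               ≈⟨ solve 2 (λ z p → (:1 :- z) :+ z :* (:1 :- p) := :1 :- z :* p) ≈-refl z (z ^ n) ⟩
    1# - z * z ^ n                            ∎

  -- r < 1 is expressed by a reciprocal y > 1, to whose powers Bernoulli's inequality applies.
  module _ {r y : ℝ.Carrier} (0<r : ℝ.0# ℝ.< r) (1<y : ℝ.1# ℝ.< y) (ry≈1 : r ℝ.* y ℝ.≈ ℝ.1#) where
    private
      0≤r = ℝ.<⇒≤ 0<r
      r<1 : r ℝ.< ℝ.1#
      r<1 = ℝ.<-resp (ℝ.*-identityˡ r) (ℝ.≈-trans (ℝ.*-comm y r) ry≈1) (ℝ.*-monoʳ-< r 0<r 1<y)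
      inv : ∃[ g ] (ℝ.0# ℝ.< g × (ℝ.1# ℝ.- r) ℝ.* g ℝ.≈ ℝ.1#)
      inv = ℝ.inverse⁺ (ℝ.<⇒0<- r<1)
      G : ℝ.Carrier
      G = proj₁ inv
      0<G = proj₁ (proj₂ inv)

    ≼-geometric⇒⟶0 : ∀ {u : ℕ → Carrier} {B} → ℝ.0# ℝ.< B → (∀ n → u n ≼ r ℝ.^ n ℝ.* B) → u ⟶ 0#
    ≼-geometric⇒⟶0 {u} {B} 0<B u≼ = ⟶-from-squares λ ε 0<ε →
      let b , 0<b , Bb≈1 = ℝ.inverse⁺ 0<B
          N , small = ℝ.^→0 0<r 1<y ry≈1 (ℝ.*-pos 0<ε 0<b)
          bound : ∀ n → N ℕ.≤ n → r ℝ.^ n ℝ.* B ℝ.< ε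
          bound n N≤n = ℝ.<-respʳ-≈ (ℝ.≈-trans (ℝ.solve 3 (λ e b B → e ℝ.:* b ℝ.:* B ℝ.:= e ℝ.:* (B ℝ.:* b)) ℝ.≈-refl ε b B) (ℝ.≈-trans (ℝ.*-congˡ Bb≈1) (ℝ.*-identityʳ ε)))
            (ℝ.*-monoʳ-< B 0<B (small n N≤n))
          square-< : ∀ {x} → ℝ.0# ℝ.≤ x → x ℝ.< ε → x ℝ.* x ℝ.< ε ℝ.* ε
          square-< 0≤x x<ε = ℝ.≤-<-trans (ℝ.*-monoˡ-≤ _ 0≤x (ℝ.<⇒≤ x<ε)) (ℝ.*-monoʳ-< ε 0<ε x<ε)
      in N , λ n N≤n → ℝ.≤-<-trans
           (ℝ.≤-trans (ℝ.≤-reflexive (normSq-cong (solve 1 (λ u → u :- :0 := u) ≈-refl (u n)))) (normSq≤ (u≼ n)))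
           (square-< (nonneg (u≼ n)) (bound n N≤n))

    private
      -- G = 1 / (1 - r) solves 1 + r G = G.
      geometric≤G : ∀ k → ℝ.Σ< k (r ℝ.^_) ℝ.≤ G
      geometric≤G zero    = ℝ.<⇒≤ 0<G
      geometric≤G (suc k) = ℝ.≤-trans
        (ℝ.+-mono-≤ ℝ.≤-refl (ℝ.≤-trans (ℝ.≤-reflexive (ℝ.≈-sym (ℝΣ-scale k))) (ℝ.*-monoˡ-≤ r 0≤r (geometric≤G k))))
        (ℝ.≤-reflexive (ℝ.≈-trans (ℝ.+-congʳ (ℝ.≈-sym (proj₂ (proj₂ inv)))) (ℝ.solve 2 (λ r g → (ℝ.:1 ℝ.:- r) ℝ.:* g ℝ.:+ r ℝ.:* g ℝ.:= g) ℝ.≈-refl r G)))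
        where
        ℝΣ-scale : ∀ k → r ℝ.* ℝ.Σ< k (r ℝ.^_) ℝ.≈ ℝ.Σ< k (λ j → r ℝ.* r ℝ.^ j)
        ℝΣ-scale k = Algebra.Properties.Semiring.Sum.*-distribˡ-sum ℝ.semiring {k} r _

    -- A series 1 + 0 + ⋯ + 0 + t (n + 1) + ⋯ dominated by a geometric one.
    gap-series : ∀ {V : ℕ → Carrier} (t : ℕ → ℕ → Carrier) → (∀ n → Sums (t n) (V n)) → (∀ n → t n 0 ≈ 1#) →
      (∀ n d → 1 ℕ.≤ d → d ℕ.≤ n → t n d ≈ 0#) → (∀ n d → t n d ≼ r ℝ.^ d) → V ⟶ 1#
    gap-series {V} t V-sum t0≈1 t≈0 t≼ = ⟶-cong (λ n → solve 1 (λ v → v :- :1 :+ :1 := v) ≈-refl (V n)) (+-identityˡ 1#)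
      (⟶-+ (≼-geometric⇒⟶0 (ℝ.*-pos 0<r 0<G) V-1≼) (⟶-const 1#))
      where
      partial : ∀ n k → Σ< (suc n +ℕ k) (t n) - 1# ≈ Σ< k (λ j → t n (suc n +ℕ j))
      partial n k = begin
        Σ< (suc n +ℕ k) (t n) - 1#
          ≈⟨ +-congʳ (Σ<-+ (suc n) k (t n)) ⟩
        t n 0 + Σ< n (t n ∘ suc) + T - 1#
          ≈⟨ +-congʳ (+-congʳ (+-cong (t0≈1 n) (sum-zero {n} _ (λ i → t≈0 n (suc (toℕ i)) (ℕ.s≤s ℕ.z≤n) (Fin.toℕ<n i))))) ⟩
        1# + 0# + T - 1#
          ≈⟨ solve 1 (λ x → :1 :+ :0 :+ x :- :1 := x) ≈-refl T ⟩
        T ∎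
        where T = Σ< k (λ j → t n (suc n +ℕ j))
      tail≤ : ∀ n k → ℝ.Σ< k (λ j → r ℝ.^ (suc n +ℕ j)) ℝ.≤ r ℝ.^ n ℝ.* (r ℝ.* G)
      tail≤ n k = ℝ.≤-resp
        (ℝ.≈-trans (Algebra.Properties.Semiring.Sum.*-distribˡ-sum ℝ.semiring {k} (r ℝ.^ suc n) _) (ℝ.Σ<-cong k (λ j _ → ℝ.≈-sym (ℝ.^-homo-* r (suc n) j))))
        (ℝ.solve 3 (λ r p g → r ℝ.:* p ℝ.:* g ℝ.:= p ℝ.:* (r ℝ.:* g)) ℝ.≈-refl r (r ℝ.^ n) G)
        (ℝ.*-monoˡ-≤ (r ℝ.^ suc n) (ℝ.^-nonneg 0≤r (suc n)) (geometric≤G k))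
      V-1≼ : ∀ n → V n - 1# ≼ r ℝ.^ n ℝ.* (r ℝ.* G)
      V-1≼ n = ⟶-≼ 0 (λ k _ → ≼-weaken (tail≤ n k) (≼-cong (≈-sym (partial n k)) ℝ.≈-refl (≼-sum {k} _ _ (λ i → t≼ n (suc n +ℕ toℕ i)))))
        (⟶-+ (⟶-reindex (suc n +ℕ_) (λ k → ℕ.m≤n+m k (suc n)) (V-sum n)) (⟶-const (- 1#)))

    geometric-series : ∀ {z w} → z ≼ r → (1# - z) * w ≈ 1# → Sums (z ^_) w
    geometric-series {z} {w} z≼r 1-z-unit = ⟶-cong partial (solve 1 (λ w → w :- w :* :0 := w) ≈-refl w)
      (⟶-+ (⟶-const w) (⟶-neg (⟶-scale w (≼-geometric⇒⟶0 ℝ.0<1 λ n → ≼-cong ≈-refl (ℝ.≈-sym (ℝ.*-identityʳ _)) (≼-^ z≼r n)))))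
      where
      partial : ∀ n → w - w * z ^ n ≈ Σ< n (z ^_)
      partial n = begin
        w - w * z ^ n                 ≈⟨ solve 2 (λ w p → w :- w :* p := w :* (:1 :- p)) ≈-refl w (z ^ n) ⟩
        w * (1# - z ^ n)              ≈⟨ *-congˡ (geometric-sum z n) ⟨
        w * ((1# - z) * Σ< n (z ^_))  ≈⟨ solve 3 (λ w z s → w :* ((:1 :- z) :* s) := ((:1 :- z) :* w) :* s) ≈-refl w z (Σ< n (z ^_)) ⟩
        ((1# - z) * w) * Σ< n (z ^_)  ≈⟨ *-congʳ 1-z-unit ⟩
        1# * Σ< n (z ^_)              ≈⟨ *-identityˡ _ ⟩
        Σ< n (z ^_)                   ∎

  private
    -- 2 x t ≤ x / 2 moves to the left, leaving x / 2 ≤ 2 L.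
    absorb : ∀ {x L t} → ℝ.0# ℝ.≤ x → x ℝ.≤ (ℝ.1# ℝ.+ ℝ.1#) ℝ.* (L ℝ.+ x ℝ.* t) → t ℝ.≤ ℝ.½ ℝ.* ℝ.½ → x ℝ.≤ (ℝ.1# ℝ.+ ℝ.1#) ℝ.* (ℝ.1# ℝ.+ ℝ.1#) ℝ.* L
    absorb {x} {L} {t} 0≤x x≤ t≤¼ = ℝ.0≤-⇒≤ (ℝ.≤-resp ℝ.≈-refl eq (ℝ.+-nonneg (ℝ.≤⇒0≤- x≤′) (ℝ.≤⇒0≤- x≤′)))
      where
      2* : ℝ.Carrier
      2* = ℝ.1# ℝ.+ ℝ.1#
      x≤′ : x ℝ.≤ 2* ℝ.* L ℝ.+ ℝ.½ ℝ.* x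
      x≤′ = ℝ.≤-trans x≤ (ℝ.≤-trans (ℝ.*-monoˡ-≤ 2* (ℝ.+-nonneg ℝ.0≤1 ℝ.0≤1) (ℝ.+-mono-≤ ℝ.≤-refl (ℝ.*-monoˡ-≤ x 0≤x t≤¼)))
        (ℝ.≤-reflexive (ℝ.≈-trans (ℝ.solve 3 (λ L x h → (ℝ.:1 ℝ.:+ ℝ.:1) ℝ.:* (L ℝ.:+ x ℝ.:* (h ℝ.:* h)) ℝ.:= (ℝ.:1 ℝ.:+ ℝ.:1) ℝ.:* L ℝ.:+ ((ℝ.:1 ℝ.:+ ℝ.:1) ℝ.:* h) ℝ.:* (h ℝ.:* x)) ℝ.≈-refl L x ℝ.½)
          (ℝ.+-congˡ (ℝ.≈-trans (ℝ.*-congʳ ℝ.2*½≈1) (ℝ.*-identityˡ _))))))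
      eq : (2* ℝ.* L ℝ.+ ℝ.½ ℝ.* x ℝ.- x) ℝ.+ (2* ℝ.* L ℝ.+ ℝ.½ ℝ.* x ℝ.- x) ℝ.≈ 2* ℝ.* 2* ℝ.* L ℝ.- x
      eq = ℝ.≈-trans (ℝ.solve 3 (λ L x y → (ℝ.:1 ℝ.:+ ℝ.:1) ℝ.:* L ℝ.:+ y ℝ.:- x ℝ.:+ ((ℝ.:1 ℝ.:+ ℝ.:1) ℝ.:* L ℝ.:+ y ℝ.:- x) ℝ.:= (ℝ.:1 ℝ.:+ ℝ.:1) ℝ.:* (ℝ.:1 ℝ.:+ ℝ.:1) ℝ.:* L ℝ.:+ (y ℝ.:+ y) ℝ.:- x ℝ.:- x) ℝ.≈-refl L x (ℝ.½ ℝ.* x))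
        (ℝ.≈-trans (ℝ.+-congʳ (ℝ.+-congʳ (ℝ.+-congˡ (ℝ.½+½ x))))
          (ℝ.solve 2 (λ L x → L ℝ.:+ x ℝ.:- x ℝ.:- x ℝ.:= L ℝ.:- x) ℝ.≈-refl (2* ℝ.* 2* ℝ.* L) x))

  -- p = l - p (v - 1), so |p|² ≤ 2 (|l|² + |p|² / 4), and the last term is absorbed.
  quotient-bound : ∀ {p v l} → p * v ≈ l → normSq (v - 1#) ℝ.≤ ℝ.½ ℝ.* ℝ.½ →
    normSq p ℝ.≤ (ℝ.1# ℝ.+ ℝ.1#) ℝ.* (ℝ.1# ℝ.+ ℝ.1#) ℝ.* normSq l
  quotient-bound {p} {v} {l} pv≈l small = absorb (normSq-nonneg p)
    (ℝ.≤-resp (normSq-cong p≈) (ℝ.*-congˡ (ℝ.+-congˡ (ℝ.≈-trans (normSq-neg _) (normSq-* p (v - 1#))))) (normSq-+≤ l (- (p * (v - 1#)))))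
    small
    where
    p≈ : l + - (p * (v - 1#)) ≈ p
    p≈ = ≈-trans (+-congʳ (≈-sym pv≈l)) (solve 2 (λ p v → p :* v :- p :* (v :- :1) := p) ≈-refl p v)

  -- P - L = - P (V - 1), where `quotient-bound` controls P as soon as V is close to 1. For Euler
  -- products, P is the product of the inverted factors and V is L times the product of the factors.
  quotient-limit : ∀ {P V : ℕ → Carrier} {L} → (∀ n → P n * V n ≈ L) → V ⟶ 1# → P ⟶ L
  quotient-limit {P} {V} {L} PV≈L (limit h) = limit λ ε 0<ε →
    let a , 0<a , _ , aK≤ε = ℝ.small 0<ε (ℝ.+-nonneg 0≤4L ℝ.0≤1)
        b , 0<b , b≤a , b≤¼ = ℝ.min⁺ 0<a (ℝ.*-pos ℝ.0<½ ℝ.0<½)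
        N , close = h b 0<b
    in N , λ n N≤n → ℝ.<-≤-trans (ℝ.≤-<-trans
         (ℝ.≤-resp (ℝ.≈-sym (ℝ.≈-trans (normSq-cong (P-L n)) (ℝ.≈-trans (normSq-neg _) (ℝ.≈-trans (normSq-* (P n) (V n - 1#)) (ℝ.*-comm _ _))))) ℝ.≈-refl
           (ℝ.*-monoˡ-≤ _ (normSq-nonneg (V n - 1#)) (ℝ.x≤y+z (quotient-bound (PV≈L n) (ℝ.≤-trans (ℝ.<⇒≤ (close n N≤n)) b≤¼)) ℝ.0≤1)))
         (ℝ.*-monoʳ-< K (ℝ.+-nonneg-pos 0≤4L ℝ.0<1) (ℝ.<-≤-trans (close n N≤n) b≤a))) aK≤ε
    where
    4L = (ℝ.1# ℝ.+ ℝ.1#) ℝ.* (ℝ.1# ℝ.+ ℝ.1#) ℝ.* normSq L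
    0≤4L : ℝ.0# ℝ.≤ 4L
    0≤4L = ℝ.*-nonneg (ℝ.*-nonneg 0≤2 0≤2) (normSq-nonneg L)
      where 0≤2 = ℝ.+-nonneg ℝ.0≤1 ℝ.0≤1
    K = 4L ℝ.+ ℝ.1#
    P-L : ∀ n → P n - L ≈ - (P n * (V n - 1#))
    P-L n = ≈-trans (+-congˡ (-‿cong (≈-sym (PV≈L n)))) (solve 2 (λ p v → p :- p :* v := :- (p :* (v :- :1))) ≈-refl (P n) (V n))

-- Derivatives

module Differentiation {R : RealNumbers} (C : ComplexField R) where
  open ComplexAnalysis C
  open Series C using (quotient-bound)
  open Relation.Binary.Reasoning.Setoid setoid
  private
    2* : ℝ.Carrier
    2* = ℝ.1# ℝ.+ ℝ.1#

    0≤2 : ℝ.0# ℝ.≤ 2*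
    0≤2 = ℝ.+-nonneg ℝ.0≤1 ℝ.0≤1

    *-swap-≤ : ∀ {x y M n} → ℝ.0# ℝ.≤ x → y ℝ.≤ M ℝ.* n → x ℝ.* y ℝ.≤ x ℝ.* M ℝ.* n
    *-swap-≤ {x} 0≤x y≤ = ℝ.≤-trans (ℝ.*-monoˡ-≤ x 0≤x y≤) (ℝ.≤-reflexive (ℝ.≈-sym (ℝ.*-assoc _ _ _)))

  -- |f s - f s₀ - f′ (s - s₀)|² ≤ bound |s - s₀|⁴ for |s - s₀|² < radius.
  record Derivative (f : Carrier → Carrier) (s₀ f′ : Carrier) : Set where
    field
      radius bound : ℝ.Carrier
      0<radius     : ℝ.0# ℝ.< radius
      0≤bound      : ℝ.0# ℝ.≤ bound
      remainder≤   : ∀ s → normSq (s - s₀) ℝ.< radius →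
        normSq (f s - f s₀ - f′ * (s - s₀)) ℝ.≤ bound ℝ.* (normSq (s - s₀) ℝ.* normSq (s - s₀))

  open Derivative

  derivative-const : ∀ c s₀ → Derivative (λ _ → c) s₀ 0#
  derivative-const c s₀ = record
    { radius = ℝ.1# ; bound = ℝ.0# ; 0<radius = ℝ.0<1 ; 0≤bound = ℝ.≤-refl
    ; remainder≤ = λ s _ → ℝ.≤-reflexive (ℝ.≈-trans
        (normSq-cong (solve 2 (λ c h → c :- c :- :0 :* h := :0) ≈-refl c (s - s₀))) (ℝ.≈-trans normSq-0 (ℝ.≈-sym (ℝ.zeroˡ _))))
    }

  derivative-+ : ∀ {f g s₀ f′ g′} → Derivative f s₀ f′ → Derivative g s₀ g′ → Derivative (λ s → f s + g s) s₀ (f′ + g′)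
  derivative-+ {f} {g} {s₀} {f′} {g′} df dg = record
    { radius = proj₁ κ ; bound = 2* ℝ.* (bound df ℝ.+ bound dg) ; 0<radius = proj₁ (proj₂ κ)
    ; 0≤bound = ℝ.*-nonneg 0≤2 (ℝ.+-nonneg (0≤bound df) (0≤bound dg))
    ; remainder≤ = rem
    }
    where
    κ : ∃[ a ] (ℝ.0# ℝ.< a × a ℝ.≤ radius df × a ℝ.≤ radius dg)
    κ = ℝ.min⁺ (0<radius df) (0<radius dg)
    rem : ∀ s → normSq (s - s₀) ℝ.< proj₁ κ → normSq (f s + g s - (f s₀ + g s₀) - (f′ + g′) * (s - s₀)) ℝ.≤
      2* ℝ.* (bound df ℝ.+ bound dg) ℝ.* (normSq (s - s₀) ℝ.* normSq (s - s₀))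
    rem s close = ℝ.≤-resp (normSq-cong (solve 7 (λ a b c d x y h → (a :- b :- x :* h) :+ (c :- d :- y :* h) := a :+ c :- (b :+ d) :- (x :+ y) :* h) ≈-refl (f s) (f s₀) (g s) (g s₀) f′ g′ (s - s₀)))
      (ℝ.solve 4 (λ t a b n → t ℝ.:* (a ℝ.:* n ℝ.:+ b ℝ.:* n) ℝ.:= t ℝ.:* (a ℝ.:+ b) ℝ.:* n) ℝ.≈-refl 2* (bound df) (bound dg) (normSq (s - s₀) ℝ.* normSq (s - s₀)))
      (ℝ.≤-trans (normSq-+≤ _ _) (ℝ.*-monoˡ-≤ 2* 0≤2 (ℝ.+-mono-≤
        (remainder≤ df s (ℝ.<-≤-trans close (proj₁ (proj₂ (proj₂ κ)))))
        (remainder≤ dg s (ℝ.<-≤-trans close (proj₂ (proj₂ (proj₂ κ))))))))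

  derivative-scale : ∀ {f s₀ f′} c → Derivative f s₀ f′ → Derivative (λ s → c * f s) s₀ (c * f′)
  derivative-scale {f} {s₀} {f′} c df = record
    { radius = radius df ; bound = normSq c ℝ.* bound df ; 0<radius = 0<radius df
    ; 0≤bound = ℝ.*-nonneg (normSq-nonneg c) (0≤bound df)
    ; remainder≤ = λ s close → ℝ.≤-trans
        (ℝ.≤-reflexive (ℝ.≈-trans (normSq-cong (solve 5 (λ c a b x h → c :* a :- c :* b :- c :* x :* h := c :* (a :- b :- x :* h)) ≈-refl c (f s) (f s₀) f′ (s - s₀))) (normSq-* c _)))
        (*-swap-≤ (normSq-nonneg c) (remainder≤ df s close))
    }

  derivative-Σ< : ∀ n {f : ℕ → Carrier → Carrier} {s₀} {f′ : ℕ → Carrier} → (∀ k → Derivative (f k) s₀ (f′ k)) →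
    Derivative (λ s → Σ< n (λ k → f k s)) s₀ (Σ< n f′)
  derivative-Σ< zero    {s₀ = s₀} df = derivative-const 0# s₀
  derivative-Σ< (suc n) df = derivative-+ (df 0) (derivative-Σ< n (df ∘ suc))

  differentiable⇒continuous : ∀ {f s₀ f′} (df : Derivative f s₀ f′) s → normSq (s - s₀) ℝ.< radius df → normSq (s - s₀) ℝ.≤ ℝ.1# →
    normSq (f s - f s₀) ℝ.≤ 2* ℝ.* (bound df ℝ.+ normSq f′) ℝ.* normSq (s - s₀)
  differentiable⇒continuous {f} {s₀} {f′} df s close n≤1 = ℝ.≤-resp
    (normSq-cong (solve 3 (λ a b y → (a :- b :- y) :+ y := a :- b) ≈-refl (f s) (f s₀) (f′ * (s - s₀))))
    (ℝ.solve 4 (λ t a b n → t ℝ.:* (a ℝ.:* n ℝ.:+ b ℝ.:* n) ℝ.:= t ℝ.:* (a ℝ.:+ b) ℝ.:* n) ℝ.≈-refl 2* (bound df) (normSq f′) n)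
    (ℝ.≤-trans (normSq-+≤ _ _) (ℝ.*-monoˡ-≤ 2* 0≤2 (ℝ.+-mono-≤
      (ℝ.≤-trans (remainder≤ df s close) (ℝ.*-monoˡ-≤ (bound df) (0≤bound df) (ℝ.≤-trans (ℝ.*-monoˡ-≤ n (normSq-nonneg _) n≤1) (ℝ.≤-reflexive (ℝ.*-identityʳ n)))))
      (ℝ.≤-reflexive (normSq-* f′ _)))))
    where n = normSq (s - s₀)

  private
    -- With n = |h|², a remainder M n² is at most ε² n once M n ≤ ε².
    bound-to-ε : ∀ {κ M} → ℝ.0# ℝ.< κ → ℝ.0# ℝ.≤ M → ∀ ε → ℝ.0# ℝ.< ε →
      ∃[ δ ] (ℝ.0# ℝ.< δ × (∀ n → ℝ.0# ℝ.≤ n → n ℝ.< δ ℝ.* δ → n ℝ.< κ × M ℝ.* (n ℝ.* n) ℝ.≤ ε ℝ.* ε ℝ.* n))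
    bound-to-ε {κ} {M} 0<κ 0≤M ε 0<ε =
      let a , 0<a , _ , aM≤εε = ℝ.small (ℝ.*-pos 0<ε 0<ε) 0≤M
          b , 0<b , b≤a , b≤κ = ℝ.min⁺ 0<a 0<κ
          δ , 0<δ , δδ≤b = ℝ.sqrt-below 0<b
      in δ , 0<δ , λ n 0≤n n<δδ →
           let n<b = ℝ.<-≤-trans n<δδ δδ≤b in
           ℝ.<-≤-trans n<b b≤κ ,
           ℝ.≤-resp (ℝ.solve 2 (λ M n → n ℝ.:* M ℝ.:* n ℝ.:= M ℝ.:* (n ℝ.:* n)) ℝ.≈-refl M n) ℝ.≈-refl
             (ℝ.*-monoʳ-≤ n 0≤n (ℝ.≤-trans (ℝ.*-monoʳ-≤ M 0≤M (ℝ.≤-trans (ℝ.<⇒≤ n<b) b≤a)) aM≤εε))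

  derivative-ε-δ : ∀ {f s₀ f′} → Derivative f s₀ f′ → ∀ ε → ℝ.0# ℝ.< ε → ∃[ δ ] (ℝ.0# ℝ.< δ ×
    (∀ s → normSq (s - s₀) ℝ.< δ ℝ.* δ → normSq (f s - f s₀ - f′ * (s - s₀)) ℝ.≤ ε ℝ.* ε ℝ.* normSq (s - s₀)))
  derivative-ε-δ df ε 0<ε = let δ , 0<δ , small = bound-to-ε (0<radius df) (0≤bound df) ε 0<ε in
    δ , 0<δ , λ s close → let n<κ , M≤ = small _ (normSq-nonneg _) close in ℝ.≤-trans (remainder≤ df s n<κ) M≤

  module _ {N D : Carrier → Carrier} {s₀ N′ D′ w₀} (dN : Derivative N s₀ N′) (dD : Derivative D s₀ D′) (w₀D≈1 : w₀ * D s₀ ≈ 1#) where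
    private
      L : Carrier
      L = N s₀ * w₀
      f′ : Carrier
      f′ = (N′ - L * D′) * w₀
      G : Carrier → Carrier
      G s = N s + - L * D s
      dG : Derivative G s₀ (N′ + - L * D′)
      dG = derivative-+ dN (derivative-scale (- L) dD)
      G′ = N′ + - L * D′
      K 4w₀ : ℝ.Carrier
      K = 2* ℝ.* (bound dD ℝ.+ normSq D′)
      0≤K : ℝ.0# ℝ.≤ K
      0≤K = ℝ.*-nonneg 0≤2 (ℝ.+-nonneg (0≤bound dD) (normSq-nonneg D′))
      4w₀ = 2* ℝ.* 2* ℝ.* normSq w₀
      0≤4w₀ : ℝ.0# ℝ.≤ 4w₀
      0≤4w₀ = ℝ.*-nonneg (ℝ.*-nonneg 0≤2 0≤2) (normSq-nonneg w₀)

      -- 1/4 is the threshold of `quotient-bound` for v = D s * w₀; it gives |w|² ≤ 4 |w₀|²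
      -- uniformly near s₀.
      a⁺ : ∃[ a ] (ℝ.0# ℝ.< a × a ℝ.≤ ℝ.1# × a ℝ.* (K ℝ.* normSq w₀) ℝ.≤ ℝ.½ ℝ.* ℝ.½)
      a⁺ = ℝ.small (ℝ.*-pos ℝ.0<½ ℝ.0<½) (ℝ.*-nonneg 0≤K (normSq-nonneg w₀))
      a = proj₁ a⁺
      b⁺ : ∃[ b ] (ℝ.0# ℝ.< b × b ℝ.≤ radius dD × b ℝ.≤ radius dG)
      b⁺ = ℝ.min⁺ (0<radius dD) (0<radius dG)
      b = proj₁ b⁺
      κ⁺ : ∃[ κ ] (ℝ.0# ℝ.< κ × κ ℝ.≤ a × κ ℝ.≤ b)
      κ⁺ = ℝ.min⁺ (proj₁ (proj₂ a⁺)) (proj₁ (proj₂ b⁺))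
      κ = proj₁ κ⁺
      M₁ M₂ M : ℝ.Carrier
      M₁ = 4w₀ ℝ.* bound dG
      M₂ = 4w₀ ℝ.* (normSq w₀ ℝ.* normSq G′ ℝ.* K)
      M = 2* ℝ.* (M₁ ℝ.+ M₂)
      0≤M : ℝ.0# ℝ.≤ M
      0≤M = ℝ.*-nonneg 0≤2 (ℝ.+-nonneg (ℝ.*-nonneg 0≤4w₀ (0≤bound dG))
        (ℝ.*-nonneg 0≤4w₀ (ℝ.*-nonneg (ℝ.*-nonneg (normSq-nonneg w₀) (normSq-nonneg G′)) 0≤K)))

      module _ (s w : Carrier) (wD≈1 : w * D s ≈ 1#) (close : normSq (s - s₀) ℝ.< κ) where
        h = s - s₀
        n = normSq h
        0≤n : ℝ.0# ℝ.≤ n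
        0≤n = normSq-nonneg h
        n<a : n ℝ.< a
        n<a = ℝ.<-≤-trans close (proj₁ (proj₂ (proj₂ κ⁺)))
        n<b : n ℝ.< b
        n<b = ℝ.<-≤-trans close (proj₂ (proj₂ (proj₂ κ⁺)))
        D-D₀≤ : normSq (D s - D s₀) ℝ.≤ K ℝ.* n
        D-D₀≤ = differentiable⇒continuous dD s (ℝ.<-≤-trans n<b (proj₁ (proj₂ (proj₂ b⁺)))) (ℝ.≤-trans (ℝ.<⇒≤ n<a) (proj₁ (proj₂ (proj₂ a⁺))))
        w≤ : normSq w ℝ.≤ 4w₀
        w≤ = quotient-bound {w} {D s * w₀} {w₀}
          (≈-trans (≈-sym (*-assoc w (D s) w₀)) (≈-trans (*-congʳ wD≈1) (*-identityˡ w₀)))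
          (ℝ.≤-trans (ℝ.≤-reflexive (ℝ.≈-trans (normSq-cong Dw₀-1) (normSq-* (D s - D s₀) w₀)))
            (ℝ.≤-trans (ℝ.*-monoʳ-≤ (normSq w₀) (normSq-nonneg w₀) D-D₀≤)
              (ℝ.≤-trans (ℝ.≤-resp (ℝ.solve 3 (λ n k w → n ℝ.:* (k ℝ.:* w) ℝ.:= k ℝ.:* n ℝ.:* w) ℝ.≈-refl n K (normSq w₀)) ℝ.≈-refl
                (ℝ.*-monoʳ-≤ (K ℝ.* normSq w₀) (ℝ.*-nonneg 0≤K (normSq-nonneg w₀)) (ℝ.<⇒≤ n<a))) (proj₂ (proj₂ (proj₂ a⁺))))))
          where
          Dw₀-1 : D s * w₀ - 1# ≈ (D s - D s₀) * w₀
          Dw₀-1 = ≈-trans (+-congˡ (-‿cong (≈-sym w₀D≈1))) (solve 3 (λ d d₀ w → d :* w :- w :* d₀ := (d :- d₀) :* w) ≈-refl (D s) (D s₀) w₀)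
        -- G s₀ = 0, and N w - N₀ w₀ = w G.
        A B : Carrier
        A = G s - G s₀ - G′ * h
        -- w * B is (w - w₀) G′ h, since w w₀ (D s₀ - D s) = w - w₀. It is quadratic in h because D
        -- s - D s₀ is O(h).
        B = (w₀ * G′) * (D s₀ - D s) * h
        split : N s * w - N s₀ * w₀ - f′ * h ≈ w * A + w * B
        split = ≈-sym (begin
          w * A + w * B
            ≈⟨ solve 9 (λ w w₀ g ns ns₀ ds ds₀ l h → w :* ((ns :+ (:- l) :* ds) :- (ns₀ :+ (:- l) :* ds₀) :- g :* h) :+ w :* ((w₀ :* g) :* (ds₀ :- ds) :* h)
                 := ns :* w :- l :* (w :* ds) :- w :* (ns₀ :- l :* ds₀) :- g :* h :* w :+ g :* h :* (w :* (w₀ :* ds₀)) :- g :* h :* (w₀ :* (w :* ds)))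
                 ≈-refl w w₀ G′ (N s) (N s₀) (D s) (D s₀) L h ⟩
          N s * w - L * (w * D s) - w * (N s₀ - L * D s₀) - G′ * h * w + G′ * h * (w * (w₀ * D s₀)) - G′ * h * (w₀ * (w * D s))
            ≈⟨ +-cong (+-cong (+-congʳ (+-cong (+-congˡ (-‿cong (*-congˡ wD≈1))) (-‿cong (*-congˡ (≈-trans (+-congˡ (-‿cong LD₀)) (-‿inverseʳ _))))))
                 (*-congˡ (*-congˡ w₀D≈1))) (-‿cong (*-congˡ (*-congˡ wD≈1))) ⟩
          N s * w - L * 1# - w * 0# - G′ * h * w + G′ * h * (w * 1#) - G′ * h * (w₀ * 1#)
            ≈⟨ solve 7 (λ ns w l n′ d′ h w₀ → ns :* w :- l :* :1 :- w :* :0 :- (n′ :+ (:- l) :* d′) :* h :* w :+ (n′ :+ (:- l) :* d′) :* h :* (w :* :1) :- (n′ :+ (:- l) :* d′) :* h :* (w₀ :* :1)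
                 := ns :* w :- l :- ((n′ :- l :* d′) :* w₀) :* h) ≈-refl (N s) w L N′ D′ h w₀ ⟩
          N s * w - N s₀ * w₀ - f′ * h ∎)
          where
          LD₀ : L * D s₀ ≈ N s₀
          LD₀ = ≈-trans (*-assoc _ _ _) (≈-trans (*-congˡ w₀D≈1) (*-identityʳ _))
        wA≤ : normSq (w * A) ℝ.≤ M₁ ℝ.* (n ℝ.* n)
        wA≤ = ℝ.≤-trans (ℝ.≤-reflexive (normSq-* w A)) (ℝ.≤-trans (ℝ.*-monoʳ-≤ _ (normSq-nonneg A) w≤)
          (*-swap-≤ 0≤4w₀ (remainder≤ dG s (ℝ.<-≤-trans n<b (proj₂ (proj₂ (proj₂ b⁺)))))))
        B≤ : normSq B ℝ.≤ normSq w₀ ℝ.* normSq G′ ℝ.* K ℝ.* (n ℝ.* n)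
        B≤ = ℝ.≤-resp (ℝ.≈-sym (ℝ.≈-trans (normSq-* _ h) (ℝ.*-congʳ (ℝ.≈-trans (normSq-* _ _) (ℝ.*-cong (normSq-* w₀ G′) (normSq-swap (D s₀) (D s)))))))
          (ℝ.solve 3 (λ c k n → c ℝ.:* (k ℝ.:* n) ℝ.:* n ℝ.:= c ℝ.:* k ℝ.:* (n ℝ.:* n)) ℝ.≈-refl (normSq w₀ ℝ.* normSq G′) K n)
          (ℝ.*-monoʳ-≤ n 0≤n (ℝ.*-monoˡ-≤ _ (ℝ.*-nonneg (normSq-nonneg w₀) (normSq-nonneg G′)) D-D₀≤))
        wB≤ : normSq (w * B) ℝ.≤ M₂ ℝ.* (n ℝ.* n)
        wB≤ = ℝ.≤-trans (ℝ.≤-reflexive (normSq-* w B)) (ℝ.≤-trans (ℝ.*-monoʳ-≤ _ (normSq-nonneg B) w≤) (*-swap-≤ 0≤4w₀ B≤))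
        quotient≤ : normSq (N s * w - N s₀ * w₀ - f′ * h) ℝ.≤ M ℝ.* (n ℝ.* n)
        quotient≤ = ℝ.≤-resp (normSq-cong (≈-sym split))
          (ℝ.solve 4 (λ t a b n → t ℝ.:* (a ℝ.:* n ℝ.:+ b ℝ.:* n) ℝ.:= t ℝ.:* (a ℝ.:+ b) ℝ.:* n) ℝ.≈-refl 2* M₁ M₂ (n ℝ.* n))
          (ℝ.≤-trans (normSq-+≤ (w * A) (w * B)) (ℝ.*-monoˡ-≤ 2* 0≤2 (ℝ.+-mono-≤ wA≤ wB≤)))

    -- A point of the domain of a `Meromorphic` function carries an inverse of the denominator;
    -- hence s is accompanied by w.
    quotient-derivative : ∀ ε → ℝ.0# ℝ.< ε → ∃[ δ ] (ℝ.0# ℝ.< δ ×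
      (∀ s w → w * D s ≈ 1# → normSq (s - s₀) ℝ.< δ ℝ.* δ →
        normSq (N s * w - N s₀ * w₀ - (N′ - N s₀ * w₀ * D′) * w₀ * (s - s₀)) ℝ.≤ ε ℝ.* ε ℝ.* normSq (s - s₀)))
    quotient-derivative ε 0<ε = let δ , 0<δ , small = bound-to-ε (proj₁ (proj₂ κ⁺)) 0≤M ε 0<ε in
      δ , 0<δ , λ s w wD≈1 close → let n<κ , M≤ = small _ (normSq-nonneg _) close in
        ℝ.≤-trans (quotient≤ s w wD≈1 n<κ) M≤

module ExponentialDerivative {R : RealNumbers} {C : ComplexField R} (expFunction : ExponentialFunction C) where
  open ComplexAnalysis C
  open ExponentialFunction expFunction using (exp)
  open Exponential expFunction
  open Differentiation C

  -- exp (- s r) = e₀ exp h for h = - (s - s₀) r, so `exp-quadratic` at h bounds the remainder; the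
  -- radius is chosen to make |h| ≤ 1.
  derivative-exp : ∀ r s₀ → Derivative (λ s → exp (- s * real r)) s₀ (- real r * exp (- s₀ * real r))
  derivative-exp r s₀ = record
    { radius = proj₁ κ ; bound = bound ; 0<radius = proj₁ (proj₂ κ)
    ; 0≤bound = ℝ.*-nonneg (ℝ.*-nonneg (normSq-nonneg e₀) (ℝ.<⇒≤ 0<bb)) (ℝ.square-nonneg (r ℝ.* r))
    ; remainder≤ = rem
    }
    where
    e₀ = exp (- s₀ * real r)
    bb = expᵣ ℝ.1# ℝ.* expᵣ ℝ.1#
    0<bb : ℝ.0# ℝ.< bb
    0<bb = ℝ.*-pos (expᵣ-pos ℝ.1#) (expᵣ-pos ℝ.1#)
    bound = normSq e₀ ℝ.* bb ℝ.* (r ℝ.* r ℝ.* (r ℝ.* r))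
    κ : ∃[ a ] (ℝ.0# ℝ.< a × a ℝ.≤ ℝ.1# × a ℝ.* (r ℝ.* r) ℝ.≤ ℝ.1#)
    κ = ℝ.small ℝ.0<1 (ℝ.square-nonneg r)
    rem : ∀ s → normSq (s - s₀) ℝ.< proj₁ κ → normSq (exp (- s * real r) - e₀ - - real r * e₀ * (s - s₀)) ℝ.≤ bound ℝ.* (normSq (s - s₀) ℝ.* normSq (s - s₀))
    rem s close = ℝ.≤-resp
      (ℝ.≈-sym (ℝ.≈-trans (normSq-cong factor) (normSq-* e₀ _)))
      (ℝ.≈-trans (ℝ.*-congˡ (ℝ.*-congˡ (ℝ.*-cong n≈ n≈)))
        (ℝ.solve 4 (λ e b n r → e ℝ.:* (b ℝ.:* (n ℝ.:* r ℝ.:* (n ℝ.:* r))) ℝ.:= e ℝ.:* b ℝ.:* (r ℝ.:* r) ℝ.:* (n ℝ.:* n)) ℝ.≈-refl (normSq e₀) bb n (r ℝ.* r)))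
      (ℝ.*-monoˡ-≤ (normSq e₀) (normSq-nonneg e₀) (exp-quadratic (ℝ.≤-resp (ℝ.≈-sym n≈) ℝ.≈-refl
        (ℝ.≤-trans (ℝ.*-monoʳ-≤ (r ℝ.* r) (ℝ.square-nonneg r) (ℝ.<⇒≤ close)) (proj₂ (proj₂ (proj₂ κ)))))))
      where
      h = - (s - s₀) * real r
      n = normSq (s - s₀)
      n≈ : normSq h ℝ.≈ n ℝ.* (r ℝ.* r)
      n≈ = ℝ.≈-trans (normSq-* _ _) (ℝ.*-cong (normSq-neg _) (normSq-real r))
      factor : exp (- s * real r) - e₀ - - real r * e₀ * (s - s₀) ≈ e₀ * (exp h - 1# - h)
      factor = ≈-trans (+-congʳ (+-congʳ (≈-trans (exp-cong (solve 3 (λ s s₀ r → (:- s) :* r := (:- s₀) :* r :+ (:- (s :- s₀)) :* r) ≈-refl s s₀ (real r))) (exp-+ _ _))))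
        (solve 5 (λ e x s s₀ r → e :* x :- e :- (:- r) :* e :* (s :- s₀) := e :* (x :- :1 :- (:- (s :- s₀)) :* r)) ≈-refl e₀ (exp h) s s₀ (real r))

-- Polynomials over 𝔽_q

module PolynomialProperties (K : FiniteField) where
  private
    module F where
      open FiniteField K public using (inverse; 0≉1; _≟_; q; enumeration)
      open CommutativeRing (FiniteField.commutativeRing K) public
      open IntegerSolver (FiniteField.commutativeRing K) public
      open FiniteSums (FiniteField.commutativeRing K) public
      open Convolution (FiniteField.commutativeRing K) public
    module A = Polynomial K
  open A using (Poly; coeff; DegreeBelow; MonicOfDegree)

  coeff-+ : ∀ f g i → coeff (f A.+ g) i F.≈ coeff f i F.+ coeff g i
  coeff-+ []      g       i       = F.sym (F.+-identityˡ _)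
  coeff-+ (c ∷ f) []      i       = F.sym (F.+-identityʳ _)
  coeff-+ (c ∷ f) (d ∷ g) zero    = F.refl
  coeff-+ (c ∷ f) (d ∷ g) (suc i) = coeff-+ f g i

  coeff-scale : ∀ c g i → coeff (List.map (c F.*_) g) i F.≈ c F.* coeff g i
  coeff-scale c []      i       = F.sym (F.zeroʳ c)
  coeff-scale c (d ∷ g) zero    = F.refl
  coeff-scale c (d ∷ g) (suc i) = coeff-scale c g i

  coeff-neg : ∀ f i → coeff (A.- f) i F.≈ F.- coeff f i
  coeff-neg []      i       = F.solve 0 (F.:0 F.:= F.:- F.:0) F.refl
  coeff-neg (c ∷ f) zero    = F.refl
  coeff-neg (c ∷ f) (suc i) = coeff-neg f i

  coeff-* : ∀ f g n → coeff (f A.* g) n F.≈ F.convolution (coeff f) (coeff g) n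
  coeff-* []      g n       = F.sym (F.convolution-zeroˡ (coeff g) n (λ _ → F.refl))
  coeff-* (c ∷ f) g zero    = F.trans (coeff-+ (List.map (c F.*_) g) _ 0) (F.trans (F.+-identityʳ _) (coeff-scale c g 0))
  coeff-* (c ∷ f) g (suc n) = F.trans (coeff-+ (List.map (c F.*_) g) _ (suc n)) (F.+-cong (coeff-scale c g (suc n)) (coeff-* f g n))

  commutativeRing : CommutativeRing 0ℓ 0ℓ
  commutativeRing = record
    { Carrier = Poly ; _≈_ = A._≈_ ; _+_ = A._+_ ; _*_ = A._*_ ; -_ = A.-_ ; 0# = A.0# ; 1# = A.1#
    ; isCommutativeRing = record
      { isRing = record
        { +-isAbelianGroup = record
          { isGroup = record
            { isMonoid = record
              { isSemigroup = record
                { isMagma = record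
                  { isEquivalence = record
                    { refl  = λ i → F.refl
                    ; sym   = λ f≈g i → F.sym (f≈g i)
                    ; trans = λ f≈g g≈h i → F.trans (f≈g i) (g≈h i)
                    }
                  ; ∙-cong = λ {f} {f′} {g} {g′} f≈f′ g≈g′ i → F.trans (coeff-+ f g i) (F.trans (F.+-cong (f≈f′ i) (g≈g′ i)) (F.sym (coeff-+ f′ g′ i)))
                  }
                ; assoc = λ f g h i → F.trans (F.trans (coeff-+ (f A.+ g) h i) (F.+-congʳ (coeff-+ f g i)))
                    (F.trans (F.+-assoc _ _ _) (F.sym (F.trans (coeff-+ f (g A.+ h) i) (F.+-congˡ (coeff-+ g h i)))))
                }
              ; identity = (λ f i → F.refl) , (λ f i → F.trans (coeff-+ f [] i) (F.+-identityʳ _))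
              }
            ; inverse = (λ f i → F.trans (coeff-+ (A.- f) f i) (F.trans (F.+-congʳ (coeff-neg f i)) (F.-‿inverseˡ _))) ,
                        (λ f i → F.trans (coeff-+ f (A.- f) i) (F.trans (F.+-congˡ (coeff-neg f i)) (F.-‿inverseʳ _)))
            ; ⁻¹-cong = λ {f} {g} f≈g i → F.trans (coeff-neg f i) (F.trans (F.-‿cong (f≈g i)) (F.sym (coeff-neg g i)))
            }
          ; comm = λ f g i → F.trans (coeff-+ f g i) (F.trans (F.+-comm _ _) (F.sym (coeff-+ g f i)))
          }
        ; *-cong = λ {f} {f′} {g} {g′} f≈f′ g≈g′ i → F.trans (coeff-* f g i) (F.trans (F.convolution-cong i f≈f′ g≈g′) (F.sym (coeff-* f′ g′ i)))
        ; *-assoc = λ f g h i → F.trans (F.trans (coeff-* (f A.* g) h i) (F.convolution-cong i (coeff-* f g) (λ _ → F.refl)))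
            (F.trans (F.convolution-assoc (coeff f) (coeff g) (coeff h) i)
              (F.sym (F.trans (coeff-* f (g A.* h) i) (F.convolution-cong i (λ _ → F.refl) (coeff-* g h)))))
        ; *-identity = (λ f i → 1*f f i) , (λ f i → F.trans (*-comm f A.1# i) (1*f f i))
        ; distrib = (λ f g h i → F.trans (*-comm f (g A.+ h) i) (F.trans (distribʳ f g h i)
                      (F.trans (coeff-+ (g A.* f) (h A.* f) i) (F.trans (F.+-cong (*-comm g f i) (*-comm h f i)) (F.sym (coeff-+ (f A.* g) (f A.* h) i)))))) ,
                    distribʳ
        }
      ; *-comm = *-comm
      }
    }
    where
    *-comm : ∀ f g i → coeff (f A.* g) i F.≈ coeff (g A.* f) i
    *-comm f g i = F.trans (coeff-* f g i) (F.trans (F.convolution-comm (coeff f) (coeff g) i) (F.sym (coeff-* g f i)))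
    1*f : ∀ f i → coeff (A.1# A.* f) i F.≈ coeff f i
    1*f f i = F.trans (coeff-* A.1# f i) (F.trans (F.convolution-constantˡ (coeff f) i (λ _ → F.refl)) (F.*-identityˡ _))
    distribʳ : ∀ f g h i → coeff ((g A.+ h) A.* f) i F.≈ coeff (g A.* f A.+ h A.* f) i
    distribʳ f g h i = F.trans (coeff-* (g A.+ h) f i) (F.trans (F.convolution-cong i (coeff-+ g h) (λ _ → F.refl))
      (F.trans (F.convolution-+ˡ (coeff g) (coeff h) (coeff f) i)
        (F.sym (F.trans (coeff-+ (g A.* f) (h A.* f) i) (F.+-cong (coeff-* g f i) (coeff-* h f i))))))

  Leading : ℕ → F.Carrier → Poly → Set
  Leading d c f = (coeff f d F.≈ c) × DegreeBelow (suc d) f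

  leading-* : ∀ {d e b c} f g → Leading d b f → Leading e c g → Leading (d +ℕ e) (b F.* c) (f A.* g)
  leading-* {d} {e} f g (fd≈b , f<) (ge≈c , g<) =
    F.trans (coeff-* f g (d +ℕ e)) (F.trans (F.convolution-leading d e f< g<) (F.*-cong fd≈b ge≈c)) ,
    λ i d+e<i → F.trans (coeff-* f g i) (F.convolution-above d e f< g< i d+e<i)

  -- Lists may end in zeros, so the degree is located by comparing coefficients with 0 from the top
  -- down.
  leading? : ∀ f → (f A.≈ A.0#) ⊎ ∃[ d ] (¬ (coeff f d F.≈ F.0#) × DegreeBelow (suc d) f)
  leading? [] = inj₁ λ _ → F.refl
  leading? (c ∷ f) with leading? f
  ... | inj₂ (d , fd≉0 , f<) = inj₂ (suc d , fd≉0 , λ { (suc i) (ℕ.s≤s d<i) → f< i d<i })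
  ... | inj₁ f≈0 with c F.≟ F.0#
  ...   | yes c≈0 = inj₁ λ { zero → c≈0 ; (suc i) → f≈0 i }
  ...   | no  c≉0 = inj₂ (0 , c≉0 , λ { (suc i) _ → f≈0 i })

  -- The list c ∷ f is c + t f. From f = h g + r follows c + t f = (t h) g + (c + t r), and
  -- subtracting k g, with k the coefficient of c + t r at d, restores the degree bound.
  divide : ∀ {d} g → MonicOfDegree d g → ∀ f → ∃[ h ] ∃[ r ] (f A.≈ (h A.* g A.+ r) × DegreeBelow d r)
  divide g (gd≈1 , g<) []      = [] , [] , (λ _ → F.refl) , λ _ _ → F.refl
  divide {d} g (gd≈1 , g<) (c ∷ f) with divide g (gd≈1 , g<) f
  ... | h , r , f≈ , r< = k ∷ h , r′ , (λ i → F.trans (eq i) (F.sym (coeff-+ ((k ∷ h) A.* g) r′ i))) , below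
    where
    k : F.Carrier
    k = coeff (c ∷ r) d
    kg r′ : Poly
    kg = List.map (k F.*_) g
    r′ = (c ∷ r) A.+ (A.- kg)
    coeff-r′ : ∀ i → coeff r′ i F.≈ coeff (c ∷ r) i F.- k F.* coeff g i
    coeff-r′ i = F.trans (coeff-+ (c ∷ r) (A.- kg) i) (F.+-congˡ (F.trans (coeff-neg kg i) (F.-‿cong (coeff-scale k g i))))
    eq : ∀ i → coeff (c ∷ f) i F.≈ coeff ((k ∷ h) A.* g) i F.+ coeff r′ i
    eq zero = F.sym (F.trans (F.+-cong (F.trans (coeff-+ kg _ 0) (F.+-congʳ (coeff-scale k g 0))) (coeff-r′ 0))
      (F.solve 2 (λ x c → x F.:+ F.:0 F.:+ (c F.:- x) F.:= c) F.refl (k F.* coeff g 0) c))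
    eq (suc i) = F.sym (F.trans (F.+-cong (F.trans (coeff-+ kg _ (suc i)) (F.+-congʳ (coeff-scale k g (suc i)))) (coeff-r′ (suc i)))
      (F.trans (F.solve 3 (λ x y r → x F.:+ y F.:+ (r F.:- x) F.:= y F.:+ r) F.refl (k F.* coeff g (suc i)) (coeff (h A.* g) i) (coeff r i))
        (F.sym (F.trans (f≈ i) (coeff-+ (h A.* g) r i)))))
    below : DegreeBelow d r′
    below i d≤i with ℕ.m≤n⇒m<n∨m≡n d≤i
    ... | inj₂ ≡.refl = F.trans (coeff-r′ d) (F.trans (F.+-congˡ (F.-‿cong (F.trans (F.*-congˡ gd≈1) (F.*-identityʳ k)))) (F.-‿inverseʳ k))
    below (suc i) _ | inj₁ (ℕ.s≤s d≤i) = F.trans (coeff-r′ (suc i))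
      (F.trans (F.+-cong (r< i d≤i) (F.-‿cong (F.trans (F.*-congˡ (g< (suc i) (ℕ.s≤s d≤i))) (F.zeroʳ k)))) (F.-‿inverseʳ F.0#))

  -- The polynomials whose coefficients from degree d on are those of b.
  Extends : Poly → ℕ → Poly → Set
  Extends b d f = ∀ i → coeff f (d +ℕ i) F.≈ coeff b i

  private
    digit : Fin F.q → F.Carrier
    digit = Inverse.from F.enumeration

    digit-injective : ∀ {i j} → digit i F.≈ digit j → i ≡ j
    digit-injective {i} {j} eq = ≡.trans (≡.sym (Inverse.strictlyInverseˡ F.enumeration i)) (≡.trans (Inverse.to-cong F.enumeration eq) (Inverse.strictlyInverseˡ F.enumeration j))

  -- b = 0 and b = 1 give the polynomials of degree below d and the monic ones of degree d. Each
  -- step of the recursion adds a constant coefficient, with q choices.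
  extensions : ∀ b d → Enumeration A.rawRing (Extends b d)
  extensions b zero = record
    { size = 1 ; element = λ _ → b ; sound = λ _ _ → F.refl ; complete = λ a h → Fin.zero , λ i → F.sym (h i)
    ; distinct = λ { {Fin.zero} {Fin.zero} _ → ≡.refl }
    }
  extensions b (suc d) = record
    { size = F.q ℕ.* size
    ; element = λ m → cons (Fin.remQuot size m)
    ; sound = λ m i → sound (proj₂ (Fin.remQuot {F.q} size m)) i
    ; complete = complete′
    ; distinct = λ {m} {n} eq → ≡.trans (≡.sym (Fin.combine-remQuot {F.q} size m)) (≡.trans
        (cong₂ Fin.combine (digit-injective (eq 0)) (distinct (eq ∘ suc)))
        (Fin.combine-remQuot {F.q} size n))
    }
    where
    open Enumeration (extensions b d)
    cons : Fin F.q × Fin size → Poly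
    cons (i , j) = digit i ∷ element j
    cons-≈ : ∀ c f i j → digit i F.≈ c → element j A.≈ f → cons (i , j) A.≈ (c ∷ f)
    cons-≈ c f i j p q zero    = p
    cons-≈ c f i j p q (suc k) = q k
    uncons : ∀ f → f A.≈ (coeff f 0 ∷ List.drop 1 f)
    uncons []      zero    = F.refl
    uncons []      (suc i) = F.refl
    uncons (c ∷ f) i       = F.refl
    complete′ : ∀ a → Extends b (suc d) a → ∃[ m ] (cons (Fin.remQuot size m) A.≈ a)
    complete′ a h =
      let i = Inverse.to F.enumeration (coeff a 0)
          j , eq = complete (List.drop 1 a) (λ k → F.trans (F.sym (uncons a (suc (d +ℕ k)))) (h k))
      in Fin.combine i j , λ k → F.trans (F.reflexive (cong (λ p → coeff (cons p) k) (Fin.remQuot-combine i j)))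
           (F.trans (cons-≈ (coeff a 0) (List.drop 1 a) i j (Inverse.strictlyInverseʳ F.enumeration (coeff a 0)) eq k) (F.sym (uncons a k)))

  below-enumeration : ∀ d → Enumeration A.rawRing (DegreeBelow d)
  below-enumeration d = record
    { size = size ; element = element ; distinct = distinct
    ; sound = λ m i d≤i → F.trans (F.reflexive (cong (coeff (element m)) (≡.sym (ℕ.m+[n∸m]≡n d≤i)))) (sound m (i ℕ.∸ d))
    ; complete = λ a a< → complete a (λ i → a< (d +ℕ i) (ℕ.m≤m+n d i))
    }
    where open Enumeration (extensions [] d)

  monic-enumeration : ∀ d → Enumeration A.rawRing (MonicOfDegree d)
  monic-enumeration d = record
    { size = size ; element = element ; distinct = distinct
    ; sound = λ m → F.trans (F.reflexive (cong (coeff (element m)) (≡.sym (ℕ.+-identityʳ d)))) (sound m 0) ,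
        λ i d<i → F.trans (F.reflexive (cong (coeff (element m)) (≡.sym (≡.trans (ℕ.+-suc d _) (ℕ.m+[n∸m]≡n d<i))))) (sound m (suc (i ℕ.∸ suc d)))
    ; complete = λ a (ad≈1 , a<) → complete a λ
        { zero    → F.trans (F.reflexive (cong (coeff a) (ℕ.+-identityʳ d))) ad≈1
        ; (suc i) → a< (d +ℕ suc i) (ℕ.≤-trans (ℕ.s≤s (ℕ.m≤m+n d i)) (ℕ.≤-reflexive (≡.sym (ℕ.+-suc d i)))) }
    }
    where open Enumeration (extensions A.1# d)

  monic-size : ∀ d → Enumeration.size (monic-enumeration d) ≡ F.q ℕ.^ d
  monic-size zero    = ≡.refl
  monic-size (suc d) = cong (F.q ℕ.*_) (monic-size d)

-- The Euclidean structure of 𝔽_q[t], with the coefficients hidden.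
record PolynomialRing : Set₁ where
  field
    rawRing           : RawRing 0ℓ 0ℓ
  open Ring rawRing
  field
    isCommutativeRing : IsCommutativeRing _≈_ _+_ _*_ -_ 0# 1#
    1≉0               : ¬ (1# ≈ 0#)
    DegreeBelow       : ℕ → Carrier → Set
    Monic             : ℕ → Carrier → Set

    below-cong : ∀ {d f g} → f ≈ g → DegreeBelow d f → DegreeBelow d g
    below-0    : ∀ d → DegreeBelow d 0#
    below-+    : ∀ {d} f g → DegreeBelow d f → DegreeBelow d g → DegreeBelow d (f + g)
    below-neg  : ∀ {d} f → DegreeBelow d f → DegreeBelow d (- f)
    below-mono : ∀ {d e f} → d ℕ.≤ e → DegreeBelow d f → DegreeBelow e f
    below-zero : ∀ {f} → DegreeBelow 0 f → f ≈ 0#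

    monic-cong       : ∀ {d f g} → f ≈ g → Monic d f → Monic d g
    monic-1          : Monic 0 1#
    monic-zero       : ∀ {f} → Monic 0 f → f ≈ 1#
    monic-+          : ∀ {d} f r → Monic d f → DegreeBelow d r → Monic d (f + r)
    monic-*          : ∀ {d e} f g → Monic d f → Monic e g → Monic (d +ℕ e) (f * g)
    monic-unique     : ∀ {d e f} → Monic d f → Monic e f → d ≡ e
    monic-quotient   : ∀ {d e} h g → Monic d (h * g) → Monic e g → ∃[ k ] (k +ℕ e ≡ d × Monic k h)
    monic⇒below      : ∀ {d f} → Monic d f → DegreeBelow (suc d) f
    monic?           : ∀ d f → Dec (Monic d f)
    multiple-below   : ∀ {d} h g → Monic d g → DegreeBelow d (h * g) → h ≈ 0#

    divide    : ∀ {d} g → Monic d g → ∀ f → ∃[ h ] ∃[ r ] (f ≈ (h * g + r) × DegreeBelow d r)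
    normalize : ∀ f → f ≈ 0# ⊎ ∃[ e ] ∃[ u ] ∃[ v ] (u * v ≈ 1# × Monic e (u * f) × (∀ d → DegreeBelow d f → e ℕ.< d))

    below-enumeration : ∀ d → Enumeration rawRing (DegreeBelow d)
    monic-enumeration : ∀ d → Enumeration rawRing (Monic d)
    q                 : ℕ
    monic-size        : ∀ d → Enumeration.size (monic-enumeration d) ≡ q ℕ.^ d

module PolynomialRingInstance (K : FiniteField) where
  open PolynomialProperties K
  private
    module F where
      open FiniteField K public using (inverse; 0≉1; _≟_; q; enumeration)
      open CommutativeRing (FiniteField.commutativeRing K) public
      open IntegerSolver (FiniteField.commutativeRing K) public
    module A = Polynomial K
  open A using (Poly; coeff; DegreeBelow; MonicOfDegree)

  private
    leading-unique : ∀ {d e b c f} → ¬ (b F.≈ F.0#) → ¬ (c F.≈ F.0#) → Leading d b f → Leading e c f → d ≡ e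
    leading-unique {d} {e} b≉0 c≉0 (fd≈b , f<d) (fe≈c , f<e) with ℕ.<-cmp d e
    ... | tri< d<e _ _ = ⊥-elim (c≉0 (F.trans (F.sym fe≈c) (f<d e d<e)))
    ... | tri≈ _ d≡e _ = d≡e
    ... | tri> _ _ e<d = ⊥-elim (b≉0 (F.trans (F.sym fd≈b) (f<e d e<d)))

    1≉0 : ¬ (F.1# F.≈ F.0#)
    1≉0 = F.0≉1 ∘ F.sym

    c*1≉0 : ∀ {c} → ¬ (c F.≈ F.0#) → ¬ (c F.* F.1# F.≈ F.0#)
    c*1≉0 c≉0 eq = c≉0 (F.trans (F.sym (F.*-identityʳ _)) eq)

    monic-quotient : ∀ {d e} h g → MonicOfDegree d (h A.* g) → MonicOfDegree e g → ∃[ k ] (k +ℕ e ≡ d × MonicOfDegree k h)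
    monic-quotient {d} {e} h g hg-monic g-monic with leading? h
    ... | inj₁ h≈0 = ⊥-elim (1≉0 (F.trans (F.sym (proj₁ hg-monic)) (CommutativeRing.trans commutativeRing
                       {h A.* g} {A.0# A.* g} {A.0#} (CommutativeRing.*-congʳ commutativeRing {g} {h} {A.0#} h≈0) (λ _ → F.refl) d)))
    ... | inj₂ (k , hk≉0 , h<) = k , k+e≡d , hk≈1 , h<
      where
      hg : Leading (k +ℕ e) (coeff h k F.* F.1#) (h A.* g)
      hg = leading-* h g (F.refl , h<) g-monic
      k+e≡d : k +ℕ e ≡ d
      k+e≡d = leading-unique {f = h A.* g} (c*1≉0 hk≉0) 1≉0 hg hg-monic
      hk≈1 : coeff h k F.≈ F.1#
      hk≈1 = F.trans (F.sym (F.*-identityʳ _)) (F.trans (F.sym (proj₁ hg)) (F.trans (F.reflexive (cong (coeff (h A.* g)) k+e≡d)) (proj₁ hg-monic)))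

    multiple-below : ∀ {d} h g → MonicOfDegree d g → DegreeBelow d (h A.* g) → h A.≈ A.0#
    multiple-below {d} h g g-monic hg< with leading? h
    ... | inj₁ h≈0 = h≈0
    ... | inj₂ (k , hk≉0 , h<) = ⊥-elim (c*1≉0 hk≉0 (F.trans (F.sym (proj₁ (leading-* h g (F.refl , h<) g-monic))) (hg< (k +ℕ d) (ℕ.m≤n+m d k))))

    coeff-[c]* : ∀ c f i → coeff ((c ∷ []) A.* f) i F.≈ c F.* coeff f i
    coeff-[c]* c f i = F.trans (coeff-+ (List.map (c F.*_) f) (F.0# ∷ []) i) (F.trans (F.+-cong (coeff-scale c f i) (0∷[] i)) (F.+-identityʳ _))
      where
      0∷[] : ∀ i → coeff (F.0# ∷ []) i F.≈ F.0#
      0∷[] zero    = F.refl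
      0∷[] (suc i) = F.refl

    normalize : ∀ f → f A.≈ A.0# ⊎ ∃[ e ] ∃[ u ] ∃[ v ] (u A.* v A.≈ A.1# × MonicOfDegree e (u A.* f) × (∀ d → DegreeBelow d f → e ℕ.< d))
    normalize f with leading? f
    ... | inj₁ f≈0 = inj₁ f≈0
    ... | inj₂ (e , fe≉0 , f<) = inj₂ (e , c⁻¹ ∷ [] , coeff f e ∷ [] , unit , monic , λ d f<d → ℕ.≰⇒> (λ d≤e → fe≉0 (f<d e d≤e)))
      where
      c⁻¹ : F.Carrier
      c⁻¹ = proj₁ (F.inverse (coeff f e) fe≉0)
      c⁻¹c≈1 : c⁻¹ F.* coeff f e F.≈ F.1#
      c⁻¹c≈1 = proj₁ (proj₂ (F.inverse (coeff f e) fe≉0))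
      unit : ((c⁻¹ ∷ []) A.* (coeff f e ∷ [])) A.≈ A.1#
      unit zero    = F.trans (coeff-[c]* c⁻¹ (coeff f e ∷ []) 0) c⁻¹c≈1
      unit (suc i) = F.trans (coeff-[c]* c⁻¹ (coeff f e ∷ []) (suc i)) (F.zeroʳ c⁻¹)
      monic : MonicOfDegree e ((c⁻¹ ∷ []) A.* f)
      monic = F.trans (coeff-[c]* c⁻¹ f e) c⁻¹c≈1 , λ i e<i → F.trans (coeff-[c]* c⁻¹ f i) (F.trans (F.*-congˡ (f< i e<i)) (F.zeroʳ c⁻¹))

    below? : ∀ d f → Dec (DegreeBelow d f)
    below? d f with leading? f
    ... | inj₁ f≈0 = yes (λ i _ → f≈0 i)
    ... | inj₂ (e , fe≉0 , f<) with d ℕ.≤? e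
    ...   | yes d≤e = no (λ f<d → fe≉0 (f<d e d≤e))
    ...   | no  d≰e = yes (λ i d≤i → f< i (ℕ.≤-trans (ℕ.≰⇒> d≰e) d≤i))

  polynomialRing : PolynomialRing
  polynomialRing = record
    { rawRing = A.rawRing
    ; isCommutativeRing = CommutativeRing.isCommutativeRing commutativeRing
    ; 1≉0 = λ 1≈0 → 1≉0 (1≈0 0)
    ; DegreeBelow = DegreeBelow
    ; Monic = MonicOfDegree
    ; below-cong = λ f≈g f< i d≤i → F.trans (F.sym (f≈g i)) (f< i d≤i)
    ; below-0 = λ d i _ → F.refl
    ; below-+ = λ f g f< g< i d≤i → F.trans (coeff-+ f g i) (F.trans (F.+-cong (f< i d≤i) (g< i d≤i)) (F.+-identityˡ _))
    ; below-neg = λ f f< i d≤i → F.trans (coeff-neg f i) (F.trans (F.-‿cong (f< i d≤i)) (F.solve 0 (F.:- F.:0 F.:= F.:0) F.refl))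
    ; below-mono = λ d≤e f< i e≤i → f< i (ℕ.≤-trans d≤e e≤i)
    ; below-zero = λ f< i → f< i ℕ.z≤n
    ; monic-cong = λ {d} f≈g (fd≈1 , f<) → F.trans (F.sym (f≈g d)) fd≈1 , λ i d<i → F.trans (F.sym (f≈g i)) (f< i d<i)
    ; monic-1 = F.refl , λ { (suc i) _ → F.refl }
    ; monic-zero = λ { (f0≈1 , f<) zero → f0≈1 ; (f0≈1 , f<) (suc i) → f< (suc i) (ℕ.s≤s ℕ.z≤n) }
    ; monic-+ = λ {d} f r (fd≈1 , f<) r< →
        F.trans (coeff-+ f r d) (F.trans (F.+-cong fd≈1 (r< d ℕ.≤-refl)) (F.+-identityʳ _)) ,
        λ i d<i → F.trans (coeff-+ f r i) (F.trans (F.+-cong (f< i d<i) (r< i (ℕ.<⇒≤ d<i))) (F.+-identityʳ _))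
    ; monic-* = λ {d} {e} f g f-monic g-monic →
        let p , < = leading-* f g f-monic g-monic in F.trans p (F.*-identityʳ _) , <
    ; monic-unique = λ {d} {e} {f} → leading-unique {d} {e} {f = f} 1≉0 1≉0
    ; monic-quotient = monic-quotient
    ; monic⇒below = proj₂
    ; monic? = λ d f → (coeff f d F.≟ F.1#) ×-dec below? (suc d) f
    ; multiple-below = multiple-below
    ; divide = divide
    ; normalize = normalize
    ; below-enumeration = below-enumeration
    ; monic-enumeration = monic-enumeration
    ; q = F.q
    ; monic-size = monic-size
    }

-- Divisibility and factorization in 𝔽_q[t]

module PolynomialArithmetic (𝒫 : PolynomialRing) where
  open PolynomialRing 𝒫 public
  private
    module Raw = Ring rawRing
  commutativeRing : CommutativeRing 0ℓ 0ℓ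
  commutativeRing = record { isCommutativeRing = isCommutativeRing }
  open CommutativeRing commutativeRing public
    renaming (refl to ≈-refl; sym to ≈-sym; trans to ≈-trans)
    hiding (rawRing; isCommutativeRing)
  open Algebra.Properties.Semiring.Exp semiring public using (_^_; ^-homo-*)
  open IntegerSolver commutativeRing public
  open Raw public using (Coprime; Irreducible; _∣_)
  open Algebra.Definitions.RawMagma (CommutativeRing.*-rawMagma commutativeRing) using (_∣ʳ_)

  divides : ∀ {f g} h → h * f ≈ g → f ∣ g
  divides h eq = record { quotient = h ; equality = eq }

  ∣-quotient : ∀ {f g} → f ∣ g → Carrier
  ∣-quotient = _∣ʳ_.quotient

  ∣-equality : ∀ {f g} (f∣g : f ∣ g) → ∣-quotient f∣g * f ≈ g
  ∣-equality = _∣ʳ_.equality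

  ∣-trans : ∀ {f g h} → f ∣ g → g ∣ h → f ∣ h
  ∣-trans {f} p q = divides (_∣ʳ_.quotient q * _∣ʳ_.quotient p)
    (≈-trans (*-assoc _ _ f) (≈-trans (*-congˡ (_∣ʳ_.equality p)) (_∣ʳ_.equality q)))

  ∣-respʳ : ∀ {f g h} → g ≈ h → f ∣ g → f ∣ h
  ∣-respʳ g≈h p = divides (_∣ʳ_.quotient p) (≈-trans (_∣ʳ_.equality p) g≈h)

  ∣-respˡ : ∀ {f g h} → f ≈ g → f ∣ h → g ∣ h
  ∣-respˡ f≈g p = divides (_∣ʳ_.quotient p) (≈-trans (*-congˡ (≈-sym f≈g)) (_∣ʳ_.equality p))

  ∣-+ : ∀ {f g h} → f ∣ g → f ∣ h → f ∣ (g + h)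
  ∣-+ {f} p q = divides (_∣ʳ_.quotient p + _∣ʳ_.quotient q) (≈-trans (distribʳ f _ _) (+-cong (_∣ʳ_.equality p) (_∣ʳ_.equality q)))

  ∣-* : ∀ {f g} h → f ∣ g → f ∣ (h * g)
  ∣-* h p = divides (h * _∣ʳ_.quotient p) (≈-trans (*-assoc _ _ _) (*-congˡ (_∣ʳ_.equality p)))

  ∣-neg : ∀ {f g} → f ∣ g → f ∣ (- g)
  ∣-neg {g = g} p = ∣-respʳ (solve 1 (λ g → (:- :1) :* g := :- g) ≈-refl g) (∣-* (- 1#) p)

  ∣-refl : ∀ {f} → f ∣ f
  ∣-refl {f} = divides 1# (*-identityˡ f)

  ∣-0 : ∀ {f} → f ∣ 0#
  ∣-0 {f} = divides 0# (zeroˡ f)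

  not-monic-0 : ∀ {e} → ¬ Monic e 0#
  not-monic-0 {e} 0-monic = case monic-quotient 0# 0# (monic-cong (≈-sym (zeroˡ 0#)) 0-monic) 0-monic of λ
    { (zero  , _   , monic₀) → 1≉0 (≈-sym (monic-zero monic₀))
    ; (suc k , k+e , _)      → ℕ.m≢1+n+m e (≡.sym k+e) }

  zero? : ∀ f → Dec (f ≈ 0#)
  zero? f with normalize f
  ... | inj₁ f≈0 = yes f≈0
  ... | inj₂ (e , u , _ , _ , monic , _) = no (λ f≈0 → not-monic-0 (monic-cong (≈-trans (*-congˡ f≈0) (zeroʳ u)) monic))

  divisible-below : ∀ {d g f} → Monic d g → g ∣ f → DegreeBelow d f → f ≈ 0#
  divisible-below {g = g} monic g∣f f< = ≈-trans (≈-sym hg≈f) (≈-trans (*-congʳ (multiple-below _ g monic (below-cong (≈-sym hg≈f) f<))) (zeroˡ g))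
    where hg≈f = _∣ʳ_.equality g∣f

  divisible? : ∀ {d} g → Monic d g → ∀ f → Dec (g ∣ f)
  divisible? g monic f with divide g monic f
  ... | h , r , f≈ , r< with zero? r
  ...   | yes r≈0 = yes (divides h (≈-sym (≈-trans f≈ (≈-trans (+-congˡ r≈0) (+-identityʳ _)))))
  ...   | no  r≉0 = no (λ g∣f → r≉0 (divisible-below monic (∣-respʳ r≈ (∣-+ g∣f (∣-neg (∣-* h ∣-refl)))) r<))
    where
    r≈ : f - h * g ≈ r
    r≈ = ≈-trans (+-congʳ f≈) (solve 2 (λ x r → x :+ r :- x := r) ≈-refl (h * g) r)

  record Bezout (f g : Carrier) : Set where
    field
      gcd x y  : Carrier
      identity : gcd ≈ x * f + y * g
      gcd∣f    : gcd ∣ f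
      gcd∣g    : gcd ∣ g

  private
    -- Euclid's algorithm, with n as fuel above the degree of g. Since `divide` wants a monic
    -- divisor, a remainder r is replaced by its monic associate u * r, and u goes into the
    -- cofactor.
    bezout-monic : ∀ n {d} → d ℕ.< n → ∀ f g → Monic d g → Bezout f g
    bezout-monic (suc n) {d} (ℕ.s≤s d≤n) f g monic with divide g monic f
    ... | h , r , f≈ , r< with normalize r
    ...   | inj₁ r≈0 = record
      { gcd = g ; x = 0# ; y = 1#
      ; identity = solve 2 (λ f g → g := :0 :* f :+ :1 :* g) ≈-refl f g
      ; gcd∣f = divides h (≈-sym (≈-trans f≈ (≈-trans (+-congˡ r≈0) (+-identityʳ _))))
      ; gcd∣g = ∣-refl
      }
    ...   | inj₂ (e , u , v , uv≈1 , ur-monic , e<) = record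
      { gcd = gcd ; x = y * u ; y = x - y * u * h
      ; identity = ≈-trans identity (≈-trans (+-congˡ (*-congˡ (*-congˡ r≈)))
          (solve 6 (λ f g h u x y → x :* g :+ y :* (u :* (f :- h :* g)) := y :* u :* f :+ (x :- y :* u :* h) :* g) ≈-refl f g h u x y))
      ; gcd∣f = ∣-respʳ (≈-sym f≈) (∣-+ (∣-* h gcd∣f) gcd∣r)
      ; gcd∣g = gcd∣f
      }
      where
      open Bezout (bezout-monic n (ℕ.<-≤-trans (e< d r<) d≤n) g (u * r) ur-monic)
      r≈ : r ≈ f - h * g
      r≈ = ≈-sym (≈-trans (+-congʳ f≈) (solve 2 (λ x r → x :+ r :- x := r) ≈-refl (h * g) r))
      gcd∣r : gcd ∣ r
      gcd∣r = ∣-respʳ (≈-trans (solve 3 (λ u v r → v :* (u :* r) := (u :* v) :* r) ≈-refl u v r) (≈-trans (*-congʳ uv≈1) (*-identityˡ r))) (∣-* v gcd∣g)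

  bezout : ∀ f g → Bezout f g
  bezout f g with normalize g
  ... | inj₁ g≈0 = record
    { gcd = f ; x = 1# ; y = 0#
    ; identity = solve 2 (λ f g → f := :1 :* f :+ :0 :* g) ≈-refl f g
    ; gcd∣f = ∣-refl ; gcd∣g = ∣-respʳ (≈-sym g≈0) ∣-0
    }
  ... | inj₂ (e , u , v , uv≈1 , monic , _) = record
    { gcd = gcd ; x = x ; y = y * u
    ; identity = ≈-trans identity (+-congˡ (≈-sym (*-assoc y u g)))
    ; gcd∣f = gcd∣f
    ; gcd∣g = ∣-respʳ (≈-trans (solve 3 (λ u v r → v :* (u :* r) := (u :* v) :* r) ≈-refl u v g) (≈-trans (*-congʳ uv≈1) (*-identityˡ g))) (∣-* v gcd∣g)
    }
    where open Bezout (bezout-monic (suc e) ℕ.≤-refl f (u * g) monic)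

  -- The ideal-theoretic form of `Coprime`, which quantifies over common divisors. Products and
  -- Euclid's lemma are computed from the cofactors.
  Comaximal : Carrier → Carrier → Set
  Comaximal f g = ∃[ a ] ∃[ b ] (a * f + b * g ≈ 1#)

  comaximal⇒coprime : ∀ {f g} → Comaximal f g → Coprime f g
  comaximal⇒coprime (a , b , eq) h∣f h∣g = ∣-respʳ eq (∣-+ (∣-* a h∣f) (∣-* b h∣g))

  gcd∣1⇒comaximal : ∀ {f g} (b : Bezout f g) → Bezout.gcd b ∣ 1# → Comaximal f g
  gcd∣1⇒comaximal {f} {g} b c∣1 = c * x , c * y , ≈-trans
      (solve 5 (λ c x y f g → c :* x :* f :+ c :* y :* g := c :* (x :* f :+ y :* g)) ≈-refl c x y f g)
      (≈-trans (*-congˡ (≈-sym identity)) (_∣ʳ_.equality c∣1))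
    where
    open Bezout b
    c = _∣ʳ_.quotient c∣1

  coprime⇒comaximal : ∀ {f g} → Coprime f g → Comaximal f g
  coprime⇒comaximal {f} {g} coprime = gcd∣1⇒comaximal b (coprime (Bezout.gcd∣f b) (Bezout.gcd∣g b))
    where b = bezout f g

  monic∣1⇒degree-0 : ∀ {e g} → Monic e g → g ∣ 1# → e ≡ 0
  monic∣1⇒degree-0 {e} {g} monic g∣1 with monic-quotient _ g (monic-cong (≈-sym (_∣ʳ_.equality g∣1)) monic-1) monic
  ... | k , k+e≡0 , _ = ℕ.m+n≡0⇒n≡0 k k+e≡0

  coprime? : ∀ f g → Dec (Coprime f g)
  coprime? f g with normalize (Bezout.gcd (bezout f g))
  ... | inj₁ gcd≈0 = no λ coprime → 1≉0 (≈-trans (≈-sym (_∣ʳ_.equality (gcd∣1 coprime))) (≈-trans (*-congˡ gcd≈0) (zeroʳ _)))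
    where
    gcd∣1 : Coprime f g → Bezout.gcd (bezout f g) ∣ 1#
    gcd∣1 coprime = coprime (Bezout.gcd∣f (bezout f g)) (Bezout.gcd∣g (bezout f g))
  ... | inj₂ (zero , u , _ , _ , monic , _) = yes (comaximal⇒coprime (gcd∣1⇒comaximal (bezout f g) (divides u (monic-zero monic))))
  ... | inj₂ (suc e , u , v , uv≈1 , monic , _) = no λ coprime →
    case monic∣1⇒degree-0 monic (∣-trans (divides v vu-gcd≈gcd) (coprime (Bezout.gcd∣f (bezout f g)) (Bezout.gcd∣g (bezout f g)))) of λ ()
    where
    vu-gcd≈gcd : v * (u * Bezout.gcd (bezout f g)) ≈ Bezout.gcd (bezout f g)
    vu-gcd≈gcd = ≈-trans (solve 3 (λ u v c → v :* (u :* c) := (u :* v) :* c) ≈-refl u v _) (≈-trans (*-congʳ uv≈1) (*-identityˡ _))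

  comaximal-* : ∀ {f g h} → Comaximal f h → Comaximal g h → Comaximal (f * g) h
  comaximal-* {f} {g} {h} (a , b , eq) (a′ , b′ , eq′) = a * a′ , a * f * b′ + b * (a′ * g) + b * b′ * h , ≈-trans
    (solve 7 (λ a b a′ b′ f g h → a :* a′ :* (f :* g) :+ (a :* f :* b′ :+ b :* (a′ :* g) :+ b :* b′ :* h) :* h := (a :* f :+ b :* h) :* (a′ :* g :+ b′ :* h)) ≈-refl a b a′ b′ f g h)
    (≈-trans (*-cong eq eq′) (*-identityˡ 1#))

  coprime-* : ∀ {f g h} → Coprime f h → Coprime g h → Coprime (f * g) h
  coprime-* p q = comaximal⇒coprime (comaximal-* (coprime⇒comaximal p) (coprime⇒comaximal q))

  coprime-cong : ∀ {f g h} → f ≈ g → Coprime f h → Coprime g h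
  coprime-cong f≈g coprime d∣g = coprime (∣-respʳ (≈-sym f≈g) d∣g)

  coprime-modulo : ∀ {f g h} → Coprime f h → h ∣ (f - g) → Coprime g h
  coprime-modulo {f} {g} coprime h∣f-g d∣g d∣h = coprime (∣-respʳ (solve 2 (λ f g → (f :- g) :+ g := f) ≈-refl f g) (∣-+ (∣-trans d∣h h∣f-g) d∣g)) d∣h

  coprime-1 : ∀ {h} → Coprime 1# h
  coprime-1 d∣1 _ = d∣1

  coprime-divisor : ∀ {f g h} → g ∣ f → Coprime f h → Coprime g h
  coprime-divisor g∣f coprime d∣g = coprime (∣-trans d∣g g∣f)

  coprime-divisorʳ : ∀ {f g h} → g ∣ h → Coprime f h → Coprime f g
  coprime-divisorʳ g∣h coprime d∣f d∣g = coprime d∣f (∣-trans d∣g g∣h)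

  -- Irreducibility makes the gcd a unit or an associate of f. In the second case f divides g with a
  -- monic unit as quotient, which is 1.
  irreducible-coprime : ∀ {d e f g} → Monic d f → Monic e g → Irreducible f → Irreducible g → ¬ (f ≈ g) → Comaximal f g
  irreducible-coprime {d} {e} {f} {g} f-monic g-monic f-irr g-irr f≉g with Raw.Irreducible.split-∣1 f-irr (≈-trans (≈-sym (_∣ʳ_.equality gcd∣f)) (*-comm _ _))
    where open Bezout (bezout f g)
  ... | inj₁ gcd∣1 = gcd∣1⇒comaximal (bezout f g) gcd∣1
  ... | inj₂ x∣1 = ⊥-elim (f≉g f≈g)
    where
    open Bezout (bezout f g)
    f∣gcd : f ∣ gcd
    f∣gcd = divides (_∣ʳ_.quotient x∣1) (≈-trans (*-congˡ (≈-sym (_∣ʳ_.equality gcd∣f)))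
      (≈-trans (≈-sym (*-assoc _ _ _)) (≈-trans (*-congʳ (_∣ʳ_.equality x∣1)) (*-identityˡ _))))
    f∣g : f ∣ g
    f∣g = ∣-trans f∣gcd gcd∣g
    f≈g : f ≈ g
    f≈g with monic-quotient _ f (monic-cong (≈-sym (_∣ʳ_.equality f∣g)) g-monic) f-monic
      | Raw.Irreducible.split-∣1 g-irr (≈-sym (_∣ʳ_.equality f∣g))
    ... | k , _ , y-monic | inj₁ y∣1 = ≈-trans (≈-sym (≈-trans (*-congʳ (monic-zero (subst (λ k → Monic k _) (monic∣1⇒degree-0 y-monic y∣1) y-monic))) (*-identityˡ f))) (_∣ʳ_.equality f∣g)
    ... | k , _ , y-monic | inj₂ f∣1 = ⊥-elim (Raw.Irreducible.p∤1 f-irr f∣1)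

  euclid : ∀ {f g h} → Comaximal f g → f ∣ (g * h) → f ∣ h
  euclid {f} {g} {h} (a , b , eq) f∣gh = ∣-respʳ
    (≈-trans (solve 5 (λ a b f g h → a :* h :* f :+ b :* (g :* h) := (a :* f :+ b :* g) :* h) ≈-refl a b f g h) (≈-trans (*-congʳ eq) (*-identityˡ h)))
    (∣-+ (∣-* (a * h) ∣-refl) (∣-* b f∣gh))

  private
    ProperDivisor : ℕ → Carrier → ℕ → Set
    ProperDivisor d f e = ∃[ m ] (1 ℕ.≤ e × Enumeration.element (monic-enumeration e) m ∣ f)

    properDivisor? : ∀ d f → Dec (∃[ e ] (ProperDivisor d f (toℕ {d} e)))
    properDivisor? d f = Fin.any? λ e → Fin.any? λ m →
      (1 ℕ.≤? toℕ e) ×-dec divisible? _ (Enumeration.sound (monic-enumeration (toℕ e)) m) f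

    -- A nonzero factor is a unit times a monic polynomial. If neither factor is a unit, the monic
    -- associate of x has degree strictly between 0 and d, where the finite search found no divisor.
    no-divisor⇒irreducible : ∀ {d f} → 1 ℕ.≤ d → Monic d f → ¬ (∃[ e ] (ProperDivisor d f (toℕ {d} e))) → Irreducible f
    no-divisor⇒irreducible {d} {f} 1≤d monic none = record
      { p∤1 = λ f∣1 → ℕ.<-irrefl (≡.sym (monic∣1⇒degree-0 monic f∣1)) 1≤d
      ; split-∣1 = λ {x} {y} → split x y
      }
      where
      split : ∀ x y → f ≈ x * y → x ∣ 1# ⊎ y ∣ 1#
      split x y f≈xy with normalize x
      ... | inj₁ x≈0 = ⊥-elim (not-monic-0 (monic-cong (≈-trans f≈xy (≈-trans (*-congʳ x≈0) (zeroˡ y))) monic))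
      ... | inj₂ (zero  , u , v , uv≈1 , ux-monic , _) = inj₁ (divides u (monic-zero ux-monic))
      ... | inj₂ (suc e , u , v , uv≈1 , ux-monic , _) with monic-quotient (v * y) (u * x) (monic-cong f≈ monic) ux-monic
        where
        f≈ : f ≈ v * y * (u * x)
        f≈ = ≈-trans f≈xy (≈-trans (≈-sym (≈-trans (*-congʳ uv≈1) (*-identityˡ _))) (solve 4 (λ u v x y → u :* v :* (x :* y) := v :* y :* (u :* x)) ≈-refl u v x y))
      ...   | zero  , _   , vy-monic = inj₂ (divides v (monic-zero vy-monic))
      ...   | suc k , eq , vy-monic = ⊥-elim (none (Fin.fromℕ< e<d , ℕ-divisor))
        where
        e<d : suc e ℕ.< d
        e<d = ℕ.≤-trans (ℕ.s≤s (ℕ.m≤n+m (suc e) k)) (ℕ.≤-reflexive eq)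
        ux∣f : (u * x) ∣ f
        ux∣f = divides (v * y) (≈-trans (solve 4 (λ u v x y → v :* y :* (u :* x) := u :* v :* (x :* y)) ≈-refl u v x y) (≈-trans (*-congʳ uv≈1) (≈-trans (*-identityˡ _) (≈-sym f≈xy))))
        divisor : ProperDivisor d f (suc e)
        divisor = let m , eq = Enumeration.complete (monic-enumeration (suc e)) (u * x) ux-monic in m , ℕ.s≤s ℕ.z≤n , ∣-respˡ (≈-sym eq) ux∣f
        ℕ-divisor : ProperDivisor d f (toℕ (Fin.fromℕ< e<d))
        ℕ-divisor = subst (ProperDivisor d f) (≡.sym (Fin.toℕ-fromℕ< e<d)) divisor

    -- Descent to divisors of smaller degree; n is fuel above the degree.
    irreducible-factor′ : ∀ n {d} → d ℕ.< n → ∀ f → 1 ℕ.≤ d → Monic d f → ∃[ e ] ∃[ g ] (e ℕ.≤ d × Monic e g × Irreducible g × g ∣ f)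
    irreducible-factor′ (suc n) {d} (ℕ.s≤s d≤n) f 1≤d monic with properDivisor? d f
    ... | no none = d , f , ℕ.≤-refl , monic , no-divisor⇒irreducible 1≤d monic none , ∣-refl
    ... | yes (e , m , 1≤e , g∣f) with irreducible-factor′ n (ℕ.<-≤-trans (Fin.toℕ<n e) d≤n) _ 1≤e (Enumeration.sound (monic-enumeration (toℕ e)) m)
    ...   | e′ , g′ , e′≤e , g′-monic , g′-irr , g′∣g = e′ , g′ , ℕ.≤-trans e′≤e (ℕ.<⇒≤ (Fin.toℕ<n e)) , g′-monic , g′-irr , ∣-trans g′∣g g∣f

  irreducible-factor : ∀ {d} f → 1 ℕ.≤ d → Monic d f → ∃[ e ] ∃[ g ] (e ℕ.≤ d × Monic e g × Irreducible g × g ∣ f)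
  irreducible-factor {d} = irreducible-factor′ (suc d) ℕ.≤-refl

-- Sums over finite sets

module EnumerationSums (A : RawRing 0ℓ 0ℓ) (≈-isEquivalence : IsEquivalence (RawRing._≈_ A)) (S : CommutativeRing 0ℓ 0ℓ) where
  private
    module A where
      open RawRing A public
      open IsEquivalence ≈-isEquivalence public
  open CommutativeRing S
  open Algebra.Properties.Semiring.Sum semiring
  open FiniteSums S
  open Enumeration

  Σ∈ : ∀ {P} → Enumeration A P → (A.Carrier → Carrier) → Carrier
  Σ∈ e g = sum (g ∘ element e)

  Σ∈-scale : ∀ {P} (e : Enumeration A P) c g → c * Σ∈ e g ≈ Σ∈ e (λ a → c * g a)
  Σ∈-scale e c g = *-distribˡ-sum c (g ∘ element e)

  -- The bijection is a relation, total and single-valued in both directions up to equality in A. On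
  -- indices it becomes a permutation between two finite sets whose sizes are not known to agree
  -- beforehand.
  Σ∈-match : ∀ {P Q} (e : Enumeration A P) (f : Enumeration A Q) (R : A.Carrier → A.Carrier → Set) {g h} →
    (∀ {a a′ b b′} → a A.≈ a′ → b A.≈ b′ → R a b → R a′ b′) →
    (∀ a → P a → ∃[ b ] (Q b × R a b)) → (∀ b → Q b → ∃[ a ] (P a × R a b)) →
    (∀ {a b b′} → R a b → R a b′ → b A.≈ b′) → (∀ {a a′ b} → R a b → R a′ b → a A.≈ a′) →
    (∀ a b → P a → Q b → R a b → g a ≈ h b) → Σ∈ e g ≈ Σ∈ f h
  Σ∈-match e f R {g} {h} R-resp total surjective functional injective g≈h = sym (trans
      (sum-permute (h ∘ element f) (Perm.permutation to from to-from from-to))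
      (sum-cong-≋ (λ m → sym (g≈h _ _ (sound e m) (sound f (to m)) (R-to m)))))
    where
    image : ∀ m → ∃[ n ] R (element e m) (element f n)
    image m = let b , Qb , r = total _ (sound e m)
                  n , eq = complete f b Qb
              in n , R-resp A.refl (A.sym eq) r
    preimage : ∀ n → ∃[ m ] R (element e m) (element f n)
    preimage n = let a , Pa , r = surjective _ (sound f n)
                     m , eq = complete e a Pa
                 in m , R-resp (A.sym eq) A.refl r
    to : Fin (size e) → Fin (size f)
    to m = proj₁ (image m)
    from : Fin (size f) → Fin (size e)
    from n = proj₁ (preimage n)
    R-to : ∀ m → R (element e m) (element f (to m))
    R-to m = proj₂ (image m)
    R-from : ∀ n → R (element e (from n)) (element f n)
    R-from n = proj₂ (preimage n)
    to-from : ∀ n → to (from n) ≡ n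
    to-from n = distinct f (functional (R-to (from n)) (R-from n))
    from-to : ∀ m → from (to m) ≡ m
    from-to m = distinct e (injective (R-from (to m)) (R-to m))

  Σ∈-same : ∀ {P Q} (e : Enumeration A P) (f : Enumeration A Q) {g h} →
    (∀ a → P a → Q a) → (∀ a → Q a → P a) → (∀ a b → P a → Q b → a A.≈ b → g a ≈ h b) → Σ∈ e g ≈ Σ∈ f h
  Σ∈-same e f P⊆Q Q⊆P = Σ∈-match e f A._≈_
    (λ a≈a′ b≈b′ a≈b → A.trans (A.sym a≈a′) (A.trans a≈b b≈b′))
    (λ a Pa → a , P⊆Q a Pa , A.refl) (λ b Qb → b , Q⊆P b Qb , A.refl)
    (λ a≈b a≈b′ → A.trans (A.sym a≈b) a≈b′) (λ a≈b a′≈b → A.trans a≈b (A.sym a′≈b))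

  singleton : ∀ a → Enumeration A (A._≈ a)
  singleton a = record
    { size = 1 ; element = λ _ → a ; sound = λ _ → A.refl ; complete = λ b b≈a → Fin.zero , A.sym b≈a
    ; distinct = λ { {Fin.zero} {Fin.zero} _ → ≡.refl }
    }

  indicator : ∀ {X : Set} → Dec X → Carrier → Carrier
  indicator (yes _) x = x
  indicator (no  _) x = 0#

  indicator-yes : ∀ {X : Set} (X? : Dec X) {x} → X → indicator X? x ≈ x
  indicator-yes (yes _) _ = refl
  indicator-yes (no ¬x) x = ⊥-elim (¬x x)

  indicator-no : ∀ {X : Set} (X? : Dec X) {x} → ¬ X → indicator X? x ≈ 0#
  indicator-no (yes x) ¬x = ⊥-elim (¬x x)
  indicator-no (no _)  _  = refl

  module _ {Q : A.Carrier → Set} (Q? : ∀ a → Dec (Q a)) (Q-resp : ∀ {a b} → a A.≈ b → Q a → Q b) where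
    private
      -- Stated for injective families, because the induction removes index 0 and the rest of an
      -- enumeration of P no longer exhausts P.
      record Filter {n} (f : Fin n → A.Carrier) : Set where
        field
          filtered : Enumeration A (λ a → (∃[ m ] (f m A.≈ a)) × Q a)
          size≤    : size filtered ℕ.≤ n
          Σ-filter : ∀ g → Σ∈ filtered g ≈ sum (λ m → indicator (Q? (f m)) (g (f m)))

      filterFamily : ∀ {n} (f : Fin n → A.Carrier) → (∀ {i j} → f i A.≈ f j → i ≡ j) → Filter f
      filterFamily {zero} f f-injective = record
        { filtered = record { size = 0 ; element = λ () ; sound = λ () ; complete = λ { _ ((() , _) , _) } ; distinct = λ { {()} } }
        ; size≤ = ℕ.z≤n
        ; Σ-filter = λ g → refl
        }
      filterFamily {suc n} f f-injective with Q? (f Fin.zero) | filterFamily (f ∘ Fin.suc) (Fin.suc-injective ∘ f-injective)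
      ... | no ¬Q0 | record { filtered = e ; size≤ = e≤ ; Σ-filter = Σe } = record
        { filtered = record
          { size = size e ; element = element e ; distinct = distinct e
          ; sound = λ m → let (i , eq) , Qa = sound e m in (Fin.suc i , eq) , Qa
          ; complete = λ { a ((Fin.zero , eq) , Qa) → ⊥-elim (¬Q0 (Q-resp (A.sym eq) Qa))
                         ; a ((Fin.suc i , eq) , Qa) → complete e a ((i , eq) , Qa) }
          }
        ; size≤ = ℕ.m≤n⇒m≤1+n e≤
        ; Σ-filter = λ g → trans (trans (Σe g) (sym (+-identityˡ _))) (+-congʳ (sym (indicator-no (Q? (f Fin.zero)) ¬Q0)))
        }
      ... | yes Q0 | record { filtered = e ; size≤ = e≤ ; Σ-filter = Σe } = record
        { filtered = record
          { size = suc (size e)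
          ; element = element′
          ; sound = λ { Fin.zero → (Fin.zero , A.refl) , Q0 ; (Fin.suc m) → let (i , eq) , Qa = sound e m in (Fin.suc i , eq) , Qa }
          ; complete = λ { a ((Fin.zero , eq) , Qa) → Fin.zero , eq
                         ; a ((Fin.suc i , eq) , Qa) → let m , eq′ = complete e a ((i , eq) , Qa) in Fin.suc m , eq′ }
          ; distinct = distinct′
          }
        ; size≤ = ℕ.s≤s e≤
        ; Σ-filter = λ g → +-cong (sym (indicator-yes (Q? (f Fin.zero)) Q0)) (Σe g)
        }
        where
        element′ : Fin (suc (size e)) → A.Carrier
        element′ Fin.zero    = f Fin.zero
        element′ (Fin.suc m) = element e m
        new : ∀ m → ¬ (f Fin.zero A.≈ element e m)
        new m eq = let (i , eq′) , _ = sound e m in case f-injective (A.trans eq (A.sym eq′)) of λ ()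
        distinct′ : ∀ {m n} → element′ m A.≈ element′ n → m ≡ n
        distinct′ {Fin.zero}  {Fin.zero}  _  = ≡.refl
        distinct′ {Fin.zero}  {Fin.suc n} eq = ⊥-elim (new n eq)
        distinct′ {Fin.suc m} {Fin.zero}  eq = ⊥-elim (new m (A.sym eq))
        distinct′ {Fin.suc m} {Fin.suc n} eq = cong Fin.suc (distinct e eq)

    module _ {P : A.Carrier → Set} (P-resp : ∀ {a b} → a A.≈ b → P a → P b) (e : Enumeration A P) where
      private
        F : Filter (element e)
        F = filterFamily (element e) (distinct e)
        G : Enumeration A (λ a → (∃[ m ] (element e m A.≈ a)) × Q a)
        G = Filter.filtered F

      filter : Enumeration A (λ a → P a × Q a)
      filter = record
        { size = size G ; element = element G ; distinct = distinct G
        ; sound = λ m → let (i , eq) , Qa = sound G m in P-resp eq (sound e i) , Qa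
        ; complete = λ a (Pa , Qa) → complete G a (complete e a Pa , Qa)
        }

      filter-size≤ : size filter ℕ.≤ size e
      filter-size≤ = Filter.size≤ F

      Σ∈-filter : ∀ g → Σ∈ filter g ≈ Σ∈ e (λ a → indicator (Q? a) (g a))
      Σ∈-filter g = Filter.Σ-filter F g

      Σ∈-split : ∀ g → Σ∈ e g ≈ Σ∈ e (λ a → indicator (Q? a) (g a)) + Σ∈ e (λ a → indicator (¬? (Q? a)) (g a))
      Σ∈-split g = trans (sum-cong-≋ (λ m → lemma (element e m))) (∑-distrib-+ {size e} _ _)
        where
        lemma : ∀ a → g a ≈ indicator (Q? a) (g a) + indicator (¬? (Q? a)) (g a)
        lemma a with Q? a
        ... | yes _ = sym (+-identityʳ _)
        ... | no  _ = sym (+-identityˡ _)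

-- Characters and the Euler product

record AbstractCharacter (𝒫 : PolynomialRing) {R : RealNumbers} (C : ComplexField R) : Set where
  private
    module P = PolynomialArithmetic 𝒫
  open CommutativeRing (ComplexField.commutativeRing C)
  field
    ℓ           : ℕ
    {{ℓ-nonZero}} : NonZero ℓ
    𝔠           : P.Carrier
    deg         : ℕ
    𝔠-monic     : P.Monic deg 𝔠
    χ           : P.Carrier → ℤ → Carrier
    χ-cong      : ∀ {a b i j} → P.Coprime a 𝔠 → P.Coprime b 𝔠 → 𝔠 P.∣ (a P.- b) → + ℓ ℤ.∣ (i ℤ.- j) → χ a i ≈ χ b j
    χ-*         : ∀ {a b} i j → P.Coprime a 𝔠 → P.Coprime b 𝔠 → χ (a P.* b) (i ℤ.+ j) ≈ χ a i * χ b j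
    χ-1         : χ P.1# (+ 0) ≈ 1#

module CharacterSums (𝒫 : PolynomialRing) {R : RealNumbers} (C : ComplexField R) (X : AbstractCharacter 𝒫 C) where
  module P = PolynomialArithmetic 𝒫
  open ComplexAnalysis C
  open EnumerationSums P.rawRing P.isEquivalence commutativeRing public
  open Enumeration
  open AbstractCharacter X public

  -- |x|² ≤ 0 is a negation, so y ≉ 0 can be exploited: 0 < |x|² and 0 < |y|² contradict |x y|² = 0,
  -- hence 0 < |x|² would force y = 0.
  zero-product : ∀ {x y} → x * y ≈ 0# → ¬ (y ≈ 0#) → x ≈ 0#
  zero-product {x} {y} xy≈0 y≉0 = normSq-zero x λ 0<nx → y≉0 (normSq-zero y λ 0<ny →
    ℝ.<-irrefl (ℝ.≈-trans (ℝ.≈-sym normSq-0) (ℝ.≈-trans (normSq-cong (≈-sym xy≈0)) (normSq-* x y))) (ℝ.*-pos 0<nx 0<ny))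

  -- `normSq-zero` reduces equality to a negated inequality.
  ≈0-stable : ∀ {z} → ¬ ¬ (z ≈ 0#) → z ≈ 0#
  ≈0-stable {z} ¬¬z≈0 = normSq-zero z λ 0<n → ¬¬z≈0 λ z≈0 → ℝ.<-irrefl (ℝ.≈-sym (ℝ.≈-trans (normSq-cong z≈0) normSq-0)) 0<n

  private
    ℓ∣i-i : ∀ i → + ℓ ℤ.∣ (i ℤ.- i)
    ℓ∣i-i i = subst (+ ℓ ℤ.∣_) (≡.sym (ℤ.+-inverseʳ i)) (ℓ ℕ.∣0)

  χ-modulo : ∀ {a b} i → P.Coprime a 𝔠 → 𝔠 P.∣ (a P.- b) → χ a i ≈ χ b i
  χ-modulo i a⊥𝔠 𝔠∣a-b = χ-cong a⊥𝔠 (P.coprime-modulo a⊥𝔠 𝔠∣a-b) 𝔠∣a-b (ℓ∣i-i i)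

  χ-resp : ∀ {a b} i → P.Coprime a 𝔠 → a P.≈ b → χ a i ≈ χ b i
  χ-resp {a} {b} i a⊥𝔠 a≈b = χ-modulo i a⊥𝔠 (P.∣-respʳ (P.≈-sym (P.≈-trans (P.+-congʳ a≈b) (P.-‿inverseʳ b))) P.∣-0)

  -- The value at the Frobenius of the constant field extension: an ℓ-th root of unity which, with
  -- the values χ a (+ 0), determines every χ a (+ d).
  ω : Carrier
  ω = χ P.1# (+ 1)

  χ-1-nat : ∀ d → χ P.1# (+ d) ≈ ω ^ d
  χ-1-nat zero    = χ-1
  χ-1-nat (suc d) = ≈-trans (χ-resp (+ suc d) P.coprime-1 (P.≈-sym (P.*-identityˡ P.1#)))
    (≈-trans (χ-* (+ 1) (+ d) P.coprime-1 P.coprime-1) (*-congˡ (χ-1-nat d)))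

  χ-nat : ∀ {a} d → P.Coprime a 𝔠 → χ a (+ d) ≈ χ a (+ 0) * ω ^ d
  χ-nat {a} d a⊥𝔠 = ≈-trans (χ-resp (+ d) a⊥𝔠 (P.≈-sym (P.*-identityʳ a)))
    (≈-trans (χ-* (+ 0) (+ d) a⊥𝔠 P.coprime-1) (*-congˡ (χ-1-nat d)))

  ω^ℓ≈1 : ω ^ ℓ ≈ 1#
  ω^ℓ≈1 = ≈-trans (≈-sym (χ-1-nat ℓ)) (≈-trans
    (χ-cong P.coprime-1 P.coprime-1 (P.∣-respʳ (P.≈-sym (P.-‿inverseʳ P.1#)) P.∣-0) (subst (ℓ ℕ.∣_) (≡.sym (ℕ.+-identityʳ ℓ)) ℕ.∣-refl)) χ-1)

  coprime-^ : ∀ {a} → P.Coprime a 𝔠 → ∀ n → P.Coprime (a P.^ n) 𝔠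
  coprime-^ a⊥𝔠 zero    = P.coprime-1
  coprime-^ a⊥𝔠 (suc n) = P.coprime-* a⊥𝔠 (coprime-^ a⊥𝔠 n)

  χ-^ : ∀ {a} → P.Coprime a 𝔠 → ∀ n → χ (a P.^ n) (+ 0) ≈ χ a (+ 0) ^ n
  χ-^ a⊥𝔠 zero    = χ-1
  χ-^ a⊥𝔠 (suc n) = ≈-trans (χ-* (+ 0) (+ 0) a⊥𝔠 (coprime-^ a⊥𝔠 n)) (*-congˡ (χ-^ a⊥𝔠 n))

  χ-unit : ∀ {a} → P.Coprime a 𝔠 → ∃[ y ] (χ a (+ 0) * y ≈ 1#)
  χ-unit {a} a⊥𝔠 = χ x (+ 0) , ≈-trans (≈-sym (χ-* (+ 0) (+ 0) a⊥𝔠 x⊥𝔠)) (≈-trans (χ-modulo (+ 0) (P.coprime-* a⊥𝔠 x⊥𝔠) 𝔠∣ax-1) χ-1)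
    where
    com = P.coprime⇒comaximal a⊥𝔠
    x = proj₁ com
    y = proj₁ (proj₂ com)
    x⊥𝔠 : P.Coprime x 𝔠
    x⊥𝔠 = P.comaximal⇒coprime (a , y , P.≈-trans (P.+-congʳ (P.*-comm a x)) (proj₂ (proj₂ com)))
    𝔠∣ax-1 : 𝔠 P.∣ (a P.* x P.- P.1#)
    𝔠∣ax-1 = P.∣-respʳ (P.≈-trans (P.solve 4 (λ a x y c → (P.:- y) P.:* c P.:= a P.:* x P.:- (x P.:* a P.:+ y P.:* c)) P.≈-refl a x y 𝔠) (P.+-congˡ (P.-‿cong (proj₂ (proj₂ com)))))
      (P.∣-* (P.- y) P.∣-refl)

  private
    normSq-unit-root : ∀ {z} n → z ^ suc n ≈ 1# → normSq z ℝ.≈ ℝ.1#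
    normSq-unit-root {z} n eq = ℝ.^suc≈1⇒≈1 n (normSq-nonneg z) (ℝ.≈-trans (ℝ.≈-sym (normSq-^ z (suc n))) (ℝ.≈-trans (normSq-cong eq) normSq-1))

    module _ {a : P.Carrier} (a⊥𝔠 : P.Coprime a 𝔠) where
      residues = P.below-enumeration deg
      remainder : ∀ k → ∃[ m ] (𝔠 P.∣ (a P.^ k P.- element residues m))
      remainder k =
        let h , r , a^k≈ , r< = P.divide 𝔠 𝔠-monic (a P.^ k)
            m , eq = complete residues r r<
        in m , P.divides h (P.≈-trans (P.solve 2 (λ x r → x P.:= x P.:+ r P.:- r) P.≈-refl (h P.* 𝔠) r) (P.+-cong (P.≈-sym a^k≈) (P.-‿cong (P.≈-sym eq))))
      index : Fin (suc (size residues)) → Fin (size residues)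
      index k = proj₁ (remainder (toℕ k))
      collision : ∃[ i ] ∃[ j ] (i Fin.< j × index i ≡ index j)
      collision = Fin.pigeonhole (ℕ.n<1+n _) index
      N = normSq (χ a (+ 0))
      0<N : ℝ.0# ℝ.< N
      0<N = let y , eq = χ-unit a⊥𝔠 in ℝ.nonneg-unit⇒pos (normSq-nonneg _) (ℝ.≈-trans (ℝ.≈-sym (normSq-* _ y)) (ℝ.≈-trans (normSq-cong eq) normSq-1))
      N^≈ : ∀ i j → index i ≡ index j → N ℝ.^ toℕ i ℝ.≈ N ℝ.^ toℕ j
      N^≈ i j eq = ℝ.≈-trans (N^ i) (ℝ.≈-trans (normSq-cong (χ-modulo (+ 0) (coprime-^ a⊥𝔠 (toℕ i)) 𝔠∣)) (ℝ.≈-sym (N^ j)))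
        where
        N^ : ∀ k → N ℝ.^ toℕ k ℝ.≈ normSq (χ (a P.^ toℕ k) (+ 0))
        N^ k = ℝ.≈-trans (ℝ.≈-sym (normSq-^ _ (toℕ k))) (normSq-cong (≈-sym (χ-^ a⊥𝔠 (toℕ k))))
        𝔠∣ : 𝔠 P.∣ (a P.^ toℕ i P.- a P.^ toℕ j)
        𝔠∣ = P.∣-respʳ (P.solve 3 (λ x y e → (x P.:- e) P.:+ (P.:- (y P.:- e)) P.:= x P.:- y) P.≈-refl (a P.^ toℕ i) (a P.^ toℕ j) (element residues (index i)))
          (P.∣-+ (proj₂ (remainder (toℕ i))) (P.∣-neg (subst (λ m → 𝔠 P.∣ (a P.^ toℕ j P.- element residues m)) (≡.sym eq) (proj₂ (remainder (toℕ j))))))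
      -- By the pigeonhole principle two powers of a agree modulo 𝔠, so N^i = N^j with i < j, and
      -- the positive N^i cancels.
      normSq-χ₀ : N ℝ.≈ ℝ.1#
      normSq-χ₀ = from-collision (proj₁ collision) (proj₁ (proj₂ collision)) (proj₁ (proj₂ (proj₂ collision))) (proj₂ (proj₂ (proj₂ collision)))
        where
        from-collision : ∀ i j → i Fin.< j → index i ≡ index j → N ℝ.≈ ℝ.1#
        from-collision i j i<j eq = ℝ.^suc≈1⇒≈1 k (ℝ.<⇒≤ 0<N) (ℝ.*-cancelʳ (N ℝ.^ toℕ i) (RealNumbers.^-pos R 0<N (toℕ i))
          (ℝ.≈-trans (ℝ.≈-trans (ℝ.≈-sym (ℝ.^-homo-* N (suc k) (toℕ i))) (ℝ.reflexive (cong (N ℝ.^_) k+i≡j))) (ℝ.≈-trans (ℝ.≈-sym (N^≈ i j eq)) (ℝ.≈-sym (ℝ.*-identityˡ _)))))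
          where
          k = toℕ j ℕ.∸ suc (toℕ i)
          k+i≡j : suc k +ℕ toℕ i ≡ toℕ j
          k+i≡j = ≡.trans (≡.sym (ℕ.+-suc k (toℕ i))) (ℕ.m∸n+n≡m i<j)

  normSq-ω : normSq ω ℝ.≈ ℝ.1#
  normSq-ω = normSq-unit-root (ℕ.pred ℓ) (subst (λ n → ω ^ n ≈ 1#) (≡.sym (ℕ.suc-pred ℓ)) ω^ℓ≈1)

  χ≼1 : ∀ {a} d → P.Coprime a 𝔠 → χ a (+ d) ≼ ℝ.1#
  χ≼1 {a} d a⊥𝔠 = ≼-cong (≈-sym (χ-nat d a⊥𝔠)) (ℝ.*-identityˡ ℝ.1#) (≼-* (unit (normSq-χ₀ a⊥𝔠))
      (unit (ℝ.≈-trans (normSq-^ ω d) (ℝ.≈-trans (ℝ.^-congˡ d normSq-ω) (ℝ.1^n≈1 d)))))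
    where
    unit : ∀ {z} → normSq z ℝ.≈ ℝ.1# → z ≼ ℝ.1#
    unit eq = ℝ.0≤1 ∣≼∣ ℝ.≤-reflexive (ℝ.≈-trans eq (ℝ.≈-sym (ℝ.*-identityˡ ℝ.1#)))

  -- Multiplication by b modulo 𝔠 permutes the elements of Q prime to 𝔠, when
  -- they are moved only by polynomials of degree less than deg.
  orthogonality : ∀ {Q : P.Carrier → Set} → (∀ {a} r → Q a → P.DegreeBelow deg r → Q (a P.+ r)) →
    (e : Enumeration P.rawRing (λ a → Q a × P.Coprime a 𝔠)) → ∀ i →
    ¬ (∀ b → P.Coprime b 𝔠 → χ b (+ 0) ≈ 1#) → Σ∈ e (λ a → χ a i) ≈ 0#
  -- No b with χ b ≠ 1 can be exhibited. Instead, S ≉ 0 and (χ b - 1) S = 0 would make every χ b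
  -- equal to 1.
  orthogonality {Q} Q-+ e i nontrivial = ≈0-stable λ S≉0 → nontrivial λ b b⊥𝔠 →
    difference-zero (zero-product {χ b (+ 0) - 1#} {S} (≈-trans (solve 2 (λ x s → (x :- :1) :* s := x :* s :- s) ≈-refl (χ b (+ 0)) S)
      (≈-trans (+-congʳ (invariant b b⊥𝔠)) (-‿inverseʳ S))) S≉0)
    where
    S = Σ∈ e (λ a → χ a i)
    -- The representative of b a modulo 𝔠 within distance deg of a: the second condition keeps it in
    -- Q and makes it unique.
    Moved : P.Carrier → P.Carrier → P.Carrier → Set
    Moved b a a′ = 𝔠 P.∣ (a′ P.- b P.* a) × P.DegreeBelow deg (a′ P.- a)
    move : ∀ b → P.Coprime b 𝔠 → ∀ a → Q a × P.Coprime a 𝔠 → ∃[ a′ ] ((Q a′ × P.Coprime a′ 𝔠) × Moved b a a′)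
    move b b⊥𝔠 a (Qa , a⊥𝔠) =
      let h , r , eq , r< = P.divide 𝔠 𝔠-monic (b P.* a P.- a)
          ba-a′ : h P.* 𝔠 P.≈ b P.* a P.- (a P.+ r)
          ba-a′ = P.≈-trans (P.solve 2 (λ x r → x P.:= x P.:+ r P.:- r) P.≈-refl (h P.* 𝔠) r) (P.≈-trans (P.+-congʳ (P.≈-sym eq))
                   (P.solve 3 (λ b a r → b P.:* a P.:- a P.:- r P.:= b P.:* a P.:- (a P.:+ r)) P.≈-refl b a r))
          𝔠∣ = P.divides h ba-a′
      in a P.+ r , (Q-+ r Qa r< , P.coprime-modulo (P.coprime-* b⊥𝔠 a⊥𝔠) 𝔠∣) ,
         P.∣-respʳ (P.solve 2 (λ x y → P.:- (x P.:- y) P.:= y P.:- x) P.≈-refl (b P.* a) (a P.+ r)) (P.∣-neg 𝔠∣) ,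
         P.below-cong (P.solve 2 (λ a r → r P.:= a P.:+ r P.:- a) P.≈-refl a r) r<
    same : ∀ {x y} → 𝔠 P.∣ (x P.- y) → P.DegreeBelow deg (x P.- y) → x P.≈ y
    same {x} {y} 𝔠∣ below = P.≈-trans (P.solve 2 (λ x y → x P.:= x P.:- y P.:+ y) P.≈-refl x y) (P.≈-trans (P.+-congʳ (P.divisible-below 𝔠-monic 𝔠∣ below)) (P.+-identityˡ y))
    invariant : ∀ b → P.Coprime b 𝔠 → χ b (+ 0) * S ≈ S
    invariant b b⊥𝔠 = ≈-trans (Σ∈-scale e (χ b (+ 0)) (λ a → χ a i)) (Σ∈-match e e (Moved b)
      (λ a≈ a′≈ (p , r) → P.∣-respʳ (P.+-cong a′≈ (P.-‿cong (P.*-congˡ a≈))) p , P.below-cong (P.+-cong a′≈ (P.-‿cong a≈)) r)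
      (move b b⊥𝔠) back
      (λ {a} {a′} {a″} (p , r) (p′ , r′) → same
        (P.∣-respʳ (P.solve 3 (λ x y z → x P.:- z P.:+ (P.:- (y P.:- z)) P.:= x P.:- y) P.≈-refl a′ a″ (b P.* a)) (P.∣-+ p (P.∣-neg p′)))
        (P.below-cong (P.solve 3 (λ x y z → x P.:- z P.:+ (P.:- (y P.:- z)) P.:= x P.:- y) P.≈-refl a′ a″ a) (P.below-+ _ _ r (P.below-neg _ r′))))
      (λ {a} {a₁} {a′} (p , r) (p′ , r′) → same
        (P.euclid (P.coprime⇒comaximal 𝔠⊥b) (P.∣-respʳ (P.solve 4 (λ b x y z → z P.:- b P.:* y P.:+ (P.:- (z P.:- b P.:* x)) P.:= b P.:* (x P.:- y)) P.≈-refl b a a₁ a′) (P.∣-+ p′ (P.∣-neg p))))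
        (P.below-cong (P.solve 3 (λ x y z → z P.:- y P.:+ (P.:- (z P.:- x)) P.:= x P.:- y) P.≈-refl a a₁ a′) (P.below-+ _ _ r′ (P.below-neg _ r))))
      (λ a a′ (_ , a⊥𝔠) (_ , a′⊥𝔠) (p , _) → ≈-trans (≈-sym (χ-* (+ 0) i b⊥𝔠 a⊥𝔠))
        (≈-trans (reflexive (cong (χ (b P.* a)) (ℤ.+-identityˡ i))) (≈-sym (χ-modulo i a′⊥𝔠 p)))))
      where
      𝔠⊥b : P.Coprime 𝔠 b
      𝔠⊥b z∣𝔠 z∣b = b⊥𝔠 z∣b z∣𝔠
      com = P.coprime⇒comaximal b⊥𝔠
      x = proj₁ com
      y = proj₁ (proj₂ com)
      x⊥𝔠 : P.Coprime x 𝔠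
      x⊥𝔠 = P.comaximal⇒coprime (b , y , P.≈-trans (P.+-congʳ (P.*-comm b x)) (proj₂ (proj₂ com)))
      -- x inverts b modulo 𝔠, so moving a′ by x undoes the move by b.
      back : ∀ a′ → Q a′ × P.Coprime a′ 𝔠 → ∃[ a ] ((Q a × P.Coprime a 𝔠) × Moved b a a′)
      back a′ Qa′ =
        let a , Qa , p , r = move x x⊥𝔠 a′ Qa′
        in a , Qa ,
           P.∣-respʳ (P.≈-trans (P.solve 6 (λ b x y c a a′ → (y P.:* a′) P.:* c P.:+ (P.:- b) P.:* (a P.:- x P.:* a′) P.:= (x P.:* b P.:+ y P.:* c) P.:* a′ P.:- b P.:* a) P.≈-refl b x y 𝔠 a a′)
                        (P.+-congʳ (P.≈-trans (P.*-congʳ (proj₂ (proj₂ com))) (P.*-identityˡ a′))))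
             (P.∣-+ (P.∣-* (y P.* a′) P.∣-refl) (P.∣-* (P.- b) p)) ,
           P.below-cong (P.solve 2 (λ a a′ → P.:- (a P.:- a′) P.:= a′ P.:- a) P.≈-refl a a′) (P.below-neg _ r)

-- Sieving by primes and convergence of the Euler product

module Sieve (𝒫 : PolynomialRing) {R : RealNumbers} (C : ComplexField R) (X : AbstractCharacter 𝒫 C) where
  open CharacterSums 𝒫 C X
  open ComplexAnalysis C
  open Series C
  open Enumeration
  private
    module Product = Algebra.Properties.CommutativeMonoid.Sum *-commutativeMonoid

  record Primes (n : ℕ) : Set where
    field
      prime       : Fin n → P.Carrier
      degree      : Fin n → ℕ
      monic       : ∀ i → P.Monic (degree i) (prime i)
      irreducible : ∀ i → P.Irreducible (prime i)
      ∤𝔠          : ∀ i → ¬ (prime i P.∣ 𝔠)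
      distinct    : ∀ {i j} → prime i P.≈ prime j → i ≡ j

  open Primes

  tail : ∀ {n} → Primes (suc n) → Primes n
  tail ps = record
    { prime = prime ps ∘ Fin.suc ; degree = degree ps ∘ Fin.suc ; monic = monic ps ∘ Fin.suc ; irreducible = irreducible ps ∘ Fin.suc
    ; ∤𝔠 = ∤𝔠 ps ∘ Fin.suc ; distinct = Fin.suc-injective ∘ distinct ps
    }

  irreducible-∤⇒coprime : ∀ {p} → P.Irreducible p → ¬ (p P.∣ 𝔠) → P.Coprime p 𝔠
  irreducible-∤⇒coprime {p} p-irr p∤𝔠 {z} z∣p z∣𝔠 = case P.Irreducible.split-∣1 p-irr (P.≈-sym (P.∣-equality z∣p)) of λ
    { (inj₁ w∣1) → ⊥-elim (p∤𝔠 (P.∣-trans (P.divides _ (P.≈-trans (P.*-congˡ (P.≈-sym (P.∣-equality z∣p))) (P.≈-trans (P.≈-sym (P.*-assoc _ _ _)) (P.≈-trans (P.*-congʳ (P.∣-equality w∣1)) (P.*-identityˡ z))))) z∣𝔠))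
    ; (inj₂ z∣1) → z∣1 }

  Avoids : ∀ {n} → Primes n → P.Carrier → Set
  Avoids ps a = ∀ i → ¬ (prime ps i P.∣ a)

  private
    Sieved : ∀ {n} → Primes n → P.Carrier → Set
    Sieved ps a = P.Coprime a 𝔠 × Avoids ps a

    sieved? : ∀ {n} (ps : Primes n) a → Dec (Sieved ps a)
    sieved? ps a = P.coprime? a 𝔠 ×-dec Fin.all? (λ i → ¬? (P.divisible? (prime ps i) (monic ps i) a))

    sieved-resp : ∀ {n} (ps : Primes n) {a b} → a P.≈ b → Sieved ps a → Sieved ps b
    sieved-resp ps a≈b (a⊥𝔠 , avoids) = P.coprime-cong a≈b a⊥𝔠 , λ i p∣b → avoids i (P.∣-respʳ (P.≈-sym a≈b) p∣b)

  coprimeMonics : ∀ d → Enumeration P.rawRing (λ a → P.Monic d a × P.Coprime a 𝔠)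
  coprimeMonics d = filter (λ a → P.coprime? a 𝔠) P.coprime-cong P.monic-cong (P.monic-enumeration d)

  sieved : ∀ {n} (ps : Primes n) d → Enumeration P.rawRing (λ a → P.Monic d a × Sieved ps a)
  sieved ps d = filter (sieved? ps) (sieved-resp ps) P.monic-cong (P.monic-enumeration d)

  coefficient : ℕ → Carrier
  coefficient d = Σ∈ (coprimeMonics d) (λ a → χ a (+ d))

  sievedCoefficient : ∀ {n} → Primes n → ℕ → Carrier
  sievedCoefficient ps d = Σ∈ (sieved ps d) (λ a → χ a (+ d))

  sievedCoefficient-none : ∀ (ps : Primes 0) d → sievedCoefficient ps d ≈ coefficient d
  sievedCoefficient-none ps d = Σ∈-same (sieved ps d) (coprimeMonics d)
    (λ a (m , a⊥𝔠 , _) → m , a⊥𝔠) (λ a (m , a⊥𝔠) → m , a⊥𝔠 , λ ())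
    (λ a b (_ , a⊥𝔠 , _) _ a≈b → χ-resp (+ d) a⊥𝔠 a≈b)

  module _ {n} (ps : Primes (suc n)) (d : ℕ) where
    private
      p : P.Carrier
      p = prime ps Fin.zero
      dp : ℕ
      dp = degree ps Fin.zero
      p⊥𝔠 : P.Coprime p 𝔠
      p⊥𝔠 = irreducible-∤⇒coprime (irreducible ps Fin.zero) (∤𝔠 ps Fin.zero)
      p∣? : ∀ a → Dec (p P.∣ a)
      p∣? = P.divisible? p (monic ps Fin.zero)
      e : Enumeration P.rawRing (λ a → P.Monic d a × Sieved (tail ps) a)
      e = sieved (tail ps) d
      e-resp : ∀ {a b} → a P.≈ b → P.Monic d a × Sieved (tail ps) a → P.Monic d b × Sieved (tail ps) b
      e-resp a≈b (m , s) = P.monic-cong a≈b m , sieved-resp (tail ps) a≈b s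
      term : P.Carrier → Carrier
      term a = χ a (+ d)

      avoiding : Σ∈ e (λ a → indicator (¬? (p∣? a)) (term a)) ≈ sievedCoefficient ps d
      avoiding = ≈-trans (≈-sym (Σ∈-filter (λ a → ¬? (p∣? a)) p∤-resp e-resp e term))
        (Σ∈-same (filter (λ a → ¬? (p∣? a)) p∤-resp e-resp e) (sieved ps d)
          (λ a ((m , a⊥𝔠 , avoids) , p∤a) → m , a⊥𝔠 , λ { Fin.zero → p∤a ; (Fin.suc i) → avoids i })
          (λ a (m , a⊥𝔠 , avoids) → (m , a⊥𝔠 , avoids ∘ Fin.suc) , avoids Fin.zero)
          (λ a b ((_ , a⊥𝔠 , _) , _) _ a≈b → χ-resp (+ d) a⊥𝔠 a≈b))
        where
        p∤-resp : ∀ {a b} → a P.≈ b → ¬ (p P.∣ a) → ¬ (p P.∣ b)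
        p∤-resp a≈b p∤a p∣b = p∤a (P.∣-respʳ (P.≈-sym a≈b) p∣b)

      -- The multiples of p of degree d are b p with deg b = d - dp. Any other prime of the list is
      -- coprime to p, so by Euclid's lemma it divides b p only if it divides b; multiplicativity
      -- extracts χ p.
      multiples : Σ∈ e (λ a → indicator (p∣? a) (term a)) ≈ χ p (+ dp) * shift dp (sievedCoefficient (tail ps)) d
      multiples with dp ℕ.≤? d
      ... | no dp≰d = ≈-trans (sum-zero _ (λ m → indicator-no (p∣? (element e m)) (λ p∣a → dp≰d (degree≤ (sound e m) p∣a))))
          (≈-sym (≈-trans (*-congˡ (reflexive (shift-< _ (ℕ.≰⇒> dp≰d)))) (zeroʳ _)))
        where
        degree≤ : ∀ {a} → P.Monic d a × Sieved (tail ps) a → p P.∣ a → dp ℕ.≤ d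
        degree≤ (m , _) p∣a = let k , k+dp≡d , _ = P.monic-quotient _ p (P.monic-cong (P.≈-sym (P.∣-equality p∣a)) m) (monic ps Fin.zero)
          in ℕ.≤-trans (ℕ.m≤n+m dp k) (ℕ.≤-reflexive k+dp≡d)
      ... | yes dp≤d = ≈-trans (≈-sym (Σ∈-filter p∣? P.∣-respʳ e-resp e term))
          (≈-trans (Σ∈-match (filter p∣? P.∣-respʳ e-resp e) (sieved (tail ps) k) (λ a b → b P.* p P.≈ a)
             (λ a≈a′ b≈b′ eq → P.≈-trans (P.*-congʳ (P.≈-sym b≈b′)) (P.≈-trans eq a≈a′))
             quotient multiple
             cancel
             (λ eq eq′ → P.≈-trans (P.≈-sym eq) eq′)
             (λ a b ((_ , a⊥𝔠 , _) , _) (_ , b⊥𝔠 , _) eq → ≈-trans (χ-resp (+ d) a⊥𝔠 (P.≈-trans (P.≈-sym eq) (P.*-comm b p)))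
               (≈-trans (reflexive (cong (λ i → χ (p P.* b) (+ i)) (≡.sym dp+k≡d))) (χ-* (+ dp) (+ k) p⊥𝔠 b⊥𝔠))))
            (≈-trans (≈-sym (Σ∈-scale (sieved (tail ps) k) (χ p (+ dp)) (λ b → χ b (+ k))))
              (*-congˡ (reflexive (≡.trans (≡.sym (shift-+ dp (sievedCoefficient (tail ps)) k)) (cong (shift dp (sievedCoefficient (tail ps))) dp+k≡d))))))
        where
        k : ℕ
        k = d ℕ.∸ dp
        dp+k≡d : dp +ℕ k ≡ d
        dp+k≡d = ℕ.m+[n∸m]≡n dp≤d
        Multiple Quotient : P.Carrier → Set
        Multiple a = (P.Monic d a × Sieved (tail ps) a) × p P.∣ a
        Quotient b = P.Monic k b × Sieved (tail ps) b
        quotient : ∀ a → Multiple a → ∃[ b ] (Quotient b × b P.* p P.≈ a)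
        quotient a ((m , a⊥𝔠 , avoids) , p∣a) =
          let b = P.∣-quotient p∣a
              eq = P.∣-equality p∣a
              k′ , k′+dp≡d , b-monic = P.monic-quotient b p (P.monic-cong (P.≈-sym eq) m) (monic ps Fin.zero)
              k′≡k = ℕ.+-cancelʳ-≡ dp k′ k (≡.trans k′+dp≡d (≡.trans (≡.sym dp+k≡d) (ℕ.+-comm dp k)))
              b∣a = P.divides p (P.≈-trans (P.*-comm p b) eq)
          in b , (subst (λ j → P.Monic j b) k′≡k b-monic , P.coprime-divisor b∣a a⊥𝔠 , λ i p∣b → avoids i (P.∣-trans p∣b b∣a)) , eq
        multiple : ∀ b → Quotient b → ∃[ a ] (Multiple a × b P.* p P.≈ a)
        multiple b (m , b⊥𝔠 , avoids) = b P.* p ,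
          ((subst (λ j → P.Monic j (b P.* p)) (≡.trans (ℕ.+-comm k dp) dp+k≡d) (P.monic-* b p m (monic ps Fin.zero)) ,
            P.coprime-* b⊥𝔠 p⊥𝔠 ,
            λ i pᵢ∣bp → avoids i (P.euclid (P.irreducible-coprime (monic ps (Fin.suc i)) (monic ps Fin.zero) (irreducible ps (Fin.suc i)) (irreducible ps Fin.zero)
                (λ eq → case distinct ps eq of λ ())) (P.∣-respʳ (P.*-comm b p) pᵢ∣bp))) ,
           P.divides b P.≈-refl) , P.≈-refl
        cancel : ∀ {a b b′} → b P.* p P.≈ a → b′ P.* p P.≈ a → b P.≈ b′
        cancel {a} {b} {b′} eq eq′ = P.≈-trans (P.solve 2 (λ x y → x P.:= x P.:- y P.:+ y) P.≈-refl b b′)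
          (P.≈-trans (P.+-congʳ (P.multiple-below (b P.- b′) p (monic ps Fin.zero)
            (P.below-cong (P.≈-sym (P.≈-trans (P.solve 3 (λ x y p → (x P.:- y) P.:* p P.:= x P.:* p P.:- y P.:* p) P.≈-refl b b′ p) (P.≈-trans (P.+-cong eq (P.-‿cong eq′)) (P.-‿inverseʳ a)))) (P.below-0 dp))))
            (P.+-identityˡ b′))

    -- Adding p to the list discards its multiples. On generating functions this multiplies by the
    -- Euler factor 1 - χ(p) u^dp.
    sieve-step : sievedCoefficient ps d ≈ sievedCoefficient (tail ps) d - χ p (+ dp) * shift dp (sievedCoefficient (tail ps)) d
    sieve-step = ≈-trans (solve 2 (λ x y → y := (x :+ y) :- x) ≈-refl (χ p (+ dp) * shift dp (sievedCoefficient (tail ps)) d) (sievedCoefficient ps d))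
      (+-congʳ (≈-sym (≈-trans (Σ∈-split p∣? P.∣-respʳ e-resp e term) (+-cong multiples avoiding))))

  sievedCoefficient-0 : ∀ {n} (ps : Primes n) → sievedCoefficient ps 0 ≈ 1#
  sievedCoefficient-0 ps = ≈-trans (Σ∈-same (sieved ps 0) (singleton P.1#) {h = λ a → χ a (+ 0)}
      (λ a (m , _) → P.monic-zero m)
      (λ a a≈1 → P.monic-cong (P.≈-sym a≈1) P.monic-1 , P.coprime-cong (P.≈-sym a≈1) P.coprime-1 , λ i p∣a → P.Irreducible.p∤1 (irreducible ps i) (P.∣-respʳ a≈1 p∣a))
      (λ a b (_ , a⊥𝔠 , _) _ a≈b → χ-resp (+ 0) a⊥𝔠 a≈b))
    (≈-trans (+-identityʳ _) χ-1)

  -- A monic a of degree d with 1 ≤ d ≤ N has a prime factor of degree at most N. As a is prime to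
  -- 𝔠, so is that factor; hence it is in the list and a has been discarded.
  sievedCoefficient-gap : ∀ {n} (ps : Primes n) N → (∀ {e g} → e ℕ.≤ N → P.Monic e g → P.Irreducible g → ¬ (g P.∣ 𝔠) → ∃[ m ] (prime ps m P.≈ g)) →
    ∀ d → 1 ℕ.≤ d → d ℕ.≤ N → sievedCoefficient ps d ≈ 0#
  sievedCoefficient-gap ps N complete d 1≤d d≤N = sum-zero _ λ m → ⊥-elim (empty (element (sieved ps d) m) (sound (sieved ps d) m))
    where
    empty : ∀ a → P.Monic d a × Sieved ps a → ⊥
    empty a (a-monic , a⊥𝔠 , avoids) =
      let e , g , e≤d , g-monic , g-irr , g∣a = P.irreducible-factor a 1≤d a-monic
          m , eq = complete (ℕ.≤-trans e≤d d≤N) g-monic g-irr (λ g∣𝔠 → P.Irreducible.p∤1 g-irr (a⊥𝔠 g∣a g∣𝔠))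
      in avoids m (P.∣-respˡ (P.≈-sym eq) g∣a)

  -- There are q^d monic polynomials of degree d, and each value of χ has modulus at most 1.
  sievedCoefficient-≼ : ∀ {n} (ps : Primes n) d → sievedCoefficient ps d ≼ (P.q ℝ.· ℝ.1#) ℝ.^ d
  sievedCoefficient-≼ ps d = ≼-weaken
    (ℝ.≤-trans (ℝ.≤-reflexive (constant (size (sieved ps d)))) (ℝ.≤-trans (ℝ.·1-mono size≤) (ℝ.≤-reflexive (ℝ.·1-homo-^ P.q d))))
    (≼-sum {size (sieved ps d)} _ (λ _ → ℝ.1#) (λ m → χ≼1 d (proj₁ (proj₂ (sound (sieved ps d) m)))))
    where
    size≤ : size (sieved ps d) ℕ.≤ P.q ℕ.^ d
    size≤ = ℕ.≤-trans (filter-size≤ (sieved? ps) (sieved-resp ps) P.monic-cong (P.monic-enumeration d)) (ℕ.≤-reflexive (P.monic-size d))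
    constant : ∀ n → ℝ.Σ {n} (λ _ → ℝ.1#) ℝ.≈ n ℝ.· ℝ.1#
    constant zero    = ℝ.≈-refl
    constant (suc n) = ℝ.+-congˡ (constant n)

  private
    shift-* : ∀ m (t : ℕ → Carrier) u d → shift m t d * u ^ d ≈ u ^ m * shift m (λ k → t k * u ^ k) d
    shift-* zero    t u d       = ≈-sym (*-identityˡ _)
    shift-* (suc m) t u zero    = ≈-trans (zeroˡ _) (≈-sym (zeroʳ _))
    shift-* (suc m) t u (suc d) = ≈-trans (solve 3 (λ s u p → s :* (u :* p) := u :* (s :* p)) ≈-refl (shift m t d) u (u ^ d))
      (≈-trans (*-congˡ (shift-* m t u d)) (≈-sym (*-assoc _ _ _)))

  module EulerProduct {u L} (L-sum : Sums (λ d → coefficient d * u ^ d) L) where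
    eulerFactor : P.Carrier → ℕ → Carrier
    eulerFactor p d = 1# - χ p (+ d) * u ^ d

    sieved-sum : ∀ {n} (ps : Primes n) → Sums (λ d → sievedCoefficient ps d * u ^ d) (Product.sum (λ m → eulerFactor (prime ps m) (degree ps m)) * L)
    sieved-sum {zero}  ps = Sums-cong (λ d → *-congʳ {u ^ d} (≈-sym (sievedCoefficient-none ps d))) (≈-sym (*-identityˡ L)) L-sum
    sieved-sum {suc n} ps = Sums-cong
      (λ d → ≈-sym (≈-trans (*-congʳ (sieve-step ps d)) (≈-trans
        (solve 4 (λ c x s u → (c :- x :* s) :* u := c :* u :+ (:- x) :* (s :* u)) ≈-refl (c′ d) x (shift dp c′ d) (u ^ d))
        (+-congˡ (≈-trans (*-congˡ (shift-* dp c′ u d)) (≈-sym (*-assoc _ _ _)))))))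
      (solve 4 (λ x p v l → v :* l :+ (:- x :* p) :* (v :* l) := (:1 :- x :* p) :* v :* l) ≈-refl x (u ^ dp) V L)
      (Sums-+ {t} {λ d → - x * u ^ dp * shift dp t d} (sieved-sum (tail ps)) (Sums-scale {shift dp t} (- x * u ^ dp) (Sums-shift {t} dp (sieved-sum (tail ps)))))
      where
      c′ t : ℕ → Carrier
      c′ = sievedCoefficient (tail ps)
      t d = c′ d * u ^ d
      dp = degree ps Fin.zero
      x  = χ (prime ps Fin.zero) (+ dp)
      V  = Product.sum (λ m → eulerFactor (prime (tail ps) m) (degree (tail ps) m))

    -- The inverted factors times V n give L, where V n is the sieved series; it tends to 1 by
    -- `gap-series` with ratio r = q ρ, since q^d terms of size at most ρ^d occur in degree d. So
    -- `quotient-limit` applies.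
    euler-product : ∀ {ρ r y} → u ≼ ρ → r ℝ.≈ (P.q ℝ.· ℝ.1#) ℝ.* ρ → ℝ.0# ℝ.< r → ℝ.1# ℝ.< y → r ℝ.* y ℝ.≈ ℝ.1# →
      (size : ℕ → ℕ) (ps : ∀ n → Primes (size n)) →
      (∀ n {e g} → e ℕ.≤ n → P.Monic e g → P.Irreducible g → ¬ (g P.∣ 𝔠) → ∃[ m ] (prime (ps n) m P.≈ g)) →
      (1/factor : ∀ n → Fin (size n) → Carrier) →
      (∀ n m → 1/factor n m * eulerFactor (prime (ps n) m) (degree (ps n) m) ≈ 1#) →
      (λ n → Product.sum (1/factor n)) ⟶ L
    euler-product {ρ} {r} u≼ρ r≈qρ 0<r 1<y ry≈1 size ps complete 1/factor inverse = quotient-limit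
      (λ n → ≈-trans (≈-sym (*-assoc _ _ L)) (≈-trans (*-congʳ (≈-trans (≈-sym (Product.∑-distrib-+ {size n} (1/factor n) _)) (≈-trans (Product.sum-cong-≋ {size n} (inverse n)) (Product.sum-replicate-zero (size n))))) (*-identityˡ L)))
      (gap-series 0<r 1<y ry≈1 (λ n d → sievedCoefficient (ps n) d * u ^ d) (λ n → sieved-sum (ps n))
        (λ n → ≈-trans (*-identityʳ _) (sievedCoefficient-0 (ps n)))
        (λ n d 1≤d d≤n → ≈-trans (*-congʳ (sievedCoefficient-gap (ps n) n (complete n) d 1≤d d≤n)) (zeroˡ _))
        (λ n d → ≼-cong ≈-refl (ℝ.≈-trans (ℝ.≈-sym (ℝ.^-distrib-* _ _ d)) (ℝ.^-congˡ d (ℝ.≈-sym r≈qρ))) (≼-* (sievedCoefficient-≼ (ps n) d) (≼-^ u≼ρ d))))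

-- The L-function

record LogarithmTable (𝒫 : PolynomialRing) {R : RealNumbers} {C : ComplexField R} (expFunction : ExponentialFunction C) : Set where
  open ComplexAnalysis C using (module ℝ)
  open Exponential expFunction using (expᵣ)
  𝕢 : ℝ.Carrier
  𝕢 = PolynomialRing.q 𝒫 ℝ.· ℝ.1#
  field
    Λ     : ℕ → ℝ.Carrier
    exp-Λ : ∀ d → expᵣ (Λ d) ℝ.≈ 𝕢 ℝ.^ d
    1<𝕢   : ℝ.1# ℝ.< 𝕢

module LSeries {𝒫 : PolynomialRing} {R : RealNumbers} {C : ComplexField R} (X : AbstractCharacter 𝒫 C)
  {expFunction : ExponentialFunction C} (table : LogarithmTable 𝒫 expFunction) where
  open ComplexAnalysis C
  open ExponentialFunction expFunction using (exp)
  open Exponential expFunction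
  open LogarithmTable table

  open CharacterSums 𝒫 C X
  open Sieve 𝒫 C X
  open Series C
  open Differentiation C
  open ExponentialDerivative expFunction
  open Enumeration
  open Relation.Binary.Reasoning.Setoid setoid

  private
    0<𝕢 : ℝ.0# ℝ.< 𝕢
    0<𝕢 = ℝ.<-trans ℝ.0<1 1<𝕢

  -- Λ d is a logarithm of q^d chosen separately for each d; injectivity of exp ties them together.
  Λ-linear : ∀ d → Λ d ℝ.≈ (d ℝ.· ℝ.1#) ℝ.* Λ 1
  Λ-linear d = expᵣ-injective (ℝ.≈-trans (exp-Λ d) (ℝ.≈-sym (ℝ.≈-trans (expᵣ-^ (Λ 1) d) (ℝ.^-congˡ d (ℝ.≈-trans (exp-Λ 1) (ℝ.*-identityʳ 𝕢))))))

  Λ-0 : Λ 0 ℝ.≈ ℝ.0#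
  Λ-0 = ℝ.≈-trans (Λ-linear 0) (ℝ.zeroˡ _)

  -- exp δ < 𝕢 for some δ > 0, because exp δ ≤ 1 + δ + δ² exp 1.
  0<Λ1 : ℝ.0# ℝ.< Λ 1
  -- exp (Λ 1) = q > 1 by itself only refutes Λ 1 ≤ 0. Placing Λ 1 against 0 < δ, with Λ 1 < δ
  -- refuted, gives a strict inequality.
  0<Λ1 = [ id , (λ Λ<δ → ⊥-elim (ℝ.<-asym (expᵣ-mono-< Λ<δ) (ℝ.<-respʳ-≈ (ℝ.≈-sym (ℝ.≈-trans (exp-Λ 1) (ℝ.*-identityʳ 𝕢))) expδ<𝕢))) ]′ (ℝ.<-cotrans 0<δ (Λ 1))
    where
    e = expᵣ ℝ.1#
    0≤e = ℝ.<⇒≤ (expᵣ-pos ℝ.1#)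
    -- The bound makes 1 + δ (1 + e) ≤ 1 + (q - 1) / 2 < q.
    small : ∃[ a ] (ℝ.0# ℝ.< a × a ℝ.≤ ℝ.1# × a ℝ.* (ℝ.1# ℝ.+ e) ℝ.≤ ℝ.½ ℝ.* (𝕢 ℝ.- ℝ.1#))
    small = ℝ.small (ℝ.*-pos ℝ.0<½ (ℝ.<⇒0<- 1<𝕢)) (ℝ.+-nonneg ℝ.0≤1 0≤e)
    δ = proj₁ small
    0<δ : ℝ.0# ℝ.< δ
    0<δ = proj₁ (proj₂ small)
    0≤δ = ℝ.<⇒≤ 0<δ
    δ≤1 : δ ℝ.≤ ℝ.1#
    δ≤1 = proj₁ (proj₂ (proj₂ small))
    nδ≈ : normSq (real δ) ℝ.≈ δ ℝ.* δ
    nδ≈ = normSq-real δ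
    remainder≈ : normSq (exp (real δ) - 1# - real δ) ℝ.≈ (expᵣ δ ℝ.- ℝ.1# ℝ.- δ) ℝ.* (expᵣ δ ℝ.- ℝ.1# ℝ.- δ)
    remainder≈ = ℝ.≈-trans (normSq-cong (≈-sym (≈-trans (real-+ _ _) (+-cong (≈-trans (real-+ _ _) (+-cong (real-expᵣ δ) (≈-trans (real-neg _) (-‿cong real-1)))) (real-neg δ))))) (normSq-real _)
    remainder≤ : expᵣ δ ℝ.- ℝ.1# ℝ.- δ ℝ.≤ e ℝ.* (δ ℝ.* δ)
    remainder≤ = ℝ.square-cancel-≤ (ℝ.*-nonneg 0≤e (ℝ.square-nonneg δ))
      (ℝ.≤-resp remainder≈ (ℝ.≈-trans (ℝ.*-congˡ (ℝ.*-cong nδ≈ nδ≈)) (ℝ.solve 2 (λ e d → e ℝ.:* e ℝ.:* (d ℝ.:* d) ℝ.:= (e ℝ.:* d) ℝ.:* (e ℝ.:* d)) ℝ.≈-refl e (δ ℝ.* δ)))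
        (exp-quadratic (ℝ.≤-trans (ℝ.≤-reflexive nδ≈) (ℝ.≤-trans (ℝ.*-mono-≤ 0≤δ ℝ.0≤1 δ≤1 δ≤1) (ℝ.≤-reflexive (ℝ.*-identityˡ ℝ.1#))))))
    expδ≤ : expᵣ δ ℝ.≤ ℝ.1# ℝ.+ δ ℝ.* (ℝ.1# ℝ.+ e)
    expδ≤ = ℝ.≤-trans (ℝ.≤-reflexive (ℝ.solve 2 (λ x d → x ℝ.:= (x ℝ.:- ℝ.:1 ℝ.:- d) ℝ.:+ (ℝ.:1 ℝ.:+ d)) ℝ.≈-refl (expᵣ δ) δ))
      (ℝ.≤-trans (ℝ.+-monoˡ-≤ (ℝ.1# ℝ.+ δ) (ℝ.≤-trans remainder≤ (ℝ.*-monoˡ-≤ e 0≤e (ℝ.≤-trans (ℝ.*-monoˡ-≤ δ 0≤δ δ≤1) (ℝ.≤-reflexive (ℝ.*-identityʳ δ))))))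
        (ℝ.≤-reflexive (ℝ.solve 2 (λ e d → e ℝ.:* d ℝ.:+ (ℝ.:1 ℝ.:+ d) ℝ.:= ℝ.:1 ℝ.:+ d ℝ.:* (ℝ.:1 ℝ.:+ e)) ℝ.≈-refl e δ)))
    half<gap : ℝ.½ ℝ.* (𝕢 ℝ.- ℝ.1#) ℝ.< 𝕢 ℝ.- ℝ.1#
    half<gap = ℝ.<-resp (ℝ.+-identityʳ _) (ℝ.½+½ _) (ℝ.+-monoʳ-< _ (ℝ.*-pos ℝ.0<½ (ℝ.<⇒0<- 1<𝕢)))
    expδ<𝕢 : expᵣ δ ℝ.< 𝕢
    expδ<𝕢 = ℝ.≤-<-trans expδ≤ (ℝ.<-respʳ-≈ (ℝ.solve 1 (λ q → ℝ.:1 ℝ.:+ (q ℝ.:- ℝ.:1) ℝ.:= q) ℝ.≈-refl 𝕢)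
      (ℝ.+-monoʳ-< ℝ.1# (ℝ.≤-<-trans (proj₂ (proj₂ (proj₂ small))) half<gap)))

  -- q^(- d s)
  e : ℕ → Carrier → Carrier
  e d s = exp (- s * real (Λ d))

  private
    exp-^ : ∀ z d → exp (real (d ℝ.· ℝ.1#) * z) ≈ exp z ^ d
    exp-^ z zero    = ≈-trans (exp-cong (≈-trans (*-congʳ real-0) (zeroˡ z))) exp-0
    exp-^ z (suc d) = ≈-trans (exp-cong (≈-trans (*-congʳ (≈-trans (real-+ _ _) (+-congʳ real-1))) (≈-trans (distribʳ z _ _) (+-congʳ (*-identityˡ z)))))
      (≈-trans (exp-+ z _) (*-congˡ (exp-^ z d)))

  e-power : ∀ d s → e d s ≈ e 1 s ^ d
  e-power d s = ≈-trans (exp-cong (≈-trans (*-congˡ (≈-trans (real-cong (Λ-linear d)) (real-* _ _)))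
      (solve 3 (λ s d l → (:- s) :* (d :* l) := d :* ((:- s) :* l)) ≈-refl s (real (d ℝ.· ℝ.1#)) (real (Λ 1)))))
    (exp-^ _ d)

  e-0 : ∀ d → e d 0# ≈ 1#
  e-0 d = ≈-trans (exp-cong (solve 1 (λ l → (:- :0) :* l := :0) ≈-refl (real (Λ d)))) exp-0

  module HalfPlane (s : Carrier) (1<s : ℝ.1# ℝ.< re s) where
    private
      σ = re s
    -- With σ = re s these are q^(-σ) = |q^(-s)|, the ratio q^(1-σ) < 1, and its reciprocal.
    ρ r y : ℝ.Carrier
    ρ = expᵣ (ℝ.- σ ℝ.* Λ 1)
    r = 𝕢 ℝ.* ρ
    y = expᵣ ((σ ℝ.- ℝ.1#) ℝ.* Λ 1)

    e≼ρ : e 1 s ≼ ρ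
    e≼ρ = ℝ.<⇒≤ (expᵣ-pos _) ∣≼∣ ℝ.≤-reflexive (ℝ.≈-trans (normSq-exp _) (ℝ.≈-trans (expᵣ-cong (ℝ.+-cong re≈ re≈)) (expᵣ-+ _ _)))
      where
      re≈ : re (- s * real (Λ 1)) ℝ.≈ ℝ.- σ ℝ.* Λ 1
      re≈ = ℝ.≈-trans (re-real* (- s) (Λ 1)) (ℝ.*-congʳ (re-neg s))

    0<r : ℝ.0# ℝ.< r
    0<r = ℝ.*-pos 0<𝕢 (expᵣ-pos _)

    1<y : ℝ.1# ℝ.< y
    1<y = ℝ.<-respˡ-≈ expᵣ-0 (expᵣ-mono-< (ℝ.*-pos (ℝ.<⇒0<- 1<s) 0<Λ1))

    ry≈1 : r ℝ.* y ℝ.≈ ℝ.1#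
    ry≈1 = ℝ.≈-trans (ℝ.*-congʳ (ℝ.≈-trans (ℝ.*-congʳ (ℝ.≈-sym (ℝ.≈-trans (exp-Λ 1) (ℝ.*-identityʳ 𝕢)))) (ℝ.≈-sym (expᵣ-+ _ _))))
      (ℝ.≈-trans (ℝ.≈-sym (expᵣ-+ _ _)) (ℝ.≈-trans (expᵣ-cong (ℝ.solve 2 (λ s l → l ℝ.:+ (ℝ.:- s) ℝ.:* l ℝ.:+ (s ℝ.:- ℝ.:1) ℝ.:* l ℝ.:= ℝ.:0) ℝ.≈-refl σ (Λ 1))) expᵣ-0))

    r<1 : r ℝ.< ℝ.1#
    r<1 = ℝ.<-resp (ℝ.*-identityˡ r) (ℝ.≈-trans (ℝ.*-comm y r) ry≈1) (ℝ.*-monoʳ-< r 0<r 1<y)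

    ≼r⇒1-unit : ∀ {z} → z ≼ r → ∃[ w ] (w * (1# - z) ≈ 1#)
    ≼r⇒1-unit {z} z≼r = let w , eq = normSq<1⇒1-unit n<1 in w , ≈-trans (*-comm w _) eq
      where
      n<1 : normSq z ℝ.< ℝ.1#
      n<1 = ℝ.≤-<-trans (normSq≤ z≼r) (ℝ.<-respʳ-≈ (ℝ.*-identityˡ ℝ.1#) (ℝ.≤-<-trans (ℝ.*-monoˡ-≤ r (ℝ.<⇒≤ 0<r) (ℝ.<⇒≤ r<1)) (ℝ.*-monoʳ-< ℝ.1# ℝ.0<1 r<1)))

    -- |χ(𝔭) q^(-ds)| ≤ ρ^d < 1
    factor-unit : ∀ {p d} → P.Monic d p → P.Irreducible p → ¬ (p P.∣ 𝔠) → ∃[ w ] (w * (1# - χ p (+ d) * e d s) ≈ 1#)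
    factor-unit {p} {zero}  p-monic p-irr p∤𝔠 = ⊥-elim (P.Irreducible.p∤1 p-irr (P.∣-respʳ (P.monic-zero p-monic) P.∣-refl))
    factor-unit {p} {suc d} p-monic p-irr p∤𝔠 = ≼r⇒1-unit (≼-weaken ρ^≤r
        (≼-cong ≈-refl (ℝ.*-identityˡ _) (≼-* (χ≼1 (suc d) (irreducible-∤⇒coprime p-irr p∤𝔠)) (≼-cong (≈-sym (e-power (suc d) s)) ℝ.≈-refl (≼-^ e≼ρ (suc d))))))
      where
      0<ρ = expᵣ-pos (ℝ.- σ ℝ.* Λ 1)
      ρ≤r : ρ ℝ.≤ r
      ρ≤r = ℝ.≤-trans (ℝ.≤-reflexive (ℝ.≈-sym (ℝ.*-identityˡ ρ))) (ℝ.*-monoʳ-≤ ρ (ℝ.<⇒≤ 0<ρ) (ℝ.<⇒≤ 1<𝕢))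
      ρ^d≤1 : ∀ d → ρ ℝ.^ d ℝ.≤ ℝ.1#
      ρ^d≤1 zero    = ℝ.≤-refl
      ρ^d≤1 (suc d) = ℝ.≤-trans (ℝ.*-monoˡ-≤ ρ (ℝ.<⇒≤ 0<ρ) (ρ^d≤1 d)) (ℝ.≤-trans (ℝ.≤-reflexive (ℝ.*-identityʳ ρ)) (ℝ.≤-trans ρ≤r (ℝ.<⇒≤ r<1)))
      ρ^≤r : ρ ℝ.^ suc d ℝ.≤ r
      ρ^≤r = ℝ.≤-trans (ℝ.*-monoˡ-≤ ρ (ℝ.<⇒≤ 0<ρ) (ρ^d≤1 d)) (ℝ.≤-trans (ℝ.≤-reflexive (ℝ.*-identityʳ ρ)) ρ≤r)

  -- L(s) = Σ_{d < length} (numerator d) q^(-ds) / (1 - ζ q^(-s))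
  record Continuation : Set where
    field
      ζ         : Carrier
      length    : ℕ
      numerator : ℕ → Carrier
      1-ζ-unit  : ∃[ w ] (w * (1# - ζ) ≈ 1#)
      unit      : ∀ s → ℝ.1# ℝ.< re s → ∃[ w ] (w * (1# - ζ * e 1 s) ≈ 1#)
      sums      : ∀ s → ℝ.1# ℝ.< re s → ∀ {w} → w * (1# - ζ * e 1 s) ≈ 1# →
                  Sums (λ d → coefficient d * e 1 s ^ d) (Σ< length (λ d → numerator d * e d s) * w)

    N N′ D D′ : Carrier → Carrier
    N  s = Σ< length (λ d → numerator d * e d s)
    N′ s = Σ< length (λ d → numerator d * (- real (Λ d) * e d s))
    D  s = 1# + - ζ * e 1 s
    D′ s = 0# + - ζ * (- real (Λ 1) * e 1 s)

    D-inverse : ∀ s {w} → w * (1# - ζ * e 1 s) ≈ 1# → w * D s ≈ 1#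
    D-inverse s {w} = ≈-trans (solve 3 (λ w z u → w :* (:1 :+ (:- z) :* u) := w :* (:1 :- z :* u)) ≈-refl w ζ (e 1 s))

    D-unit : ∀ s → ℝ.1# ℝ.< re s → ∃[ w ] (w * D s ≈ 1# × D s * w ≈ 1#)
    D-unit s 1<s = let w , eq = unit s 1<s in w , D-inverse s eq , ≈-trans (*-comm (D s) w) (D-inverse s eq)

    D-unit-at-0 : ∃[ w ] (w * D 0# ≈ 1# × D 0# * w ≈ 1#)
    D-unit-at-0 = let w , eq = 1-ζ-unit
                      w*D≈1 = D-inverse 0# (≈-trans (*-congˡ (+-congˡ (-‿cong (≈-trans (*-congˡ (e-0 1)) (*-identityʳ ζ))))) eq)
                  in w , w*D≈1 , ≈-trans (*-comm (D 0#) w) w*D≈1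

    derivative-N : ∀ s → Derivative N s (N′ s)
    derivative-N s = derivative-Σ< length (λ d → derivative-scale (numerator d) (derivative-exp (Λ d) s))

    derivative-D : ∀ s → Derivative D s (D′ s)
    derivative-D s = derivative-+ (derivative-const 1# s) (derivative-scale (- ζ) (derivative-exp (Λ 1) s))

  continuation-nontrivial : ¬ (∀ b → P.Coprime b 𝔠 → χ b (+ 0) ≈ 1#) → Continuation
  continuation-nontrivial nontrivial = record
    -- ζ = 0 makes the denominator identically 1.
    { ζ = 0# ; length = deg ; numerator = coefficient
    ; 1-ζ-unit = 1# , solve 0 (:1 :* (:1 :- :0) := :1) ≈-refl
    ; unit = λ s _ → 1# , solve 1 (λ u → :1 :* (:1 :- :0 :* u) := :1) ≈-refl (e 1 s)
    ; sums = λ s _ {w} w-unit → let t = λ d → coefficient d * e 1 s ^ d in Sums-cong {t} {t} (λ _ → ≈-refl)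
        (≈-trans (Σ<-cong deg (λ d _ → *-congˡ {coefficient d} (≈-sym (e-power d s)))) (≈-sym (≈-trans (*-congˡ (≈-trans (solve 2 (λ w u → w := w :* (:1 :- :0 :* u)) ≈-refl w (e 1 s)) w-unit)) (*-identityʳ _))))
        (Sums-finite {t} deg (λ d deg≤d → ≈-trans (*-congʳ (vanishing d deg≤d)) (zeroˡ _)))
    }
    where
    -- For d ≥ deg, adding a polynomial of degree below deg keeps a polynomial monic of degree d,
    -- which is the invariance that `orthogonality` asks for.
    vanishing : ∀ d → deg ℕ.≤ d → coefficient d ≈ 0#
    vanishing d deg≤d = orthogonality {P.Monic d} (λ r a-monic r< → P.monic-+ _ r a-monic (P.below-mono deg≤d r<)) (coprimeMonics d) (+ d) nontrivial

  𝕢ω : Carrier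
  𝕢ω = real 𝕢 * ω

  𝕢ω^ℓ : 𝕢ω ^ ℓ ≈ real (𝕢 ℝ.^ ℓ)
  𝕢ω^ℓ = ≈-trans (^-distrib-* (real 𝕢) ω ℓ) (≈-trans (*-cong (≈-sym (real-^ 𝕢 ℓ)) ω^ℓ≈1) (*-identityʳ _))

  0<𝕢^ℓ-1 : ℝ.0# ℝ.< 𝕢 ℝ.^ ℓ ℝ.- ℝ.1#
  0<𝕢^ℓ-1 = ℝ.0<^-1 1<𝕢 ℓ

  module _ (deg≡0 : deg ≡ 0) where
    𝔠≈1 : 𝔠 P.≈ P.1#
    𝔠≈1 = P.monic-zero (subst (λ d → P.Monic d 𝔠) deg≡0 𝔠-monic)

    all-divisible : ∀ a → 𝔠 P.∣ a
    all-divisible a = P.divides a (P.≈-trans (P.*-congˡ 𝔠≈1) (P.*-identityʳ a))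

    all-coprime : ∀ a → P.Coprime a 𝔠
    all-coprime a _ z∣𝔠 = P.∣-respʳ 𝔠≈1 z∣𝔠

    χ-trivial : ∀ a d → χ a (+ d) ≈ ω ^ d
    χ-trivial a d = ≈-trans (χ-modulo (+ d) (all-coprime a) (all-divisible _)) (χ-1-nat d)

    private
      coefficient≈ : ∀ d → coefficient d ≈ 𝕢ω ^ d
      coefficient≈ d = begin
        coefficient d
          ≈⟨ Σ∈-same (coprimeMonics d) (P.monic-enumeration d) (λ _ → proj₁) (λ a m → m , all-coprime a) (λ a b _ _ _ → χ-trivial a d) ⟩
        Σ∈ (P.monic-enumeration d) (λ _ → ω ^ d)
          ≈⟨ constant (size (P.monic-enumeration d)) ⟩
        real (size (P.monic-enumeration d) ℝ.· ℝ.1#) * ω ^ d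
          ≈⟨ *-congʳ (≈-trans (reflexive (cong (λ n → real (n ℝ.· ℝ.1#)) (P.monic-size d))) (≈-trans (real-cong (ℝ.·1-homo-^ P.q d)) (real-^ 𝕢 d))) ⟩
        real 𝕢 ^ d * ω ^ d
          ≈⟨ ^-distrib-* (real 𝕢) ω d ⟨
        𝕢ω ^ d ∎
        where
        constant : ∀ n → sum {n} (λ _ → ω ^ d) ≈ real (n ℝ.· ℝ.1#) * ω ^ d
        constant zero    = ≈-sym (≈-trans (*-congʳ real-0) (zeroˡ _))
        constant (suc n) = ≈-trans (+-cong (≈-sym (*-identityˡ _)) (constant n)) (≈-trans (≈-sym (distribʳ _ _ _)) (*-congʳ (≈-sym (≈-trans (real-+ _ _) (+-congʳ real-1)))))

      𝕢ω*e≼r : ∀ s (1<s : ℝ.1# ℝ.< re s) → 𝕢ω * e 1 s ≼ HalfPlane.r s 1<s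
      𝕢ω*e≼r s 1<s = ≼-* (≼-cong ≈-refl (ℝ.*-identityʳ 𝕢) (≼-* (≼-real (ℝ.<⇒≤ 0<𝕢)) (≼-cong (≈-trans (χ-1-nat 1) (*-identityʳ ω)) ℝ.≈-refl (χ≼1 1 P.coprime-1)))) (HalfPlane.e≼ρ s 1<s)

    continuation-trivial : Continuation
    continuation-trivial = record
      { ζ = 𝕢ω ; length = 1 ; numerator = λ _ → 1#
      ; 1-ζ-unit = 1-unit
      ; unit = λ s 1<s → HalfPlane.≼r⇒1-unit s 1<s (𝕢ω*e≼r s 1<s)
      ; sums = λ s 1<s {w} w-unit → let open HalfPlane s 1<s in Sums-cong
          {λ d → (𝕢ω * e 1 s) ^ d} {λ d → coefficient d * e 1 s ^ d}
          (λ d → ≈-trans (^-distrib-* 𝕢ω (e 1 s) d) (*-congʳ {e 1 s ^ d} (≈-sym (coefficient≈ d))))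
          (≈-sym (≈-trans (*-congʳ (≈-trans (+-identityʳ _) (≈-trans (*-identityˡ _) (e-power 0 s)))) (*-identityˡ w)))
          (geometric-series 0<r 1<y ry≈1 (𝕢ω*e≼r s 1<s) (≈-trans (*-comm _ w) w-unit))
      }
      where
      -- 1 - z divides 1 - z^ℓ, which is the negative real number 1 - q^ℓ whatever the root of unity
      -- ω is.
      1-unit : ∃[ w ] (w * (1# - 𝕢ω) ≈ 1#)
      1-unit = - real y * Σ< ℓ (𝕢ω ^_) , (begin
          - real y * S * (1# - 𝕢ω)     ≈⟨ solve 3 (λ y s z → (:- y) :* s :* (:1 :- z) := (:- y) :* ((:1 :- z) :* s)) ≈-refl (real y) S 𝕢ω ⟩
          - real y * ((1# - 𝕢ω) * S)   ≈⟨ *-congˡ (geometric-sum 𝕢ω ℓ) ⟩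
          - real y * (1# - 𝕢ω ^ ℓ)     ≈⟨ solve 2 (λ y q → (:- y) :* (:1 :- q) := (q :- :1) :* y) ≈-refl (real y) (𝕢ω ^ ℓ) ⟩
          (𝕢ω ^ ℓ - 1#) * real y       ≈⟨ *-congʳ (+-cong 𝕢ω^ℓ (≈-trans (-‿cong (≈-sym real-1)) (≈-sym (real-neg _)))) ⟩
          (real (𝕢 ℝ.^ ℓ) + real (ℝ.- ℝ.1#)) * real y ≈⟨ *-congʳ (real-+ _ _) ⟨
          real (𝕢 ℝ.^ ℓ ℝ.- ℝ.1#) * real y ≈⟨ real-* _ _ ⟨
          real ((𝕢 ℝ.^ ℓ ℝ.- ℝ.1#) ℝ.* y) ≈⟨ real-cong (proj₂ (proj₂ inv)) ⟩
          real ℝ.1#                    ≈⟨ real-1 ⟩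
          1#                           ∎)
        where
        inv = ℝ.inverse⁺ 0<𝕢^ℓ-1
        y = proj₁ inv
        S = Σ< ℓ (𝕢ω ^_)

  open Complements ℓ

  module NontrivialValues (nontrivial : ¬ (∀ b → P.Coprime b 𝔠 → χ b (+ 0) ≈ 1#)) where
    open Continuation (continuation-nontrivial nontrivial)

    -- ln |𝔠 / a| for a of degree d.
    gap : ℕ → ℝ.Carrier
    gap d = ((deg ℕ.∸ d) ℝ.· ℝ.1#) ℝ.* Λ 1

    private
      Λ-gap : ∀ {d} → d ℕ.≤ deg → Λ deg ℝ.≈ Λ d ℝ.+ gap d
      Λ-gap {d} d≤deg = ℝ.≈-trans (Λ-linear deg) (ℝ.≈-trans (ℝ.*-congʳ (ℝ.≈-trans (ℝ.reflexive (cong (ℝ._· ℝ.1#) (≡.sym (ℕ.m+[n∸m]≡n d≤deg)))) (ℝ.×-homo-+ ℝ.1# d (deg ℕ.∸ d))))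
        (ℝ.≈-trans (ℝ.distribʳ _ _ _) (ℝ.+-congʳ (ℝ.≈-sym (Λ-linear d)))))

    -- L′(0) + L(0) ln|𝔠| = Σ c_d (deg 𝔠 - d) ln q
    derivative-at-0 : ∀ w → w * D 0# ≈ 1# → (N′ 0# - N 0# * w * D′ 0#) * w ≈ - (N 0# * w * real (Λ deg)) + Σ< deg (λ d → coefficient d * real (gap d))
    derivative-at-0 w wD≈1 = begin
      (N′ 0# - N 0# * w * D′ 0#) * w
        ≈⟨ *-cong (+-congˡ (-‿cong (*-congˡ D′≈0))) w≈1 ⟩
      (N′ 0# - N 0# * w * 0#) * 1#
        ≈⟨ solve 3 (λ n′ n w → (n′ :- n :* w :* :0) :* :1 := n′) ≈-refl (N′ 0#) (N 0#) w ⟩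
      N′ 0#
        ≈⟨ Σ<-cong deg termwise ⟩
      Σ< deg (λ d → - real (Λ deg) * (coefficient d * e d 0#) + coefficient d * real (gap d))
        ≈⟨ ∑-distrib-+ {deg} (λ i → - real (Λ deg) * (coefficient (toℕ i) * e (toℕ i) 0#)) _ ⟩
      Σ< deg (λ d → - real (Λ deg) * (coefficient d * e d 0#)) + G
        ≈⟨ +-congʳ (*-distribˡ-sum {deg} (- real (Λ deg)) _) ⟨
      - real (Λ deg) * N 0# + G
        ≈⟨ +-congʳ (≈-trans (solve 2 (λ l n → (:- l) :* n := :- (n :* :1 :* l)) ≈-refl (real (Λ deg)) (N 0#)) (-‿cong (*-congʳ (*-congˡ (≈-sym w≈1))))) ⟩
      - (N 0# * w * real (Λ deg)) + G ∎
      where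
      G = Σ< deg (λ d → coefficient d * real (gap d))
      w≈1 : w ≈ 1#
      w≈1 = ≈-trans (solve 2 (λ w u → w := w :* (:1 :+ (:- :0) :* u)) ≈-refl w (e 1 0#)) wD≈1
      D′≈0 : D′ 0# ≈ 0#
      D′≈0 = solve 1 (λ x → :0 :+ (:- :0) :* x := :0) ≈-refl (- real (Λ 1) * e 1 0#)
      termwise : ∀ d → d ℕ.< deg → coefficient d * (- real (Λ d) * e d 0#) ≈ - real (Λ deg) * (coefficient d * e d 0#) + coefficient d * real (gap d)
      termwise d d<deg = begin
        c * (- real (Λ d) * e d 0#)
          ≈⟨ *-congˡ (*-congˡ (e-0 d)) ⟩
        c * (- real (Λ d) * 1#)
          ≈⟨ solve 3 (λ c l g → c :* ((:- l) :* :1) := (:- (l :+ g)) :* (c :* :1) :+ c :* g) ≈-refl c (real (Λ d)) (real (gap d)) ⟩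
        - (real (Λ d) + real (gap d)) * (c * 1#) + c * real (gap d)
          ≈⟨ +-congʳ (*-cong (-‿cong (≈-trans (≈-sym (real-+ _ _)) (real-cong (ℝ.≈-sym (Λ-gap (ℕ.<⇒≤ d<deg)))))) (*-congˡ (≈-sym (e-0 d)))) ⟩
        - real (Λ deg) * (c * e d 0#) + c * real (gap d) ∎
        where c = coefficient d

    module _ (residues : Enumeration P.rawRing (λ a → P.DegreeBelow deg a × P.Coprime a 𝔠)) where
      private
        el : Fin (size residues) → P.Carrier
        el = element residues

      constant-part : ∀ (μ : Fin ℓ → ℝ.Carrier) → sum (λ m → sum {ℓ} (λ i → χ (el m) (+ (toℕ i +ℕ deg)) * real (μ i))) ≈ 0#
      constant-part μ = ≈-trans (∑-comm (λ m i → χ (el m) (+ (toℕ i +ℕ deg)) * real (μ i)))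
        (sum-zero {ℓ} _ λ i → ≈-trans (≈-sym (*-distribʳ-sum (real (μ i)) (λ m → χ (el m) (+ (toℕ i +ℕ deg)))))
          (≈-trans (*-congʳ (orthogonality {P.DegreeBelow deg} (λ r a< r< → P.below-+ _ r a< r<) residues (+ (toℕ i +ℕ deg)) nontrivial)) (zeroˡ _)))

      -- B m i is the contribution of the factor x^(-∂(x, y - 1)) of Γ*(x, y) at x = a_m / 𝔠.
      module _ (B : Fin (size residues) → Fin ℓ → ℝ.Carrier)
        (B-none : ∀ m i → (∀ d → d ℕ.< deg → ¬ P.Monic d (el m)) → B m i ℝ.≈ ℝ.0#)
        (B-off : ∀ m i d → d ℕ.< deg → P.Monic d (el m) → ¬ (ℓ ℕ.∣ ((deg ℕ.∸ d) +ℕ toℕ i)) → B m i ℝ.≈ ℝ.0#)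
        (B-on : ∀ m i d → d ℕ.< deg → P.Monic d (el m) → ℓ ℕ.∣ ((deg ℕ.∸ d) +ℕ toℕ i) → B m i ℝ.≈ gap d) where
        private
          value : P.Carrier → ℕ → Carrier
          value a d = χ a (+ d) * real (gap d)

          term : Fin (size residues) → Fin ℓ → Carrier
          term m i = χ (el m) (+ (toℕ i +ℕ deg)) * real (B m i)

          -- (i + deg) - d = (deg - d) + i is a multiple of ℓ.
          shifted : ∀ m (i : Fin ℓ) {d} → d ℕ.≤ deg → ℓ ℕ.∣ ((deg ℕ.∸ d) +ℕ toℕ i) → χ (el m) (+ (toℕ i +ℕ deg)) ≈ χ (el m) (+ d)
          shifted m i {d} d≤deg ℓ∣ = χ-cong a⊥𝔠 a⊥𝔠 (P.∣-respʳ (P.≈-sym (P.-‿inverseʳ (el m))) P.∣-0) (subst (ℓ ℕ.∣_) (≡.sym abs≡) ℓ∣)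
            where
            a⊥𝔠 = proj₂ (sound residues m)
            abs≡ : ℤ.∣ (+ (toℕ i +ℕ deg)) ℤ.- + d ∣ ≡ (deg ℕ.∸ d) +ℕ toℕ i
            abs≡ = ≡.trans (cong ℤ.∣_∣ (≡.trans (ℤ.[+m]-[+n]≡m⊖n (toℕ i +ℕ deg) d) (ℤ.⊖-≥ (ℕ.≤-trans d≤deg (ℕ.m≤n+m deg (toℕ i))))))
              (≡.trans (ℕ.+-∸-assoc (toℕ i) d≤deg) (ℕ.+-comm (toℕ i) (deg ℕ.∸ d)))

          -- For a monic of degree d exactly one i < ℓ contributes, namely the complement of deg -
          -- d, and there χ(a, i + deg) = χ(a, d). For other a both sides vanish.
          row : ∀ m → sum {ℓ} (term m) ≈ Σ< deg (λ d → indicator (P.monic? d (el m)) (value (el m) d))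
          row m with Fin.any? {deg} (λ d → P.monic? (toℕ d) (el m))
          ... | no none = ≈-trans
            (sum-zero {ℓ} (term m) (λ i → ≈-trans (*-congˡ (≈-trans (real-cong (B-none m i λ d d<deg a-monic → none (Fin.fromℕ< d<deg , subst (λ d → P.Monic d (el m)) (≡.sym (Fin.toℕ-fromℕ< d<deg)) a-monic))) real-0)) (zeroʳ _)))
            (≈-sym (sum-zero {deg} _ (λ d → indicator-no (P.monic? (toℕ d) (el m)) (λ a-monic → none (d , a-monic)))))
          ... | yes (d , a-monic) = begin
            sum {ℓ} (term m)
              ≈⟨ sum-single {ℓ} (term m) i₀ (λ i i≢i₀ → ≈-trans (*-congˡ (≈-trans (real-cong (B-off m i (toℕ d) d<deg a-monic (λ ℓ∣ → i≢i₀ (complement-unique _ i i₀ ℓ∣ ℓ∣i₀)))) real-0)) (zeroʳ _)) ⟩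
            term m i₀
              ≈⟨ *-cong (shifted m i₀ (ℕ.<⇒≤ d<deg) ℓ∣i₀) (real-cong (B-on m i₀ (toℕ d) d<deg a-monic ℓ∣i₀)) ⟩
            value (el m) (toℕ d)
              ≈⟨ indicator-yes (P.monic? (toℕ d) (el m)) a-monic ⟨
            indicator (P.monic? (toℕ d) (el m)) (value (el m) (toℕ d))
              ≈⟨ sum-single {deg} (λ j → indicator (P.monic? (toℕ j) (el m)) (value (el m) (toℕ j))) d (λ j j≢d → indicator-no (P.monic? (toℕ j) (el m)) (λ j-monic → j≢d (Fin.toℕ-injective (P.monic-unique j-monic a-monic)))) ⟨
            Σ< deg (λ d → indicator (P.monic? d (el m)) (value (el m) d)) ∎
            where
            d<deg = Fin.toℕ<n d
            i₀ = proj₁ (complement-exists (deg ℕ.∸ toℕ d))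
            ℓ∣i₀ : ℓ ℕ.∣ ((deg ℕ.∸ toℕ d) +ℕ toℕ i₀)
            ℓ∣i₀ = proj₂ (complement-exists (deg ℕ.∸ toℕ d))

          -- A monic polynomial of degree d < deg is its own residue, so the monic residues of
          -- degree d are those summed in `coefficient d`.
          column : ∀ d → d ℕ.< deg → Σ∈ residues (λ a → indicator (P.monic? d a) (value a d)) ≈ coefficient d * real (gap d)
          column d d<deg = begin
            Σ∈ residues (λ a → indicator (P.monic? d a) (value a d))
              ≈⟨ Σ∈-filter (P.monic? d) P.monic-cong residues-resp residues (λ a → value a d) ⟨
            Σ∈ monicResidues (λ a → value a d)
              ≈⟨ Σ∈-same monicResidues (coprimeMonics d) (λ a ((_ , a⊥𝔠) , m) → m , a⊥𝔠)
                   (λ a (m , a⊥𝔠) → (P.below-mono d<deg (P.monic⇒below m) , a⊥𝔠) , m)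
                   (λ a b ((_ , a⊥𝔠) , _) _ a≈b → *-congʳ (χ-resp (+ d) a⊥𝔠 a≈b)) ⟩
            Σ∈ (coprimeMonics d) (λ a → value a d)
              ≈⟨ *-distribʳ-sum (real (gap d)) (λ m → χ (element (coprimeMonics d) m) (+ d)) ⟨
            coefficient d * real (gap d) ∎
            where
            residues-resp : ∀ {a b} → a P.≈ b → P.DegreeBelow deg a × P.Coprime a 𝔠 → P.DegreeBelow deg b × P.Coprime b 𝔠
            residues-resp a≈b (a< , a⊥𝔠) = P.below-cong a≈b a< , P.coprime-cong a≈b a⊥𝔠
            monicResidues = filter (P.monic? d) P.monic-cong residues-resp residues

        bracket-part : sum (λ m → sum {ℓ} (term m)) ≈ Σ< deg (λ d → coefficient d * real (gap d))
        bracket-part = ≈-trans (sum-cong-≋ {size residues} row) (≈-trans (∑-comm (λ m d → indicator (P.monic? (toℕ {deg} d) (el m)) (value (el m) (toℕ d))))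
          (Σ<-cong deg column))

  module TrivialValues (deg≡0 : deg ≡ 0) where
    open Continuation (continuation-trivial deg≡0)

    residue-sum : (residues : Enumeration P.rawRing (λ a → P.DegreeBelow deg a × P.Coprime a 𝔠)) (μ : Fin ℓ → ℝ.Carrier) →
      sum (λ m → sum (λ i → χ (element residues m) (+ (toℕ i +ℕ deg)) * real (μ i))) ≈ sum (λ i → ω ^ toℕ i * real (μ i))
    residue-sum residues μ = ≈-trans
      (sum-cong-≋ {size residues} (λ m → sum-cong-≋ {ℓ} (λ i → *-congʳ (≈-trans (χ-trivial deg≡0 _ (toℕ i +ℕ deg)) (reflexive (cong (ω ^_) (≡.trans (cong (toℕ i +ℕ_) deg≡0) (ℕ.+-identityʳ (toℕ i)))))))))
      (≈-trans (Σ∈-same residues (singleton P.0#) {h = λ _ → sum (λ i → ω ^ toℕ i * real (μ i))}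
        (λ a (a< , _) → P.below-zero (subst (λ d → P.DegreeBelow d a) deg≡0 a<))
        (λ a a≈0 → P.below-cong (P.≈-sym a≈0) (P.below-0 deg) , all-coprime deg≡0 a)
        (λ a b _ _ _ → ≈-refl)) (+-identityʳ _))

    private
      z = 𝕢ω
      S₀ S₁ : Carrier
      S₀ = Σ< ℓ (z ^_)
      S₁ = Σ< ℓ (λ k → real (k ℝ.· ℝ.1#) * z ^ k)

      -- The operator z d/dz applied to the geometric sum, multiplied by (1 - z)² so that the
      -- induction is polynomial.
      S₁-closed : ∀ n → (1# - z) * (1# - z) * Σ< n (λ k → real (k ℝ.· ℝ.1#) * z ^ k) ≈ z * (1# - z ^ n) - real (n ℝ.· ℝ.1#) * z ^ n * (1# - z)
      S₁-closed zero    = ≈-trans (solve 1 (λ z → (:1 :- z) :* (:1 :- z) :* :0 := z :* (:1 :- :1) :- :0 :* :1 :* (:1 :- z)) ≈-refl z)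
        (+-congˡ (-‿cong (*-congʳ (*-congʳ (≈-sym real-0)))))
      S₁-closed (suc n) = begin
        (1# - z) * (1# - z) * Σ< (suc n) t
          ≈⟨ *-congˡ (Σ<-suc n t) ⟩
        (1# - z) * (1# - z) * (Σ< n t + real (n ℝ.· ℝ.1#) * z ^ n)
          ≈⟨ distribˡ _ _ _ ⟩
        (1# - z) * (1# - z) * Σ< n t + (1# - z) * (1# - z) * (real (n ℝ.· ℝ.1#) * z ^ n)
          ≈⟨ +-congʳ (S₁-closed n) ⟩
        z * (1# - z ^ n) - real (n ℝ.· ℝ.1#) * z ^ n * (1# - z) + (1# - z) * (1# - z) * (real (n ℝ.· ℝ.1#) * z ^ n)
          ≈⟨ solve 3 (λ z p n → z :* (:1 :- p) :- n :* p :* (:1 :- z) :+ (:1 :- z) :* (:1 :- z) :* (n :* p) := z :* (:1 :- z :* p) :- (:1 :+ n) :* (z :* p) :* (:1 :- z)) ≈-refl z (z ^ n) (real (n ℝ.· ℝ.1#)) ⟩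
        z * (1# - z * z ^ n) - (1# + real (n ℝ.· ℝ.1#)) * (z * z ^ n) * (1# - z)
          ≈⟨ +-congˡ (-‿cong (*-congʳ (*-congʳ (≈-trans (real-+ _ _) (+-congʳ real-1))))) ⟨
        z * (1# - z ^ suc n) - real (suc n ℝ.· ℝ.1#) * z ^ suc n * (1# - z) ∎
        where
        t : ℕ → Carrier
        t k = real (k ℝ.· ℝ.1#) * z ^ k

    -- With Q = q^ℓ: (Q - 1)² ∂ (q^c / (1 - q^ℓ)) = - (Q - 1) c q^c + ℓ Q q^c.
    module _ (∂ᵣ : Fin ℓ → ℝ.Carrier)
      (∂ᵣ-value : ∀ c → (𝕢 ℝ.^ ℓ ℝ.- ℝ.1#) ℝ.* (𝕢 ℝ.^ ℓ ℝ.- ℝ.1#) ℝ.* ∂ᵣ c ℝ.≈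
        ℝ.- ((𝕢 ℝ.^ ℓ ℝ.- ℝ.1#) ℝ.* ((toℕ c ℝ.· ℝ.1#) ℝ.* 𝕢 ℝ.^ toℕ c)) ℝ.+ (ℓ ℝ.· ℝ.1#) ℝ.* 𝕢 ℝ.^ ℓ ℝ.* 𝕢 ℝ.^ toℕ c) where
      private
        Q nℓ : Carrier
        Q = real (𝕢 ℝ.^ ℓ)
        nℓ = real (ℓ ℝ.· ℝ.1#)
        Q-1 : Carrier
        Q-1 = real (𝕢 ℝ.^ ℓ ℝ.- ℝ.1#)
        Q-1≈ : Q-1 ≈ Q - 1#
        Q-1≈ = ≈-trans (real-+ _ _) (+-congˡ (≈-trans (real-neg _) (-‿cong real-1)))
        Q-1-inverse : ∃[ y ] (Q-1 * y ≈ 1#)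
        Q-1-inverse = let y , _ , eq = ℝ.inverse⁺ 0<𝕢^ℓ-1 in real y , ≈-trans (≈-sym (real-* _ _)) (≈-trans (real-cong eq) real-1)
        T : Carrier
        T = sum (λ c → ω ^ toℕ {ℓ} c * real (∂ᵣ c))
        z^ : ∀ c → ω ^ c * real (𝕢 ℝ.^ c) ≈ z ^ c
        z^ c = ≈-trans (*-comm _ _) (≈-trans (*-congʳ (real-^ 𝕢 c)) (≈-sym (^-distrib-* (real 𝕢) ω c)))

        termwise : ∀ c → Q-1 * Q-1 * (ω ^ toℕ {ℓ} c * real (∂ᵣ c)) ≈ - Q-1 * (real (toℕ c ℝ.· ℝ.1#) * z ^ toℕ c) + nℓ * Q * z ^ toℕ c
        termwise c = begin
          Q-1 * Q-1 * (ω ^ k * real (∂ᵣ c))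
            ≈⟨ solve 3 (λ q w d → q :* q :* (w :* d) := w :* (q :* q :* d)) ≈-refl Q-1 (ω ^ k) (real (∂ᵣ c)) ⟩
          ω ^ k * (Q-1 * Q-1 * real (∂ᵣ c))
            ≈⟨ *-congˡ (≈-trans (≈-sym (≈-trans (real-* _ _) (*-congʳ (real-* _ _)))) (≈-trans (real-cong (∂ᵣ-value c))
                 (≈-trans (real-+ _ _) (+-cong (≈-trans (real-neg _) (-‿cong (≈-trans (real-* _ _) (*-congˡ (real-* _ _))))) (≈-trans (real-* _ _) (*-congʳ (real-* _ _))))))) ⟩
          ω ^ k * (- (Q-1 * (real (k ℝ.· ℝ.1#) * real (𝕢 ℝ.^ k))) + nℓ * Q * real (𝕢 ℝ.^ k))
            ≈⟨ solve 6 (λ w q n p l Q → w :* (:- (q :* (n :* p)) :+ l :* Q :* p) := (:- q) :* (n :* (w :* p)) :+ l :* Q :* (w :* p)) ≈-refl (ω ^ k) Q-1 (real (k ℝ.· ℝ.1#)) (real (𝕢 ℝ.^ k)) nℓ Q ⟩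
          - Q-1 * (real (k ℝ.· ℝ.1#) * (ω ^ k * real (𝕢 ℝ.^ k))) + nℓ * Q * (ω ^ k * real (𝕢 ℝ.^ k))
            ≈⟨ +-cong (*-congˡ (*-congˡ (z^ k))) (*-congˡ (z^ k)) ⟩
          - Q-1 * (real (k ℝ.· ℝ.1#) * z ^ k) + nℓ * Q * z ^ k ∎
          where k = toℕ c

        T-sums : Q-1 * Q-1 * T ≈ - Q-1 * S₁ + nℓ * Q * S₀
        T-sums = begin
          Q-1 * Q-1 * T
            ≈⟨ *-distribˡ-sum {ℓ} (Q-1 * Q-1) _ ⟩
          sum (λ c → Q-1 * Q-1 * (ω ^ toℕ {ℓ} c * real (∂ᵣ c)))
            ≈⟨ sum-cong-≋ {ℓ} termwise ⟩
          Σ< ℓ (λ k → - Q-1 * (real (k ℝ.· ℝ.1#) * z ^ k) + nℓ * Q * z ^ k)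
            ≈⟨ ∑-distrib-+ {ℓ} (λ i → - Q-1 * (real (toℕ i ℝ.· ℝ.1#) * z ^ toℕ i)) _ ⟩
          Σ< ℓ (λ k → - Q-1 * (real (k ℝ.· ℝ.1#) * z ^ k)) + Σ< ℓ (λ k → nℓ * Q * z ^ k)
            ≈⟨ +-cong (*-distribˡ-sum {ℓ} (- Q-1) _) (*-distribˡ-sum {ℓ} (nℓ * Q) _) ⟨
          - Q-1 * S₁ + nℓ * Q * S₀ ∎

      -- Σ ω^c ∂_c = z / (1 - z)² for z = q ω.
      ∂-sum : ∀ w → w * (1# - z) ≈ 1# → T ≈ z * w * w
      ∂-sum w w-unit = begin
        T                                ≈⟨ cancel (Q-1 * (1# - z)) (y * w) yw-unit T ⟨
        y * w * (y * w) * (Q-1 * (1# - z) * (Q-1 * (1# - z)) * T)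
          ≈⟨ *-congˡ (≈-trans (solve 3 (λ q z t → q :* (:1 :- z) :* (q :* (:1 :- z)) :* t := (:1 :- z) :* (:1 :- z) :* (q :* q :* t)) ≈-refl Q-1 z T) (≈-trans (*-congˡ T-sums) closed)) ⟩
        y * w * (y * w) * (Q-1 * Q-1 * z)
          ≈⟨ solve 4 (λ y w q z → y :* w :* (y :* w) :* (q :* q :* z) := z :* w :* w :* ((q :* y) :* (q :* y))) ≈-refl y w Q-1 z ⟩
        z * w * w * (Q-1 * y * (Q-1 * y)) ≈⟨ *-congˡ (≈-trans (*-cong yQ yQ) (*-identityˡ 1#)) ⟩
        z * w * w * 1#                   ≈⟨ *-identityʳ _ ⟩
        z * w * w                        ∎
        where
        y = proj₁ Q-1-inverse
        yQ = proj₂ Q-1-inverse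
        yw-unit : y * w * (Q-1 * (1# - z)) ≈ 1#
        yw-unit = ≈-trans (solve 4 (λ y w q z → y :* w :* (q :* (:1 :- z)) := (q :* y) :* (w :* (:1 :- z))) ≈-refl y w Q-1 z) (≈-trans (*-cong yQ w-unit) (*-identityˡ 1#))
        cancel : ∀ x v → v * x ≈ 1# → ∀ t → v * v * (x * x * t) ≈ t
        cancel x v vx≈1 t = ≈-trans (solve 3 (λ v x t → v :* v :* (x :* x :* t) := (v :* x) :* (v :* x) :* t) ≈-refl v x t) (≈-trans (*-congʳ (≈-trans (*-cong vx≈1 vx≈1) (*-identityˡ 1#))) (*-identityˡ t))
        closed : (1# - z) * (1# - z) * (- Q-1 * S₁ + nℓ * Q * S₀) ≈ Q-1 * Q-1 * z
        closed = begin
          (1# - z) * (1# - z) * (- Q-1 * S₁ + nℓ * Q * S₀)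
            ≈⟨ solve 5 (λ z q s₁ n s₀ → (:1 :- z) :* (:1 :- z) :* ((:- q) :* s₁ :+ n :* s₀) := (:- q) :* ((:1 :- z) :* (:1 :- z) :* s₁) :+ n :* (:1 :- z) :* ((:1 :- z) :* s₀)) ≈-refl z Q-1 S₁ (nℓ * Q) S₀ ⟩
          - Q-1 * ((1# - z) * (1# - z) * S₁) + nℓ * Q * (1# - z) * ((1# - z) * S₀)
            ≈⟨ +-cong (*-congˡ (≈-trans (S₁-closed ℓ) (+-cong (*-congˡ (+-congˡ (-‿cong 𝕢ω^ℓ))) (-‿cong (*-congʳ (*-congˡ 𝕢ω^ℓ))))))
                 (*-congˡ (≈-trans (geometric-sum z ℓ) (+-congˡ (-‿cong 𝕢ω^ℓ)))) ⟩
          - Q-1 * (z * (1# - Q) - nℓ * Q * (1# - z)) + nℓ * Q * (1# - z) * (1# - Q)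
            ≈⟨ solve 4 (λ p z Q n → (:- p) :* (z :* (:1 :- Q) :- n :* (:1 :- z)) :+ n :* (:1 :- z) :* (:1 :- Q) := p :* z :* (Q :- :1) :+ n :* (:1 :- z) :* (p :- (Q :- :1))) ≈-refl Q-1 z Q (nℓ * Q) ⟩
          Q-1 * z * (Q - 1#) + nℓ * Q * (1# - z) * (Q-1 - (Q - 1#))
            -- The two summands with factor ℓ Q cancel: one is the boundary term of Σ k z^k, the
            -- other comes from the second term of ∂.
            ≈⟨ +-cong (*-congˡ (≈-sym Q-1≈)) (≈-trans (*-congˡ (≈-trans (+-congʳ Q-1≈) (-‿inverseʳ _))) (zeroʳ _)) ⟩
          Q-1 * z * Q-1 + 0#
            ≈⟨ solve 2 (λ p z → p :* z :* p :+ :0 := p :* p :* z) ≈-refl Q-1 z ⟩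
          Q-1 * Q-1 * z ∎

      -- Here L = 1 / D with D = 1 - z at 0 and D′ = z ln q, so L′ = - z ln q / (1 - z)², which
      -- `∂-sum` expands; and ln |𝔠| = 0.
      derivative-at-0 : ∀ w → w * D 0# ≈ 1# →
        (N′ 0# - N 0# * w * D′ 0#) * w ≈ - (N 0# * w * real (Λ deg)) + sum (λ c → ω ^ toℕ {ℓ} c * real (ℝ.- (∂ᵣ c ℝ.* Λ 1)))
      derivative-at-0 w wD≈1 = begin
        (N′ 0# - N 0# * w * D′ 0#) * w
          ≈⟨ *-congʳ (+-cong N′≈0 (-‿cong (*-cong (*-congʳ N≈1) D′≈))) ⟩
        (0# - 1# * w * (z * real (Λ 1))) * w
          ≈⟨ solve 3 (λ w z l → (:0 :- :1 :* w :* (z :* l)) :* w := (:- l) :* (z :* w :* w)) ≈-refl w z (real (Λ 1)) ⟩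
        - real (Λ 1) * (z * w * w)
          ≈⟨ *-congˡ (∂-sum w w-unit) ⟨
        - real (Λ 1) * T
          ≈⟨ *-distribˡ-sum {ℓ} (- real (Λ 1)) _ ⟩
        sum (λ c → - real (Λ 1) * (ω ^ toℕ {ℓ} c * real (∂ᵣ c)))
          ≈⟨ sum-cong-≋ {ℓ} (λ c → ≈-trans (solve 3 (λ l w d → (:- l) :* (w :* d) := w :* (:- (d :* l))) ≈-refl (real (Λ 1)) (ω ^ toℕ c) (real (∂ᵣ c)))
               (*-congˡ (≈-sym (≈-trans (real-neg _) (-‿cong (real-* _ _)))))) ⟩
        S
          ≈⟨ +-identityˡ S ⟨
        0# + S
          ≈⟨ +-congʳ (≈-trans (-‿cong (≈-trans (*-congˡ (≈-trans (real-cong (ℝ.≈-trans (ℝ.reflexive (cong Λ deg≡0)) Λ-0)) real-0)) (zeroʳ _))) (solve 0 (:- :0 := :0) ≈-refl)) ⟨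
        - (N 0# * w * real (Λ deg)) + S ∎
        where
        S = sum (λ c → ω ^ toℕ {ℓ} c * real (ℝ.- (∂ᵣ c ℝ.* Λ 1)))
        w-unit : w * (1# - z) ≈ 1#
        w-unit = ≈-trans (*-congˡ (≈-sym (≈-trans (+-congˡ (*-congˡ (e-0 1))) (solve 1 (λ z → :1 :+ (:- z) :* :1 := :1 :- z) ≈-refl z)))) wD≈1
        N≈1 : N 0# ≈ 1#
        N≈1 = ≈-trans (+-identityʳ _) (≈-trans (*-identityˡ _) (e-0 0))
        N′≈0 : N′ 0# ≈ 0#
        N′≈0 = ≈-trans (+-identityʳ _) (≈-trans (*-identityˡ _) (≈-trans (*-congʳ (≈-trans (-‿cong (≈-trans (real-cong Λ-0) real-0)) (solve 0 (:- :0 := :0) ≈-refl))) (zeroˡ _)))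
        D′≈ : D′ 0# ≈ z * real (Λ 1)
        D′≈ = ≈-trans (+-congˡ (*-congˡ (*-congˡ (e-0 1)))) (solve 2 (λ z l → :0 :+ (:- z) :* ((:- l) :* :1) := z :* l) ≈-refl z (real (Λ 1)))

-- Degrees in k_∞ and gamma values

0<i-j⇒j<i : ∀ {i j} → + 0 ℤ.< i ℤ.- j → j ℤ.< i
0<i-j⇒j<i 0<i-j = ℤ.≰⇒> λ i≤j → ℤ.<⇒≱ 0<i-j (ℤ.i≤j⇒i-j≤0 i≤j)

i-j<0⇒i<j : ∀ {i j} → i ℤ.- j ℤ.< + 0 → i ℤ.< j
i-j<0⇒i<j i-j<0 = ℤ.≰⇒> λ j≤i → ℤ.<⇒≱ i-j<0 (ℤ.i≤j⇒0≤j-i j≤i)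

i<j⇒0<j-i : ∀ {i j} → i ℤ.< j → + 0 ℤ.< j ℤ.- i
i<j⇒0<j-i i<j = ℤ.≰⇒> λ j-i≤0 → ℤ.<⇒≱ i<j (ℤ.i-j≤0⇒i≤j j-i≤0)

i<j⇒i-j<0 : ∀ {i j} → i ℤ.< j → i ℤ.- j ℤ.< + 0
i<j⇒i-j<0 i<j = ℤ.≰⇒> λ 0≤i-j → ℤ.<⇒≱ i<j (ℤ.0≤i-j⇒j≤i 0≤i-j)

module LaurentDegrees (K : FiniteField) where
  private
    module F where
      open FiniteField K public using (inverse; 0≉1; _≟_; q; q-nonTrivial)
      open CommutativeRing (FiniteField.commutativeRing K) public
      open IntegerSolver (FiniteField.commutativeRing K) public
      open FiniteSums (FiniteField.commutativeRing K) public
      open Convolution (FiniteField.commutativeRing K) public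
      open Algebra.Properties.Semiring.Exp semiring public using (_^_)
    module ℤS = IntegerSolver ℤ.+-*-commutativeRing
    module A = Polynomial K
  open Laurent K
  open k∞

  private
    truncate : ℤ → ℕ
    truncate (+ n)    = n
    truncate -[1+ _ ] = 0

    ≤truncate : ∀ z → z ℤ.≤ + truncate z
    ≤truncate (+ n)    = ℤ.≤-refl
    ≤truncate -[1+ _ ] = ℤ.-≤+

  coeff-digit : ∀ f e j → top f ℤ.- e ≡ + j → coeff f e ≡ digit f j
  coeff-digit f e j eq with top f ℤ.- e | eq
  ... | _ | ≡.refl = ≡.refl

  coeff-above : ∀ f e → top f ℤ.< e → coeff f e ≡ F.0#
  coeff-above f e top<e with top f ℤ.- e in eq
  ... | -[1+ _ ] = ≡.refl
  ... | + j      = ⊥-elim (ℤ.<⇒≱ top<e (ℤ.0≤i-j⇒j≤i (subst (+ 0 ℤ.≤_) (≡.sym eq) (ℤ.+≤+ ℕ.z≤n))))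

  digit-coeff : ∀ f j → coeff f (top f ℤ.- + j) ≡ digit f j
  digit-coeff f j = coeff-digit f (top f ℤ.- + j) j (ℤS.solve 2 (λ t j → t ℤS.:- (t ℤS.:- j) ℤS.:= j) ≡.refl (top f) (+ j))

  record Bounded (f : k∞) (d : ℤ) : Set where
    constructor bounded
    field
      vanishes : ∀ e → d ℤ.< e → coeff f e F.≈ F.0#

  open Bounded public

  record Lead (f : k∞) (d : ℤ) (c : F.Carrier) : Set where
    constructor lead
    field
      leading : coeff f d F.≈ c
      bound   : Bounded f d

  open Lead public

  bounded-mono : ∀ {f d e} → d ℤ.≤ e → Bounded f d → Bounded f e
  bounded-mono d≤e f< = bounded λ i e<i → vanishes f< i (ℤ.≤-<-trans d≤e e<i)

  -- `top` need not be the degree, as digit 0 may vanish. A bound d forces the first top - d digits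
  -- to be 0, and `truncate` covers bounds above `top`.
  bounded-digits : ∀ {f d} → Bounded f d → ∀ i → i ℕ.< truncate (top f ℤ.- d) → digit f i F.≈ F.0#
  bounded-digits {f} {d} f< i i< = F.trans (F.reflexive (≡.sym (digit-coeff f i))) (vanishes f< _ d<)
    where
    d< : d ℤ.< top f ℤ.- + i
    d< with top f ℤ.- d in eq
    ... | + n = 0<i-j⇒j<i (subst (+ 0 ℤ.<_) (≡.trans (cong (λ z → z ℤ.- + i) (≡.sym eq)) (ℤS.solve 3 (λ t d i → t ℤS.:- d ℤS.:- i ℤS.:= t ℤS.:- i ℤS.:- d) ≡.refl (top f) d (+ i)))
                  (i<j⇒0<j-i (ℤ.+<+ i<)))

  digit-* : ∀ f g n → digit (f * g) n F.≈ F.convolution (digit f) (digit g) n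
  digit-* f g = cauchy (digit f) (digit g)
    where
    cauchy : ∀ a b n → F.Σ< (suc n) (λ j → a j F.* b (n ℕ.∸ j)) F.≈ F.convolution a b n
    cauchy a b zero    = F.+-identityʳ _
    cauchy a b (suc n) = F.+-congˡ (cauchy (a ∘ suc) b n)

  private
    index-split : ∀ s t d e → s ℤ.+ t ℤ.- (d ℤ.+ e) ≡ (s ℤ.- d) ℤ.+ (t ℤ.- e)
    index-split = ℤS.solve 4 (λ s t d e → s ℤS.:+ t ℤS.:- (d ℤS.:+ e) ℤS.:= (s ℤS.:- d) ℤS.:+ (t ℤS.:- e)) ≡.refl

    neg-swap : ∀ s d {y} → s ℤ.- d ≡ y → ℤ.- y ≡ d ℤ.- s
    neg-swap s d ≡.refl = ℤS.solve 2 (λ s d → ℤS.:- (s ℤS.:- d) ℤS.:= d ℤS.:- s) ≡.refl s d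

    vanish : ∀ f g {d e} → Bounded f d → Bounded g e → ∀ i → (top f ℤ.+ top g) ℤ.- i ℤ.< + (truncate (top f ℤ.- d) +ℕ truncate (top g ℤ.- e)) → coeff (f * g) i F.≈ F.0#
    vanish f g {d} {e} f< g< i i< with (top f ℤ.+ top g) ℤ.- i
    ... | -[1+ _ ] = F.refl
    ... | + n      = F.trans (digit-* f g n) (F.convolution-below (truncate (top f ℤ.- d)) (truncate (top g ℤ.- e)) n (bounded-digits {f} {d} f<) (bounded-digits {g} {e} g<) (ℤ.drop‿+<+ i<))

  bounded-* : ∀ f g {d e} → Bounded f d → Bounded g e → Bounded (f * g) (d ℤ.+ e)
  bounded-* f g {d} {e} f< g< = bounded λ i d+e<i → vanish f g {d} {e} f< g< i (ℤ.<-≤-trans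
    (ℤ.+-monoʳ-< (top f ℤ.+ top g) (ℤ.neg-mono-< d+e<i))
    (ℤ.≤-trans (ℤ.≤-reflexive (index-split (top f) (top g) d e)) (ℤ.+-mono-≤ (≤truncate (top f ℤ.- d)) (≤truncate (top g ℤ.- e)))))

  -- d and e are mere bounds, so either may exceed `top`; then both sides are 0. Otherwise
  -- `convolution-trailing` isolates the product of the first digits that can be nonzero.
  coeff-* : ∀ f g {d e} → Bounded f d → Bounded g e → coeff (f * g) (d ℤ.+ e) F.≈ coeff f d F.* coeff g e
  coeff-* f g {d} {e} f< g< = by-sign (top f ℤ.- d) (top g ℤ.- e) ≡.refl ≡.refl
    where
    by-sign : ∀ y z → top f ℤ.- d ≡ y → top g ℤ.- e ≡ z → coeff (f * g) (d ℤ.+ e) F.≈ coeff f d F.* coeff g e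
    by-sign (+ p) (+ q) eq eq′ = F.trans (F.reflexive (coeff-digit (f * g) (d ℤ.+ e) (p +ℕ q) (≡.trans (index-split (top f) (top g) d e) (cong₂ ℤ._+_ eq eq′))))
      (F.trans (digit-* f g (p +ℕ q)) (F.trans
        (F.convolution-trailing p q (subst (λ y → ∀ i → i ℕ.< truncate y → digit f i F.≈ F.0#) eq (bounded-digits {f} {d} f<))
                                    (subst (λ y → ∀ i → i ℕ.< truncate y → digit g i F.≈ F.0#) eq′ (bounded-digits {g} {e} g<)))
        (F.*-cong (F.reflexive (≡.sym (coeff-digit f d p eq))) (F.reflexive (≡.sym (coeff-digit g e q eq′))))))
    by-sign -[1+ p ] z eq eq′ = F.trans
      (vanish f g {d} {e} f< g< (d ℤ.+ e) (ℤ.<-≤-trans (subst (ℤ._< (+ 0 ℤ.+ z)) (≡.sym (≡.trans (index-split (top f) (top g) d e) (cong₂ ℤ._+_ eq eq′))) (ℤ.+-monoˡ-< z ℤ.-<+))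
        (subst (λ y → + 0 ℤ.+ z ℤ.≤ + (truncate (top f ℤ.- d)) ℤ.+ + truncate y) (≡.sym eq′) (ℤ.+-mono-≤ (ℤ.+≤+ ℕ.z≤n) (≤truncate z)))))
      (F.sym (F.trans (F.*-congʳ (F.reflexive (coeff-above f d (0<i-j⇒j<i (subst (+ 0 ℤ.<_) (neg-swap (top f) d eq) (ℤ.+<+ (ℕ.s≤s ℕ.z≤n))))))) (F.zeroˡ _)))
    by-sign (+ p) -[1+ q ] eq eq′ = F.trans
      (vanish f g {d} {e} f< g< (d ℤ.+ e) (ℤ.<-≤-trans (subst (ℤ._< (+ p ℤ.+ + 0)) (≡.sym (≡.trans (index-split (top f) (top g) d e) (cong₂ ℤ._+_ eq eq′))) (ℤ.+-monoʳ-< (+ p) {_} {+ 0} ℤ.-<+))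
        (subst (λ y → + p ℤ.+ + 0 ℤ.≤ + truncate y ℤ.+ + truncate (top g ℤ.- e)) (≡.sym eq) (ℤ.+-monoʳ-≤ (+ p) (ℤ.+≤+ ℕ.z≤n)))))
      (F.sym (F.trans (F.*-congˡ (F.reflexive (coeff-above g e (0<i-j⇒j<i (subst (+ 0 ℤ.<_) (neg-swap (top g) e eq′) (ℤ.+<+ (ℕ.s≤s ℕ.z≤n))))))) (F.zeroʳ _)))

  lead-* : ∀ {f g d e b c} → Lead f d b → Lead g e c → Lead (f * g) (d ℤ.+ e) (b F.* c)
  lead-* {f} {g} (lead p f<) (lead r g<) = lead (F.trans (coeff-* f g f< g<) (F.*-cong p r)) (bounded-* f g f< g<)

  lead-cong : ∀ {f d e b c} → d ≡ e → b F.≈ c → Lead f d b → Lead f e c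
  lead-cong ≡.refl b≈c (lead p f<) = lead (F.trans p b≈c) f<

  coeff-+ : ∀ f g e → coeff (f + g) e F.≈ coeff f e F.+ coeff g e
  coeff-+ f g e = by-sign (N ℤ.- e) ≡.refl
    where
    N = top f ℤ.⊔ top g
    by-sign : ∀ z → N ℤ.- e ≡ z → coeff (f + g) e F.≈ coeff f e F.+ coeff g e
    by-sign (+ j) eq = F.reflexive (≡.trans (coeff-digit (f + g) e j eq) (cong (λ i → coeff f i F.+ coeff g i)
      (≡.trans (cong (λ z → N ℤ.- z) (≡.sym eq)) (ℤS.solve 2 (λ n e → n ℤS.:- (n ℤS.:- e) ℤS.:= e) ≡.refl N e))))
    by-sign -[1+ j ] eq = F.trans (F.reflexive (coeff-above (f + g) e N<e)) (F.sym (F.trans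
      (F.+-cong (F.reflexive (coeff-above f e (ℤ.≤-<-trans (ℤ.i≤i⊔j (top f) (top g)) N<e))) (F.reflexive (coeff-above g e (ℤ.≤-<-trans (ℤ.i≤j⊔i (top f) (top g)) N<e))))
      (F.+-identityˡ _)))
      where
      N<e : N ℤ.< e
      N<e = i-j<0⇒i<j (subst (ℤ._< + 0) (≡.sym eq) ℤ.-<+)

  coeff-neg : ∀ f e → coeff (- f) e F.≈ F.- coeff f e
  coeff-neg f e with top f ℤ.- e
  ... | + _      = F.refl
  ... | -[1+ _ ] = F.solve 0 (F.:0 F.:= F.:- F.:0) F.refl

  lead-+ : ∀ {f g d e c} → e ℤ.< d → Lead f d c → Bounded g e → Lead (f + g) d c
  lead-+ {f} {g} {d} e<d (lead p f<) g< = lead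
    (F.trans (coeff-+ f g d) (F.trans (F.+-cong p (vanishes g< d e<d)) (F.+-identityʳ _)))
    (bounded λ i d<i → F.trans (coeff-+ f g i) (F.trans (F.+-cong (vanishes f< i d<i) (vanishes g< i (ℤ.<-trans e<d d<i))) (F.+-identityʳ _)))

  bounded-neg : ∀ {f d} → Bounded f d → Bounded (- f) d
  bounded-neg {f} f< = bounded λ i d<i → F.trans (coeff-neg f i) (F.trans (F.-‿cong (vanishes f< i d<i)) (F.solve 0 (F.:- F.:0 F.:= F.:0) F.refl))

  lead-monomial : ∀ c e → Lead (monomial c e) e c
  lead-monomial c e = lead (F.reflexive (coeff-digit (monomial c e) e 0 (ℤ.+-inverseʳ e))) (bounded λ i e<i → F.reflexive (coeff-above (monomial c e) i e<i))

  lead-1 : Lead 1# (+ 0) F.1#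
  lead-1 = lead-monomial F.1# (+ 0)

  lead-^ : ∀ {f d c} n → Lead f d c → Lead (f ^ n) (+ n ℤ.* d) (c F.^ n)
  lead-^ zero    f-lead = lead-1
  lead-^ {d = d} (suc n) f-lead = lead-cong (≡.sym (ℤ.suc-* (+ n) d)) F.refl (lead-* f-lead (lead-^ n f-lead))

  -- The 1-units of `k∞`. They are closed under products, inverses and limits, and contain every
  -- factor of `Π-ari` and, for |x| < 1, of `Π-geo`.
  Unital : k∞ → Set
  Unital f = Lead f (+ 0) F.1#

  unital-* : ∀ {f g} → Unital f → Unital g → Unital (f * g)
  unital-* f-unital g-unital = lead-cong ≡.refl (F.*-identityˡ F.1#) (lead-* f-unital g-unital)

  unital-^ : ∀ {f} n → Unital f → Unital (f ^ n)
  unital-^ zero    f-unital = lead-1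
  unital-^ (suc n) f-unital = unital-* f-unital (unital-^ n f-unital)

  unital-product : ∀ {n} (f : Fin n → k∞) → (∀ i → Unital (f i)) → Unital (product f)
  unital-product {zero}  f f-unital = lead-1
  unital-product {suc n} f f-unital = unital-* (f-unital Fin.zero) (unital-product (f ∘ Fin.suc) (f-unital ∘ Fin.suc))

  -- Far enough along the sequence, all coefficients in degrees at least 0 already agree with those
  -- of the limit.
  unital-limit : ∀ {u f} → ConvergesTo u f → (∀ n → Unital (u n)) → Unital f
  unital-limit u⟶f u-unital = let N , eq = u⟶f (+ 0)
                                  lead p u< = u-unital N
    in lead (F.trans (F.sym (eq N ℕ.≤-refl (+ 0) ℤ.≤-refl)) p) (bounded λ e 0<e → F.trans (F.sym (eq N ℕ.≤-refl e (ℤ.<⇒≤ 0<e))) (vanishes u< e 0<e))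

  -- The coefficients of the inverse g vanish above - d: otherwise g f would have positive degree.
  lead-inverse : ∀ {f g d b c} → b F.* c F.≈ F.1# → Lead f d c → g * f ≈ 1# → Lead g (ℤ.- d) b
  lead-inverse {f} {g} {d} {b} {c} bc≈1 f-lead gf≈1 = lead coefficient g-bounded
    where
    step : ∀ k → Bounded g (ℤ.- d ℤ.+ + suc k) → Bounded g (ℤ.- d ℤ.+ + k)
    step k g< = bounded λ e -d+k<e → above e -d+k<e
      where
      above : ∀ e → ℤ.- d ℤ.+ + k ℤ.< e → coeff g e F.≈ F.0#
      above e -d+k<e with ℤ.<-cmp e (ℤ.- d ℤ.+ + suc k)
      ... | tri> _ _ >e = vanishes g< e >e
      ... | tri< e< _ _ = ⊥-elim (ℤ.<⇒≱ -d+k<e (subst (e ℤ.≤_) pred≡ (ℤ.i<j⇒i≤pred[j] e<)))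
        where
        pred≡ : ℤ.pred (ℤ.- d ℤ.+ + suc k) ≡ ℤ.- d ℤ.+ + k
        pred≡ = ℤS.solve 2 (λ d k → (ℤS.:- ℤS.:1) ℤS.:+ (ℤS.:- d ℤS.:+ (ℤS.:1 ℤS.:+ k)) ℤS.:= ℤS.:- d ℤS.:+ k) ≡.refl d (+ k)
      ... | tri≈ _ ≡.refl _ = F.trans (F.sym (F.*-identityʳ _)) (F.trans (F.*-congˡ (F.sym (F.trans (F.*-comm c b) bc≈1)))
          (F.trans (F.sym (F.*-assoc _ c b)) (F.trans (F.*-congʳ gc≈0) (F.zeroˡ b))))
        where
        e′ = ℤ.- d ℤ.+ + suc k
        e′+d≡ : e′ ℤ.+ d ≡ + suc k
        e′+d≡ = ℤS.solve 2 (λ d k → (ℤS.:- d ℤS.:+ k) ℤS.:+ d ℤS.:= k) ≡.refl d (+ suc k)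
        -- The product is the coefficient of g f = 1 in degree e′ + d = k + 1 > 0.
        gc≈0 : coeff g e′ F.* c F.≈ F.0#
        gc≈0 = F.trans (F.*-congˡ (F.sym (leading f-lead))) (F.trans (F.sym (coeff-* g f {e′} {d} g< (bound f-lead)))
          (F.trans (gf≈1 (e′ ℤ.+ d)) (vanishes (bound lead-1) (e′ ℤ.+ d) (subst (+ 0 ℤ.<_) (≡.sym e′+d≡) (ℤ.+<+ (ℕ.s≤s ℕ.z≤n))))))
    descend : ∀ k → Bounded g (ℤ.- d ℤ.+ + k) → Bounded g (ℤ.- d)
    descend zero    g< = subst (Bounded g) (ℤ.+-identityʳ (ℤ.- d)) g<
    descend (suc k) g< = descend k (step k g<)
    g-bounded : Bounded g (ℤ.- d)
    -- The descent starts at a height not below `top g`, where vanishing is automatic.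
    g-bounded = descend (truncate (top g ℤ.+ d)) $ bounded λ e <e → F.reflexive (coeff-above g e (ℤ.≤-<-trans
      (subst (ℤ._≤ (ℤ.- d ℤ.+ + truncate (top g ℤ.+ d))) (ℤS.solve 2 (λ t d → ℤS.:- d ℤS.:+ (t ℤS.:+ d) ℤS.:= t) ≡.refl (top g) d) (ℤ.+-monoʳ-≤ (ℤ.- d) (≤truncate (top g ℤ.+ d)))) <e))
    gc≈1 : coeff g (ℤ.- d) F.* c F.≈ F.1#
    gc≈1 = F.trans (F.*-congˡ (F.sym (leading f-lead))) (F.trans (F.sym (coeff-* g f {ℤ.- d} {d} g-bounded (bound f-lead)))
      (F.trans (gf≈1 (ℤ.- d ℤ.+ d)) (F.trans (F.reflexive (cong (coeff 1#) (ℤ.+-inverseˡ d))) (leading lead-1))))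
    coefficient : coeff g (ℤ.- d) F.≈ b
    coefficient = F.trans (F.sym (F.*-identityʳ _)) (F.trans (F.*-congˡ (F.sym (F.trans (F.*-comm c b) bc≈1)))
      (F.trans (F.sym (F.*-assoc _ c b)) (F.trans (F.*-congʳ gc≈1) (F.*-identityˡ b))))

  unital-inverse : ∀ {f} → Unital f → (1/f : IsUnit f) → Unital (proj₁ 1/f)
  unital-inverse f-unital (g , gf≈1 , _) = lead-inverse (F.*-identityˡ F.1#) f-unital gf≈1

  hasDegree-lead : ∀ {f d e c} → ¬ (c F.≈ F.0#) → Lead f d c → HasDegree f e → e ≡ d
  hasDegree-lead {f} {d} {e} c≉0 (lead p f<d) (fe≉0 , f<e) with ℤ.<-cmp e d
  ... | tri< e<d _ _ = ⊥-elim (c≉0 (F.trans (F.sym p) (f<e d e<d)))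
  ... | tri≈ _ e≡d _ = e≡d
  ... | tri> _ _ d<e = ⊥-elim (fe≉0 (vanishes f<d e d<e))

  private
    coeff-0 : ∀ e → coeff 0# e F.≈ F.0#
    coeff-0 e with (+ 0) ℤ.- e
    ... | + zero    = F.refl
    ... | + suc _   = F.refl
    ... | -[1+ _ ]  = F.refl

  zero-* : ∀ f g → f ≈ 0# → f * g ≈ 0#
  zero-* f g f≈0 e = F.trans (product-zero e) (F.sym (coeff-0 e))
    where
    product-zero : ∀ e → coeff (f * g) e F.≈ F.0#
    product-zero e with (top f ℤ.+ top g) ℤ.- e
    ... | -[1+ _ ] = F.refl
    ... | + n      = F.trans (digit-* f g n) (F.convolution-zeroˡ (digit g) n (λ k →
      F.trans (F.reflexive (≡.sym (digit-coeff f k))) (F.trans (f≈0 (top f ℤ.- + k)) (coeff-0 (top f ℤ.- + k)))))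

  private
    coeff-θ* : ∀ g e → coeff ((θ^ (+ 1)) * g) (+ 1 ℤ.+ e) F.≈ coeff g e
    coeff-θ* g e = by-sign (top g ℤ.- e) ≡.refl
      where
      shift≡ : top ((θ^ (+ 1)) * g) ℤ.- (+ 1 ℤ.+ e) ≡ top g ℤ.- e
      shift≡ = ℤS.solve 2 (λ t e → ℤS.:1 ℤS.:+ t ℤS.:- (ℤS.:1 ℤS.:+ e) ℤS.:= t ℤS.:- e) ≡.refl (top g) e
      by-sign : ∀ z → top g ℤ.- e ≡ z → coeff ((θ^ (+ 1)) * g) (+ 1 ℤ.+ e) F.≈ coeff g e
      by-sign (+ j) eq = F.trans (F.reflexive (coeff-digit ((θ^ (+ 1)) * g) (+ 1 ℤ.+ e) j (≡.trans shift≡ eq)))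
        (F.trans (digit-* (θ^ (+ 1)) g j) (F.trans (F.convolution-constantˡ (digit g) j (λ _ → F.refl)) (F.trans (F.*-identityˡ _) (F.reflexive (≡.sym (coeff-digit g e j eq))))))
      by-sign -[1+ j ] eq = F.trans (F.reflexive (coeff-above ((θ^ (+ 1)) * g) (+ 1 ℤ.+ e) (i-j<0⇒i<j (subst (ℤ._< + 0) (≡.sym (≡.trans shift≡ eq)) ℤ.-<+))))
        (F.reflexive (≡.sym (coeff-above g e (i-j<0⇒i<j (subst (ℤ._< + 0) (≡.sym eq) ℤ.-<+)))))

  eval-coeff : ∀ a i → coeff (a ⟨θ⟩) (+ i) F.≈ A.coeff a i
  eval-coeff-neg : ∀ a i → coeff (a ⟨θ⟩) -[1+ i ] F.≈ F.0#

  eval-coeff []      i       = coeff-0 (+ i)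
  eval-coeff (c ∷ a) zero    = F.trans (coeff-+ (monomial c (+ 0)) ((θ^ (+ 1)) * (a ⟨θ⟩)) (+ 0))
    (F.trans (F.+-cong (leading (lead-monomial c (+ 0))) (F.trans (coeff-θ* (a ⟨θ⟩) -[1+ 0 ]) (eval-coeff-neg a 0))) (F.+-identityʳ c))
  eval-coeff (c ∷ a) (suc i) = F.trans (coeff-+ (monomial c (+ 0)) ((θ^ (+ 1)) * (a ⟨θ⟩)) (+ suc i))
    (F.trans (F.+-cong (vanishes (bound (lead-monomial c (+ 0))) (+ suc i) (ℤ.+<+ (ℕ.s≤s ℕ.z≤n))) (F.trans (coeff-θ* (a ⟨θ⟩) (+ i)) (eval-coeff a i))) (F.+-identityˡ _))

  eval-coeff-neg []      i = coeff-0 -[1+ i ]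
  eval-coeff-neg (c ∷ a) i = F.trans (coeff-+ (monomial c (+ 0)) ((θ^ (+ 1)) * (a ⟨θ⟩)) -[1+ i ])
    (F.trans (F.+-congˡ (F.trans (coeff-θ* (a ⟨θ⟩) -[1+ suc i ]) (eval-coeff-neg a (suc i)))) (F.+-identityʳ _))

  lead-eval : ∀ {d c} a → A.coeff a d F.≈ c → A.DegreeBelow (suc d) a → Lead (a ⟨θ⟩) (+ d) c
  lead-eval a ad≈c a< = lead (F.trans (eval-coeff a _) ad≈c) (bounded λ { (+ i) (ℤ.+<+ d<i) → F.trans (eval-coeff a i) (a< i d<i) })

  eval-zero : ∀ a → a A.≈ A.0# → (a ⟨θ⟩) ≈ 0#
  eval-zero a a≈0 (+ i)    = F.trans (eval-coeff a i) (F.trans (a≈0 i) (F.sym (coeff-0 (+ i))))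
  eval-zero a a≈0 -[1+ i ] = F.trans (eval-coeff-neg a i) (F.sym (coeff-0 -[1+ i ]))

module GammaDegrees (K : FiniteField) (ℓ : ℕ) {{_ : NonZero ℓ}} where
  open LaurentDegrees K
  open Laurent K
  open Gamma K ℓ
  private
    module F where
      open FiniteField K public using (inverse; 0≉1; _≟_; q; q-nonTrivial)
      open CommutativeRing (FiniteField.commutativeRing K) public
      open Algebra.Properties.Semiring.Exp semiring public using (_^_; ^-congˡ)
      open Algebra.Properties.CommutativeSemiring.Exp commutativeSemiring public using (^-distrib-*)
    module A = Polynomial K
    1≉0 : ¬ (F.1# F.≈ F.0#)
    1≉0 = F.0≉1 ∘ F.sym

  -- For j < m the exponent q^j - q^m is negative, so each factor is 1 plus a term of negative
  -- degree.
  unital-Π-ari : ∀ {y} (Π : Π-ari y) → Unital (Π-ari.value Π)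
  unital-Π-ari {y} Π = unital-limit (Π-ari.limit Π) λ n → unital-product {n} _ λ i →
    unital-^ (y (suc (toℕ i))) (unital-product {suc (toℕ i)} _ λ j → factor (Fin.toℕ<n j))
    where
    factor : ∀ {j m} → j ℕ.< m → Unital (1# - (θ^ ((+ (F.q ℕ.^ j)) ℤ.- (+ (F.q ℕ.^ m)))))
    factor {j} {m} j<m = lead-+ (i<j⇒i-j<0 (ℤ.+<+ (ℕ.^-monoʳ-< F.q (ℕ.nonTrivial⇒n>1 F.q) j<m))) lead-1
      (bounded-neg {θ^ ((+ (F.q ℕ.^ j)) ℤ.- (+ (F.q ℕ.^ m)))} (bound (lead-monomial F.1# _)))

  -- |1 + x / a| = 1 because |x| < 1 ≤ |a|.
  unital-Π-geo : ∀ {x y} → Bounded x -[1+ 0 ] → (Π : Π-geo x y) → Unital (Π-geo.value Π)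
  unital-Π-geo {x} {y} x< Π = unital-limit limit λ n → unital-product {n} _ λ i → unital-product _ λ m →
    unital-^ (y (toℕ i)) (unital-inverse (1+x/a (toℕ i) m) (factor (toℕ i) m))
    where
    open Π-geo Π
    1+x/a : ∀ i m → Unital (1# + x * proj₁ (1/a i m))
    1+x/a i m = lead-+ {e = -[1+ 0 ]} ℤ.-<+ lead-1 (bounded-mono {x * proj₁ (1/a i m)} (ℤ.i-j≤i -[1+ 0 ] (+ i)) (bounded-* x (proj₁ (1/a i m)) {_} {ℤ.- + i} x< (bound 1/a-lead)))
      where
      a-monic = Enumeration.sound (monics i) m
      1/a-lead : Lead (proj₁ (1/a i m)) (ℤ.- + i) F.1#
      1/a-lead = lead-inverse (F.*-identityˡ F.1#) (lead-eval (a i m) (proj₁ a-monic) (proj₂ a-monic)) (proj₁ (proj₂ (1/a i m)))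

  private
    sum-applyUpTo-zero : ∀ (f : ℕ → ℕ) g n → (∀ k → k ℕ.< n → f (g k) ≡ 0) → List.foldr _+ℕ_ 0 (List.map f (List.applyUpTo g n)) ≡ 0
    sum-applyUpTo-zero f g zero    h = ≡.refl
    sum-applyUpTo-zero f g (suc n) h = cong₂ _+ℕ_ (h 0 (ℕ.s≤s ℕ.z≤n)) (sum-applyUpTo-zero f (g ∘ suc) n (λ k k<n → h (suc k) (ℕ.s≤s k<n)))

    sum-applyUpTo-single : ∀ (f : ℕ → ℕ) g n k → k ℕ.< n → (∀ j → j ≢ k → f (g j) ≡ 0) → List.foldr _+ℕ_ 0 (List.map f (List.applyUpTo g n)) ≡ f (g k)
    sum-applyUpTo-single f g (suc n) zero    _           h = ≡.trans (cong (f (g 0) +ℕ_) (sum-applyUpTo-zero f (g ∘ suc) n (λ k _ → h (suc k) λ ()))) (ℕ.+-identityʳ _)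
    sum-applyUpTo-single f g (suc n) (suc k) (ℕ.s≤s k<n) h = cong₂ _+ℕ_ (h 0 λ ()) (sum-applyUpTo-single f (g ∘ suc) n k k<n (λ j j≢k → h (suc j) (j≢k ∘ ℕ.suc-injective)))

    if-yes : ∀ {X : Set} (X? : Dec X) {u v : ℕ} → X → (if does X? then u else v) ≡ u
    if-yes (yes _) _ = ≡.refl
    if-yes (no ¬x) x = ⊥-elim (¬x x)

    if-no : ∀ {X : Set} (X? : Dec X) {u v : ℕ} → ¬ X → (if does X? then u else v) ≡ v
    if-no (yes x) ¬x = ⊥-elim (¬x x)
    if-no (no _)  _  = ≡.refl

  module _ {x N c} (c≉0 : ¬ (c F.≈ F.0#)) (x-lead : Lead x -[1+ N ] c) where
    private
      first? : ∀ n → Dec ((∀ (j : Fin n) → ε x (suc (toℕ j)) F.≈ F.0#) × (ε x (suc n) F.≈ F.1#))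
      first? n = Fin.all? {n} (λ j → ε x (suc (toℕ j)) F.≟ F.0#) ×-dec (ε x (suc n) F.≟ F.1#)

      ε-below : ∀ {n} → n ℕ.< N → ε x (suc n) F.≈ F.0#
      ε-below n<N = vanishes (bound x-lead) _ (ℤ.-<- n<N)

      -- `⟨ x ⟩ n` asks that the first nonzero digit be the one at n + 1, but that digit sits at N +
      -- 1: for n < N the digit tested is 0, for n > N the digit at N + 1 spoils the initial zeros.
      bracket-other : ∀ n → n ≢ N → ⟨ x ⟩ n ≡ 0
      bracket-other n n≢N with ℕ.<-cmp n N
      ... | tri< n<N _ _ = if-no (first? n) λ (_ , ε≈1) → 1≉0 (F.trans (F.sym ε≈1) (ε-below n<N))
      ... | tri≈ _ n≡N _ = ⊥-elim (n≢N n≡N)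
      ... | tri> _ _ N<n = if-no (first? n) λ (ε≈0 , _) → c≉0 (F.trans (F.sym (leading x-lead))
        (F.trans (F.reflexive (cong (λ k → ε x (suc k)) (≡.sym (Fin.toℕ-fromℕ< N<n)))) (ε≈0 (Fin.fromℕ< N<n))))

      bracket-monic : c F.≈ F.1# → ⟨ x ⟩ N ≡ 1
      bracket-monic c≈1 = if-yes (first? N) ((λ j → ε-below (Fin.toℕ<n j)) , F.trans (leading x-lead) c≈1)

      bracket-nonmonic : ¬ (c F.≈ F.1#) → ⟨ x ⟩ N ≡ 0
      bracket-nonmonic c≉1 = if-no (first? N) λ (_ , ε≈1) → c≉1 (F.trans (F.sym (leading x-lead)) ε≈1)

      module _ (i : ℕ) where
        summand : ℕ → ℕ
        summand n = if does (ℓ ℕ.∣? (n ℕ.+ 1 ℕ.+ i)) then ⟨ x ⟩ n else 0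

        bracket-sum : ∀ {m} → IsBracket x i m → m ≡ summand N
        -- The stable value is read off at a length beyond M that includes the index N.
        bracket-sum (M , stable) = ≡.trans (≡.sym (stable (M ℕ.⊔ suc N) (ℕ.m≤m⊔n M (suc N))))
          (sum-applyUpTo-single summand id (M ℕ.⊔ suc N) N (ℕ.m≤n⊔m M (suc N)) other)
          where
          other : ∀ j → j ≢ N → summand j ≡ 0
          other j j≢N with does (ℓ ℕ.∣? (j ℕ.+ 1 ℕ.+ i))
          ... | true  = bracket-other j j≢N
          ... | false = ≡.refl

    isBracket-nonmonic : ∀ {i m} → ¬ (c F.≈ F.1#) → IsBracket x i m → m ≡ 0
    isBracket-nonmonic {i} c≉1 isBracket = ≡.trans (bracket-sum i isBracket) zero-summand
      where
      zero-summand : summand i N ≡ 0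
      zero-summand with does (ℓ ℕ.∣? (N ℕ.+ 1 ℕ.+ i))
      ... | true  = bracket-nonmonic c≉1
      ... | false = ≡.refl

    isBracket-off : ∀ {i m} → ¬ (ℓ ℕ.∣ (N ℕ.+ 1 ℕ.+ i)) → IsBracket x i m → m ≡ 0
    isBracket-off {i} ℓ∤ isBracket = ≡.trans (bracket-sum i isBracket) (if-no (ℓ ℕ.∣? (N ℕ.+ 1 ℕ.+ i)) ℓ∤)

    isBracket-on : ∀ {i m} → c F.≈ F.1# → ℓ ℕ.∣ (N ℕ.+ 1 ℕ.+ i) → IsBracket x i m → m ≡ 1
    isBracket-on {i} c≈1 ℓ∣ isBracket = ≡.trans (bracket-sum i isBracket) (≡.trans (if-yes (ℓ ℕ.∣? (N ℕ.+ 1 ℕ.+ i)) ℓ∣) (bracket-monic c≈1))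

    -- |Γ*(x, y)| = |θ|^(exponent + m (N + 1)) where m = ∂(x, y - 1).
    mantissa-lead : ∀ {i} (γ : Γ* x i) → ∃[ m ] ∃[ b ] (IsBracket x i m × ¬ (b F.≈ F.0#) × Lead (mantissa γ) (+ (m ℕ.* suc N)) b)
    mantissa-lead (at-zero x≈0 _ _) = ⊥-elim (c≉0 (F.trans (F.sym (leading x-lead)) (F.trans (x≈0 -[1+ N ]) F.refl)))
    mantissa-lead (off-zero _ Γari 1/Γari m isBracket 1/x^m geo) = m , b F.* F.1# F.* F.1# , isBracket , b≉0 ,
      lead-cong degree≡ F.refl (lead-* (lead-* 1/x^m-lead (unital-Π-geo x<1 geo)) (unital-inverse (unital-Π-ari Γari) 1/Γari))
      where
      x<1 : Bounded x -[1+ 0 ]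
      x<1 = bounded-mono {x} (ℤ.-≤- ℕ.z≤n) (bound x-lead)
      c⁻¹ : F.Carrier
      c⁻¹ = proj₁ (F.inverse c c≉0)
      -- x^m has leading coefficient c^m with c arbitrary, so its inverse starts with c^(-m); for
      -- the degree it matters that this is nonzero.
      b : F.Carrier
      b = c⁻¹ F.^ m
      bc≈1 : b F.* c F.^ m F.≈ F.1#
      bc≈1 = F.trans (F.sym (F.^-distrib-* c⁻¹ c m)) (F.trans (F.^-congˡ m (proj₁ (proj₂ (F.inverse c c≉0)))) (1^ m))
        where
        1^ : ∀ n → F.1# F.^ n F.≈ F.1#
        1^ zero    = F.refl
        1^ (suc n) = F.trans (F.*-identityˡ _) (1^ n)
      b≉0 : ¬ (b F.* F.1# F.* F.1# F.≈ F.0#)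
      b≉0 b11≈0 = 1≉0 (F.trans (F.sym bc≈1) (F.trans (F.*-congʳ (F.trans (F.sym (F.trans (F.*-identityʳ _) (F.*-identityʳ _))) b11≈0)) (F.zeroˡ _)))
      1/x^m-lead : Lead (proj₁ 1/x^m) (ℤ.- (+ m ℤ.* -[1+ N ])) b
      1/x^m-lead = lead-inverse bc≈1 (lead-^ m x-lead) (proj₁ (proj₂ 1/x^m))
      degree≡ : ℤ.- (+ m ℤ.* -[1+ N ]) ℤ.+ + 0 ℤ.+ + 0 ≡ + (m ℕ.* suc N)
      degree≡ = ≡.trans (IntegerSolver.solve ℤ.+-*-commutativeRing 2 (λ m n → S.:- (m S.:* (S.:- n)) S.:+ S.:0 S.:+ S.:0 S.:= m S.:* n) ≡.refl (+ m) (+ suc N)) (≡.sym (ℤ.pos-* m (suc N)))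
        where module S = IntegerSolver ℤ.+-*-commutativeRing

  mantissa-lead-zero : ∀ {x i} → x ≈ 0# → (γ : Γ* x i) → Unital (mantissa γ)
  mantissa-lead-zero x≈0 (at-zero _ Γari 1/Γari)      = unital-inverse (unital-Π-ari Γari) 1/Γari
  mantissa-lead-zero x≈0 (off-zero x≉0 _ _ _ _ _ _) = ⊥-elim (x≉0 x≈0)

-- Rational exponents and logarithms of absolute values

module RationalValues (R : RealNumbers) where
  open RealProperties R
  open Relation.Binary.Reasoning.Setoid setoid
  open ℚᵘ using (ℚᵘ; ↥_; ↧ₙ_)

  ⟦+⟧ : ∀ n → ⟦ + n ⟧ℤ ≈ n · 1#
  ⟦+⟧ n = ≈-sym (Algebra.Properties.Semiring.Mult.TCOptimised.×ᵤ≈× semiring n 1#)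

  ⟦+⟧-* : ∀ m n → ⟦ + (m ℕ.* n) ⟧ℤ ≈ ⟦ + m ⟧ℤ * ⟦ + n ⟧ℤ
  ⟦+⟧-* m n = ≈-trans (reflexive (cong ⟦_⟧ℤ (ℤ.pos-* m n))) (⟦⟧-* (+ m) (+ n))

  infix 4 _represents_
  -- Cross-multiplied, so that sums and products follow the unnormalised fractions without division
  -- in the reals.
  record _represents_ (x : Carrier) (r : ℚᵘ) : Set where
    constructor representing
    field
      equation : ⟦ + ↧ₙ r ⟧ℤ * x ≈ ⟦ ↥ r ⟧ℤ

  open _represents_ public

  represents-/ : ∀ {x} n d .{d≢0 : NonZero d} → (d · 1#) * x ≈ ⟦ n ⟧ℤ → x represents ((n ℚᵘ./ d) {{d≢0}})
  represents-/ n (suc d) eq = representing $ ≈-trans (*-congʳ (⟦+⟧ (suc d))) eq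

  represents-neg : ∀ {x r} → x represents r → - x represents (ℚᵘ.- r)
  represents-neg {x} {ℚᵘ.mkℚᵘ n d} (representing eq) = representing $ ≈-trans (solve 2 (λ d x → d :* (:- x) := :- (d :* x)) ≈-refl ⟦ + suc d ⟧ℤ x) (≈-trans (-‿cong eq) (≈-sym (⟦⟧-neg n)))

  represents-* : ∀ {x y r s} → x represents r → y represents s → x * y represents (r ℚᵘ.* s)
  represents-* {x} {y} {ℚᵘ.mkℚᵘ m c} {ℚᵘ.mkℚᵘ n d} (representing eq) (representing eq′) = representing $ begin
    ⟦ + (suc c ℕ.* suc d) ⟧ℤ * (x * y)                 ≈⟨ *-congʳ (⟦+⟧-* (suc c) (suc d)) ⟩
    ⟦ + suc c ⟧ℤ * ⟦ + suc d ⟧ℤ * (x * y)              ≈⟨ solve 4 (λ c d x y → c :* d :* (x :* y) := (c :* x) :* (d :* y)) ≈-refl ⟦ + suc c ⟧ℤ ⟦ + suc d ⟧ℤ x y ⟩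
    (⟦ + suc c ⟧ℤ * x) * (⟦ + suc d ⟧ℤ * y)            ≈⟨ *-cong eq eq′ ⟩
    ⟦ m ⟧ℤ * ⟦ n ⟧ℤ                                    ≈⟨ ⟦⟧-* m n ⟨
    ⟦ m ℤ.* n ⟧ℤ                                       ∎

  represents-+ : ∀ {x y r s} → x represents r → y represents s → x + y represents (r ℚᵘ.+ s)
  represents-+ {x} {y} {ℚᵘ.mkℚᵘ m c} {ℚᵘ.mkℚᵘ n d} (representing eq) (representing eq′) = representing $ begin
    ⟦ + (suc c ℕ.* suc d) ⟧ℤ * (x + y)                 ≈⟨ *-congʳ (⟦+⟧-* (suc c) (suc d)) ⟩
    C * D * (x + y)                                    ≈⟨ solve 4 (λ c d x y → c :* d :* (x :+ y) := (c :* x) :* d :+ (d :* y) :* c) ≈-refl C D x y ⟩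
    (C * x) * D + (D * y) * C                          ≈⟨ +-cong (*-congʳ eq) (*-congʳ eq′) ⟩
    ⟦ m ⟧ℤ * D + ⟦ n ⟧ℤ * C                            ≈⟨ +-cong (⟦⟧-* m (+ suc d)) (⟦⟧-* n (+ suc c)) ⟨
    ⟦ m ℤ.* + suc d ⟧ℤ + ⟦ n ℤ.* + suc c ⟧ℤ            ≈⟨ ⟦⟧-+ (m ℤ.* + suc d) (n ℤ.* + suc c) ⟨
    ⟦ m ℤ.* + suc d ℤ.+ n ℤ.* + suc c ⟧ℤ               ∎
    where
    C = ⟦ + suc c ⟧ℤ
    D = ⟦ + suc d ⟧ℤ

module Exponents (K : FiniteField) (R : RealNumbers) (ℓ : ℕ) {{_ : NonZero ℓ}} where
  open RealProperties R
  open RationalValues R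
  open FiniteField K using (q; q-nonTrivial)
  open Gamma K ℓ using (∂)

  𝕢 : Carrier
  𝕢 = q · 1#

  1<𝕢 : 1# < 𝕢
  1<𝕢 = <-≤-trans (<-resp (+-identityʳ 1#) ≈-refl (+-monoʳ-< 1# (0<n· 1))) (·1-mono (ℕ.nonTrivial⇒n>1 q))

  private
    Y : Carrier
    Y = 𝕢 ^ ℓ - 1#

    Y-inverse : ∃[ y ] (0# < y × Y * y ≈ 1#)
    Y-inverse = inverse⁺ (0<^-1 1<𝕢 ℓ)

    y : Carrier
    y = proj₁ Y-inverse

    Yy≈1 : Y * y ≈ 1#
    Yy≈1 = proj₂ (proj₂ Y-inverse)

    Y≈ : ((q ℕ.^ ℓ) ℕ.∸ 1) · 1# ≈ Y
    Y≈ = ≈-trans (solve 1 (λ n → n := (:1 :+ n) :- :1) ≈-refl (((q ℕ.^ ℓ) ℕ.∸ 1) · 1#))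
      (+-congʳ (≈-trans (reflexive (cong (_· 1#) (ℕ.m+[n∸m]≡n 1≤q^ℓ))) (·1-homo-^ q ℓ)))
      where
      1≤q^ℓ : 1 ℕ.≤ q ℕ.^ ℓ
      1≤q^ℓ = ℕ.m^n>0 q {{ℕ.nonTrivial⇒nonZero q}} ℓ

  -- The real value of ∂, with y = 1 / (q^ℓ - 1); the first sign is that of 1 / (1 - q^ℓ).
  ∂ᵣ : ℕ → Carrier
  ∂ᵣ c = - ((c · 1#) * 𝕢 ^ c * y) + (ℓ · 1#) * 𝕢 ^ (ℓ +ℕ c) * y * y

  ∂ᵣ-represents : ∀ c → ∂ᵣ c represents ∂ c
  ∂ᵣ-represents c = represents-+ (represents-neg (represents-/ _ ((q ℕ.^ ℓ) ℕ.∸ 1) (fraction (c ℕ.* q ℕ.^ c) (≈-trans (×1-homo-* c (q ℕ.^ c)) (*-congˡ (·1-homo-^ q c))))))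
    (represents-* (represents-/ _ ((q ℕ.^ ℓ) ℕ.∸ 1) (fraction (ℓ ℕ.* q ℕ.^ (ℓ +ℕ c)) (≈-trans (×1-homo-* ℓ (q ℕ.^ (ℓ +ℕ c))) (*-congˡ (·1-homo-^ q (ℓ +ℕ c))))))
                  (represents-/ (+ 1) ((q ℕ.^ ℓ) ℕ.∸ 1) (≈-trans (*-congʳ Y≈) Yy≈1)))
    where
    fraction : ∀ n {x} → n · 1# ≈ x → (((q ℕ.^ ℓ) ℕ.∸ 1) · 1#) * (x * y) ≈ ⟦ + n ⟧ℤ
    fraction n {x} n≈x = ≈-trans (*-congʳ Y≈) (≈-trans (solve 3 (λ Y x y → Y :* (x :* y) := x :* (Y :* y)) ≈-refl Y x y)
      (≈-trans (*-congˡ Yy≈1) (≈-trans (*-identityʳ x) (≈-trans (≈-sym n≈x) (≈-sym (⟦+⟧ n))))))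

  ∂ᵣ-value : ∀ c → Y * Y * ∂ᵣ c ≈ - (Y * ((c · 1#) * 𝕢 ^ c)) + (ℓ · 1#) * 𝕢 ^ ℓ * 𝕢 ^ c
  ∂ᵣ-value c = ≈-trans (*-congˡ (+-congˡ (*-congʳ (*-congʳ (*-congˡ (^-homo-* 𝕢 ℓ c))))))
    (≈-trans (solve 5 (λ Y y n l p → Y :* Y :* (:- (n :* y) :+ l :* p :* y :* y) := :- (Y :* n :* (Y :* y)) :+ l :* p :* ((Y :* y) :* (Y :* y))) ≈-refl Y y ((c · 1#) * 𝕢 ^ c) (ℓ · 1#) (𝕢 ^ ℓ * 𝕢 ^ c))
      (≈-trans (+-cong (-‿cong (≈-trans (*-congˡ Yy≈1) (*-identityʳ _))) (≈-trans (*-congˡ (≈-trans (*-cong Yy≈1 Yy≈1) (*-identityˡ 1#))) (≈-trans (*-identityʳ _) (≈-sym (*-assoc _ _ _))))) ≈-refl))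

module Logarithms (R : RealNumbers) (E : ExpLog R) (K : FiniteField) where
  open ExpLog E
  open Absolute K R
  open ComplexFieldInstance R using (complexField)
  open ComplexAnalysis complexField
  open FiniteField K using (q; q-nonTrivial)
  open RationalValues R
  open ℚᵘ using (ℚᵘ; ↥_; ↧ₙ_)

  expFunction : ExponentialFunction complexField
  expFunction = record { exp = exp ; exp-series = λ z → ⟶-from-squares (exp-series z) }

  open Exponential expFunction

  expᵣ-ln : ∀ x 0<x → expᵣ (ln x 0<x) ℝ.≈ x
  expᵣ-ln x 0<x = ℝ.≈-trans (re-cong (exp-ln x 0<x)) (re-real x)

  private
    λ₁ : ℝ.Carrier
    λ₁ = ln (q^ (+ 1)) (0<q^ 1)

    instance
      q-nonZero : NonZero q
      q-nonZero = ℕ.nonTrivial⇒nonZero q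

    expᵣ-λ₁ : expᵣ λ₁ ℝ.≈ q ℝ.· ℝ.1#
    expᵣ-λ₁ = ℝ.≈-trans (expᵣ-ln _ _) (ℝ.*-identityʳ _)

    expᵣ-neg : ∀ {x y z} → expᵣ x ℝ.≈ y → y ℝ.* z ℝ.≈ ℝ.1# → expᵣ (ℝ.- x) ℝ.≈ z
    expᵣ-neg {x} {y} {z} eq yz≈1 = ℝ.*-cancelʳ (expᵣ x) (expᵣ-pos x)
      (ℝ.≈-trans (ℝ.*-comm _ _) (ℝ.≈-trans (expᵣ-inverse x) (ℝ.≈-sym (ℝ.≈-trans (ℝ.*-comm z _) (ℝ.≈-trans (ℝ.*-congʳ eq) yz≈1)))))

    expᵣ-q^ : ∀ n → expᵣ (ℝ.⟦ + n ⟧ℤ ℝ.* λ₁) ℝ.≈ (q ℝ.· ℝ.1#) ℝ.^ n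
    expᵣ-q^ n = ℝ.≈-trans (expᵣ-cong (ℝ.*-congʳ (⟦+⟧ n))) (ℝ.≈-trans (expᵣ-^ λ₁ n) (ℝ.^-congˡ n expᵣ-λ₁))

    expᵣ-power : ∀ z → expᵣ (ℝ.⟦ z ⟧ℤ ℝ.* λ₁) ℝ.≈ q^ z
    expᵣ-power (+ n)    = expᵣ-q^ n
    expᵣ-power -[1+ n ] = ℝ.≈-trans (expᵣ-cong (ℝ.solve 2 (λ x l → (ℝ.:- x) ℝ.:* l ℝ.:= ℝ.:- (x ℝ.:* l)) ℝ.≈-refl ℝ.⟦ + suc n ⟧ℤ λ₁))
      (expᵣ-neg (expᵣ-q^ (suc n)) (ℝ.^-inverse (ℝ.n*1/n≈1 q) (suc n)))

  -- For r = a/b the defining equation v^b = q^(a + b deg f) becomes linear under the logarithm, and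
  -- the root is a division by b, made after exponentiating both sides.
  ln-absoluteValue : ∀ {r f x} (v : AbsoluteValue r f) → x represents r →
    ln (AbsoluteValue.value v) (AbsoluteValue.positive v) ℝ.≈ (x ℝ.+ ℝ.⟦ AbsoluteValue.degree v ⟧ℤ) ℝ.* λ₁
  ln-absoluteValue {r} {f} {x} v x-represents = ℝ.*-cancelʳ (b ℝ.· ℝ.1#) (ℝ.0<n· b {{ℕ.>-nonZero 0<b}}) (ℝ.≈-trans (ℝ.*-comm _ _) (expᵣ-injective (begin
      expᵣ ((b ℝ.· ℝ.1#) ℝ.* L)                          ≈⟨ expᵣ-^ L b ⟩
      expᵣ L ℝ.^ b                                       ≈⟨ ℝ.^-congˡ b (expᵣ-ln value positive) ⟩
      value ℝ.^ b                                        ≈⟨ power ⟩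
      q^ (↥ r ℤ.+ degree ℤ.* + b)                        ≈⟨ expᵣ-power (↥ r ℤ.+ degree ℤ.* + b) ⟨
      expᵣ (ℝ.⟦ ↥ r ℤ.+ degree ℤ.* + b ⟧ℤ ℝ.* λ₁)        ≈⟨ expᵣ-cong (ℝ.*-congʳ (ℝ.≈-trans (ℝ.⟦⟧-+ (↥ r) (degree ℤ.* + b)) (ℝ.+-cong (ℝ.≈-sym (equation x-represents)) (ℝ.⟦⟧-* degree (+ b))))) ⟩
      expᵣ ((ℝ.⟦ + b ⟧ℤ ℝ.* x ℝ.+ ℝ.⟦ degree ⟧ℤ ℝ.* ℝ.⟦ + b ⟧ℤ) ℝ.* λ₁) ≈⟨ expᵣ-cong (ℝ.≈-trans
          (ℝ.solve 4 (λ b x d l → (b ℝ.:* x ℝ.:+ d ℝ.:* b) ℝ.:* l ℝ.:= (x ℝ.:+ d) ℝ.:* l ℝ.:* b) ℝ.≈-refl ℝ.⟦ + b ⟧ℤ x ℝ.⟦ degree ⟧ℤ λ₁) (ℝ.*-congˡ (⟦+⟧ b))) ⟩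
      expᵣ ((x ℝ.+ ℝ.⟦ degree ⟧ℤ) ℝ.* λ₁ ℝ.* (b ℝ.· ℝ.1#)) ∎)))
    where
    open AbsoluteValue v
    open Relation.Binary.Reasoning.Setoid ℝ.setoid
    b : ℕ
    b = ↧ₙ r
    0<b : 0 ℕ.< b
    0<b = ℕ.s≤s ℕ.z≤n
    L = ln value positive

-- The formula at 0

module ConductorLFunction (R : RealNumbers) (E : ExpLog R) (K : FiniteField) (ℓ : ℕ) {{_ : NonZero ℓ}}
  {𝔫 : Polynomial.Poly K} (φ : Characters.Character K R ℓ 𝔫) (conductor : Characters.Conductor K R ℓ φ) where

  open Characters K R ℓ
  open Conductor conductor renaming (reduced to ψ) public
  open PolynomialRingInstance K using (polynomialRing)
  open ComplexFieldInstance R using (complexField)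
  open LFunction K R E ℓ
  open Logarithms R E K
  open Exponents K R ℓ
  open RationalValues R
  open ExpLog E using (exp; ln)
  open Absolute K R
  private
    module C = Complex R
    module A = Polynomial K
    module K∞ = Laurent K
    module F = FiniteField K
  open ComplexAnalysis complexField

  abstractCharacter : AbstractCharacter polynomialRing complexField
  abstractCharacter = record
    { ℓ = ℓ ; 𝔠 = 𝔠 ; deg = deg ; 𝔠-monic = monic ; χ = χ ψ
    ; χ-cong = χ-cong ψ ; χ-* = *-homo ψ ; χ-1 = 1-homo ψ
    }

  open CharacterSums polynomialRing complexField abstractCharacter using (module P; χ-resp; ω)
  open Sieve polynomialRing complexField abstractCharacter using (Primes; module EulerProduct)
  open Differentiation complexField

  logarithmTable : LogarithmTable polynomialRing expFunction
  logarithmTable = record { Λ = ln∣_∣ ; exp-Λ = λ d → expᵣ-ln _ (0<q^ d) ; 1<𝕢 = 1<𝕢 }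

  open LSeries abstractCharacter logarithmTable public
    using (module Continuation; Continuation; continuation-trivial; continuation-nontrivial; module HalfPlane; module TrivialValues; module NontrivialValues; e; e-power)

  module Construction (continuation : Continuation) where
    open Continuation continuation

    private
      numeratorEntire denominatorEntire : C.Entire
      numeratorEntire = record
        { value = N ; derivative = N′
        ; isDerivative = λ s ε 0<ε → let δ , 0<δ , close = derivative-ε-δ (derivative-N s) ε 0<ε in δ , 0<δ , λ z _ → close z
        }
      denominatorEntire = record
        { value = D ; derivative = D′
        ; isDerivative = λ s ε 0<ε → let δ , 0<δ , close = derivative-ε-δ (derivative-D s) ε 0<ε in δ , 0<δ , λ z _ → close z
        }

    meromorphic : C.Meromorphic
    meromorphic = record { numerator = numeratorEntire ; denominator = denominatorEntire ; nonTrivial = 0# , D-unit-at-0 }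

    private
      euler-at : ∀ s → ℝ.1# ℝ.< re s → Σ[ s∈D ∈ C.Meromorphic.Domain meromorphic s ] EulerProduct ψ s (C.Meromorphic.value meromorphic s s∈D)
      euler-at s 1<s = D-unit s 1<s , λ primes →
        let open Enumeration
            ps : ∀ n → Primes (size (primes n))
            ps n = record
              { prime = element (primes n)
              ; degree = λ m → proj₁ (sound (primes n) m)
              ; monic = λ m → proj₁ (proj₂ (sound (primes n) m))
              ; irreducible = λ m → proj₁ (proj₂ (proj₂ (proj₂ (sound (primes n) m))))
              ; ∤𝔠 = λ m → proj₂ (proj₂ (proj₂ (proj₂ (sound (primes n) m))))
              ; distinct = distinct (primes n)
              }
            factor : ∀ n m → ∃[ w ] (w * (1# - χ ψ (element (primes n) m) (+ proj₁ (sound (primes n) m)) * e (proj₁ (sound (primes n) m)) s) ≈ 1#)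
            factor n m = factor-unit (Primes.monic (ps n) m) (Primes.irreducible (ps n) m) (Primes.∤𝔠 (ps n) m)
        in (λ n m → proj₁ (factor n m) , proj₂ (factor n m) , ≈-trans (*-comm _ (proj₁ (factor n m))) (proj₂ (factor n m))) ,
           ⟶-to-squares (euler-product e≼ρ ℝ.≈-refl 0<r 1<y ry≈1 (λ n → size (primes n)) ps
             (λ n e≤n g-monic g-irr g∤𝔠 → complete (primes n) _ (_ , g-monic , e≤n , g-irr , g∤𝔠))
             (λ n m → proj₁ (factor n m))
             (λ n m → ≈-trans (*-congˡ (+-congˡ (-‿cong (*-congˡ (≈-sym (e-power (proj₁ (sound (primes n) m)) s)))))) (proj₂ (factor n m))))
        where
        open HalfPlane s 1<s
        open EulerProduct (sums s 1<s (proj₂ (unit s 1<s)))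

    𝓛 : L-function ψ
    𝓛 = record { L = meromorphic ; euler = euler-at }

    0∈D : C.Meromorphic.Domain meromorphic 0#
    0∈D = D-unit-at-0

    L′0 : Carrier
    L′0 = (N′ 0# - N 0# * proj₁ 0∈D * D′ 0#) * proj₁ 0∈D

    hasDerivative : C.HasDerivativeAt (C.Meromorphic.Domain meromorphic) (C.Meromorphic.value meromorphic) 0# 0∈D L′0
    hasDerivative ε 0<ε = let δ , 0<δ , close = quotient-derivative (derivative-N 0#) (derivative-D 0#) (proj₁ (proj₂ 0∈D)) ε 0<ε
      in δ , 0<δ , λ s d → close s (proj₁ d) (proj₁ (proj₂ d))

  -- If ψ were trivial on (A/𝔠)^×, it would come from a character modulo 1.
  nontrivial : ¬ (deg ≡ 0) → ¬ (∀ b → P.Coprime b 𝔠 → χ ψ b (+ 0) ≈ 1#)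
  -- Minimality then makes 𝔠 divide 1.
  nontrivial deg≢0 trivial = deg≢0 (P.monic∣1⇒degree-0 {g = 𝔠} monic (minimal P.monic-1 (P.divides 𝔫 (P.*-identityʳ 𝔫)) ψ₁ induced))
    where
    ψ₁ : Character A.1#
    ψ₁ = record
      { χ = λ _ i → χ ψ A.1# i
      ; χ-cong = λ _ _ _ ℓ∣ → χ-cong ψ P.coprime-1 P.coprime-1 (P.∣-respʳ (P.≈-sym {P.1# P.- P.1#} {P.0#} (P.-‿inverseʳ P.1#)) (P.∣-0 {𝔠})) ℓ∣
      ; *-homo = λ i j _ _ → ≈-trans (χ-resp (i ℤ.+ j) P.coprime-1 (P.≈-sym {P.1# P.* P.1#} {P.1#} (P.*-identityˡ P.1#))) (*-homo ψ i j P.coprime-1 P.coprime-1)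
      ; 1-homo = 1-homo ψ
      }
    induced : ψ₁ Induces φ
    -- χ(1, i) = χ(a, 0) χ(1, i) = χ(a, i).
    induced a i a⊥𝔫 = ≈-trans (≈-sym (*-identityˡ _)) (≈-trans (*-congʳ (≈-sym (trivial a a⊥𝔠)))
      (≈-trans (≈-sym (*-homo ψ (+ 0) i a⊥𝔠 P.coprime-1))
        (≈-trans (reflexive (cong (χ ψ (a P.* P.1#)) (ℤ.+-identityˡ i)))
          (≈-trans (χ-resp i (P.coprime-* a⊥𝔠 P.coprime-1) (P.*-identityʳ a)) (induces a i a⊥𝔫)))))
      where
      a⊥𝔠 : P.Coprime a 𝔠
      a⊥𝔠 = P.coprime-divisorʳ {a} {𝔠} {𝔫} divides a⊥𝔫

  module GammaValues
    (residues : Enumeration A.rawRing (λ a → A.DegreeBelow deg a × A.Coprime a 𝔠))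
    (1/𝔠 : K∞.IsUnit (𝔠 K∞.⟨θ⟩))
    (γ : (m : Fin (Enumeration.size residues)) (i : Fin ℓ) → Gamma.Γ* K ℓ ((Enumeration.element residues m K∞.⟨θ⟩) K∞.* proj₁ 1/𝔠) (toℕ i))
    (∣γ∣ : ∀ m i → AbsoluteValue (Gamma.exponent K ℓ (γ m i)) (Gamma.mantissa K ℓ (γ m i))) where
    open Enumeration residues
    open Laurent K using (_⟨θ⟩)
    open Gamma K ℓ
    open LaurentDegrees K
    open GammaDegrees K ℓ
    open PolynomialProperties K using (leading?)

    lnΓ : Fin size → Fin ℓ → ℝ.Carrier
    lnΓ m i = ln (AbsoluteValue.value (∣γ∣ m i)) (AbsoluteValue.positive (∣γ∣ m i))

    μ : Fin ℓ → ℝ.Carrier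
    μ i = ℝ.- (∂ᵣ (toℕ i) ℝ.* ln∣ 1 ∣)

    B : Fin size → Fin ℓ → ℝ.Carrier
    B m i = ℝ.⟦ AbsoluteValue.degree (∣γ∣ m i) ⟧ℤ ℝ.* ln∣ 1 ∣

    -- The rational power of θ contributes `μ i`, which is the same for every residue; the degree of
    -- the mantissa contributes `B m i`.
    lnΓ-split : ∀ m i → lnΓ m i ℝ.≈ μ i ℝ.+ B m i
    lnΓ-split m i = ℝ.≈-trans (ln-absoluteValue (∣γ∣ m i) (represents-neg (∂ᵣ-represents (toℕ i))))
      (ℝ.solve 3 (λ x d l → (ℝ.:- x ℝ.:+ d) ℝ.:* l ℝ.:= ℝ.:- (x ℝ.:* l) ℝ.:+ d ℝ.:* l) ℝ.≈-refl (∂ᵣ (toℕ i)) ℝ.⟦ AbsoluteValue.degree (∣γ∣ m i) ⟧ℤ ln∣ 1 ∣)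

    sum-split : sum {size} (λ m → sum {ℓ} (λ i → χ ψ (element m) (+ (toℕ i +ℕ deg)) * real (lnΓ m i))) ≈
      sum {size} (λ m → sum {ℓ} (λ i → χ ψ (element m) (+ (toℕ i +ℕ deg)) * real (μ i))) +
      sum {size} (λ m → sum {ℓ} (λ i → χ ψ (element m) (+ (toℕ i +ℕ deg)) * real (B m i)))
    sum-split = ≈-trans (sum-cong-≋ {size} (λ m → ≈-trans (sum-cong-≋ {ℓ} (λ i →
        ≈-trans (*-congˡ {χ ψ (element m) (+ (toℕ i +ℕ deg))} (≈-trans (real-cong (lnΓ-split m i)) (real-+ (μ i) (B m i)))) (distribˡ (χ ψ (element m) (+ (toℕ i +ℕ deg))) (real (μ i)) (real (B m i)))))
        (∑-distrib-+ {ℓ} (λ i → χ ψ (element m) (+ (toℕ i +ℕ deg)) * real (μ i)) (λ i → χ ψ (element m) (+ (toℕ i +ℕ deg)) * real (B m i)))))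
      (∑-distrib-+ {size} (λ m → sum {ℓ} (λ i → χ ψ (element m) (+ (toℕ i +ℕ deg)) * real (μ i))) (λ m → sum {ℓ} (λ i → χ ψ (element m) (+ (toℕ i +ℕ deg)) * real (B m i))))

    private
      1≉0 : ¬ (F.1# F.≈ F.0#)
      1≉0 = F.0≉1 ∘ F.sym

      B≈ : ∀ m i {n} → AbsoluteValue.degree (∣γ∣ m i) ≡ + n → B m i ℝ.≈ (n ℝ.· ℝ.1#) ℝ.* ln∣ 1 ∣
      B≈ m i {n} eq = ℝ.*-congʳ (ℝ.≈-trans (ℝ.reflexive (cong ℝ.⟦_⟧ℤ eq)) (⟦+⟧ n))

      B≈0 : ∀ m i → AbsoluteValue.degree (∣γ∣ m i) ≡ + 0 → B m i ℝ.≈ ℝ.0#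
      B≈0 m i eq = ℝ.≈-trans (B≈ m i eq) (ℝ.zeroˡ _)

    -- The only residue is 0, so x = 0 and the mantissa is the inverse of a 1-unit.
    B-zero : deg ≡ 0 → ∀ m i → B m i ℝ.≈ ℝ.0#
    B-zero deg≡0 m i = B≈0 m i (hasDegree-lead 1≉0 (mantissa-lead-zero x≈0 (γ m i)) (AbsoluteValue.hasDegree (∣γ∣ m i)))
      where
      x≈0 : ((element m ⟨θ⟩) K∞.* proj₁ 1/𝔠) K∞.≈ K∞.0#
      x≈0 = zero-* (element m ⟨θ⟩) (proj₁ 1/𝔠) (eval-zero (element m) (λ i → proj₁ (sound m) i (subst (ℕ._≤ i) (≡.sym deg≡0) ℕ.z≤n)))

    module _ (deg≢0 : ¬ (deg ≡ 0)) (m : Fin size) where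
      private
        a : A.Poly
        a = element m

        -- a is nonzero, because 0 is not prime to a 𝔠 of positive degree.
        leading-term : ∃[ d ] (¬ (A.coeff a d F.≈ F.0#) × A.DegreeBelow (suc d) a)
        leading-term = [ (λ a≈0 → ⊥-elim (deg≢0 (P.monic∣1⇒degree-0 {g = 𝔠} monic (proj₂ (sound m) (P.∣-respʳ (P.≈-sym {a} {P.0#} a≈0) (P.∣-0 {𝔠})) (P.∣-refl {𝔠}))))) , id ]′ (leading? a)

        d : ℕ
        d = proj₁ leading-term
        c : F.Carrier
        c = A.coeff a d
        c≉0 : ¬ (c F.≈ F.0#)
        c≉0 = proj₁ (proj₂ leading-term)
        d<deg : d ℕ.< deg
        d<deg = ℕ.≰⇒> λ deg≤d → c≉0 (proj₁ (sound m) d deg≤d)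
        -- x = a / 𝔠 has degree d - deg = - (N + 1), which is the indexing of `⟨_⟩_`.
        N : ℕ
        N = deg ℕ.∸ suc d
        1+N≡ : suc N ≡ deg ℕ.∸ d
        1+N≡ = ≡.sym (ℕ.+-∸-assoc 1 d<deg)
        degree≡ : + d ℤ.+ (ℤ.- + deg) ≡ -[1+ N ]
        degree≡ = ≡.trans (ℤ.[+m]-[+n]≡m⊖n d deg) (≡.trans (ℤ.⊖-< d<deg) (cong (λ n → ℤ.- (+ n)) (≡.sym 1+N≡)))
        x-lead : Lead ((a ⟨θ⟩) K∞.* proj₁ 1/𝔠) -[1+ N ] c
        x-lead = lead-cong degree≡ (CommutativeRing.*-identityʳ F.commutativeRing c)
          (lead-* (lead-eval a F.≈-refl (proj₂ (proj₂ leading-term)))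
            (lead-inverse (CommutativeRing.*-identityˡ F.commutativeRing F.1#) (lead-eval 𝔠 (proj₁ monic) (proj₂ monic)) (proj₁ (proj₂ 1/𝔠))))

        module _ (i : Fin ℓ) where
          bracket : ℕ
          bracket = proj₁ (mantissa-lead c≉0 x-lead (γ m i))
          isBracket : IsBracket ((a ⟨θ⟩) K∞.* proj₁ 1/𝔠) (toℕ i) bracket
          isBracket = proj₁ (proj₂ (proj₂ (mantissa-lead c≉0 x-lead (γ m i))))
          degree-value : AbsoluteValue.degree (∣γ∣ m i) ≡ + (bracket ℕ.* suc N)
          degree-value = hasDegree-lead (proj₁ (proj₂ (proj₂ (proj₂ leads)))) (proj₂ (proj₂ (proj₂ (proj₂ leads)))) (AbsoluteValue.hasDegree (∣γ∣ m i))
            where leads = mantissa-lead c≉0 x-lead (γ m i)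
          N+1+i≡ : N ℕ.+ 1 ℕ.+ toℕ i ≡ (deg ℕ.∸ d) +ℕ toℕ i
          N+1+i≡ = cong (_+ℕ toℕ i) (≡.trans (ℕ.+-comm N 1) 1+N≡)
          bracket-zero : bracket ≡ 0 → B m i ℝ.≈ ℝ.0#
          bracket-zero eq = B≈0 m i (≡.trans degree-value (cong (λ k → + (k ℕ.* suc N)) eq))

        same-degree : ∀ {d′} → A.MonicOfDegree d′ a → d′ ≡ d × c F.≈ F.1#
        same-degree {d′} (ad′≈1 , a<) = go (ℕ.<-cmp d′ d)
          where
          go : _ → d′ ≡ d × c F.≈ F.1#
          go (tri< d′<d _ _)    = ⊥-elim (c≉0 (a< d d′<d))
          go (tri≈ _ ≡.refl _) = ≡.refl , ad′≈1
          go (tri> _ _ d<d′)    = ⊥-elim (1≉0 (F.trans (F.sym ad′≈1) (proj₂ (proj₂ leading-term) d′ d<d′)))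

      B-none : ∀ i → (∀ d′ → d′ ℕ.< deg → ¬ A.MonicOfDegree d′ a) → B m i ℝ.≈ ℝ.0#
      B-none i none = bracket-zero i (isBracket-nonmonic c≉0 x-lead (λ c≈1 → none d d<deg (c≈1 , proj₂ (proj₂ leading-term))) (isBracket i))

      B-off : ∀ i d′ → d′ ℕ.< deg → A.MonicOfDegree d′ a → ¬ (ℓ ℕ.∣ ((deg ℕ.∸ d′) +ℕ toℕ i)) → B m i ℝ.≈ ℝ.0#
      B-off i d′ _ a-monic ℓ∤ = bracket-zero i (isBracket-off c≉0 x-lead (λ ℓ∣ → ℓ∤ (subst (ℓ ℕ.∣_) (≡.trans (N+1+i≡ i) (cong (λ k → (deg ℕ.∸ k) +ℕ toℕ i) (≡.sym (proj₁ (same-degree a-monic))))) ℓ∣)) (isBracket i))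

      B-on : ∀ i d′ → d′ ℕ.< deg → A.MonicOfDegree d′ a → ℓ ℕ.∣ ((deg ℕ.∸ d′) +ℕ toℕ i) → B m i ℝ.≈ ((deg ℕ.∸ d′) ℝ.· ℝ.1#) ℝ.* ln∣ 1 ∣
      B-on i d′ _ a-monic ℓ∣ = B≈ m i (≡.trans (degree-value i) (cong +_ (≡.trans (cong (ℕ._* suc N) bracket≡1) (≡.trans (ℕ.*-identityˡ (suc N)) (≡.trans 1+N≡ (cong (deg ℕ.∸_) (≡.sym d′≡d)))))))
        where
        d′≡d = proj₁ (same-degree a-monic)
        bracket≡1 : bracket i ≡ 1
        bracket≡1 = isBracket-on c≉0 x-lead (proj₂ (same-degree a-monic)) (subst (ℓ ℕ.∣_) (≡.sym (≡.trans (N+1+i≡ i) (cong (λ k → (deg ℕ.∸ k) +ℕ toℕ i) (≡.sym d′≡d)))) ℓ∣) (isBracket i)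

    private
      total : Carrier
      total = sum {size} (λ m → sum {ℓ} (λ i → χ ψ (element m) (+ (toℕ i +ℕ deg)) * real (lnΓ m i)))

    formula-nontrivial : (deg≢0 : ¬ (deg ≡ 0)) → let open Continuation (continuation-nontrivial (nontrivial deg≢0)) in
      ∀ w → w * D 0# ≈ 1# → (N′ 0# - N 0# * w * D′ 0#) * w ≈ - (N 0# * w * real ln∣ deg ∣) + total
    formula-nontrivial deg≢0 w w-unit = ≈-trans (derivative-at-0 w w-unit) (+-congˡ (≈-sym (≈-trans sum-split
      (≈-trans (+-cong (constant-part residues μ) (bracket-part residues B (B-none deg≢0) (B-off deg≢0) (B-on deg≢0))) (+-identityˡ _)))))
      where open NontrivialValues (nontrivial deg≢0)

    formula-trivial : (deg≡0 : deg ≡ 0) → let open Continuation (continuation-trivial deg≡0) in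
      ∀ w → w * D 0# ≈ 1# → (N′ 0# - N 0# * w * D′ 0#) * w ≈ - (N 0# * w * real ln∣ deg ∣) + total
    formula-trivial deg≡0 w w-unit = ≈-trans (derivative-at-0 (λ c → ∂ᵣ (toℕ c)) (λ c → ∂ᵣ-value (toℕ c)) w w-unit) (+-congˡ (≈-sym (≈-trans sum-split
      (≈-trans (+-congˡ B-part) (≈-trans (+-identityʳ _) (residue-sum residues μ))))))
      where
      open TrivialValues deg≡0
      B-part : sum {size} (λ m → sum {ℓ} (λ i → χ ψ (element m) (+ (toℕ i +ℕ deg)) * real (B m i))) ≈ 0#
      B-part = sum-zero {size} _ λ m → sum-zero {ℓ} _ λ i → ≈-trans (*-congˡ {χ ψ (element m) (+ (toℕ i +ℕ deg))} (≈-trans (real-cong (B-zero deg≡0 m i)) real-0)) (zeroʳ _)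

theorem6p4p5 :
  (R : RealNumbers) (E : ExpLog R) (K : FiniteField) →
  let module A = Polynomial K
      module K∞ = Laurent K
      open K∞ using (_⟨θ⟩)
      open Complex R
      open ExpLog E using (ln)
      open Absolute K R
  in
  (ℓ : ℕ) {{_ : NonZero ℓ}} →
  let open Characters K R ℓ
      open LFunction K R E ℓ
      open Gamma K ℓ
  in
  (𝔫 : A.Poly) {d : ℕ} → A.MonicOfDegree d 𝔫 →
  (φ : Character 𝔫) (conductor : Conductor φ) →
  let open Conductor conductor renaming (reduced to ψ) in
  Σ[ 𝓛 ∈ L-function ψ ]
  let open L-function 𝓛 using (L)
      open Meromorphic L using (Domain) renaming (value to L⟨_⟩)
  in
  Σ[ 0∈D ∈ Domain 0# ]
  Σ[ L′0 ∈ ℂ ] (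
    HasDerivativeAt Domain L⟨_⟩ 0# 0∈D L′0 ×
    ((residues : Enumeration A.rawRing (λ a → A.DegreeBelow deg a × A.Coprime a 𝔠)) →
     let open Enumeration residues in
     (1/𝔠 : K∞.IsUnit (𝔠 ⟨θ⟩))
     (γ : (m : Fin size) (i : Fin ℓ) → Γ* ((element m ⟨θ⟩) K∞.* proj₁ 1/𝔠) (toℕ i))
     (∣γ∣ : ∀ m i → AbsoluteValue (exponent (γ m i)) (mantissa (γ m i))) →
     L′0 ≈
       - (L⟨ 0# ⟩ 0∈D * real ln∣ deg ∣)
       + sum {size} (λ m → sum {ℓ} (λ i →
           χ ψ (element m) (+ (toℕ i +ℕ deg))
           * real (ln (AbsoluteValue.value (∣γ∣ m i)) (AbsoluteValue.positive (∣γ∣ m i)))))))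
theorem6p4p5 R E K ℓ 𝔫 𝔫-monic φ conductor =
  -- Everything up to `L′0` is fixed before the gamma data. The inverse of D at 0 contained in `0∈D`
  -- is the w of the two formulas.
  [ (λ deg≡0 → let open Construction (continuation-trivial deg≡0) in
      𝓛 , 0∈D , L′0 , hasDerivative , λ residues 1/𝔠 γ ∣γ∣ →
      GammaValues.formula-trivial residues 1/𝔠 γ ∣γ∣ deg≡0 (proj₁ 0∈D) (proj₁ (proj₂ 0∈D)))
  , (λ deg≢0 → let open Construction (continuation-nontrivial (nontrivial deg≢0)) in
      𝓛 , 0∈D , L′0 , hasDerivative , λ residues 1/𝔠 γ ∣γ∣ →
      GammaValues.formula-nontrivial residues 1/𝔠 γ ∣γ∣ deg≢0 (proj₁ 0∈D) (proj₁ (proj₂ 0∈D)))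
  ]′ (toSum (deg ℕ.≟ 0))
  where
  open ConductorLFunction R E K ℓ φ conductor
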